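{- Let $n\ge 2$ be an integer. 1. $\eta(C_2^2\oplus C_{2n})=2n+4$ and $\mathsf s(C_2^2\oplus C_{2n})=4n+3$. 2. $\eta(C_2^3\oplus C_{2n})=2n+6$, and if $n\ge 36$, then $\mathsf s(C_2^3\oplus C_{2n})=4n+5$.
   Context: $C_m$ denotes the cyclic group of order $m$, and $C_m^k$ the direct sum of $k$ copies of $C_m$. Groups are finite abelian, written additively; $\exp(G)$ is the exponent of $G$. A sequence over $G$ is a finite unordered sequence of elements of $G$ with repetition allowed (a multiset; an element of the free abelian monoid with basis $G$). Its length is the number of terms counted with multiplicity; a subsequence is a sub-multiset; it is zero-sum if the sum of its terms (with multiplicity) is $0$. The constant $\mathsf s(G)$ is the smallest positive integer $l$ such that every sequence $S$ over $G$ of length $|S|\ge l$ has a zero-sum subsequence $T$ of length $|T|=\exp(G)$. The constant $\eta(G)$ is the smallest positive integer $l$ such that every sequence $S$ over $G$ of length $|S|\ge l$ has a nonempty zero-sum subsequence $T$ of length $1\le |T|\le \exp(G)$. -}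

module Defs where

open import Algebra.Bundles using (AbelianGroup)
import Algebra.Construct.DirectProduct as DirectProduct
import Algebra.Construct.Terminal as Terminal
import Algebra.Definitions.RawMonoid as MonoidMultiple
open import Data.Integer.Base as ℤ using (ℤ; +_; 0ℤ)
open import Data.Integer.Divisibility.Signed using (_∣_; divides; ∣m⇒∣-m; ∣m∣n⇒∣m+n)
import Data.Integer.Properties as ℤ
open import Data.Integer.Tactic.RingSolver using (solve-∀)
open import Data.List.Base using (List; _++_; foldr; length)
import Data.List.Relation.Binary.Permutation.Setoid as Permutation
open import Data.Nat.Base using (ℕ; zero; suc; _≤_; _≥_)
open import Data.Product.Base using (_×_; _,_; ∃-syntax)
open import Level using (Level; 0ℓ; _⊔_)
open import Relation.Binary.PropositionalEquality.Core using (_≡_; refl; sym; subst)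
open import Relation.Unary using (Pred)

private
  variable
    c ℓ p : Level

infix 4 _≡_mod_

_≡_mod_ : ℤ → ℤ → ℕ → Set
x ≡ y mod m = + m ∣ x ℤ.- y

private
  ≡⇒≡mod : ∀ m {x y} → x ≡ y → x ≡ y mod m
  ≡⇒≡mod m {x} refl = divides 0ℤ (ℤ.+-inverseʳ x)

  mod-sym : ∀ m x y → x ≡ y mod m → y ≡ x mod m
  mod-sym m x y d = subst (+ m ∣_) (lemma x y) (∣m⇒∣-m d)
    where
    lemma : ∀ x y → ℤ.- (x ℤ.- y) ≡ y ℤ.- x
    lemma = solve-∀

  mod-trans : ∀ m x y z → x ≡ y mod m → y ≡ z mod m → x ≡ z mod m
  mod-trans m x y z d e = subst (+ m ∣_) (lemma x y z) (∣m∣n⇒∣m+n d e)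
    where
    lemma : ∀ x y z → (x ℤ.- y) ℤ.+ (y ℤ.- z) ≡ x ℤ.- z
    lemma = solve-∀

  +-cong-mod : ∀ m x y u v → x ≡ y mod m → u ≡ v mod m → x ℤ.+ u ≡ y ℤ.+ v mod m
  +-cong-mod m x y u v d e = subst (+ m ∣_) (lemma x y u v) (∣m∣n⇒∣m+n d e)
    where
    lemma : ∀ x y u v → (x ℤ.- y) ℤ.+ (u ℤ.- v) ≡ (x ℤ.+ u) ℤ.- (y ℤ.+ v)
    lemma = solve-∀

  neg-cong-mod : ∀ m x y → x ≡ y mod m → ℤ.- x ≡ ℤ.- y mod m
  neg-cong-mod m x y d = subst (+ m ∣_) (lemma x y) (∣m⇒∣-m d)
    where
    lemma : ∀ x y → ℤ.- (x ℤ.- y) ≡ ℤ.- x ℤ.- (ℤ.- y)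
    lemma = solve-∀

-- ℤ / mℤ as a setoid; it has order m for m ≥ 1, while C 0 is ℤ.

C : ℕ → AbelianGroup 0ℓ 0ℓ
C m = record
  { Carrier = ℤ
  ; _≈_     = _≡_mod m
  ; _∙_     = ℤ._+_
  ; ε       = 0ℤ
  ; _⁻¹     = ℤ.-_
  ; isAbelianGroup = record
    { isGroup = record
      { isMonoid = record
        { isSemigroup = record
          { isMagma = record
            { isEquivalence = record
              { refl  = λ {x} → ≡⇒≡mod m {x} refl
              ; sym   = λ {x} {y} → mod-sym m x y
              ; trans = λ {x} {y} {z} → mod-trans m x y z
              }
            ; ∙-cong = λ {x} {y} {u} {v} → +-cong-mod m x y u v
            }
          ; assoc = λ x y z → ≡⇒≡mod m (ℤ.+-assoc x y z)
          }
        ; identity = (λ x → ≡⇒≡mod m (ℤ.+-identityˡ x))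
                   , (λ x → ≡⇒≡mod m (ℤ.+-identityʳ x))
        }
      ; inverse = (λ x → ≡⇒≡mod m (ℤ.+-inverseˡ x))
                , (λ x → ≡⇒≡mod m (ℤ.+-inverseʳ x))
      ; ⁻¹-cong = λ {x} {y} → neg-cong-mod m x y
      }
    ; comm = λ x y → ≡⇒≡mod m (ℤ.+-comm x y)
    }
  }

infixr 6 _⊕_
infixl 8 _^⊕_

_⊕_ : AbelianGroup c ℓ → AbelianGroup c ℓ → AbelianGroup c ℓ
_⊕_ = DirectProduct.abelianGroup

_^⊕_ : AbelianGroup c ℓ → ℕ → AbelianGroup c ℓ
G ^⊕ zero  = Terminal.abelianGroup
G ^⊕ suc k = G ⊕ G ^⊕ k

-- The constants η and s are given as relations "l is the least number such
-- that …", because a general abelian group need not have any such number.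

IsLeast : Pred ℕ p → Pred ℕ p
IsLeast P l = P l × (∀ k → P k → l ≤ k)

module _ (G : AbelianGroup c ℓ) where

  open AbelianGroup G
  open MonoidMultiple rawMonoid using () renaming (_×_ to _·_)
  open Permutation setoid using (_↭_)

  IsExponent : Pred ℕ (c ⊔ ℓ)
  IsExponent = IsLeast λ e → e ≥ 1 × (∀ x → e · x ≈ ε)

  -- Lists stand for unordered sequences, so a subsequence is a divisor in
  -- the free abelian monoid: its terms occur in S in any order, each with
  -- at most its multiplicity in S.

  _IsSubsequenceOf_ : List Carrier → List Carrier → Set (c ⊔ ℓ)
  T IsSubsequenceOf S = ∃[ U ] T ++ U ↭ S

  ZeroSum : Pred (List Carrier) ℓ
  ZeroSum T = foldr _∙_ ε T ≈ ε

  Isη : Pred ℕ (c ⊔ ℓ)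
  Isη l = ∃[ e ] IsExponent e × IsLeast (λ k → k ≥ 1 ×
    (∀ S → length S ≥ k →
      ∃[ T ] T IsSubsequenceOf S × ZeroSum T × 1 ≤ length T × length T ≤ e)) l

  Is𝗌 : Pred ℕ (c ⊔ ℓ)
  Is𝗌 l = ∃[ e ] IsExponent e × IsLeast (λ k → k ≥ 1 ×
    (∀ S → length S ≥ k →
      ∃[ T ] T IsSubsequenceOf S × ZeroSum T × length T ≡ e)) l

{-# OPTIONS --safe #-}

-- Appending 2n − 1 zeros bounds η by 𝗌, and the bound on 𝗌 is multiplicative
-- in n, so that n may be taken to be a prime p.  The terms, sorted by their
-- classes modulo 2, are paired to blocks of equal class, up to a remainder D of
-- 7, 9, 11, 13 or 15 distinct classes, and blocks of unequal value are joined to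
-- couples.  By Cauchy–Davenport the choices of one block from each of t couples
-- realise t + 1 sums modulo p.  If no zero-sum subsequence of length 2p exists,
-- then the even subsets of D with class sum 0, possibly enlarged by spare blocks
-- or by items of a dissolved couple, therefore have fewer than p − t + 1 sums.  This
-- forces the items of D to have nearly constant values, and then each couple to
-- contain a block of one common value, whence p equal contributions sum to 0.
-- Extremal sequences consist of copies of 0, of 2n − 1 copies of the generator g
-- of order 2n, and of e and e + g for each basis vector e of the 2-group.

module Submission where

open import Algebra.Bundles using (AbelianGroup; CommutativeMonoid)
import Algebra.Definitions.RawMonoid as RawMonoid
import Algebra.Solver.CommutativeMonoid
open import Data.Bool.Base as Bool using (Bool; true; false; _xor_; not; if_then_else_; _∨_; _∧_)
import Data.Bool.Properties as Bool
open import Data.Empty using (⊥; ⊥-elim)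
open import Data.Fin.Base as Fin using (Fin; toℕ; fromℕ<)
import Data.Fin.Properties as Fin
open import Data.Integer.Base as ℤ using (ℤ; +_; 0ℤ; 1ℤ; ∣_∣)
open import Data.Integer.DivMod using (_%ℕ_; n%ℕd<d; a≡a%ℕn+[a/ℕn]*n; _/ℕ_)
open import Data.Integer.Divisibility.Signed as ℤ using (divides; ∣ᵤ⇒∣; ∣⇒∣ᵤ; ∣m∣n⇒∣m+n; ∣n⇒∣m*n; ∣m⇒∣-m; _∣?_)
import Data.Integer.Properties as ℤ
open import Data.Integer.Tactic.RingSolver using (solve-∀)
open import Data.List.Base using (List; []; _∷_; _++_; [_]; length; map; foldr; lookup; take; drop; replicate)
open import Data.List.Properties using (length-map; length-++; map-++; take++drop≡id; length-take; length-replicate; ++-assoc; take-map)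
open import Data.List.Membership.Propositional using (_∈_; find)
open import Data.List.Membership.Propositional.Properties using (∈-∃++; ∈-lookup; ∈-++⁻)
open import Data.List.Relation.Binary.Permutation.Propositional
open import Data.List.Relation.Binary.Permutation.Propositional.Properties
  using (++⁺ˡ; ++⁺ʳ; ++⁺; ++-comm; shift; shifts; ↭-length; ↭-map-inv; All-resp-↭; map⁺; ∈-resp-↭; ++-commutativeMonoid; drop-∷)
import Data.List.Relation.Binary.Permutation.Setoid.Properties as Permutationₛ
open import Data.List.Relation.Unary.All as All using (All; []; _∷_)
import Data.List.Relation.Unary.All.Properties as All
open import Data.List.Relation.Unary.AllPairs as AllPairs using (AllPairs; []; _∷_)
import Data.List.Relation.Unary.AllPairs.Properties as AllPairs
open import Data.List.Relation.Unary.Any as Any using (Any; here; there)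
open import Data.List.Relation.Unary.Any.Properties using (lookup-index)
open import Data.Maybe.Base using (Maybe; just; nothing; _>>=_; _<∣>_; is-just; maybe′) renaming (map to mapᴹ)
open import Data.Nat.Base as ℕ using (ℕ; zero; suc; s≤s; z≤n; _+_; _*_; _≥_)
import Data.Nat.DivMod as ℕ
import Data.Nat.Divisibility as ℕ
import Data.Nat.ListAction as ℕ
open import Data.Nat.ListAction.Properties using (sum-++; sum-↭)
import Data.Nat.Primality as Primality
open import Data.Nat.Primality using (Prime; euclidsLemma)
open import Data.Nat.Primality.Factorisation using (factorise; PrimeFactorisation)
import Data.Nat.Properties as ℕ
import Data.Nat.Tactic.RingSolver as ℕ-Solver
open import Data.Product.Base using (Σ; ∃; ∃-syntax; _×_; _,_; proj₁; proj₂)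
open import Data.Sum.Base as Sum using (_⊎_; inj₁; inj₂; [_,_]′) renaming (map to map-⊎)
open import Data.Unit.Base using (tt)
open import Data.Vec.Base as Vec using (Vec; []; _∷_; zipWith)
import Data.Vec.Properties as Vec
open import Function.Base using (_∘_; id; _$_)
open import Function.Bundles using (Equivalence)
open import Level using (0ℓ)
open import Relation.Binary.PropositionalEquality using (_≡_; _≢_; refl; sym; cong; cong₂; subst; subst₂; setoid; module ≡-Reasoning)
  renaming (trans to ≡-trans)
open import Relation.Nullary using (¬_; Dec; yes; no; contradiction)
open import Relation.Nullary.Decidable using (does; _⊎-dec_; _×-dec_; ¬?; decidable-stable; dec-true; dec-false; map′)

-- Congruences and the Cauchy–Davenport argument

-- The class of a term has four bits: its coordinates in the 2-group, padded to three, and the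
-- parity of its last coordinate. Class sum 0 then makes the total even, so for odd p only
-- divisibility by p remains to be arranged; p = 2 is treated separately modulo 4. Since 2p - 1
-- blocks would already contain p blocks of sum 0, a counterexample of 4p + 5 terms has at most 2p -
-- 2 blocks, and if o is the number by which it falls short, the remainder has 9 + 2o classes. There
-- are only 16 classes, so o is at most 3. For the smaller group the same count with 4p + 3 terms
-- takes place among eight classes and leaves exactly seven. The obstacle is that the remainder acts
-- only through its closed even subsets, and which of these exist depends on its position in the
-- four-dimensional space. The facts needed about that position are finite and are checked by
-- evaluation, mostly on one translate of each set; what they imply for the values is linear algebra
-- modulo p. The fewer couples there are, the more option values are tolerated, so the larger
-- remainders need finer arguments.

module Bag {El : Set} = Algebra.Solver.CommutativeMonoid (++-commutativeMonoid {A = El})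

private
  variable
    El Bl : Set

_⊑_ : List El → List El → Set
T ⊑ S = ∃[ U ] S ↭ T ++ U

⊑-trans : {R S T : List El} → R ⊑ S → S ⊑ T → R ⊑ T
⊑-trans {R = R} (U , p) (W , q) =
  U ++ W , trans q (trans (++⁺ʳ W p) (Bag.solve 3 (λ a b c → (a ⊕ b) ⊕ c ⊜ a ⊕ (b ⊕ c)) refl R U W))
  where open Bag using (_⊕_; _⊜_)

⊑-length : {S T : List El} → T ⊑ S → length T ℕ.≤ length S
⊑-length {T = T} (U , p) = subst (length T ℕ.≤_) (sym (≡-trans (↭-length p) (length-++ T))) (ℕ.m≤m+n _ _)

⊑-refl : {S : List El} → S ⊑ S
⊑-refl {S = S} = [] , ↭-sym (Bag.solve 1 (λ a → a ⊕ Bag.id ⊜ a) refl S)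
  where open Bag using (_⊕_; _⊜_)

↭⇒⊑ : {S T : List El} → S ↭ T → T ⊑ S
↭⇒⊑ p = let (U , q) = ⊑-refl in U , trans p q

⊑-++ʳ : (S T : List El) → S ⊑ (S ++ T)
⊑-++ʳ S T = T , refl

⊑-++ˡ : (S T : List El) → T ⊑ (S ++ T)
⊑-++ˡ S T = S , ++-comm S T

⊑-++ : {S S′ T T′ : List El} → S ⊑ S′ → T ⊑ T′ → (S ++ T) ⊑ (S′ ++ T′)
⊑-++ {S = S} {T = T} (U , p) (W , q) = U ++ W ,
  trans (++⁺ p q) (Bag.solve 4 (λ a b c d → (a ⊕ b) ⊕ (c ⊕ d) ⊜ (a ⊕ c) ⊕ (b ⊕ d)) refl S U T W)
  where open Bag using (_⊕_; _⊜_)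

∈⇒↭ : {x : El} {xs : List El} → x ∈ xs → ∃[ ys ] xs ↭ x ∷ ys
∈⇒↭ {x = x} x∈xs with ∈-∃++ x∈xs
... | ys , zs , refl = ys ++ zs , shift x ys zs

sum-by : (El → ℤ) → List El → ℤ
sum-by f []       = 0ℤ
sum-by f (x ∷ xs) = f x ℤ.+ sum-by f xs

sum-by-++ : ∀ (f : El → ℤ) xs {ys} → sum-by f (xs ++ ys) ≡ sum-by f xs ℤ.+ sum-by f ys
sum-by-++ f []       = sym (ℤ.+-identityˡ _)
sum-by-++ f (x ∷ xs) = ≡-trans (cong (λ s → f x ℤ.+ s) (sum-by-++ f xs)) (sym (ℤ.+-assoc (f x) _ _))

sum-by-↭ : ∀ (f : El → ℤ) {xs ys} → xs ↭ ys → sum-by f xs ≡ sum-by f ys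
sum-by-↭ f refl = refl
sum-by-↭ f (prep x p) = cong (λ s → f x ℤ.+ s) (sum-by-↭ f p)
sum-by-↭ f (swap {xs} {ys} x y p) = ≡-trans (cong (λ s → f x ℤ.+ (f y ℤ.+ s)) (sum-by-↭ f p)) (swapped (f x) (f y) _)
  where
  swapped : ∀ a b c → a ℤ.+ (b ℤ.+ c) ≡ b ℤ.+ (a ℤ.+ c)
  swapped = solve-∀
sum-by-↭ f (trans p q) = ≡-trans (sum-by-↭ f p) (sum-by-↭ f q)

flat : List (El × El) → List El
flat []             = []
flat ((x , y) ∷ ps) = x ∷ y ∷ flat ps

flat-++ : ∀ (ps qs : List (El × El)) → flat (ps ++ qs) ≡ flat ps ++ flat qs
flat-++ []             qs = refl
flat-++ ((x , y) ∷ ps) qs = cong (λ zs → x ∷ y ∷ zs) (flat-++ ps qs)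

flat-↭ : {ps qs : List (El × El)} → ps ↭ qs → flat ps ↭ flat qs
flat-↭ refl = refl
flat-↭ (prep (x , y) p) = prep x (prep y (flat-↭ p))
flat-↭ (swap (x , y) (z , w) p) =
  trans (prep x (prep y (prep z (prep w (flat-↭ p)))))
        (shifts (x ∷ y ∷ []) (z ∷ w ∷ []))
flat-↭ (trans p q) = trans (flat-↭ p) (flat-↭ q)

length-flat : ∀ (ps : List (El × El)) → length (flat ps) ≡ 2 ℕ.* length ps
length-flat []       = refl
length-flat (p ∷ ps) = ≡-trans (cong (2 ℕ.+_) (length-flat ps)) (sym (ℕ.*-suc 2 (length ps)))

module Mod (p : ℕ) where

  Z : ℤ → Set
  Z x = + p ℤ.∣ x

  Z? : ∀ x → Dec (Z x)
  Z? x = + p ∣? x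

  Z-+ : ∀ {x y} → Z x → Z y → Z (x ℤ.+ y)
  Z-+ = ∣m∣n⇒∣m+n

  Z-0 : Z 0ℤ
  Z-0 = divides 0ℤ refl

  Z-neg : ∀ {x} → Z x → Z (ℤ.- x)
  Z-neg = ∣m⇒∣-m

  Z-* : ∀ k {x} → Z x → Z (k ℤ.* x)
  Z-* k = ∣n⇒∣m*n k

  infix 4 _≋_ _≋?_

  -- A record instead of the bare divisibility of `x - y`, so that `x` and `y` can be recovered by
  -- unification.
  record _≋_ (x y : ℤ) : Set where
    constructor mk≋
    field un≋ : Z (x ℤ.- y)

  open _≋_ public

  _≋?_ : ∀ x y → Dec (x ≋ y)
  x ≋? y = map′ mk≋ un≋ (Z? (x ℤ.- y))

  ≋-by : ∀ {a b x y} → a ℤ.- b ≡ x ℤ.- y → a ≋ b → x ≋ y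
  ≋-by e (mk≋ d) = mk≋ (subst Z e d)

  ≋-refl : ∀ {x} → x ≋ x
  ≋-refl {x} = mk≋ (subst Z (sym (ℤ.+-inverseʳ x)) Z-0)

  ≋-sym : ∀ {x y} → x ≋ y → y ≋ x
  ≋-sym {x} {y} (mk≋ d) = mk≋ (subst Z (e x y) (Z-neg d))
    where
    e : ∀ x y → ℤ.- (x ℤ.- y) ≡ y ℤ.- x
    e = solve-∀

  ≋-trans : ∀ {x y z} → x ≋ y → y ≋ z → x ≋ z
  ≋-trans {x} {y} {z} (mk≋ d) (mk≋ d′) = mk≋ (subst Z (e x y z) (Z-+ d d′))
    where
    e : ∀ x y z → (x ℤ.- y) ℤ.+ (y ℤ.- z) ≡ x ℤ.- z
    e = solve-∀

  ≡⇒≋ : ∀ {x y} → x ≡ y → x ≋ y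
  ≡⇒≋ refl = ≋-refl

  Z-resp : ∀ {x y} → x ≋ y → Z y → Z x
  Z-resp {x} {y} (mk≋ d) e = subst Z (lem x y) (Z-+ d e)
    where
    lem : ∀ x y → (x ℤ.- y) ℤ.+ y ≡ x
    lem = solve-∀

  ≋⇒Z : ∀ {x} → x ≋ 0ℤ → Z x
  ≋⇒Z x≋0 = Z-resp x≋0 Z-0

  Z⇒≋ : ∀ {x} → Z x → x ≋ 0ℤ
  Z⇒≋ {x} d = mk≋ (subst Z (sym (ℤ.+-identityʳ x)) d)

  Distinct : List ℤ → Set
  Distinct = AllPairs (λ x y → ¬ x ≋ y)

module ModPrime (p : ℕ) (prime : Prime p) where

  open Mod p public
  open import Data.Nat.Primality using (prime⇒nonZero; prime⇒nonTrivial)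

  private instance _ = prime⇒nonZero prime

  Z-*⁻ : ∀ k {x} → Z (k ℤ.* x) → Z k ⊎ Z x
  Z-*⁻ k {x} d with euclidsLemma ∣ k ∣ ∣ x ∣ prime (subst (p ℕ.∣_) (ℤ.abs-* k x) (∣⇒∣ᵤ d))
  ... | inj₁ e = inj₁ (∣ᵤ⇒∣ e)
  ... | inj₂ e = inj₂ (∣ᵤ⇒∣ e)

  Z-<⇒≡0 : ∀ {n} → n ℕ.< p → Z (+ n) → n ≡ 0
  Z-<⇒≡0 {zero}  n<p d = refl
  Z-<⇒≡0 {suc n} n<p d = contradiction (∣⇒∣ᵤ d) (ℕ.>⇒∤ n<p)

  private
    residue : ℤ → Fin p
    residue x = fromℕ< (n%ℕd<d x p)

    residue-≡⇒≋ : ∀ {x y} → residue x ≡ residue y → x ≋ y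
    residue-≡⇒≋ {x} {y} e = mk≋ $ divides (x /ℕ p ℤ.- y /ℕ p) (begin
        x ℤ.- y
      ≡⟨ cong₂ ℤ._-_ (a≡a%ℕn+[a/ℕn]*n x p) (a≡a%ℕn+[a/ℕn]*n y p) ⟩
        (+ (x %ℕ p) ℤ.+ x /ℕ p ℤ.* + p) ℤ.- (+ (y %ℕ p) ℤ.+ y /ℕ p ℤ.* + p)
      ≡⟨ cong (λ r → (+ r ℤ.+ x /ℕ p ℤ.* + p) ℤ.- (+ (y %ℕ p) ℤ.+ y /ℕ p ℤ.* + p)) r≡ ⟩
        (+ (y %ℕ p) ℤ.+ x /ℕ p ℤ.* + p) ℤ.- (+ (y %ℕ p) ℤ.+ y /ℕ p ℤ.* + p)
      ≡⟨ lem (+ (y %ℕ p)) (x /ℕ p) (y /ℕ p) (+ p) ⟩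
        (x /ℕ p ℤ.- y /ℕ p) ℤ.* + p ∎)
      where
      open ≡-Reasoning
      r≡ : x %ℕ p ≡ y %ℕ p
      r≡ = ≡-trans (sym (Fin.toℕ-fromℕ< (n%ℕd<d x p))) (≡-trans (cong toℕ e) (Fin.toℕ-fromℕ< (n%ℕd<d y p)))
      lem : ∀ r a b p → (r ℤ.+ a ℤ.* p) ℤ.- (r ℤ.+ b ℤ.* p) ≡ (a ℤ.- b) ℤ.* p
      lem = solve-∀

    lookup-distinct : ∀ {xs} → Distinct xs → ∀ {i j} → i Fin.< j → ¬ lookup xs i ≋ lookup xs j
    lookup-distinct (px ∷ d) {Fin.zero}  {Fin.suc j} i<j = All.lookup px (∈-lookup j)
    lookup-distinct (px ∷ d) {Fin.suc i} {Fin.suc j} (s≤s i<j) = lookup-distinct d i<j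

  Distinct⇒length≤ : ∀ {xs} → Distinct xs → length xs ℕ.≤ p
  Distinct⇒length≤ {xs} d = ℕ.≮⇒≥ λ p<len →
    let (i , j , i<j , e) = Fin.pigeonhole p<len (residue ∘ lookup xs)
    in lookup-distinct d i<j (residue-≡⇒≋ e)

  private
    -- Among the p translates `v + k δ` with k < p, two would share an index in a shorter list; then
    -- p divides `(j - i) δ` although 0 < j - i < p and `δ` is nonzero.
    few-multiples : ∀ v {δ} → ¬ Z δ → ∀ vs (index : ℕ → Fin (length vs)) →
                    (∀ k → v ℤ.+ + k ℤ.* δ ≋ lookup vs (index k)) → p ℕ.≤ length vs
    few-multiples v {δ} δ≢0 vs index visits = ℕ.≮⇒≥ λ len<p →
      let (i , j , i<j , e) = Fin.pigeonhole len<p (λ i → index (toℕ i)) in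
      clash (toℕ i) (toℕ j) (Fin.toℕ<n j) i<j e
      where
      lem : ∀ v i j δ → (v ℤ.+ j ℤ.* δ) ℤ.- (v ℤ.+ i ℤ.* δ) ≡ (j ℤ.- i) ℤ.* δ
      lem = solve-∀
      clash : ∀ i j → j ℕ.< p → i ℕ.< j → index i ≡ index j → ⊥
      clash i j j<p i<j e = [ differ , δ≢0 ]′ (Z-*⁻ (+ j ℤ.- + i) {δ} (subst Z (lem v (+ i) (+ j) δ) (un≋
        (≋-trans (visits j) (≋-sym (subst (λ l → v ℤ.+ + i ℤ.* δ ≋ lookup vs l) e (visits i)))))))
        where
        differ : ¬ Z (+ j ℤ.- + i)
        differ d = ℕ.<⇒≢ (ℕ.m<n⇒0<n∸m i<j) (sym (Z-<⇒≡0 {j ℕ.∸ i} (ℕ.≤-<-trans (ℕ.m∸n≤m j i) j<p)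
          (subst Z (≡-trans (ℤ.m-n≡m⊖n j i) (ℤ.⊖-≥ (ℕ.<⇒≤ i<j))) d)))

    -- A set closed under adding `δ` contains the whole orbit of one of its elements, and for prime
    -- p that orbit has p elements.
    closed⇒large : ∀ {vs v} → v ∈ vs → ∀ {δ} → ¬ Z δ →
                   (∀ {w} → w ∈ vs → Any (λ w′ → w ℤ.+ δ ≋ w′) vs) → p ℕ.≤ length vs
    closed⇒large {vs} {v} v∈ {δ} δ≢0 closed =
      few-multiples v δ≢0 vs (λ k → Any.index (orbit k)) (λ k → lookup-index (orbit k))
      where
      start : ∀ v δ → (v ℤ.+ 0ℤ ℤ.* δ) ≡ v
      start = solve-∀
      step : ∀ v k δ w → (v ℤ.+ k ℤ.* δ) ℤ.- w ≡ (v ℤ.+ (1ℤ ℤ.+ k) ℤ.* δ) ℤ.- (w ℤ.+ δ)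
      step = solve-∀
      orbit : ∀ k → Any (λ w → v ℤ.+ + k ℤ.* δ ≋ w) vs
      orbit zero    = Any.map (λ {refl → ≡⇒≋ (start v δ)}) v∈
      orbit (suc k) with find (orbit k)
      ... | w , w∈ , d = Any.map (≋-trans (≋-by (step v (+ k) δ w) d)) (closed w∈)

  -- One Cauchy-Davenport step. If every translate by `y` were already a translate by `x`, then `vs`
  -- would be closed under adding `y - x` and would have p elements. `P` and `Q` record how a sum is
  -- realised before and after the step.
  grow : ∀ (P Q : ℤ → Set) x y → ¬ x ≋ y →
         (∀ {v} → P v → Q (v ℤ.+ x)) → (∀ {v} → P v → Q (v ℤ.+ y)) →
         ∀ {vs} → Distinct vs → All P vs → 1 ℕ.≤ length vs → length vs ℕ.< p →
         ∃[ ws ] Distinct ws × All Q ws × length ws ≡ suc (length vs)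
  grow P Q x y x≢y Px Py {vs@(v ∷ _)} dvs Pvs _ len<p
    with Any.any? (λ w → All.all? (λ w′ → ¬? ((w ℤ.+ y) ≋? (w′ ℤ.+ x))) vs) vs
  ... | yes new =
    let (w , w∈ , fresh) = find new
    in (w ℤ.+ y) ∷ map (λ v → v ℤ.+ x) vs
     , All.map⁺ fresh ∷ AllPairs.map⁺ (AllPairs.map (λ {a} {b} n e → n (≋-by (lem a b x) e)) dvs)
     , Py (All.lookup Pvs w∈) ∷ All.map⁺ (All.map Px Pvs)
     , cong suc (length-map _ vs)
    where
    lem : ∀ a b x → (a ℤ.+ x) ℤ.- (b ℤ.+ x) ≡ a ℤ.- b
    lem = solve-∀
  ... | no none = contradiction (closed⇒large {vs} (here refl) (λ d → x≢y (≋-sym (mk≋ d))) closed) (ℕ.<⇒≱ len<p)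
    where
    lem : ∀ w y w′ x → (w ℤ.+ y) ℤ.- (w′ ℤ.+ x) ≡ (w ℤ.+ (y ℤ.- x)) ℤ.- w′
    lem = solve-∀
    closed : ∀ {w} → w ∈ vs → Any (λ w′ → w ℤ.+ (y ℤ.- x) ≋ w′) vs
    closed {w} w∈ with Any.any? (λ w′ → (w ℤ.+ (y ℤ.- x)) ≋? w′) vs
    ... | yes a = a
    ... | no na = contradiction
      (Any.map (λ {refl → All.map (λ {w′} n e → n (≋-by (lem w y w′ x) e)) (All.¬Any⇒All¬ vs na)}) w∈) none

  -- Without a zero among them, 0 could be added to the list, giving p + 1 distinct residues.
  full⇒zero : ∀ {vs} → Distinct vs → p ℕ.≤ length vs → Any Z vs
  full⇒zero {vs} dvs p≤ with Any.any? Z? vs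
  ... | yes a = a
  ... | no na = contradiction
    (Distinct⇒length≤ (All.map (λ {w} n e → n (subst Z (lem w) (Z-neg (un≋ {0ℤ} {w} e)))) (All.¬Any⇒All¬ vs na) ∷ dvs))
    (ℕ.<⇒≱ (s≤s p≤))
    where
    lem : ∀ w → ℤ.- (0ℤ ℤ.- w) ≡ w
    lem = solve-∀

  module Blocks (val : Bl → ℤ) where

    Unequal : Bl × Bl → Set
    Unequal (x , y) = ¬ val x ≋ val y

    record Selection (ms : List (Bl × Bl)) : Set where
      field
        chosen others : List Bl
        split         : flat ms ↭ chosen ++ others
        length-chosen : length chosen ≡ length ms

    open Selection public

    -- Cauchy–Davenport for two-element sets.
    selection-sum : ∀ ms → All Unequal ms → ∀ {vs} → Distinct vs → 1 ℕ.≤ length vs →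
                    p ℕ.≤ length vs ℕ.+ length ms →
                    Σ (Selection ms) λ s → Any (λ v → Z (sum-by val (chosen s) ℤ.+ v)) vs
    selection-sum [] [] {vs} dvs _ p≤ =
      record { chosen = [] ; others = [] ; split = refl ; length-chosen = refl }
      , Any.map (λ {v} → subst Z (sym (ℤ.+-identityˡ v)))
                (full⇒zero dvs (subst (p ℕ.≤_) (ℕ.+-identityʳ _) p≤))
    selection-sum ((x , y) ∷ ms) (x≢y ∷ us) {vs} dvs nonempty p≤
      = let (ws , dws , Qws , 1≤ , p≤′) = larger
            (s , a) = selection-sum ms us dws 1≤ p≤′
            (w , w∈ , z) = find a
        in extend s w (All.lookup Qws w∈) z
      where
      Q : ℤ → Set
      Q w = Any (λ v → w ≡ v ℤ.+ val x ⊎ w ≡ v ℤ.+ val y) vs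
      larger : ∃[ ws ] Distinct ws × All Q ws × 1 ℕ.≤ length ws × p ℕ.≤ length ws ℕ.+ length ms
      larger with length vs ℕ.<? p
      ... | yes len<p =
        let (ws , dws , Qws , e) = grow (_∈ vs) Q (val x) (val y) x≢y
              (Any.map λ { refl → inj₁ refl }) (Any.map λ { refl → inj₂ refl })
              dvs (All.tabulate id) nonempty len<p
        in ws , dws , Qws , subst (1 ℕ.≤_) (sym e) (s≤s z≤n)
         , subst (p ℕ.≤_) (≡-trans (ℕ.+-suc (length vs) (length ms)) (cong (ℕ._+ length ms) (sym e))) p≤
      -- All residues are present already; choosing `x` merely translates them, and nothing has to
      -- grow.
      ... | no len≮p =
        map (λ v → v ℤ.+ val x) vs
        , AllPairs.map⁺ (AllPairs.map (λ {a} {b} n e → n (≋-by (lem a b (val x)) e)) dvs)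
        , All.map⁺ (All.tabulate (Any.map λ { refl → inj₁ refl }))
        , subst (1 ℕ.≤_) (sym (length-map _ vs)) nonempty
        , ℕ.≤-trans (ℕ.≮⇒≥ len≮p) (subst (λ l → length vs ℕ.≤ l ℕ.+ length ms) (sym (length-map _ vs)) (ℕ.m≤m+n _ _))
        where
        lem : ∀ a b x → (a ℤ.+ x) ℤ.- (b ℤ.+ x) ≡ a ℤ.- b
        lem = solve-∀
      move : ∀ s v x → s ℤ.+ (v ℤ.+ x) ≡ (x ℤ.+ s) ℤ.+ v
      move = solve-∀
      extend : (s : Selection ms) → ∀ w → Q w → Z (sum-by val (chosen s) ℤ.+ w) →
               Σ (Selection ((x , y) ∷ ms)) λ s′ → Any (λ v → Z (sum-by val (chosen s′) ℤ.+ v)) vs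
      extend s w q z with find q
      ... | v , v∈ , inj₁ refl =
        record { chosen = x ∷ chosen s ; others = y ∷ others s
               ; split = prep x (trans (prep y (split s)) (↭-sym (shift y (chosen s) (others s))))
               ; length-chosen = cong suc (length-chosen s) }
        , Any.map (λ { refl → subst Z (move _ v (val x)) z }) v∈
      ... | v , v∈ , inj₂ refl =
        record { chosen = y ∷ chosen s ; others = x ∷ others s
               ; split = trans (swap x y (split s)) (prep y (↭-sym (shift x (chosen s) (others s))))
               ; length-chosen = cong suc (length-chosen s) }
        , Any.map (λ { refl → subst Z (move _ v (val y)) z }) v∈

    Has : ℤ → Bl × Bl → Set
    Has u (x , y) = val x ≋ u ⊎ val y ≋ u

    Has? : ∀ u m → Dec (Has u m)
    Has? u (x , y) = (val x ≋? u) ⊎-dec (val y ≋? u)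

    -- If more than one block stays unmatched, a single value `u` is to blame: all unmatched blocks
    -- have it and every couple contains it. Then as many blocks of value `u` can be selected as
    -- there are couples and unmatched blocks together.
    record Matching (xs : List Bl) : Set where
      field
        matched : List (Bl × Bl)
        rest    : List Bl
        splits  : xs ↭ flat matched ++ rest
        unequal : All Unequal matched
        maximal : length rest ℕ.≤ 1 ⊎ ∃[ u ] All (λ x → val x ≋ u) rest × All (Has u) matched

    matching : ∀ xs → Matching xs
    matching [] = record { matched = [] ; rest = [] ; splits = refl ; unequal = [] ; maximal = inj₁ z≤n }
    matching (x ∷ xs) with matching xs
    ... | record { matched = ms ; rest = [] ; splits = s ; unequal = us } =
      record { matched = ms ; rest = x ∷ [] ; unequal = us ; maximal = inj₁ (s≤s z≤n)
             ; splits = trans (prep x s) (↭-sym (shift x (flat ms) [])) }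
    ... | record { matched = ms ; rest = y ∷ r ; splits = s ; unequal = us ; maximal = m }
      with val x ≋? val y
    ... | no x≢y =
      record { matched = (x , y) ∷ ms ; rest = r ; unequal = x≢y ∷ us
             ; splits = prep x (trans s (shift y (flat ms) r))
             ; maximal = shrink m }
      where
      shrink : length (y ∷ r) ℕ.≤ 1 ⊎ ∃[ u ] All (λ x → val x ≋ u) (y ∷ r) × All (Has u) ms →
               length r ℕ.≤ 1 ⊎ ∃[ u ] All (λ x → val x ≋ u) r × All (Has u) ((x , y) ∷ ms)
      shrink (inj₁ (s≤s l)) = inj₁ (ℕ.≤-trans l z≤n)
      shrink (inj₂ (u , y≋u ∷ r≋u , hs)) = inj₂ (u , r≋u , inj₂ y≋u ∷ hs)
    matching (x ∷ xs) | record { matched = ms ; rest = y ∷ r ; splits = s ; unequal = us ; maximal = inj₂ (u , y≋u ∷ r≋u , hs) }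
      | yes x≋y =
      record { matched = ms ; rest = x ∷ y ∷ r ; unequal = us
             ; splits = trans (prep x s) (↭-sym (shift x (flat ms) (y ∷ r)))
             ; maximal = inj₂ (u , ≋-trans x≋y y≋u ∷ y≋u ∷ r≋u , hs) }
    matching (x ∷ xs) | record { matched = ms ; rest = y ∷ [] ; splits = s ; unequal = us ; maximal = inj₁ _ }
      | yes x≋y with Any.any? (λ m → ¬? (Has? (val x) m)) ms
    ... | no none =
      record { matched = ms ; rest = x ∷ y ∷ [] ; unequal = us
             ; splits = trans (prep x s) (↭-sym (shift x (flat ms) (y ∷ [])))
             ; maximal = inj₂ (val x , ≋-refl ∷ ≋-sym x≋y ∷ []
                              , All.map (λ {m} → decidable-stable (Has? (val x) m)) (All.¬Any⇒All¬ ms none)) }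
    -- A couple without the common value of `x` and `y` is broken up: one of its blocks goes to `x`,
    -- the other to `y`, and nothing is left over.
    ... | yes some with find some
    ... | (v , w) , m∈ , ¬has with ∈⇒↭ m∈
    ... | ms′ , π =
      record { matched = (x , v) ∷ (y , w) ∷ ms′ ; rest = [] ; maximal = inj₁ z≤n
             ; unequal = (λ d → ¬has (inj₁ (≋-sym d)))
                       ∷ (λ d → ¬has (inj₂ (≋-sym (≋-trans x≋y d))))
                       ∷ All.tail (All-resp-↭ π us)
             ; splits = trans (prep x (trans s (++⁺ʳ (y ∷ []) (flat-↭ π))))
                 (Bag.solve 5 (λ a b c d e → a ⊕ ((c ⊕ (d ⊕ e)) ⊕ b) ⊜ (a ⊕ (c ⊕ (b ⊕ (d ⊕ e)))) ⊕ Bag.id)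
                   refl [ x ] [ y ] [ v ] [ w ] (flat ms′)) }
      where open Bag using (_⊕_; _⊜_)
    matching (x ∷ xs) | record { rest = _ ∷ _ ∷ _ ; maximal = inj₁ (s≤s ()) } | yes _
 

-- Subsets of a vector space over the field with two elements

V : ℕ → Set
V = Vec Bool

infixl 6 _⊕ᵛ_

_⊕ᵛ_ : ∀ {n} → V n → V n → V n
_⊕ᵛ_ = zipWith _xor_

0ᵛ : ∀ {n} → V n
0ᵛ = Vec.replicate _ false

_≟ᵛ_ : ∀ {n} (u v : V n) → Dec (u ≡ v)
_≟ᵛ_ = Vec.≡-dec Bool._≟_

⊕ᵛ-assoc : ∀ {n} (u v w : V n) → (u ⊕ᵛ v) ⊕ᵛ w ≡ u ⊕ᵛ (v ⊕ᵛ w)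
⊕ᵛ-assoc = Vec.zipWith-assoc Bool.xor-assoc

⊕ᵛ-comm : ∀ {n} (u v : V n) → u ⊕ᵛ v ≡ v ⊕ᵛ u
⊕ᵛ-comm = Vec.zipWith-comm Bool.xor-comm

⊕ᵛ-identityˡ : ∀ {n} (u : V n) → 0ᵛ ⊕ᵛ u ≡ u
⊕ᵛ-identityˡ = Vec.zipWith-identityˡ Bool.xor-identityˡ

⊕ᵛ-identityʳ : ∀ {n} (u : V n) → u ⊕ᵛ 0ᵛ ≡ u
⊕ᵛ-identityʳ = Vec.zipWith-identityʳ Bool.xor-identityʳ

⊕ᵛ-self : ∀ {n} (u : V n) → u ⊕ᵛ u ≡ 0ᵛ
⊕ᵛ-self []      = refl
⊕ᵛ-self (b ∷ u) = cong₂ _∷_ (Bool.xor-same b) (⊕ᵛ-self u)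

⊕ᵛ-cancel : ∀ {n} (u v : V n) → u ⊕ᵛ (u ⊕ᵛ v) ≡ v
⊕ᵛ-cancel u v = ≡-trans (sym (⊕ᵛ-assoc u u v)) (≡-trans (cong (_⊕ᵛ v) (⊕ᵛ-self u)) (⊕ᵛ-identityˡ v))

-- The characteristic function as a binary tree, so that subsets of a fixed size can be generated
-- one half at a time.
Sub : ℕ → Set
Sub zero    = Bool
Sub (suc n) = Sub n × Sub n

look : ∀ {n} → Sub n → V n → Bool
look b       []          = b
look (s , t) (false ∷ v) = look s v
look (s , t) (true  ∷ v) = look t v

tabulate : ∀ {n} → (V n → Bool) → Sub n
tabulate {zero}  f = f []
tabulate {suc n} f = tabulate (f ∘ (false ∷_)) , tabulate (f ∘ (true ∷_))

look-tabulate : ∀ {n} (f : V n → Bool) v → look (tabulate f) v ≡ f v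
look-tabulate f []          = refl
look-tabulate f (false ∷ v) = look-tabulate (f ∘ (false ∷_)) v
look-tabulate f (true  ∷ v) = look-tabulate (f ∘ (true ∷_)) v

infix 4 _∈ˢ_

_∈ˢ_ : ∀ {n} → V n → Sub n → Set
v ∈ˢ t = look t v ≡ true

count : ∀ {n} → Sub n → ℕ
count {zero}  b       = if b then 1 else 0
count {suc n} (s , t) = count s ℕ.+ count t

-- Search procedures carry their correctness proofs; only the constructors
-- just and nothing are ever evaluated.

search : ∀ {n} (t : Sub n) {P : V n → Set} → (∀ v → v ∈ˢ t → Maybe (P v)) → Maybe (∃[ v ] v ∈ˢ t × P v)
search {zero}  true    f = mapᴹ (λ p → [] , refl , p) (f [] refl)
search {zero}  false   f = nothing
search {suc n} (s , t) f = mapᴹ (λ (v , m , p) → false ∷ v , m , p) (search s (f ∘ (false ∷_)))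
                       <∣> mapᴹ (λ (v , m , p) → true ∷ v , m , p) (search t (f ∘ (true ∷_)))

forAll : ∀ {n} (t : Sub n) {P : V n → Set} → (∀ v → v ∈ˢ t → Maybe (P v)) → Maybe (∀ v → v ∈ˢ t → P v)
forAll {zero}  true    f = mapᴹ (λ p → λ { [] _ → p }) (f [] refl)
forAll {zero}  false   f = just λ { [] () }
forAll {suc n} (s , t) f =
  forAll s (f ∘ (false ∷_)) >>= λ g →
  forAll t (f ∘ (true ∷_)) >>= λ h →
  just λ { (false ∷ v) → g v ; (true ∷ v) → h v }

in? : ∀ {n} (t : Sub n) v → Maybe (v ∈ˢ t)
in? t v with look t v
... | true  = just refl
... | false = nothing

same : ∀ {n} → V n → V n → Bool
same []          []          = true
same (false ∷ u) (false ∷ v) = same u v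
same (true  ∷ u) (true  ∷ v) = same u v
same (_ ∷ u)     (_ ∷ v)     = false

same-refl : ∀ {n} (u : V n) → same u u ≡ true
same-refl []          = refl
same-refl (false ∷ u) = same-refl u
same-refl (true  ∷ u) = same-refl u

same-sound : ∀ {n} (u v : V n) → same u v ≡ true → u ≡ v
same-sound []          []          _ = refl
same-sound (false ∷ u) (false ∷ v) e = cong (false ∷_) (same-sound u v e)
same-sound (true  ∷ u) (true  ∷ v) e = cong (true ∷_) (same-sound u v e)

unequal? : ∀ {n} (u v : V n) → Maybe (u ≢ v)
unequal? u v = by (same u v) refl
  where
  by : ∀ b → same u v ≡ b → Maybe (u ≢ v)
  by true  e = nothing
  by false e = just λ { refl → contradiction (≡-trans (sym (same-refl u)) e) λ () }

private
  Entries : ∀ n → (V n → Set) → Set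
  Entries zero    P = P []
  Entries (suc n) P = Entries n (P ∘ (false ∷_)) × Entries n (P ∘ (true ∷_))

  allEntries : ∀ {n} {P : V n → Set} → (∀ v → P v) → Entries n P
  allEntries {zero}  f = f []
  allEntries {suc n} f = allEntries (f ∘ (false ∷_)) , allEntries (f ∘ (true ∷_))

  entry : ∀ {n} {P : V n → Set} → Entries n P → ∀ v → P v
  entry x       []          = x
  entry (x , y) (false ∷ v) = entry x v
  entry (x , y) (true  ∷ v) = entry y v

-- The values are stored in a tree instead of being given by a function, so that repeated lookups
-- can share them.
record Table {n} (P : V n → Set) : Set where
  constructor tab
  field entries : Entries n P

table : ∀ {n} {P : V n → Set} → (∀ v → P v) → Table P
table f = tab (allEntries f)

get : ∀ {n} {P : V n → Set} → Table P → ∀ v → P v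
get (tab es) = entry es

-- Enumeration of the subsets of a given size

allWithCount : ∀ n → ℕ → (Sub n → Bool) → Bool
splitCount   : ∀ n → ℕ → ℕ → (Sub n × Sub n → Bool) → Bool
allWithCount zero    zero          f = f false
allWithCount zero    (suc zero)    f = f true
allWithCount zero    (suc (suc k)) f = true
allWithCount (suc n) k             f = splitCount n 0 k f
splitCount n i zero    f = allWithCount n i (λ s → allWithCount n 0 (λ t → f (s , t)))
splitCount n i (suc j) f = allWithCount n i (λ s → allWithCount n (suc j) (λ t → f (s , t))) ∧ splitCount n (suc i) j f

private
  ∧-true : ∀ {a b} → a ∧ b ≡ true → a ≡ true × b ≡ true
  ∧-true {true} e = refl , e

allWithCount-sound : ∀ n k f → allWithCount n k f ≡ true → ∀ t → count t ≡ k → f t ≡ true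
splitCount-sound : ∀ n i j f → splitCount n i j f ≡ true → ∀ s t → i ℕ.≤ count s → count s ℕ.+ count t ≡ i ℕ.+ j → f (s , t) ≡ true
allWithCount-sound zero zero          f e false refl = e
allWithCount-sound zero (suc zero)    f e true  refl = e
allWithCount-sound zero (suc (suc k)) f e true  ()
allWithCount-sound zero (suc (suc k)) f e false ()
allWithCount-sound (suc n) k f e (s , t) c = splitCount-sound n 0 k f e s t ℕ.z≤n c
splitCount-sound n i j f e s t i≤s c with count s ℕ.≟ i
splitCount-sound n i zero f e s t i≤s c | yes refl =
  allWithCount-sound n 0 _ (allWithCount-sound n i _ e s refl) t (ℕ.+-cancelˡ-≡ (count s) _ _ c)
splitCount-sound n i (suc j) f e s t i≤s c | yes refl =
  allWithCount-sound n (suc j) _ (allWithCount-sound n i _ (proj₁ (∧-true e)) s refl) t (ℕ.+-cancelˡ-≡ (count s) _ _ c)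
splitCount-sound n i zero f e s t i≤s c | no s≢i =
  contradiction (ℕ.≤-antisym (ℕ.≤-trans (ℕ.m≤m+n (count s) _) (ℕ.≤-reflexive (≡-trans c (ℕ.+-identityʳ i)))) i≤s) s≢i
splitCount-sound n i (suc j) f e s t i≤s c | no s≢i =
  splitCount-sound n (suc i) j f (proj₂ (∧-true {allWithCount n i _} e)) s t
    (ℕ.≤∧≢⇒< i≤s (s≢i ∘ sym)) (≡-trans c (ℕ.+-suc i j))

from-is-just : ∀ {P : Set} (m : Maybe P) → is-just m ≡ true → P
from-is-just (just p) _ = p

-- Proof by reflection: one Boolean evaluation over all sets of size `k` certifies that `decide`
-- succeeds wherever `accept` holds, and the proof is then read off from `decide`. With `balanced`
-- as filter only suitable translates have to be decided.
byEnumeration : ∀ {n k} {P : Sub n → Set} (accept : Sub n → Bool) (decide : ∀ t → Maybe (P t)) →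
                allWithCount n k (λ t → not (accept t) ∨ is-just (decide t)) ≡ true →
                ∀ t → count t ≡ k → accept t ≡ true → P t
byEnumeration {n} {k} accept decide e t c a =
  from-is-just (decide t) (subst (λ b → not b ∨ is-just (decide t) ≡ true) a (allWithCount-sound n k _ e t c))

flip : ∀ {n} → V n → Sub n → Sub n
flip []          b       = b
flip (false ∷ o) (s , t) = flip o s , flip o t
flip (true  ∷ o) (s , t) = flip o t , flip o s

look-flip : ∀ {n} (o : V n) t v → look (flip o t) v ≡ look t (v ⊕ᵛ o)
look-flip []          b       []          = refl
look-flip (false ∷ o) (s , t) (false ∷ v) = look-flip o s v
look-flip (false ∷ o) (s , t) (true  ∷ v) = look-flip o t v
look-flip (true  ∷ o) (s , t) (false ∷ v) = look-flip o t v
look-flip (true  ∷ o) (s , t) (true  ∷ v) = look-flip o s v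

count-flip : ∀ {n} (o : V n) t → count (flip o t) ≡ count t
count-flip []          b       = refl
count-flip (false ∷ o) (s , t) = cong₂ ℕ._+_ (count-flip o s) (count-flip o t)
count-flip (true  ∷ o) (s , t) = ≡-trans (cong₂ ℕ._+_ (count-flip o t) (count-flip o s)) (ℕ.+-comm (count t) (count s))

private
  add₂ : ℕ × ℕ → ℕ × ℕ → ℕ × ℕ
  add₂ (a , b) (c , d) = a ℕ.+ c , b ℕ.+ d

  marginals : ∀ {n} → Sub n → Vec (ℕ × ℕ) n
  marginals {zero}  b       = []
  marginals {suc n} (s , t) = (count s , count t) ∷ zipWith add₂ (marginals s) (marginals t)

  heavier : ℕ × ℕ → Bool
  heavier (a , b) = not (b ℕ.≤ᵇ a)

-- In each coordinate at least half of the points have a zero; every set has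
-- exactly one such translate if its size is odd.
balanced : ∀ {n} → Sub n → Bool
balanced t = Vec.foldr′ _∧_ true (Vec.map (not ∘ heavier) (marginals t))

private
  swap-if : Bool → ℕ × ℕ → ℕ × ℕ
  swap-if true  (a , b) = b , a
  swap-if false x       = x

  swap-if-add : ∀ {n} (o : V n) xs ys → zipWith add₂ (zipWith swap-if o xs) (zipWith swap-if o ys) ≡ zipWith swap-if o (zipWith add₂ xs ys)
  swap-if-add []          []       []       = refl
  swap-if-add (false ∷ o) (x ∷ xs) (y ∷ ys) = cong (_ ∷_) (swap-if-add o xs ys)
  swap-if-add (true  ∷ o) (x ∷ xs) (y ∷ ys) = cong (_ ∷_) (swap-if-add o xs ys)

  add-comm : ∀ {n} (xs ys : Vec (ℕ × ℕ) n) → zipWith add₂ xs ys ≡ zipWith add₂ ys xs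
  add-comm = Vec.zipWith-comm λ (a , b) (c , d) → cong₂ _,_ (ℕ.+-comm a c) (ℕ.+-comm b d)

  marginals-flip : ∀ {n} (o : V n) t → marginals (flip o t) ≡ zipWith swap-if o (marginals t)
  marginals-flip []          b       = refl
  marginals-flip (false ∷ o) (s , t) = cong₂ _∷_ (cong₂ _,_ (count-flip o s) (count-flip o t))
    (≡-trans (cong₂ (zipWith add₂) (marginals-flip o s) (marginals-flip o t)) (swap-if-add o _ _))
  marginals-flip (true  ∷ o) (s , t) = cong₂ _∷_ (cong₂ _,_ (count-flip o t) (count-flip o s))
    (≡-trans (cong₂ (zipWith add₂) (marginals-flip o t) (marginals-flip o s))
      (≡-trans (swap-if-add o _ _) (cong (zipWith swap-if o) (add-comm (marginals t) (marginals s)))))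

  majority : ∀ {n} (xs : Vec (ℕ × ℕ) n) →
             Vec.foldr′ _∧_ true (Vec.map (not ∘ heavier) (zipWith swap-if (Vec.map heavier xs) xs)) ≡ true
  majority []             = refl
  majority ((a , b) ∷ xs) = cong₂ _∧_ (one a b) (majority xs)
    where
    one : ∀ a b → not (heavier (swap-if (heavier (a , b)) (a , b))) ≡ true
    one a b with b ℕ.≤ᵇ a in e
    ... | true  = cong (not ∘ not) e
    ... | false = cong (not ∘ not) (Bool.T-≡ .Equivalence.to (ℕ.≤⇒≤ᵇ {a} {b} (ℕ.<⇒≤ (ℕ.≰⇒> λ b≤a → subst Bool.T e (ℕ.≤⇒≤ᵇ {b} {a} b≤a)))))

balance : ∀ {n} → Sub n → V n
balance t = Vec.map heavier (marginals t)

balanced-flip : ∀ {n} (t : Sub n) → balanced (flip (balance t) t) ≡ true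
balanced-flip t =
  ≡-trans (cong (λ m → Vec.foldr′ _∧_ true (Vec.map (not ∘ heavier) m)) (marginals-flip (balance t) t)) (majority (marginals t))

-- If every quadruple of points of t with sum 0 has value κ, then each pair in a
-- strong direction has value κ / 2, and each point with Norm has value κ / 4.
record Strong (t : Sub 4) (d : V 4) : Set where
  field
    d≢0 : d ≢ 0ᵛ
    a b c : V 4
    a∈ : a ∈ˢ t
    b∈ : b ∈ˢ t
    c∈ : c ∈ˢ t
    a′∈ : a ⊕ᵛ d ∈ˢ t
    b′∈ : b ⊕ᵛ d ∈ˢ t
    c′∈ : c ⊕ᵛ d ∈ˢ t
    b≢a : b ≢ a
    b≢a′ : b ≢ a ⊕ᵛ d
    c≢a : c ≢ a
    c≢a′ : c ≢ a ⊕ᵛ d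
    c≢b : c ≢ b
    c≢b′ : c ≢ b ⊕ᵛ d

private
  collect : ∀ {n} (t : Sub n) {P : V n → Set} → (∀ v → v ∈ˢ t → Maybe (P v)) → List (∃[ v ] v ∈ˢ t × P v) → List (∃[ v ] v ∈ˢ t × P v)
  collect t f rest = go t _ (λ v m → mapᴹ (λ p → v , m , p) (f v m)) rest
    where
    go : ∀ {n} (t : Sub n) (Q : Set) → (∀ v → v ∈ˢ t → Maybe Q) → List Q → List Q
    go {zero}  true  Q f qs = maybe′ (_∷ qs) qs (f [] refl)
    go {zero}  false Q f qs = qs
    go {suc n} (s , t) Q f qs = go s Q (f ∘ (false ∷_)) (go t Q (f ∘ (true ∷_)) qs)

  -- Selects one end of each pair `v`, `v ⊕ᵛ d`, namely the one that has a zero at the first nonzero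
  -- coordinate of `d`. Pairs found this way are disjoint.
  lower : ∀ {n} → V n → V n → Bool
  lower []          []      = false
  lower (false ∷ d) (_ ∷ v) = lower d v
  lower (true  ∷ d) (b ∷ v) = not b

strong? : ∀ t d → Maybe (Strong t d)
strong? t d = pick (collect t (λ v _ → if lower d v then in? t (v ⊕ᵛ d) else nothing) [])
  where
  pick : List (∃[ v ] v ∈ˢ t × v ⊕ᵛ d ∈ˢ t) → Maybe (Strong t d)
  pick ((a , a∈ , a′∈) ∷ (b , b∈ , b′∈) ∷ (c , c∈ , c′∈) ∷ _) =
    unequal? d 0ᵛ >>= λ d≢0 → unequal? b a >>= λ b≢a → unequal? b (a ⊕ᵛ d) >>= λ b≢a′ →
    unequal? c a >>= λ c≢a → unequal? c (a ⊕ᵛ d) >>= λ c≢a′ → unequal? c b >>= λ c≢b → unequal? c (b ⊕ᵛ d) >>= λ c≢b′ →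
    just record { d≢0 = d≢0 ; a = a ; b = b ; c = c ; a∈ = a∈ ; b∈ = b∈ ; c∈ = c∈ ; a′∈ = a′∈ ; b′∈ = b′∈ ; c′∈ = c′∈
                ; b≢a = b≢a ; b≢a′ = b≢a′ ; c≢a = c≢a ; c≢a′ = c≢a′ ; c≢b = c≢b ; c≢b′ = c≢b′ }
  pick _ = nothing

data Norm (t : Sub 4) : V 4 → Set where
  triangle : ∀ {x y z} → x ∈ˢ t → y ∈ˢ t → z ∈ˢ t →
             Strong t (x ⊕ᵛ y) → Strong t (x ⊕ᵛ z) → Strong t (y ⊕ᵛ z) → Norm t x
  adjacent : ∀ {x y} → x ∈ˢ t → y ∈ˢ t → Strong t (x ⊕ᵛ y) → Norm t y → Norm t x

module _ (t : Sub 4) where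

  private
    Strongs Norms : Set
    Strongs = Table (λ d → Maybe (Strong t d))
    Norms   = Table (λ v → Maybe (Norm t v))

    seed : Strongs → Maybe (∃[ x ] x ∈ˢ t × Norm t x)
    seed st = search t λ x x∈ →
      search t (λ y y∈ → get st (x ⊕ᵛ y) >>= λ xy →
        search t (λ z z∈ → get st (x ⊕ᵛ z) >>= λ xz → get st (y ⊕ᵛ z) >>= λ yz → just (triangle {t} x∈ y∈ z∈ xy xz yz)))
      >>= λ (_ , _ , _ , _ , n) → just n

    spread : Strongs → Norms → Norms
    spread st ns = table λ v → get ns v <∣>
      (in? t v >>= λ v∈ → search t (λ u u∈ → get ns u >>= λ nu → get st (v ⊕ᵛ u) >>= λ s → just (adjacent v∈ u∈ s nu))
       >>= λ (_ , _ , n) → just n)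

    start : (∃[ x ] x ∈ˢ t × Norm t x) → Norms
    start (x , _ , nx) = table λ v → if-same v (same v x) refl
      where
      if-same : ∀ v b → same v x ≡ b → Maybe (Norm t v)
      if-same v true  e = just (subst (Norm t) (sym (same-sound v x e)) nx)
      if-same v false _ = nothing

  -- s and r are compared through a quadruple and a sextuple of otherwise normal points.
  record Exceptional (s r : V 4) : Set where
    field
      z₁ z₂ z₃ z₄ z₅ z₆ : V 4
      norms    : Norm t z₁ × Norm t z₂ × Norm t z₃ × Norm t z₄ × Norm t z₅ × Norm t z₆
      in-t     : z₁ ∈ˢ t × z₂ ∈ˢ t × z₃ ∈ˢ t × z₄ ∈ˢ t × z₅ ∈ˢ t × z₆ ∈ˢ t
      quad     : z₂ ≡ s ⊕ᵛ r ⊕ᵛ z₁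
      sextuple : z₆ ≡ s ⊕ᵛ r ⊕ᵛ z₃ ⊕ᵛ z₄ ⊕ᵛ z₅
      distinct : z₁ ≢ s × z₁ ≢ r × z₃ ≢ s × z₃ ≢ r × z₄ ≢ s × z₄ ≢ r × z₄ ≢ z₃ × z₅ ≢ s × z₅ ≢ r × z₅ ≢ z₃ × z₅ ≢ z₄
               × z₆ ≢ s × z₆ ≢ r × z₆ ≢ z₃ × z₆ ≢ z₄ × z₆ ≢ z₅

  private
    exceptional? : Norms → ∀ s r → Maybe (Exceptional s r)
    exceptional? ns s r =
      search t (λ z₁ _ → get ns z₁ >>= λ n₁ → unequal? z₁ s >>= λ e₁ → unequal? z₁ r >>= λ e₂ →
        in? t (s ⊕ᵛ r ⊕ᵛ z₁) >>= λ i₂ → get ns (s ⊕ᵛ r ⊕ᵛ z₁) >>= λ n₂ → just (n₁ , e₁ , e₂ , i₂ , n₂))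
        >>= λ (z₁ , i₁ , n₁ , e₁ , e₂ , i₂ , n₂) →
      search t (λ z₃ _ → get ns z₃ >>= λ n₃ → unequal? z₃ s >>= λ e₃ → unequal? z₃ r >>= λ e₄ →
       search t (λ z₄ _ → get ns z₄ >>= λ n₄ → unequal? z₄ s >>= λ e₅ → unequal? z₄ r >>= λ e₆ → unequal? z₄ z₃ >>= λ e₇ →
        search t (λ z₅ _ → get ns z₅ >>= λ n₅ → unequal? z₅ s >>= λ e₈ → unequal? z₅ r >>= λ e₉ →
                          unequal? z₅ z₃ >>= λ f₁ → unequal? z₅ z₄ >>= λ f₂ →
         in? t (s ⊕ᵛ r ⊕ᵛ z₃ ⊕ᵛ z₄ ⊕ᵛ z₅) >>= λ i₆ → get ns (s ⊕ᵛ r ⊕ᵛ z₃ ⊕ᵛ z₄ ⊕ᵛ z₅) >>= λ n₆ →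
         unequal? (s ⊕ᵛ r ⊕ᵛ z₃ ⊕ᵛ z₄ ⊕ᵛ z₅) s >>= λ f₃ → unequal? (s ⊕ᵛ r ⊕ᵛ z₃ ⊕ᵛ z₄ ⊕ᵛ z₅) r >>= λ f₄ →
         unequal? (s ⊕ᵛ r ⊕ᵛ z₃ ⊕ᵛ z₄ ⊕ᵛ z₅) z₃ >>= λ f₅ → unequal? (s ⊕ᵛ r ⊕ᵛ z₃ ⊕ᵛ z₄ ⊕ᵛ z₅) z₄ >>= λ f₆ →
         unequal? (s ⊕ᵛ r ⊕ᵛ z₃ ⊕ᵛ z₄ ⊕ᵛ z₅) z₅ >>= λ f₇ →
         just (n₅ , e₈ , e₉ , f₁ , f₂ , i₆ , n₆ , f₃ , f₄ , f₅ , f₆ , f₇)) >>= λ q → just (n₄ , e₅ , e₆ , e₇ , q))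
        >>= λ q → just (n₃ , e₃ , e₄ , q))
        >>= λ (z₃ , i₃ , n₃ , e₃ , e₄ , z₄ , i₄ , n₄ , e₅ , e₆ , e₇ , z₅ , i₅ , n₅ , e₈ , e₉ , f₁ , f₂ , i₆ , n₆ , f₃ , f₄ , f₅ , f₆ , f₇) →
      just record { norms = n₁ , n₂ , n₃ , n₄ , n₅ , n₆ ; in-t = i₁ , i₂ , i₃ , i₄ , i₅ , i₆ ; quad = refl ; sextuple = refl
                  ; distinct = e₁ , e₂ , e₃ , e₄ , e₅ , e₆ , e₇ , e₈ , e₉ , f₁ , f₂ , f₃ , f₄ , f₅ , f₆ , f₇ }

  -- A set of nine points may contain points not recognised as normal. Two of them must at least
  -- come with an `Exceptional` witness, which options of weight 3 exclude later.
  Rigid : Set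
  Rigid = (∃[ x ] x ∈ˢ t × Norm t x) ×
          (∀ s → s ∈ˢ t → ∀ r → r ∈ˢ t → s ≡ r ⊎ (Norm t s ⊎ Norm t r) ⊎ Exceptional s r)

  rigid? : Maybe Rigid
  rigid? = analyse (table (strong? t))
    where
    pairs : Norms → Maybe (∀ s → s ∈ˢ t → ∀ r → r ∈ˢ t → s ≡ r ⊎ (Norm t s ⊎ Norm t r) ⊎ Exceptional s r)
    pairs ns = forAll t λ s _ → forAll t λ r _ →
      mapᴹ (inj₂ ∘ inj₁ ∘ inj₁) (get ns s) <∣> mapᴹ (inj₂ ∘ inj₁ ∘ inj₂) (get ns r) <∣>
      mapᴹ inj₁ (equal s r) <∣> mapᴹ (inj₂ ∘ inj₂) (exceptional? ns s r)
      where
      equal : ∀ s r → Maybe (s ≡ r)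
      equal s r with s ≟ᵛ r
      ... | yes e = just e
      ... | no _  = nothing
    analyse : Strongs → Maybe Rigid
    -- Two rounds of propagation from one seed suffice for nine points; `allNorm?` manages with one.
    analyse st = seed st >>= λ x → mapᴹ (x ,_) (pairs (spread st (spread st (start x))))

  AllNorm : Set
  AllNorm = ∀ v → v ∈ˢ t → Norm t v

  allNorm? : Maybe AllNorm
  allNorm? = go (table (strong? t))
    where
    go : Strongs → Maybe AllNorm
    go st = seed st >>= λ x → finish (spread st (start x))
      where
      finish : Norms → Maybe AllNorm
      finish ns = forAll t (λ v _ → get ns v)

count≤ : ∀ {n} (t : Sub n) → count t ℕ.≤ 2 ℕ.^ n
count≤ {zero}  false   = ℕ.z≤n
count≤ {zero}  true    = ℕ.s≤s ℕ.z≤n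
count≤ {suc n} (s , t) = subst (count s ℕ.+ count t ℕ.≤_) (cong (2 ℕ.^ n ℕ.+_) (sym (ℕ.+-identityʳ _))) (ℕ.+-mono-≤ (count≤ s) (count≤ t))

empty : ∀ {n} → Sub n
empty {zero}  = false
empty {suc n} = empty , empty

abstract
  rigid₉ : ∀ t → count t ≡ 9 → balanced t ≡ true → Rigid t
  rigid₉ = byEnumeration balanced rigid? refl

  private
    -- Even sizes are included because an item of a new class may be adjoined to a remainder of odd
    -- size.
    allNorm₁₁ : ∀ t → count t ≡ 11 → balanced t ≡ true → AllNorm t
    allNorm₁₁ = byEnumeration balanced allNorm? refl
    allNorm₁₂ : ∀ t → count t ≡ 12 → balanced t ≡ true → AllNorm t
    allNorm₁₂ = byEnumeration balanced allNorm? refl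
    allNorm₁₃ : ∀ t → count t ≡ 13 → balanced t ≡ true → AllNorm t
    allNorm₁₃ = byEnumeration balanced allNorm? refl
    allNorm₁₄ : ∀ t → count t ≡ 14 → balanced t ≡ true → AllNorm t
    allNorm₁₄ = byEnumeration balanced allNorm? refl
    allNorm₁₅ : ∀ t → count t ≡ 15 → balanced t ≡ true → AllNorm t
    allNorm₁₅ = byEnumeration balanced allNorm? refl
    allNorm₁₆ : ∀ t → count t ≡ 16 → balanced t ≡ true → AllNorm t
    allNorm₁₆ = byEnumeration balanced allNorm? refl

    -- Among eight points only nine subsets have seven or more elements, so no reduction by
    -- translation is made.
    hyperplane₇ : ∀ s → count s ≡ 7 → true ≡ true → AllNorm (s , empty)
    hyperplane₇ = byEnumeration (λ _ → true) (λ s → allNorm? (s , empty)) refl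
    hyperplane₈ : ∀ s → count s ≡ 8 → true ≡ true → AllNorm (s , empty)
    hyperplane₈ = byEnumeration (λ _ → true) (λ s → allNorm? (s , empty)) refl

  allNorm≥11 : ∀ t → 11 ℕ.≤ count t → balanced t ≡ true → AllNorm t
  allNorm≥11 t 11≤ = by (ℕ.≤⇒≤‴ 11≤) (ℕ.≤⇒≤‴ (count≤ t))
    where
    by : 11 ℕ.≤‴ count t → count t ℕ.≤‴ 16 → balanced t ≡ true → AllNorm t
    by (ℕ.≤‴-reflexive e) _ = allNorm₁₁ t (sym e)
    by (ℕ.≤‴-step (ℕ.≤‴-reflexive e)) _ = allNorm₁₂ t (sym e)
    by (ℕ.≤‴-step (ℕ.≤‴-step (ℕ.≤‴-reflexive e))) _ = allNorm₁₃ t (sym e)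
    by (ℕ.≤‴-step (ℕ.≤‴-step (ℕ.≤‴-step (ℕ.≤‴-reflexive e)))) _ = allNorm₁₄ t (sym e)
    by (ℕ.≤‴-step (ℕ.≤‴-step (ℕ.≤‴-step (ℕ.≤‴-step (ℕ.≤‴-reflexive e))))) _ = allNorm₁₅ t (sym e)
    by (ℕ.≤‴-step (ℕ.≤‴-step (ℕ.≤‴-step (ℕ.≤‴-step (ℕ.≤‴-step 16≤))))) ≤16 = allNorm₁₆ t (ℕ.≤-antisym (ℕ.≤‴⇒≤ ≤16) (ℕ.≤‴⇒≤ 16≤))

  allNorm-hyperplane : ∀ s → 7 ℕ.≤ count s → AllNorm (s , empty)
  allNorm-hyperplane s 7≤ with count s ℕ.≟ 7
  ... | yes e = hyperplane₇ s e refl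
  ... | no ne = hyperplane₈ s (ℕ.≤-antisym (count≤ s) (ℕ.≤∧≢⇒< 7≤ λ e → ne (sym e))) refl

  rigid-translate : ∀ t → count t ≡ 9 → ∃[ o ] Rigid (flip o t)
  rigid-translate t c = balance t , rigid₉ _ (≡-trans (count-flip (balance t) t) c) (balanced-flip t)

  allNorm-translate : ∀ t → 11 ℕ.≤ count t → ∃[ o ] AllNorm (flip o t)
  allNorm-translate t c = balance t , allNorm≥11 _ (subst (11 ℕ.≤_) (sym (count-flip (balance t) t)) c) (balanced-flip t)

-- Values constrained by quadruples

⊕ᵛ-commutativeMonoid : ℕ → CommutativeMonoid _ _
⊕ᵛ-commutativeMonoid n = record
  { Carrier = V n ; _≈_ = _≡_ ; _∙_ = _⊕ᵛ_ ; ε = 0ᵛ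
  ; isCommutativeMonoid = record
    { isMonoid = record
      { isSemigroup = record
        { isMagma = record { isEquivalence = Relation.Binary.PropositionalEquality.isEquivalence ; ∙-cong = cong₂ _⊕ᵛ_ }
        ; assoc = ⊕ᵛ-assoc }
      ; identity = ⊕ᵛ-identityˡ , ⊕ᵛ-identityʳ }
    ; comm = ⊕ᵛ-comm } }

module Xor n = Algebra.Solver.CommutativeMonoid (⊕ᵛ-commutativeMonoid n)

⊕ᵛ-cancelʳ : ∀ {n} (u v : V n) → (u ⊕ᵛ v) ⊕ᵛ v ≡ u
⊕ᵛ-cancelʳ u v = ≡-trans (⊕ᵛ-assoc u v v) (≡-trans (cong (u ⊕ᵛ_) (⊕ᵛ-self v)) (⊕ᵛ-identityʳ u))

⊕ᵛ-injectiveʳ : ∀ {n} {u v : V n} w → u ⊕ᵛ w ≡ v ⊕ᵛ w → u ≡ v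
⊕ᵛ-injectiveʳ {u = u} {v} w e = ≡-trans (sym (⊕ᵛ-cancelʳ u w)) (≡-trans (cong (_⊕ᵛ w) e) (⊕ᵛ-cancelʳ v w))

⊕ᵛ≡0 : ∀ {n} {u v : V n} → u ⊕ᵛ v ≡ 0ᵛ → u ≡ v
⊕ᵛ≡0 {u = u} {v} e = ⊕ᵛ-injectiveʳ v (≡-trans e (sym (⊕ᵛ-self v)))

pair-sum : ∀ {n} (u d : V n) → u ⊕ᵛ (u ⊕ᵛ d) ≡ d
pair-sum = ⊕ᵛ-cancel

quad-sum : ∀ {n} (a d b : V n) → a ⊕ᵛ (a ⊕ᵛ d) ⊕ᵛ (b ⊕ᵛ (b ⊕ᵛ d)) ≡ 0ᵛ
quad-sum a d b = ≡-trans (cong₂ _⊕ᵛ_ (pair-sum a d) (pair-sum b d)) (⊕ᵛ-self d)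

module QuadValues (m : ℕ) where
  open Mod m

  2·_ 4·_ : ℤ → ℤ
  2· x = x ℤ.+ x
  4· x = 2· x ℤ.+ 2· x

  record Quads (t : Sub 4) (f : V 4 → ℤ) (κ : ℤ) : Set where
    constructor mkQuads
    field quad-value : ∀ a b c d → a ∈ˢ t → b ∈ˢ t → c ∈ˢ t → d ∈ˢ t →
                       a ≢ b → a ≢ c → a ≢ d → b ≢ c → b ≢ d → c ≢ d → a ⊕ᵛ b ⊕ᵛ (c ⊕ᵛ d) ≡ 0ᵛ →
                       (f a ℤ.+ f b) ℤ.+ (f c ℤ.+ f d) ≋ κ

  open Quads public

  module _ {t f κ} (quads : Quads t f κ) where

    private
      pairs≋ : ∀ {d} → d ≢ 0ᵛ → ∀ {a b} → a ∈ˢ t → a ⊕ᵛ d ∈ˢ t → b ∈ˢ t → b ⊕ᵛ d ∈ˢ t →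
               b ≢ a → b ≢ a ⊕ᵛ d → (f a ℤ.+ f (a ⊕ᵛ d)) ℤ.+ (f b ℤ.+ f (b ⊕ᵛ d)) ≋ κ
      pairs≋ {d} d≢0 {a} {b} a∈ a′∈ b∈ b′∈ b≢a b≢a′ =
        quad-value quads a (a ⊕ᵛ d) b (b ⊕ᵛ d) a∈ a′∈ b∈ b′∈ (shifted a) (b≢a ∘ sym)
          (λ e → b≢a′ (≡-trans (sym (⊕ᵛ-cancelʳ b d)) (cong (_⊕ᵛ d) (sym e))))
          (b≢a′ ∘ sym) (λ e → b≢a (sym (⊕ᵛ-injectiveʳ d e))) (shifted b) (quad-sum a d b)
        where
        shifted : ∀ x → x ≢ x ⊕ᵛ d
        shifted x e = d≢0 (≡-trans (sym (pair-sum x d)) (≡-trans (cong (x ⊕ᵛ_) (sym e)) (⊕ᵛ-self x)))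

    private
      -- The values of three disjoint parallel pairs have pairwise sums `κ`; two of these sums minus
      -- the third leave twice the first value.
      first-pair : ∀ {d} (st : Strong t d) → let a = Strong.a st in 2· (f a ℤ.+ f (a ⊕ᵛ d)) ≋ κ
      first-pair {d} st = mk≋ (subst Z (lem (f a ℤ.+ f (a ⊕ᵛ d)) (f b ℤ.+ f (b ⊕ᵛ d)) (f c ℤ.+ f (c ⊕ᵛ d)) κ)
        (Z-+ (Z-+ (un≋ (pairs≋ d≢0 a∈ a′∈ b∈ b′∈ b≢a b≢a′)) (un≋ (pairs≋ d≢0 a∈ a′∈ c∈ c′∈ c≢a c≢a′)))
             (Z-neg (un≋ (pairs≋ d≢0 b∈ b′∈ c∈ c′∈ c≢b c≢b′)))))
        where
        open Strong st
        lem : ∀ p q r κ → ((p ℤ.+ q) ℤ.- κ) ℤ.+ ((p ℤ.+ r) ℤ.- κ) ℤ.- ((q ℤ.+ r) ℤ.- κ) ≡ (p ℤ.+ p) ℤ.- κ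
        lem = solve-∀

    -- A pair in the direction `d` either is the first of the three given ones, in one of two
    -- orders, or is disjoint from it; in the latter case the two values add up to `κ`.
    strong-value : ∀ {d} → Strong t d → ∀ {x} → x ∈ˢ t → x ⊕ᵛ d ∈ˢ t → 2· (f x ℤ.+ f (x ⊕ᵛ d)) ≋ κ
    strong-value {d} st {x} x∈ x′∈ with x ≟ᵛ Strong.a st | x ≟ᵛ (Strong.a st ⊕ᵛ d)
    ... | yes refl | _ = first-pair st
    ... | no x≢a | yes e =
      subst (λ y → 2· y ≋ κ) (≡-trans (ℤ.+-comm (f a) (f (a ⊕ᵛ d))) (cong₂ (λ y z → f y ℤ.+ f z) (sym e) e′)) (first-pair st)
      where
      open Strong st
      e′ : a ≡ x ⊕ᵛ d
      e′ = ≡-trans (sym (⊕ᵛ-cancelʳ a d)) (cong (_⊕ᵛ d) (sym e))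
    ... | no x≢a | no x≢a′ =
      mk≋ (subst Z (lem (f a ℤ.+ f (a ⊕ᵛ d)) (f x ℤ.+ f (x ⊕ᵛ d)) κ)
        (Z-+ (Z-+ (un≋ (pairs≋ d≢0 a∈ a′∈ x∈ x′∈ x≢a x≢a′)) (un≋ (pairs≋ d≢0 a∈ a′∈ x∈ x′∈ x≢a x≢a′)))
             (Z-neg (un≋ (first-pair st)))))
      where
      open Strong st
      lem : ∀ p q κ → ((p ℤ.+ q) ℤ.- κ) ℤ.+ ((p ℤ.+ q) ℤ.- κ) ℤ.- ((p ℤ.+ p) ℤ.- κ) ≡ (q ℤ.+ q) ℤ.- κ
      lem = solve-∀

    adjacent-value : ∀ {x y} → x ∈ˢ t → y ∈ˢ t → Strong t (x ⊕ᵛ y) → 2· (f x ℤ.+ f y) ≋ κ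
    adjacent-value {x} {y} x∈ y∈ st =
      subst (λ z → 2· (f x ℤ.+ f z) ≋ κ) (pair-sum x y) (strong-value st x∈ (subst (_∈ˢ t) (sym (pair-sum x y)) y∈))

    -- In a triangle `2(x + y) + 2(x + z) - 2(y + z)` isolates `4x`; along a strong edge the value
    -- passes from `y` to `x`.
    norm-value : ∀ {x} → Norm t x → 4· (f x) ≋ κ
    norm-value (triangle {x} {y} {z} x∈ y∈ z∈ xy xz yz) =
      mk≋ (subst Z (lem (f x) (f y) (f z) κ)
        (Z-+ (Z-+ (un≋ (adjacent-value x∈ y∈ xy)) (un≋ (adjacent-value x∈ z∈ xz))) (Z-neg (un≋ (adjacent-value y∈ z∈ yz)))))
      where
      lem : ∀ x y z κ → (((x ℤ.+ y) ℤ.+ (x ℤ.+ y)) ℤ.- κ) ℤ.+ (((x ℤ.+ z) ℤ.+ (x ℤ.+ z)) ℤ.- κ) ℤ.- (((y ℤ.+ z) ℤ.+ (y ℤ.+ z)) ℤ.- κ)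
            ≡ ((x ℤ.+ x) ℤ.+ (x ℤ.+ x)) ℤ.- κ
      lem = solve-∀
    norm-value (adjacent {x} {y} x∈ y∈ xy ny) =
      mk≋ (subst Z (lem (f x) (f y) κ)
        (Z-+ (Z-+ (un≋ (adjacent-value x∈ y∈ xy)) (un≋ (adjacent-value x∈ y∈ xy))) (Z-neg (un≋ (norm-value ny)))))
      where
      lem : ∀ x y κ → (((x ℤ.+ y) ℤ.+ (x ℤ.+ y)) ℤ.- κ) ℤ.+ (((x ℤ.+ y) ℤ.+ (x ℤ.+ y)) ℤ.- κ) ℤ.- (((y ℤ.+ y) ℤ.+ (y ℤ.+ y)) ℤ.- κ)
            ≡ ((x ℤ.+ x) ℤ.+ (x ℤ.+ x)) ℤ.- κ
      lem = solve-∀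

  -- A translation adds `o` four times, so closed quadruples stay closed.
  quads-flip : ∀ {t f κ} o → Quads t f κ → Quads (flip o t) (λ v → f (v ⊕ᵛ o)) κ
  quads-flip {t} o quads = mkQuads λ a b c d a∈ b∈ c∈ d∈ n₁ n₂ n₃ n₄ n₅ n₆ e →
    quad-value quads _ _ _ _ (in′ a a∈) (in′ b b∈) (in′ c c∈) (in′ d d∈) (n₁ ∘ inj) (n₂ ∘ inj) (n₃ ∘ inj) (n₄ ∘ inj) (n₅ ∘ inj) (n₆ ∘ inj)
      (≡-trans (Xor.solve 4 5 (λ a b c d o → ((a ⊕ o) ⊕ (b ⊕ o)) ⊕ ((c ⊕ o) ⊕ (d ⊕ o)) ⊜ ((a ⊕ b) ⊕ (c ⊕ d)) ⊕ ((o ⊕ o) ⊕ (o ⊕ o))) refl a b c d o)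
        (cong₂ _⊕ᵛ_ e (⊕ᵛ-self (o ⊕ᵛ o))))
    where
    open Xor 4 using (_⊕_; _⊜_)
    in′ : ∀ v → v ∈ˢ flip o t → v ⊕ᵛ o ∈ˢ t
    in′ v v∈ = ≡-trans (sym (look-flip o t v)) v∈
    inj : ∀ {u v} → u ⊕ᵛ o ≡ v ⊕ᵛ o → u ≡ v
    inj = ⊕ᵛ-injectiveʳ o

  private
    unflip : ∀ (o : V 4) (t : Sub 4) v → v ∈ˢ t → v ⊕ᵛ o ∈ˢ flip o t
    unflip o t v v∈ = ≡-trans (look-flip o t (v ⊕ᵛ o)) (≡-trans (cong (look t) (⊕ᵛ-cancelʳ v o)) v∈)

    flipped-value : ∀ (f : V 4 → ℤ) κ o v → 4· (f (v ⊕ᵛ o ⊕ᵛ o)) ≋ κ → 4· (f v) ≋ κ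
    flipped-value f κ o v = subst (λ w → 4· (f w) ≋ κ) (⊕ᵛ-cancelʳ v o)

  data Big (t : Sub 4) : Set where
    eleven     : 11 ℕ.≤ count t → Big t
    hyperplane : 7 ℕ.≤ count {3} (proj₁ t) → proj₂ t ≡ empty → Big t

  big-value : ∀ {t f κ} → Quads t f κ → Big t → ∀ {v} → v ∈ˢ t → 4· (f v) ≋ κ
  big-value {t} {f} {κ} quads (eleven 11≤) {v} v∈ with allNorm-translate t 11≤
  ... | o , n = flipped-value f κ o v (norm-value (quads-flip o quads) (n _ (unflip o t v v∈)))
  big-value {s , _} quads (hyperplane 7≤ refl) v∈ = norm-value quads (allNorm-hyperplane s 7≤ _ v∈)

  nine-value : ∀ {t f κ} → Quads t f κ → count t ≡ 9 → ∃[ v ] v ∈ˢ t × 4· (f v) ≋ κ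
  nine-value {t} {f} {κ} quads c with rigid-translate t c
  ... | o , (v , v∈ , nv) , _ = v ⊕ᵛ o , ≡-trans (sym (look-flip o t v)) v∈ , norm-value (quads-flip o quads) nv

  -- This is `Exceptional` with the translation undone and normality replaced by its consequence for
  -- the values.
  record Obstruction (t : Sub 4) (f : V 4 → ℤ) (κ : ℤ) (s r : V 4) : Set where
    field
      z₁ z₂ z₃ z₄ z₅ z₆ : V 4
      values : 4· (f z₁) ≋ κ × 4· (f z₂) ≋ κ × 4· (f z₃) ≋ κ × 4· (f z₄) ≋ κ × 4· (f z₅) ≋ κ × 4· (f z₆) ≋ κ
      in-t     : z₁ ∈ˢ t × z₂ ∈ˢ t × z₃ ∈ˢ t × z₄ ∈ˢ t × z₅ ∈ˢ t × z₆ ∈ˢ t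
      quad     : z₂ ≡ s ⊕ᵛ r ⊕ᵛ z₁
      sextuple : z₆ ≡ s ⊕ᵛ r ⊕ᵛ z₃ ⊕ᵛ z₄ ⊕ᵛ z₅
      distinct : z₁ ≢ s × z₁ ≢ r × z₃ ≢ s × z₃ ≢ r × z₄ ≢ s × z₄ ≢ r × z₄ ≢ z₃ × z₅ ≢ s × z₅ ≢ r × z₅ ≢ z₃ × z₅ ≢ z₄
               × z₆ ≢ s × z₆ ≢ r × z₆ ≢ z₃ × z₆ ≢ z₄ × z₆ ≢ z₅

  nine-dichotomy : ∀ {t f κ} → Quads t f κ → count t ≡ 9 → ∀ {s r} → s ∈ˢ t → r ∈ˢ t → s ≢ r →
                   (4· (f s) ≋ κ ⊎ 4· (f r) ≋ κ) ⊎ Obstruction t f κ s r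
  nine-dichotomy {t} {f} {κ} quads c {s} {r} s∈ r∈ s≢r
    with rigid-translate t c
  ... | o , _ , pairs with pairs (s ⊕ᵛ o) (unflip o t s s∈) (r ⊕ᵛ o) (unflip o t r r∈)
  ... | inj₁ e = contradiction (⊕ᵛ-injectiveʳ o e) s≢r
  ... | inj₂ (inj₁ n) =
    inj₁ (map-⊎ (flipped-value f κ o s ∘ norm-value quads′) (flipped-value f κ o r ∘ norm-value quads′) n)
    where
    quads′ = quads-flip o quads
  ... | inj₂ (inj₂ x) = inj₂ record
    { z₁ = E.z₁ ⊕ᵛ o ; z₂ = E.z₂ ⊕ᵛ o ; z₃ = E.z₃ ⊕ᵛ o ; z₄ = E.z₄ ⊕ᵛ o ; z₅ = E.z₅ ⊕ᵛ o ; z₆ = E.z₆ ⊕ᵛ o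
    ; values = let (a , b , c , d , e , g) = E.norms in value a , value b , value c , value d , value e , value g
    ; in-t = let (a , b , c , d , e , g) = E.in-t in in′ E.z₁ a , in′ E.z₂ b , in′ E.z₃ c , in′ E.z₄ d , in′ E.z₅ e , in′ E.z₆ g
    ; quad = ≡-trans (cong (_⊕ᵛ o) E.quad)
        (≡-trans (Xor.solve 4 4 (λ s r z o → (((s ⊕ o) ⊕ (r ⊕ o)) ⊕ z) ⊕ o ⊜ ((s ⊕ r) ⊕ (z ⊕ o)) ⊕ (o ⊕ o)) refl s r E.z₁ o)
        (≡-trans (cong (s ⊕ᵛ r ⊕ᵛ (E.z₁ ⊕ᵛ o) ⊕ᵛ_) (⊕ᵛ-self o)) (⊕ᵛ-identityʳ _)))
    ; sextuple = ≡-trans (cong (_⊕ᵛ o) E.sextuple)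
        (≡-trans (Xor.solve 4 6 (λ s r x y z o → (((((s ⊕ o) ⊕ (r ⊕ o)) ⊕ x) ⊕ y) ⊕ z) ⊕ o ⊜ (((s ⊕ r) ⊕ (x ⊕ o)) ⊕ (y ⊕ o)) ⊕ (z ⊕ o)) refl s r E.z₃ E.z₄ E.z₅ o)
          refl)
    ; distinct = let (a₁ , a₂ , a₃ , a₄ , a₅ , a₆ , a₇ , a₈ , a₉ , b₁ , b₂ , b₃ , b₄ , b₅ , b₆ , b₇) = E.distinct
                 in out a₁ , out a₂ , out a₃ , out a₄ , out a₅ , out a₆ , a₇ ∘ inj , out a₈ , out a₉ , b₁ ∘ inj , b₂ ∘ inj
                  , out b₃ , out b₄ , b₅ ∘ inj , b₆ ∘ inj , b₇ ∘ inj }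
    where
    open Xor 4 using (_⊕_; _⊜_)
    module E = Exceptional x
    value : ∀ {v} → Norm (flip o t) v → 4· (f (v ⊕ᵛ o)) ≋ κ
    value = norm-value (quads-flip o quads)
    in′ : ∀ v → v ∈ˢ flip o t → v ⊕ᵛ o ∈ˢ t
    in′ v v∈ = ≡-trans (sym (look-flip o t v)) v∈
    inj : ∀ {u v} → u ⊕ᵛ o ≡ v ⊕ᵛ o → u ≡ v
    inj = ⊕ᵛ-injectiveʳ o
    out : ∀ {u v} → u ≢ v ⊕ᵛ o → u ⊕ᵛ o ≢ v
    out {u} {v} ne e = ne (≡-trans (sym (⊕ᵛ-cancelʳ u o)) (cong (_⊕ᵛ o) e))

-- Sequences with classes

Item : Set
Item = V 4 × ℤ

xsum : ∀ {n} → List (V n) → V n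
xsum []       = 0ᵛ
xsum (v ∷ vs) = v ⊕ᵛ xsum vs

xsum-++ : ∀ {n} (us : List (V n)) {vs} → xsum (us ++ vs) ≡ xsum us ⊕ᵛ xsum vs
xsum-++ []       = sym (⊕ᵛ-identityˡ _)
xsum-++ (u ∷ us) = ≡-trans (cong (u ⊕ᵛ_) (xsum-++ us)) (sym (⊕ᵛ-assoc u _ _))

xsum-↭ : ∀ {n} {us vs : List (V n)} → us ↭ vs → xsum us ≡ xsum vs
xsum-↭ refl         = refl
xsum-↭ (prep x p)   = cong (x ⊕ᵛ_) (xsum-↭ p)
xsum-↭ {n} (swap {us} {vs} x y p) = ≡-trans (cong (λ z → x ⊕ᵛ (y ⊕ᵛ z)) (xsum-↭ p))
  (Xor.solve n 3 (λ a b c → a ⊕ (b ⊕ c) ⊜ b ⊕ (a ⊕ c)) refl x y (xsum vs))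
  where open Xor n using (_⊕_; _⊜_)
xsum-↭ (trans p q)  = ≡-trans (xsum-↭ p) (xsum-↭ q)

class : Item → V 4
class = proj₁

classes : List Item → List (V 4)
classes = map class

total : List Item → ℤ
total = sum-by proj₂

Unique : List (V 4) → Set
Unique = AllPairs _≢_

Separated : List Item → Set
Separated = AllPairs (λ x y → class x ≢ class y)

insert : ∀ {n} → V n → Sub n → Sub n
insert []          b       = true
insert (false ∷ v) (s , t) = insert v s , t
insert (true  ∷ v) (s , t) = s , insert v t

∈-insert-here : ∀ {n} (v : V n) t → v ∈ˢ insert v t
∈-insert-here []          b       = refl
∈-insert-here (false ∷ v) (s , t) = ∈-insert-here v s
∈-insert-here (true  ∷ v) (s , t) = ∈-insert-here v t

∈-insert-there : ∀ {n} (v : V n) t u → u ∈ˢ t → u ∈ˢ insert v t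
∈-insert-there []          b       []          e = refl
∈-insert-there (false ∷ v) (s , t) (false ∷ u) e = ∈-insert-there v s u e
∈-insert-there (false ∷ v) (s , t) (true  ∷ u) e = e
∈-insert-there (true  ∷ v) (s , t) (false ∷ u) e = e
∈-insert-there (true  ∷ v) (s , t) (true  ∷ u) e = ∈-insert-there v t u e

∈-insert⁻ : ∀ {n} (v : V n) t u → u ∈ˢ insert v t → u ≡ v ⊎ u ∈ˢ t
∈-insert⁻ []          b       []          e = inj₁ refl
∈-insert⁻ (false ∷ v) (s , t) (false ∷ u) e = Sum.map₁ (cong (false ∷_)) (∈-insert⁻ v s u e)
∈-insert⁻ (false ∷ v) (s , t) (true  ∷ u) e = inj₂ e
∈-insert⁻ (true  ∷ v) (s , t) (false ∷ u) e = inj₂ e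
∈-insert⁻ (true  ∷ v) (s , t) (true  ∷ u) e = Sum.map₁ (cong (true ∷_)) (∈-insert⁻ v t u e)

count-insert : ∀ {n} (v : V n) t → ¬ v ∈ˢ t → count (insert v t) ≡ suc (count t)
count-insert []          true    v∉ = contradiction refl v∉
count-insert []          false   v∉ = refl
count-insert (false ∷ v) (s , t) v∉ = cong (ℕ._+ count t) (count-insert v s v∉)
count-insert (true  ∷ v) (s , t) v∉ = ≡-trans (cong (count s ℕ.+_) (count-insert v t v∉)) (ℕ.+-suc (count s) (count t))

∉-empty : ∀ {n} (v : V n) → ¬ v ∈ˢ empty
∉-empty (false ∷ v) = ∉-empty v
∉-empty (true  ∷ v) = ∉-empty v

count-mono : ∀ {n} (s t : Sub n) → (∀ v → v ∈ˢ s → v ∈ˢ t) → count s ℕ.≤ count t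
count-mono {zero}  false t    f = z≤n
count-mono {zero}  true  true f = ℕ.≤-refl
count-mono {zero}  true  false f = contradiction (f [] refl) λ ()
count-mono {suc n} (s , s′) (t , t′) f =
  ℕ.+-mono-≤ (count-mono s t (λ v → f (false ∷ v))) (count-mono s′ t′ (λ v → f (true ∷ v)))

support : List Item → Sub 4
support []      = empty
support (x ∷ D) = insert (class x) (support D)

value : List Item → V 4 → ℤ
value []      v = 0ℤ
value (x ∷ D) v with class x ≟ᵛ v
... | yes _ = proj₂ x
... | no  _ = value D v

∈-support : ∀ {x D} → x ∈ D → class x ∈ˢ support D
∈-support {x} {_ ∷ D} (here refl) = ∈-insert-here (class x) (support D)
∈-support {x} {y ∷ D} (there x∈)  = ∈-insert-there (class y) (support D) (class x) (∈-support x∈)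

support-∈ : ∀ D {v} → v ∈ˢ support D → (v , value D v) ∈ D
support-∈ []      {v} v∈ = contradiction v∈ (∉-empty v)
support-∈ (x ∷ D) {v} v∈ with class x ≟ᵛ v
... | yes refl = here refl
... | no x≢v with ∈-insert⁻ (class x) (support D) v v∈
...   | inj₁ refl = contradiction refl x≢v
...   | inj₂ v∈′  = there (support-∈ D v∈′)

value-∈ : ∀ {D} → Separated D → ∀ {x} → x ∈ D → value D (class x) ≡ proj₂ x
value-∈ {y ∷ D} (d ∷ ds) {x} x∈ with class y ≟ᵛ class x | x∈
... | yes e | here refl = refl
... | yes e | there x∈′ = contradiction e (All.lookup d x∈′)
... | no ne | here refl = contradiction refl ne
... | no ne | there x∈′ = value-∈ ds x∈′

count-support : ∀ {D} → Separated D → count (support D) ≡ length D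
count-support {[]}    []       = refl
count-support {x ∷ D} (d ∷ ds) = ≡-trans
  (count-insert (class x) (support D) (λ v∈ → All.lookup d (support-∈ D v∈) refl)) (cong suc (count-support ds))

unique⇒⊑ : {A : Set} {T S : List A} → AllPairs _≢_ T → All (_∈ S) T → T ⊑ S
unique⇒⊑ {S = S} [] [] = S , refl
unique⇒⊑ {T = t ∷ T} (t∉ ∷ u) (t∈ ∷ ts∈) with ∈⇒↭ t∈
... | S′ , π = let (U , σ) = unique⇒⊑ u (All.zipWith remaining (t∉ , ts∈)) in U , trans π (prep t σ)
  where
  remaining : ∀ {s} → t ≢ s × s ∈ _ → s ∈ S′
  remaining (t≢s , s∈) with ∈-resp-↭ π s∈
  ... | here refl = contradiction refl t≢s
  ... | there s∈′ = s∈′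

members : List Item → List (V 4) → List Item
members D = map (λ v → v , value D v)

members-⊑ : ∀ D {vs} → Unique vs → All (_∈ˢ support D) vs → members D vs ⊑ D
members-⊑ D u vs∈ = unique⇒⊑ (AllPairs.map⁺ (AllPairs.map (λ ne e → ne (cong proj₁ e)) u)) (All.map⁺ (All.map (support-∈ D) vs∈))

classes-members : ∀ D vs → classes (members D vs) ≡ vs
classes-members D []       = refl
classes-members D (v ∷ vs) = cong (v ∷_) (classes-members D vs)

total-members : ∀ D vs → total (members D vs) ≡ sum-by (value D) vs
total-members D []       = refl
total-members D (v ∷ vs) = cong (λ s → value D v ℤ.+ s) (total-members D vs)

without : V 4 → List Item → List Item
without v []      = []
without v (x ∷ D) with class x ≟ᵛ v
... | yes _ = without v D
... | no  _ = x ∷ without v D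

without-⊑ : ∀ v D → without v D ⊑ D
without-⊑ v []      = [] , refl
without-⊑ v (x ∷ D) with class x ≟ᵛ v | without-⊑ v D
... | yes _ | U , π = x ∷ U , trans (prep x π) (↭-sym (shift x (without v D) U))
... | no  _ | U , π = U , prep x π

without-All : ∀ {P : Item → Set} v {D} → All P D → All P (without v D)
without-All v {[]}    []       = []
without-All v {x ∷ D} (p ∷ ps) with class x ≟ᵛ v
... | yes _ = without-All v ps
... | no  _ = p ∷ without-All v ps

without-≢ : ∀ v D → All (λ x → v ≢ class x) (without v D)
without-≢ v []      = []
without-≢ v (x ∷ D) with class x ≟ᵛ v
... | yes _ = without-≢ v D
... | no ne = (ne ∘ sym) ∷ without-≢ v D

without-Separated : ∀ v {D} → Separated D → Separated (without v D)
without-Separated v {[]}    []       = []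
without-Separated v {x ∷ D} (d ∷ ds) with class x ≟ᵛ v
... | yes _ = without-Separated v ds
... | no  _ = without-All v d ∷ without-Separated v ds

without-∈ : ∀ v {x D} → x ∈ D → class x ≢ v → x ∈ without v D
without-∈ v {x} {y ∷ D} x∈ ne with class y ≟ᵛ v | x∈
... | yes e | here refl = contradiction e ne
... | yes e | there x∈′ = without-∈ v x∈′ ne
... | no  _ | here refl = here refl
... | no  _ | there x∈′ = there (without-∈ v x∈′ ne)

-- An item of the same class is displaced, so classes stay distinct while the support can only grow.
put : Item → List Item → List Item
put w D = w ∷ without (class w) D

put-⊑ : ∀ w D → put w D ⊑ (w ∷ D)
put-⊑ w D = let (U , π) = without-⊑ (class w) D in U , prep w π

put-Separated : ∀ w {D} → Separated D → Separated (put w D)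
put-Separated w {D} ds = without-≢ (class w) D ∷ without-Separated (class w) ds

put-support : ∀ w D v → v ∈ˢ support D → v ∈ˢ support (put w D)
put-support w D v v∈ with v ≟ᵛ class w
... | yes refl = ∈-insert-here (class w) (support (without (class w) D))
... | no ne    = ∈-insert-there (class w) (support (without (class w) D)) v (∈-support (without-∈ (class w) (support-∈ D v∈) ne))

Blk : Set
Blk = Item × Item

Twin : Blk → Set
Twin (x , y) = class x ≡ class y

block-value : Blk → ℤ
block-value (x , y) = proj₂ x ℤ.+ proj₂ y

xsum-twins : ∀ {bs} → All Twin bs → xsum (classes (flat bs)) ≡ 0ᵛ
xsum-twins [] = refl
xsum-twins {(x , y) ∷ bs} (e ∷ es) = ≡-trans
  (cong₂ (λ u z → u ⊕ᵛ (class y ⊕ᵛ z)) e (xsum-twins es))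
  (≡-trans (cong (class y ⊕ᵛ_) (⊕ᵛ-identityʳ _)) (⊕ᵛ-self (class y)))

total-flat : ∀ bs → total (flat bs) ≡ sum-by block-value bs
total-flat []             = refl
total-flat ((x , y) ∷ bs) = ≡-trans (cong (λ s → proj₂ x ℤ.+ (proj₂ y ℤ.+ s)) (total-flat bs)) (sym (ℤ.+-assoc (proj₂ x) (proj₂ y) _))

record Pairing (S : List Item) : Set where
  field
    blocks    : List Blk
    leftover  : List Item
    paired    : S ↭ flat blocks ++ leftover
    twins     : All Twin blocks
    separated : Separated leftover

-- Greedy: an item meeting its own class in the remainder forms a block with the item found there.
pairing : ∀ S → Pairing S
pairing [] = record { blocks = [] ; leftover = [] ; paired = refl ; twins = [] ; separated = [] }
pairing (x ∷ S) with pairing S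
... | record { blocks = bs ; leftover = D ; paired = π ; twins = ts ; separated = ds }
  with Any.any? (λ y → class x ≟ᵛ class y) D
... | no none = record { blocks = bs ; leftover = x ∷ D ; twins = ts ; separated = All.¬Any⇒All¬ D none ∷ ds
                       ; paired = trans (prep x π) (↭-sym (shift x (flat bs) D)) }
... | yes some with find some
...   | y , y∈ , e with ∈⇒↭ y∈
...     | D′ , σ = record { blocks = (x , y) ∷ bs ; leftover = D′ ; twins = e ∷ ts
                          ; separated = AllPairs.tail (separated-↭ σ ds)
                          ; paired = prep x (trans π (trans (++⁺ˡ (flat bs) σ) (shift y (flat bs) D′))) }
  where
  separated-↭ : ∀ {D D′} → D ↭ D′ → Separated D → Separated D′
  separated-↭ refl ds = ds
  separated-↭ (prep x p) (d ∷ ds) = All-resp-↭ p d ∷ separated-↭ p ds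
  separated-↭ (swap x y p) ((xy ∷ d) ∷ (d′ ∷ ds)) = ((xy ∘ sym) ∷ All-resp-↭ p d′) ∷ (All-resp-↭ p d ∷ separated-↭ p ds)
  separated-↭ (trans p q) ds = separated-↭ q (separated-↭ p ds)

-- Weights count pairs of items, so that a block weighs 1.
record Opt (R : List Item) (w : ℕ) (v : ℤ) : Set where
  constructor opt
  field
    items  : List Item
    within : items ⊑ R
    weight : length items ≡ 2 ℕ.* w
    closed : xsum (classes items) ≡ 0ᵛ
    amount : total items ≡ v

open Opt public

opt-⊑ : ∀ {R R′ w v} → R ⊑ R′ → Opt R w v → Opt R′ w v
opt-⊑ i o = record { items = items o ; within = ⊑-trans (within o) i ; weight = weight o ; closed = closed o ; amount = amount o }

opt-≡ : ∀ {R w v v′} → v ≡ v′ → Opt R w v → Opt R w v′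
opt-≡ refl o = o

opt-++ : ∀ {R R′ w w′ v v′} → Opt R w v → Opt R′ w′ v′ → Opt (R ++ R′) (w ℕ.+ w′) (v ℤ.+ v′)
opt-++ {w = w} {w′} o o′ = record
  { items = items o ++ items o′
  ; within = ⊑-++ (within o) (within o′)
  ; weight = ≡-trans (length-++ (items o)) (≡-trans (cong₂ ℕ._+_ (weight o) (weight o′)) (sym (ℕ.*-distribˡ-+ 2 w w′)))
  ; closed = ≡-trans (cong xsum (map-++ class (items o) (items o′)))
      (≡-trans (xsum-++ (classes (items o))) (≡-trans (cong₂ _⊕ᵛ_ (closed o) (closed o′)) refl))
  ; amount = ≡-trans (sum-by-++ proj₂ (items o)) (cong₂ ℤ._+_ (amount o) (amount o′)) }

opt-blocks : ∀ {bs} → All Twin bs → Opt (flat bs) (length bs) (sum-by block-value bs)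
opt-blocks {bs} ts = record
  { items = flat bs ; within = ⊑-refl ; weight = length-flat bs ; closed = xsum-twins ts ; amount = total-flat bs }

opt-members : ∀ D {vs w} → Unique vs → All (_∈ˢ support D) vs → length vs ≡ 2 ℕ.* w → xsum vs ≡ 0ᵛ →
              Opt D w (sum-by (value D) vs)
opt-members D {vs} u vs∈ len z = record
  { items = members D vs ; within = members-⊑ D u vs∈ ; weight = ≡-trans (length-map _ vs) len
  ; closed = ≡-trans (cong xsum (classes-members D vs)) z ; amount = total-members D vs }

-- Couples against options

module Stages (p : ℕ) (prime : Prime p) where

  open ModPrime p prime
  open Blocks block-value public

  -- Divisibility by p is enough here: the parity bit supplies the factor 2 for closed `T`.
  Avoids : List Item → Set
  Avoids S = ∀ {T} → T ⊑ S → length T ≡ 2 ℕ.* p → xsum (classes T) ≡ 0ᵛ → ¬ Z (total T)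

  -- The couples are reserved for Cauchy-Davenport, and `R` is the material for options: the
  -- remainder, spare blocks and the blocks of dissolved couples.
  record Stage (S : List Item) (ms : List (Blk × Blk)) (R : List Item) : Set where
    constructor stage
    field
      layout : S ↭ flat (flat ms) ++ R
      twins  : All Twin (flat ms)
      unlike : All Unequal ms

  module _ {S} (avoids : Avoids S) where

    -- The couples realise enough sums modulo p to cancel one of w distinct options.
    core : ∀ {ms R w} → Stage S ms R → w ℕ.+ length ms ≡ p → ∀ {vs} → All (Opt R w) vs →
           1 ℕ.≤ length vs → w ℕ.≤ length vs → ¬ Distinct vs
    core {ms} {R} {w} st e {vs} os 1≤ w≤ d
      with selection-sum ms (Stage.unlike st) d 1≤ (subst (ℕ._≤ length vs ℕ.+ length ms) e (ℕ.+-monoˡ-≤ (length ms) w≤))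
    ... | s , a with find a
    ... | v , v∈ , z = avoids inside len cls zsum
      where
      o = All.lookup os v∈
      T = flat (chosen s) ++ items o
      tw : All Twin (chosen s)
      tw = All.++⁻ˡ (chosen s) (All-resp-↭ (split s) (Stage.twins st))
      inside : T ⊑ S
      inside = ⊑-trans (⊑-++ {S = flat (chosen s)} (flat (others s) , trans (flat-↭ (split s)) (↭-reflexive (flat-++ (chosen s) (others s)))) (within o))
        (↭⇒⊑ (Stage.layout st))
      len : length T ≡ 2 ℕ.* p
      len = ≡-trans (length-++ (flat (chosen s))) (≡-trans (cong₂ ℕ._+_ (≡-trans (length-flat (chosen s)) (cong (2 ℕ.*_) (length-chosen s))) (weight o))
        (≡-trans (sym (ℕ.*-distribˡ-+ 2 (length ms) w)) (cong (2 ℕ.*_) (≡-trans (ℕ.+-comm (length ms) w) e))))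
      cls : xsum (classes T) ≡ 0ᵛ
      cls = ≡-trans (cong xsum (map-++ class (flat (chosen s)) (items o)))
        (≡-trans (xsum-++ (classes (flat (chosen s)))) (≡-trans (cong₂ _⊕ᵛ_ (xsum-twins tw) (closed o)) refl))
      zsum : Z (total T)
      zsum = subst Z (sym (≡-trans (sum-by-++ proj₂ (flat (chosen s))) (cong₂ ℤ._+_ (total-flat (chosen s)) (amount o)))) z

-- Erdős–Ginzburg–Ziv

take-⊑ : {A : Set} (n : ℕ) (xs : List A) → take n xs ⊑ xs
take-⊑ n xs = drop n xs , ↭-reflexive (sym (take++drop≡id n xs))

length-take-≤ : {A : Set} {n : ℕ} {xs : List A} → n ℕ.≤ length xs → length (take n xs) ≡ n
length-take-≤ {n = n} {xs} n≤ = ≡-trans (length-take n xs) (ℕ.m≤n⇒m⊓n≡m n≤)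

All-⊑ : {A : Set} {P : A → Set} {T S : List A} → T ⊑ S → All P S → All P T
All-⊑ {T = T} (U , π) ps = All.++⁻ˡ T (All-resp-↭ π ps)

flat-⊑ : {A : Set} {ps qs : List (A × A)} → ps ⊑ qs → flat ps ⊑ flat qs
flat-⊑ {ps = ps} (U , π) = flat U , trans (flat-↭ π) (↭-reflexive (flat-++ ps U))

module PrimeBlocks (p : ℕ) (prime : Prime p) where

  open ModPrime p prime

  module _ {X : Set} (val : X → ℤ) where

    open Blocks val

    sum-≋ : ∀ {u xs} → All (λ x → val x ≋ u) xs → sum-by val xs ≋ + length xs ℤ.* u
    sum-≋ {u} [] = ≡⇒≋ (sym (ℤ.*-zeroˡ u))
    sum-≋ {u} {x ∷ xs} (x≋u ∷ es) = mk≋ (subst Z (lem (val x) (sum-by val xs) u (+ length xs))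
      (Z-+ (un≋ x≋u) (un≋ (sum-≋ es))))
      where
      lem : ∀ x s u n → (x ℤ.- u) ℤ.+ (s ℤ.- n ℤ.* u) ≡ (x ℤ.+ s) ℤ.- (1ℤ ℤ.+ n) ℤ.* u
      lem = solve-∀

    select-equal : ∀ {u} ms → All (Has u) ms → Σ (Selection ms) λ s → All (λ x → val x ≋ u) (chosen s)
    select-equal [] [] = record { chosen = [] ; others = [] ; split = refl ; length-chosen = refl } , []
    select-equal ((x , y) ∷ ms) (h ∷ hs) with select-equal ms hs | h
    ... | s , es | inj₁ e =
      record { chosen = x ∷ chosen s ; others = y ∷ others s
             ; split = prep x (trans (prep y (split s)) (↭-sym (shift y (chosen s) (others s))))
             ; length-chosen = cong suc (length-chosen s) } , e ∷ es
    ... | s , es | inj₂ e =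
      record { chosen = y ∷ chosen s ; others = x ∷ others s
             ; split = trans (swap x y (split s)) (prep y (↭-sym (shift x (chosen s) (others s))))
             ; length-chosen = cong suc (length-chosen s) } , e ∷ es

    equal⇒zero : ∀ {u xs} → All (λ x → val x ≋ u) xs → length xs ≡ p → Z (sum-by val xs)
    equal⇒zero {u} {xs} es e = Z-resp (sum-≋ es) (subst Z (≡-trans (ℤ.*-comm u (+ p)) (cong (λ n → + n ℤ.* u) (sym e))) (Z-* u ℤ.∣-refl))

    ZeroSubset : List X → Set
    ZeroSubset xs = ∃[ T ] T ⊑ xs × length T ≡ p × Z (sum-by val T)

    zero-⊑ : ∀ {xs ys} → xs ⊑ ys → ZeroSubset xs → ZeroSubset ys
    zero-⊑ i (T , j , r) = T , ⊑-trans j i , r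

    majority⇒zero : ∀ {xs u} (m : Matching xs) → All (λ x → val x ≋ u) (Matching.rest m) → All (Has u) (Matching.matched m) →
                    p ℕ.≤ length (Matching.matched m) ℕ.+ length (Matching.rest m) → ZeroSubset xs
    majority⇒zero {xs} {u} m rs hs p≤ =
      let (s , es) = select-equal ms hs
          ys = chosen s ++ rs′
          ys⊑ = ⊑-trans (⊑-++ {S = chosen s} (others s , split s) (⊑-refl {S = rs′})) (↭⇒⊑ (Matching.splits m))
          len = subst (p ℕ.≤_) (sym (≡-trans (length-++ (chosen s)) (cong (ℕ._+ length rs′) (length-chosen s)))) p≤
      in take p ys , ⊑-trans (take-⊑ p ys) ys⊑ , length-take-≤ len
       , equal⇒zero (All-⊑ (take-⊑ p ys) (All.++⁺ es rs)) (length-take-≤ len)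
      where
      ms = Matching.matched m
      rs′ = Matching.rest m

    matching-length : ∀ {xs} (m : Matching xs) → 2 ℕ.* length (Matching.matched m) ℕ.+ length (Matching.rest m) ≡ length xs
    matching-length m = sym (≡-trans (↭-length (Matching.splits m)) (≡-trans (length-++ (flat (Matching.matched m)))
      (cong (ℕ._+ length (Matching.rest m)) (length-flat (Matching.matched m)))))

    -- A matching of exactly 2p - 1 elements cannot leave none. If it leaves one, the p - 1 couples
    -- together with this element reach every residue; otherwise some value `u` occurs at least p
    -- times.
    egz : ∀ {xs} → 2 ℕ.* p ℕ.≤ suc (length xs) → ZeroSubset xs
    egz {xs} 2p≤ = zero-⊑ (take-⊑ k xs) (go (matching (take k xs)))
      where
      k = ℕ.pred (2 ℕ.* p)
      suc-k : suc k ≡ 2 ℕ.* p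
      suc-k = ℕ.suc-pred (2 ℕ.* p) {{ℕ.m*n≢0 2 p {{_}} {{Primality.prime⇒nonZero prime}}}}
      len : length (take k xs) ≡ k
      len = length-take-≤ (ℕ.≤-pred (subst (ℕ._≤ suc (length xs)) (sym suc-k) 2p≤))
      size : ∀ m → suc (2 ℕ.* length (Matching.matched m) ℕ.+ length (Matching.rest m)) ≡ 2 ℕ.* p
      size m = ≡-trans (cong suc (≡-trans (matching-length m) len)) suc-k
      odd : ∀ t p → suc (2 ℕ.* t ℕ.+ 0) ≢ 2 ℕ.* p
      odd t p e = ℕ.even≢odd p t (≡-trans (sym e) (cong suc (ℕ.+-identityʳ _)))
      go : Matching (take k xs) → ZeroSubset (take k xs)
      go m with Matching.maximal m
      ... | inj₂ (u , rs , hs) = majority⇒zero m rs hs (ℕ.≮⇒≥ λ small → ℕ.<⇒≢ (bound (length (Matching.matched m)) (length (Matching.rest m)) small) (size m))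
        where
        bound : ∀ t r → t ℕ.+ r ℕ.< p → suc (2 ℕ.* t ℕ.+ r) ℕ.< 2 ℕ.* p
        bound t r small = subst (ℕ._< 2 ℕ.* p) (lem t r)
          (ℕ.≤-trans (ℕ.≤-reflexive (lem′ t r)) (ℕ.+-mono-≤ (ℕ.≤-trans (s≤s (ℕ.m≤m+n t r)) small) (ℕ.+-mono-≤ small (z≤n {0}))))
          where
          lem : ∀ t r → t ℕ.+ suc (t ℕ.+ r) ≡ suc (2 ℕ.* t ℕ.+ r)
          lem = ℕ-Solver.solve-∀
          lem′ : ∀ t r → suc (t ℕ.+ suc (t ℕ.+ r)) ≡ suc t ℕ.+ (suc (t ℕ.+ r) ℕ.+ 0)
          lem′ = ℕ-Solver.solve-∀
      ... | inj₁ r≤1 with Matching.rest m in eq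
      ...   | [] = contradiction (≡-trans (cong (λ r → suc (2 ℕ.* length (Matching.matched m) ℕ.+ length r)) (sym eq)) (size m)) (odd (length (Matching.matched m)) p)
      ...   | _ ∷ _ ∷ _ = contradiction r≤1 λ { (s≤s ()) }
      ...   | x ∷ [] =
        let t = length (Matching.matched m)
            e : suc t ≡ p
            e = ℕ.*-cancelˡ-≡ _ _ 2 (≡-trans (lem t) (≡-trans (cong (λ r → suc (2 ℕ.* t ℕ.+ length r)) (sym eq)) (size m)))
            (s , a) = selection-sum (Matching.matched m) (Matching.unequal m) {val x ∷ []} ([] ∷ []) (s≤s z≤n) (ℕ.≤-reflexive (sym e))
        in chosen s ++ [ x ]
         , ⊑-trans (⊑-++ {S = chosen s} (others s , split s) (⊑-refl {S = [ x ]})) (↭⇒⊑ (subst (λ r → take k xs ↭ flat (Matching.matched m) ++ r) eq (Matching.splits m)))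
         , ≡-trans (length-++ (chosen s)) (≡-trans (cong (ℕ._+ 1) (length-chosen s)) (≡-trans (ℕ.+-comm t 1) e))
         , last {chosen s} a
        where
        lem : ∀ t → 2 ℕ.* suc t ≡ suc (2 ℕ.* t ℕ.+ 1)
        lem = ℕ-Solver.solve-∀
        last : ∀ {ys} → Any (λ v → Z (sum-by val ys ℤ.+ v)) (val x ∷ []) → Z (sum-by val (ys ++ [ x ]))
        last {ys} (here z) = subst Z (sym (≡-trans (sum-by-++ val ys) (cong (λ v → sum-by val ys ℤ.+ v) (ℤ.+-identityʳ (val x))))) z

-- Couples of unequal blocks

Flat : Item → Set
Flat x = Vec.head (class x) ≡ false

support-flat : ∀ {D} → All Flat D → proj₂ (support D) ≡ empty
support-flat []                                = refl
support-flat {((false ∷ v) , z) ∷ D} (refl ∷ fs) = support-flat fs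

put-longer : ∀ w {D} → Separated D → length D ℕ.≤ length (put w D)
put-longer w {D} ds = subst₂ ℕ._≤_ (count-support ds) (count-support (put-Separated w ds))
  (count-mono (support D) (support (put w D)) (put-support w D))

data Large (D : List Item) : Set where
  eleven     : 11 ℕ.≤ length D → Large D
  hyperplane : 7 ℕ.≤ length D → All Flat D → Large D

module StageOps (p : ℕ) (prime : Prime p) where

  open ModPrime p prime public
  open Stages p prime public
  open QuadValues p public
  open PrimeBlocks p prime public

  for-each : ∀ {P : Blk × Blk → Set} {ms} → (∀ {b c ms′} → ms ↭ (b , c) ∷ ms′ → P (b , c)) → All P ms
  for-each f = All.tabulate λ m∈ → let (_ , σ) = ∈⇒↭ m∈ in f σ

  module _ {S : List Item} where

    -- Dissolves a couple. One couple fewer raises the required weight of options by one, but both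
    -- blocks, and their single items, become available for options.
    pull : ∀ {b c ms R} → Stage S ((b , c) ∷ ms) R → Stage S ms (flat (b ∷ c ∷ []) ++ R)
    pull {b} {c} {ms} {R} (stage π (_ ∷ _ ∷ ts) (_ ∷ us)) =
      stage (trans π (Bag.solve 3 (λ x y r → x ⊕ (y ⊕ r) ⊜ y ⊕ (x ⊕ r)) refl (flat (b ∷ c ∷ [])) (flat (flat ms)) R)) ts us
      where open Bag using (_⊕_; _⊜_)

    pull-twins : ∀ {b c ms R} → Stage S ((b , c) ∷ ms) R → Twin b × Twin c
    pull-twins (stage _ (tb ∷ tc ∷ _) _) = tb , tc

    push : ∀ {b c ms R} → Stage S ms (flat (b ∷ c ∷ []) ++ R) → Twin b → Twin c → Unequal (b , c) → Stage S ((b , c) ∷ ms) R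
    push {b} {c} {ms} {R} (stage π ts us) tb tc u =
      stage (trans π (Bag.solve 3 (λ x y r → y ⊕ (x ⊕ r) ⊜ x ⊕ (y ⊕ r)) refl (flat (b ∷ c ∷ [])) (flat (flat ms)) R)) (tb ∷ tc ∷ ts) (u ∷ us)
      where open Bag using (_⊕_; _⊜_)

    stage-R : ∀ {ms R R′} → R ↭ R′ → Stage S ms R → Stage S ms R′
    stage-R {ms} σ (stage π ts us) = stage (trans π (++⁺ˡ (flat (flat ms)) σ)) ts us

    stage-↭ : ∀ {ms ms′ R} → ms ↭ ms′ → Stage S ms R → Stage S ms′ R
    stage-↭ {R = R} σ (stage π ts us) =
      stage (trans π (++⁺ʳ R (flat-↭ (flat-↭ σ)))) (All-resp-↭ (flat-↭ σ) ts) (All-resp-↭ σ us)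

    stage-⊑ : ∀ {ms R} → Stage S ms R → R ⊑ S
    stage-⊑ {ms} {R} (stage π ts us) = flat (flat ms) , trans π (++-comm (flat (flat ms)) R)

    -- The spare block and the matched block `c` trade places, so whatever is shown about the spare
    -- block of any stage also holds for `c`.
    exchange : ∀ {b c s ms R} → Stage S ((b , c) ∷ ms) (flat [ s ] ++ R) → Twin s → ¬ block-value s ≋ block-value b →
               Stage S ((s , b) ∷ ms) (flat [ c ] ++ R)
    exchange {b} {c} {s} {ms} {R} st ts ne =
      push (stage-R (Bag.solve 4 (λ b c s r → (b ⊕ c) ⊕ (s ⊕ r) ⊜ (s ⊕ b) ⊕ (c ⊕ r)) refl (flat [ b ]) (flat [ c ]) (flat [ s ]) R) (pull st))
        ts (proj₁ (pull-twins st)) ne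
      where open Bag using (_⊕_; _⊜_)

    flip-pair : ∀ {b c ms R} → Stage S ((b , c) ∷ ms) R → Stage S ((c , b) ∷ ms) R
    flip-pair {b} {c} {ms} {R} st@(stage _ _ (u ∷ _)) =
      push (stage-R (Bag.solve 3 (λ b c r → (b ⊕ c) ⊕ r ⊜ (c ⊕ b) ⊕ r) refl (flat [ b ]) (flat [ c ]) R) (pull st))
        (proj₂ (pull-twins st)) (proj₁ (pull-twins st)) (λ e → u (≋-sym e))
      where open Bag using (_⊕_; _⊜_)

    module _ (avoids : Avoids S) where

      -- The counterpart of `core` for couples that share a value: choosing the blocks of value `a`
      -- makes their contribution exact, so a single option can complete the sum to 0.
      finish : ∀ {ms R w v a} → Stage S ms R → All (Has a) ms → Opt R w v → w ℕ.+ length ms ≡ p →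
               ¬ v ℤ.+ + length ms ℤ.* a ≋ 0ℤ
      finish {ms} {R} {w} {v} {a} st hs o e z with select-equal block-value ms hs
      ... | s , es = avoids inside len cls (≋⇒Z (≋-trans sum z))
        where
        T = flat (chosen s) ++ items o
        inside : T ⊑ S
        inside = ⊑-trans (⊑-++ {S = flat (chosen s)} (flat (others s) , trans (flat-↭ (split s)) (↭-reflexive (flat-++ (chosen s) (others s)))) (within o))
          (↭⇒⊑ (Stage.layout st))
        len : length T ≡ 2 ℕ.* p
        len = ≡-trans (length-++ (flat (chosen s))) (≡-trans (cong₂ ℕ._+_ (≡-trans (length-flat (chosen s)) (cong (2 ℕ.*_) (length-chosen s))) (weight o))
          (≡-trans (sym (ℕ.*-distribˡ-+ 2 (length ms) w)) (cong (2 ℕ.*_) (≡-trans (ℕ.+-comm (length ms) w) e))))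
        cls : xsum (classes T) ≡ 0ᵛ
        cls = ≡-trans (cong xsum (map-++ class (flat (chosen s)) (items o)))
          (≡-trans (xsum-++ (classes (flat (chosen s))))
          (≡-trans (cong₂ _⊕ᵛ_ (xsum-twins (All.++⁻ˡ (chosen s) (All-resp-↭ (split s) (Stage.twins st)))) (closed o)) refl))
        lem : ∀ s v x → s ℤ.- x ≡ (s ℤ.+ v) ℤ.- (v ℤ.+ x)
        lem = solve-∀
        sum : total T ≋ v ℤ.+ + length ms ℤ.* a
        sum = ≋-trans (≡⇒≋ (≡-trans (sum-by-++ proj₂ (flat (chosen s))) (cong₂ ℤ._+_ (total-flat (chosen s)) (amount o))))
          (≋-by (lem (sum-by block-value (chosen s)) v (+ length ms ℤ.* a))
            (subst (λ n → sum-by block-value (chosen s) ≋ + n ℤ.* a) (length-chosen s) (sum-≋ block-value es)))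

      no-zero-blocks : ∀ {bs R} → S ↭ flat bs ++ R → All Twin bs → ¬ ZeroSubset block-value bs
      no-zero-blocks {bs} {R} π ts (T , i , len , z) =
        avoids (⊑-trans (flat-⊑ i) (R , π)) (≡-trans (length-flat T) (cong (2 ℕ.*_) len))
          (xsum-twins (All-⊑ i ts)) (subst Z (sym (total-flat T)) z)

      -- Any 2p - 1 blocks contain p with sum 0, that is 2p items that cancel in class. This bound
      -- is what forces the remainder to be large.
      few-blocks : ∀ {bs R} → S ↭ flat bs ++ R → All Twin bs → 2 ℕ.+ length bs ℕ.≤ 2 ℕ.* p
      few-blocks π ts = ℕ.≰⇒> λ 2p≤ → no-zero-blocks π ts (egz block-value 2p≤)

      private
        agree-≡ : ∀ {ms R u v} → Stage S ms R → 2 ℕ.+ length ms ≡ p → Opt R 2 u → Opt R 2 v → ¬ ¬ u ≋ v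
        agree-≡ st e o o′ u≢v = core avoids st e (o ∷ o′ ∷ []) (s≤s z≤n) (s≤s (s≤s z≤n)) ((u≢v ∷ []) ∷ [] ∷ [])

      -- For weight 2 already two distinct option values are too many.
      agree : ∀ {ms R u v} → Stage S ms R → 2 ℕ.+ length ms ≡ p → Opt R 2 u → Opt R 2 v → u ≋ v
      agree {u = u} {v} st e o o′ = decidable-stable (u ≋? v) (agree-≡ st e o o′)

  quad-opt : ∀ D {a b c d} → a ∈ˢ support D → b ∈ˢ support D → c ∈ˢ support D → d ∈ˢ support D →
             a ≢ b → a ≢ c → a ≢ d → b ≢ c → b ≢ d → c ≢ d → a ⊕ᵛ b ⊕ᵛ (c ⊕ᵛ d) ≡ 0ᵛ →
             Opt D 2 ((value D a ℤ.+ value D b) ℤ.+ (value D c ℤ.+ value D d))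
  quad-opt D {a} {b} {c} {d} a∈ b∈ c∈ d∈ n₁ n₂ n₃ n₄ n₅ n₆ e =
    opt-≡ (lem (value D a) (value D b) (value D c) (value D d))
      (opt-members D ((n₁ ∷ n₂ ∷ n₃ ∷ []) ∷ (n₄ ∷ n₅ ∷ []) ∷ (n₆ ∷ []) ∷ [] ∷ []) (a∈ ∷ b∈ ∷ c∈ ∷ d∈ ∷ []) refl
        (≡-trans (Xor.solve 4 4 (λ a b c d → a ⊕ (b ⊕ (c ⊕ (d ⊕ Xor.id))) ⊜ (a ⊕ b) ⊕ (c ⊕ d)) refl a b c d) e))
    where
    open Xor 4 using (_⊕_; _⊜_)
    lem : ∀ a b c d → a ℤ.+ (b ℤ.+ (c ℤ.+ (d ℤ.+ 0ℤ))) ≡ (a ℤ.+ b) ℤ.+ (c ℤ.+ d)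
    lem = solve-∀

  table-quads : ∀ {D R κ} → D ⊑ R → (∀ {v} → Opt R 2 v → v ≋ κ) → Quads (support D) (value D) κ
  table-quads {D} i f = mkQuads λ a b c d a∈ b∈ c∈ d∈ n₁ n₂ n₃ n₄ n₅ n₆ e →
    f (opt-⊑ i (quad-opt D a∈ b∈ c∈ d∈ n₁ n₂ n₃ n₄ n₅ n₆ e))

  large-value : ∀ {D κ} → Separated D → Large D → Quads (support D) (value D) κ → ∀ {x} → x ∈ D → 4· (proj₂ x) ≋ κ
  large-value {D} {κ} ds l q {x} x∈ = subst (λ z → 4· z ≋ κ) (value-∈ ds x∈) (big-value q (big l) (∈-support x∈))
    where
    big : Large D → Big (support D)
    big (eleven 11≤)       = eleven (subst (11 ℕ.≤_) (sym (count-support ds)) 11≤)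
    big (hyperplane 7≤ fs) = hyperplane
      (subst (7 ℕ.≤_) (≡-trans (sym (count-support ds)) (≡-trans (cong (λ t → count {3} (proj₁ (support D)) ℕ.+ count {3} t) (support-flat fs)) (ℕ.+-identityʳ _))) 7≤)
      (support-flat fs)

norm⇒strong : ∀ {t v} → Norm t v → ∃[ d ] Strong t d
norm⇒strong (triangle _ _ _ s _ _) = _ , s
norm⇒strong (adjacent _ _ s _)     = _ , s

strong-flip : ∀ o t {d} → Strong (flip o t) d → ∃[ a ] ∃[ b ] a ∈ˢ t × a ⊕ᵛ d ∈ˢ t × b ∈ˢ t × b ⊕ᵛ d ∈ˢ t × d ≢ 0ᵛ × b ≢ a × b ≢ a ⊕ᵛ d
strong-flip o t {d} st =
  a ⊕ᵛ o , b ⊕ᵛ o , in′ a a∈ , in″ a a′∈ , in′ b b∈ , in″ b b′∈ , d≢0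
  , b≢a ∘ ⊕ᵛ-injectiveʳ o
  , (λ e → b≢a′ (⊕ᵛ-injectiveʳ o (≡-trans e (sym (swapped a)))))
  where
  open Strong st
  swapped : ∀ v → v ⊕ᵛ d ⊕ᵛ o ≡ v ⊕ᵛ o ⊕ᵛ d
  swapped v = ≡-trans (⊕ᵛ-assoc v d o) (≡-trans (cong (v ⊕ᵛ_) (⊕ᵛ-comm d o)) (sym (⊕ᵛ-assoc v o d)))
  in′ : ∀ v → v ∈ˢ flip o t → v ⊕ᵛ o ∈ˢ t
  in′ v v∈ = ≡-trans (sym (look-flip o t v)) v∈
  in″ : ∀ v → v ⊕ᵛ d ∈ˢ flip o t → v ⊕ᵛ o ⊕ᵛ d ∈ˢ t
  in″ v v∈ = subst (_∈ˢ t) (swapped v) (in′ (v ⊕ᵛ d) v∈)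

module OddPrime (p : ℕ) (prime : Prime p) (odd : ¬ + p ℤ.∣ + 2) where

  open StageOps p prime public

  halve : ∀ {x} → Z (x ℤ.+ x) → Z x
  halve {x} z = [ (λ e → contradiction e odd) , id ]′ (Z-*⁻ (+ 2) {x} (subst Z (lem x) z))
    where
    lem : ∀ x → x ℤ.+ x ≡ + 2 ℤ.* x
    lem = solve-∀

  parallel-opt : ∀ D {a b d} → a ∈ˢ support D → a ⊕ᵛ d ∈ˢ support D → b ∈ˢ support D → b ⊕ᵛ d ∈ˢ support D →
                 d ≢ 0ᵛ → b ≢ a → b ≢ a ⊕ᵛ d →
                 Opt D 2 ((value D a ℤ.+ value D (a ⊕ᵛ d)) ℤ.+ (value D b ℤ.+ value D (b ⊕ᵛ d)))
  parallel-opt D {a} {b} {d} a∈ a′∈ b∈ b′∈ d≢0 b≢a b≢a′ =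
    quad-opt D a∈ a′∈ b∈ b′∈ (shifted a) (b≢a ∘ sym)
      (λ e → b≢a′ (≡-trans (sym (⊕ᵛ-cancelʳ b d)) (cong (_⊕ᵛ d) (sym e))))
      (b≢a′ ∘ sym) (λ e → b≢a (sym (⊕ᵛ-injectiveʳ d e))) (shifted b) (quad-sum a d b)
    where
    shifted : ∀ x → x ≢ x ⊕ᵛ d
    shifted x e = d≢0 (≡-trans (sym (pair-sum x d)) (≡-trans (cong (x ⊕ᵛ_) (sym e)) (⊕ᵛ-self x)))

  -- Normality of a point yields a strong direction, and two parallel pairs in it form a closed
  -- quadruple. Its value serves as the reference `κ`.
  some-quad : ∀ {D} → Separated D → 11 ℕ.≤ length D → ∃[ κ ] Opt D 2 κ
  some-quad {x ∷ D} ds 11≤ with allNorm-translate (support (x ∷ D)) (subst (11 ℕ.≤_) (sym (count-support ds)) 11≤)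
  ... | o , n with norm⇒strong (n (class x ⊕ᵛ o) (≡-trans (look-flip o t (class x ⊕ᵛ o)) (≡-trans (cong (look t) (⊕ᵛ-cancelʳ (class x) o)) (∈-support {x} {x ∷ D} (here refl)))))
    where t = support (x ∷ D)
  ... | d , s with strong-flip o (support (x ∷ D)) s
  ... | a , b , a∈ , a′∈ , b∈ , b′∈ , d≢0 , b≢a , b≢a′ = _ , parallel-opt (x ∷ D) a∈ a′∈ b∈ b′∈ d≢0 b≢a b≢a′

  Fits : ∀ {D} → Large D → Item → Set
  Fits (eleven _)       w = Data.Unit.Base.⊤
  Fits (hyperplane _ _) w = Flat w

  put-large : ∀ {D} (l : Large D) → Separated D → ∀ w → Fits l w → Large (put w D)
  put-large (eleven 11≤)       ds w f = eleven (ℕ.≤-trans 11≤ (put-longer w ds))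
  put-large (hyperplane 7≤ fs) ds w f = hyperplane (ℕ.≤-trans 7≤ (put-longer w ds)) (f ∷ without-All (class w) fs)

  put-within : ∀ {w D R} → D ⊑ R → put w D ⊑ (w ∷ R)
  put-within {w} {D} (U , π) = ⊑-trans (put-⊑ w D) (U , prep w π)

  module _ {S : List Item} (avoids : Avoids S) where

    -- Either item of `s` can be put into `D`, where it becomes a normal point. So four times each
    -- item is `κ`; adding the two equations and halving gives the claim.
    block-double : ∀ {ms s D R κ} → Stage S ms (flat [ s ] ++ R) → D ⊑ R → Separated D →
                   (l : Large D) → Fits l (proj₁ s) → Fits l (proj₂ s) →
                   (∀ {v} → Opt (flat [ s ] ++ R) 2 v → v ≋ κ) → 2· (block-value s) ≋ κ
    block-double {s = w , w′} {D} {R} {κ} st i ds l fw fw′ agrees =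
      mk≋ (halve (subst Z (lem (proj₂ w) (proj₂ w′) κ) (Z-+ (un≋ (fixed fw i₁)) (un≋ (fixed fw′ i₂)))))
      where
      lem : ∀ x y κ → (((x ℤ.+ x) ℤ.+ (x ℤ.+ x)) ℤ.- κ) ℤ.+ (((y ℤ.+ y) ℤ.+ (y ℤ.+ y)) ℤ.- κ)
            ≡ (((x ℤ.+ y) ℤ.+ (x ℤ.+ y)) ℤ.- κ) ℤ.+ (((x ℤ.+ y) ℤ.+ (x ℤ.+ y)) ℤ.- κ)
      lem = solve-∀
      i₁ : put w D ⊑ (w ∷ w′ ∷ R)
      i₁ = put-within (⊑-trans i (⊑-++ˡ [ w′ ] R))
      i₂ : put w′ D ⊑ (w ∷ w′ ∷ R)
      i₂ = ⊑-trans (put-within i) (⊑-++ˡ [ w ] (w′ ∷ R))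
      fixed : ∀ {x} → Fits l x → put x D ⊑ (w ∷ w′ ∷ R) → 4· (proj₂ x) ≋ κ
      fixed {x} f j = large-value (put-Separated x ds) (put-large l ds x f) (table-quads j agrees) (here refl)

    -- Dissolving one couple makes its own sum `b + c` the reference `κ`. Each of the two blocks
    -- then has double `κ`, so they are equal, contrary to being a couple.
    hyperplane-case : ∀ {ms D} → Stage S ms D → 1 ℕ.+ length ms ≡ p → Separated D → 7 ℕ.≤ length D → All Flat S → ⊥
    hyperplane-case {[]} st e = contradiction (subst Prime (sym e) prime) λ ()
    hyperplane-case {(b , c) ∷ ms} {D} st@(stage _ _ (u ∷ _)) e ds 7≤ fs =
      u (mk≋ (halve (subst Z (lem (block-value b) (block-value c) _) (Z-+ (un≋ b-double) (Z-neg (un≋ c-double))))))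
      where
      st′ = pull st
      st″ = pull (flip-pair st)
      κ = block-value b ℤ.+ (block-value c ℤ.+ 0ℤ)
      tb = proj₁ (pull-twins st)
      tc = proj₂ (pull-twins st)
      R = flat (b ∷ c ∷ []) ++ D
      agrees : ∀ {v} → Opt R 2 v → v ≋ κ
      agrees o = agree avoids st′ e o (opt-⊑ (⊑-++ʳ (flat (b ∷ c ∷ [])) D) (opt-blocks (tb ∷ tc ∷ [])))
      swapped : R ↭ flat (c ∷ b ∷ []) ++ D
      swapped = Bag.solve 3 (λ x y z → (x ⊕ y) ⊕ z ⊜ (y ⊕ x) ⊕ z) refl (flat [ b ]) (flat [ c ]) D
        where open Bag using (_⊕_; _⊜_)
      D-flat : All Flat D
      D-flat = All-⊑ (stage-⊑ st) fs
      R-flat : All Flat R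
      R-flat = All-⊑ (stage-⊑ st′) fs
      l = hyperplane 7≤ D-flat
      b-double : 2· (block-value b) ≋ κ
      b-double = block-double st′ (⊑-++ˡ (flat [ c ]) D) ds l (All.lookup R-flat (here refl)) (All.lookup R-flat (there (here refl))) agrees
      c-double : 2· (block-value c) ≋ κ
      c-double = block-double st″ (⊑-++ˡ (flat [ b ]) D) ds l (All.lookup R-flat (there (there (here refl)))) (All.lookup R-flat (there (there (there (here refl)))))
        (λ o → agrees (opt-⊑ (↭⇒⊑ swapped) o))
      lem : ∀ b c κ → ((b ℤ.+ b) ℤ.- κ) ℤ.- ((c ℤ.+ c) ℤ.- κ) ≡ (b ℤ.- c) ℤ.+ (b ℤ.- c)
      lem = solve-∀

    -- The spare block has double `κ`. A couple without its value could exchange a block for it, and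
    -- the block released would have the same double, hence the same value. So every couple contains
    -- that value, and p copies of it, two of them in the form of `κ`, sum to 0.
    eleven-case : ∀ {ms s D} → Stage S ms (flat [ s ] ++ D) → Twin s → 2 ℕ.+ length ms ≡ p → Separated D → 11 ℕ.≤ length D → ⊥
    eleven-case {ms} {s} {D} st ts e ds 11≤ =
      finish avoids st has (opt-⊑ (⊑-++ˡ (flat [ s ]) D) q) e balanced-sum
      where
      κ = proj₁ (some-quad ds 11≤)
      q = proj₂ (some-quad ds 11≤)
      doubled : ∀ {ms s} → Stage S ms (flat [ s ] ++ D) → 2 ℕ.+ length ms ≡ p → 2· (block-value s) ≋ κ
      doubled {s = s} st e = block-double st ⊑-refl ds (eleven 11≤) _ _
        (λ o → agree avoids st e o (opt-⊑ (⊑-++ˡ (flat [ s ]) D) q))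
      equal : ∀ x y κ → ((x ℤ.+ x) ℤ.- κ) ℤ.- ((y ℤ.+ y) ℤ.- κ) ≡ (x ℤ.- y) ℤ.+ (x ℤ.- y)
      equal = solve-∀
      has : All (Has (block-value s)) ms
      has = for-each one
        where
        one : ∀ {b c ms′} → ms ↭ (b , c) ∷ ms′ → Has (block-value s) (b , c)
        one {b} {c} {ms′} σ with block-value s ≋? block-value b
        ... | yes s≋b = inj₁ (≋-sym s≋b)
        ... | no s≢b  = inj₂ (mk≋ (halve (subst Z (equal (block-value c) (block-value s) κ)
          (Z-+ (un≋ (doubled (exchange (stage-↭ σ st) ts s≢b) (subst (λ n → 2 ℕ.+ n ≡ p) (↭-length σ) e)))
               (Z-neg (un≋ (doubled st e)))))))
      lem : ∀ κ n s → (+ 2 ℤ.+ n) ℤ.* s ℤ.- ((s ℤ.+ s) ℤ.- κ) ≡ κ ℤ.+ n ℤ.* s ℤ.- 0ℤ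
      lem = solve-∀
      balanced-sum : κ ℤ.+ + length ms ℤ.* block-value s ≋ 0ℤ
      balanced-sum = mk≋ (subst Z (lem κ (+ length ms) (block-value s))
        (Z-+ (multiple (block-value s)) (Z-neg (un≋ (doubled st e)))))
        where
        multiple : ∀ x → Z ((+ 2 ℤ.+ + length ms) ℤ.* x)
        multiple x = subst (λ n → Z (+ n ℤ.* x)) (sym e) (ℤ.∣m⇒∣m*n x ℤ.∣-refl)

-- Nine leftover classes

module NinePoints (p : ℕ) (prime : Prime p) (odd : ¬ + p ℤ.∣ + 2) where

  open OddPrime p prime odd public

  module _ {S : List Item} (avoids : Avoids S) where

    three : ∀ {ms R u v w} → Stage S ms R → 3 ℕ.+ length ms ≡ p → Opt R 3 u → Opt R 3 v → Opt R 3 w → ¬ u ≋ v → w ≋ u ⊎ w ≋ v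
    three {u = u} {v} {w} st e ou ov ow u≢v with w ≋? u | w ≋? v
    ... | yes w≋u | _       = inj₁ w≋u
    ... | no _    | yes w≋v = inj₂ w≋v
    ... | no w≢u  | no w≢v  = ⊥-elim (core avoids st e (ow ∷ ou ∷ ov ∷ []) (s≤s z≤n) (s≤s (s≤s (s≤s z≤n)))
                                ((w≢u ∷ w≢v ∷ []) ∷ (u≢v ∷ []) ∷ [] ∷ []))

    private
      xsum-constant : ∀ {v T T′} → All (λ x → class x ≡ v) T → All (λ x → class x ≡ v) T′ → length T ≡ length T′ →
                      xsum (classes T) ≡ xsum (classes T′)
      xsum-constant {T = []}    {[]}     []       []         _ = refl
      xsum-constant {T = x ∷ T} {y ∷ T′} (e ∷ es) (e′ ∷ es′) l =
        cong₂ _⊕ᵛ_ (≡-trans e (sym e′)) (xsum-constant es es′ (ℕ.suc-injective l))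

    -- Two applications of the Erdős–Ginzburg–Ziv theorem within one class.
    concentrated : ∀ {T v} → T ⊑ S → All (λ x → class x ≡ v) T → 3 ℕ.* p ℕ.≤ suc (length T) → ⊥
    concentrated {T} {v} i cs len = avoids {T₁ ++ T₂} (⊑-trans (⊑-trans (⊑-++ (⊑-refl {S = T₁}) T₂⊑) (↭⇒⊑ π)) i)
        (≡-trans (length-++ T₁) (≡-trans (cong₂ ℕ._+_ l₁ l₂) (cong (p ℕ.+_) (sym (ℕ.+-identityʳ p)))))
        (≡-trans (cong xsum (map-++ class T₁ T₂)) (≡-trans (xsum-++ (classes T₁))
          (≡-trans (cong (_⊕ᵛ xsum (classes T₂)) (xsum-constant (All-⊑ {T = T₁} (U , π) cs) (All-⊑ {T = T₂} (⊑-trans T₂⊑ (T₁ , trans π (++-comm T₁ U))) cs) (≡-trans l₁ (sym l₂))))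
            (⊕ᵛ-self (xsum (classes T₂))))))
        (subst Z (sym (sum-by-++ proj₂ T₁)) (Z-+ z₁ z₂))
      where
      first = egz proj₂ {T} (ℕ.≤-trans (ℕ.*-monoˡ-≤ p {2} {3} (s≤s (s≤s z≤n))) len)
      T₁ = proj₁ first
      U = proj₁ (proj₁ (proj₂ first))
      π = proj₂ (proj₁ (proj₂ first))
      l₁ = proj₁ (proj₂ (proj₂ first))
      z₁ = proj₂ (proj₂ (proj₂ first))
      remaining : 2 ℕ.* p ℕ.≤ suc (length U)
      remaining = ℕ.+-cancelˡ-≤ p _ _ (ℕ.≤-trans len (ℕ.≤-reflexive
        (≡-trans (cong suc (≡-trans (↭-length π) (≡-trans (length-++ T₁) (cong (ℕ._+ length U) l₁)))) (sym (ℕ.+-suc p (length U))))))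
      second = egz proj₂ {U} remaining
      T₂ = proj₁ second
      T₂⊑ = proj₁ (proj₂ second)
      l₂ = proj₁ (proj₂ (proj₂ second))
      z₂ = proj₂ (proj₂ (proj₂ second))

    module _ {b c b₂ c₂ ms D} (st : Stage S ((b , c) ∷ (b₂ , c₂) ∷ ms) D) (e : 3 ℕ.+ length ms ≡ p)
             (ds : Separated D) (nine : length D ≡ 9) (apart : class (proj₁ b) ≢ class (proj₁ c)) where

      private
        β = block-value
        κ = β b ℤ.+ β c
        R₁ = flat (b ∷ c ∷ []) ++ D
        R₂ = flat (b₂ ∷ c₂ ∷ []) ++ R₁
        st₁ = pull st
        st₂ = pull st₁
        tb = proj₁ (pull-twins st)
        tc = proj₂ (pull-twins st)
        tb₂ = proj₁ (pull-twins st₁)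
        tc₂ = proj₂ (pull-twins st₁)
        b≢c = All.head (Stage.unlike st)
        b₂≢c₂ = All.head (Stage.unlike st₁)

        agrees : ∀ {v} → Opt R₁ 2 v → v ≋ κ
        agrees o = ≋-trans (agree avoids st₁ e o (opt-⊑ (⊑-++ʳ (flat (b ∷ c ∷ [])) D) (opt-blocks (tb ∷ tc ∷ []))))
          (≡⇒≋ (cong (λ z → β b ℤ.+ z) (ℤ.+-identityʳ (β c))))

        triple : ∀ {b₁ b₂′ b₃} {X : List Item} → flat (b₁ ∷ b₂′ ∷ b₃ ∷ []) ++ X ↭ R₂ → Twin b₁ → Twin b₂′ → Twin b₃ →
                 Opt R₂ 3 (β b₁ ℤ.+ β b₂′ ℤ.+ β b₃)
        triple {b₁} {b₂′} {b₃} {X} σ t₁ t₂ t₃ = opt-≡ (lem (β b₁) (β b₂′) (β b₃))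
          (opt-⊑ (⊑-trans (⊑-++ʳ (flat (b₁ ∷ b₂′ ∷ b₃ ∷ [])) X) (↭⇒⊑ (↭-sym σ))) (opt-blocks (t₁ ∷ t₂ ∷ t₃ ∷ [])))
          where
          lem : ∀ a b c → a ℤ.+ (b ℤ.+ (c ℤ.+ 0ℤ)) ≡ a ℤ.+ b ℤ.+ c
          lem = solve-∀

        module _ where
          open Bag using (_⊕_; _⊜_)
          bcb₂ : Opt R₂ 3 (β b ℤ.+ β c ℤ.+ β b₂)
          bcb₂ = triple {X = flat [ c₂ ] ++ D} (Bag.solve 5 (λ u v x y d → (u ⊕ (v ⊕ x)) ⊕ (y ⊕ d) ⊜ (x ⊕ y) ⊕ ((u ⊕ v) ⊕ d)) refl (flat [ b ]) (flat [ c ]) (flat [ b₂ ]) (flat [ c₂ ]) D) tb tc tb₂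
          bcc₂ : Opt R₂ 3 (β b ℤ.+ β c ℤ.+ β c₂)
          bcc₂ = triple {X = flat [ b₂ ] ++ D} (Bag.solve 5 (λ u v x y d → (u ⊕ (v ⊕ y)) ⊕ (x ⊕ d) ⊜ (x ⊕ y) ⊕ ((u ⊕ v) ⊕ d)) refl (flat [ b ]) (flat [ c ]) (flat [ b₂ ]) (flat [ c₂ ]) D) tb tc tc₂
          b₂c₂b : Opt R₂ 3 (β b₂ ℤ.+ β c₂ ℤ.+ β b)
          b₂c₂b = triple {X = flat [ c ] ++ D} (Bag.solve 5 (λ u v x y d → (x ⊕ (y ⊕ u)) ⊕ (v ⊕ d) ⊜ (x ⊕ y) ⊕ ((u ⊕ v) ⊕ d)) refl (flat [ b ]) (flat [ c ]) (flat [ b₂ ]) (flat [ c₂ ]) D) tb₂ tc₂ tb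
          b₂c₂c : Opt R₂ 3 (β b₂ ℤ.+ β c₂ ℤ.+ β c)
          b₂c₂c = triple {X = flat [ b ] ++ D} (Bag.solve 5 (λ u v x y d → (x ⊕ (y ⊕ v)) ⊕ (u ⊕ d) ⊜ (x ⊕ y) ⊕ ((u ⊕ v) ⊕ d)) refl (flat [ b ]) (flat [ c ]) (flat [ b₂ ]) (flat [ c₂ ]) D) tb₂ tc₂ tc

        shifted≢ : ¬ β b ℤ.+ β c ℤ.+ β b₂ ≋ β b ℤ.+ β c ℤ.+ β c₂
        shifted≢ d = b₂≢c₂ (≋-by (lem (β b ℤ.+ β c) (β b₂) (β c₂)) d)
          where
          lem : ∀ k x y → (k ℤ.+ x) ℤ.- (k ℤ.+ y) ≡ x ℤ.- y
          lem = solve-∀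

        weight₃ : ∀ {w} → Opt R₂ 3 w → w ≋ β b ℤ.+ β c ℤ.+ β b₂ ⊎ w ≋ β b ℤ.+ β c ℤ.+ β c₂
        weight₃ o = three st₂ e bcb₂ bcc₂ o shifted≢

        -- The distinct options `b₂ + c₂ + b` and `b₂ + c₂ + c` must be the two admissible values
        -- `κ + b₂` and `κ + c₂` in some order; comparing the sums of both gives the equation.
        same-sum : β b₂ ℤ.+ β c₂ ≋ κ
        same-sum = combine (weight₃ b₂c₂b) (weight₃ b₂c₂c)
          where
          P = β b ℤ.+ β c ℤ.+ β b₂
          Q = β b ℤ.+ β c ℤ.+ β c₂
          u = β b₂ ℤ.+ β c₂ ℤ.+ β b
          v = β b₂ ℤ.+ β c₂ ℤ.+ β c
          cancel : ∀ k x y → (k ℤ.+ x) ℤ.- (k ℤ.+ y) ≡ x ℤ.- y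
          cancel = solve-∀
          differ : ∀ {w} → u ≋ w → v ≋ w → ⊥
          differ d d′ = b≢c (≋-by (cancel (β b₂ ℤ.+ β c₂) (β b) (β c)) (≋-trans d (≋-sym d′)))
          lem₁ : ∀ b c x y → ((x ℤ.+ y ℤ.+ b) ℤ.- (b ℤ.+ c ℤ.+ x)) ℤ.+ ((x ℤ.+ y ℤ.+ c) ℤ.- (b ℤ.+ c ℤ.+ y)) ≡ (x ℤ.+ y) ℤ.- (b ℤ.+ c)
          lem₁ = solve-∀
          lem₂ : ∀ b c x y → ((x ℤ.+ y ℤ.+ b) ℤ.- (b ℤ.+ c ℤ.+ y)) ℤ.+ ((x ℤ.+ y ℤ.+ c) ℤ.- (b ℤ.+ c ℤ.+ x)) ≡ (x ℤ.+ y) ℤ.- (b ℤ.+ c)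
          lem₂ = solve-∀
          combine : u ≋ P ⊎ u ≋ Q → v ≋ P ⊎ v ≋ Q → β b₂ ℤ.+ β c₂ ≋ κ
          combine (inj₁ d) (inj₁ d′) = ⊥-elim (differ d d′)
          combine (inj₂ d) (inj₂ d′) = ⊥-elim (differ d d′)
          combine (inj₁ d) (inj₂ d′) = mk≋ (subst Z (lem₁ (β b) (β c) (β b₂) (β c₂)) (Z-+ (un≋ d) (un≋ d′)))
          combine (inj₂ d) (inj₁ d′) = mk≋ (subst Z (lem₂ (β b) (β c) (β b₂) (β c₂)) (Z-+ (un≋ d) (un≋ d′)))

        quarter-≢ : ∀ {x y k} → ¬ x ≋ y → k ≋ x ℤ.+ y → ¬ 4· x ≋ 2· k
        quarter-≢ {x} {y} {k} x≢y d d′ = x≢y (mk≋ (halve (subst Z (lem x y k) (Z-+ (Z-+ (un≋ d) (un≋ d)) (un≋ d′)))))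
          where
          lem : ∀ x y k → ((k ℤ.- (x ℤ.+ y)) ℤ.+ (k ℤ.- (x ℤ.+ y))) ℤ.+ (((x ℤ.+ x) ℤ.+ (x ℤ.+ x)) ℤ.- (k ℤ.+ k))
                ≡ (x ℤ.- y) ℤ.+ (x ℤ.- y)
          lem = solve-∀

        module _ {X Y : Item} (i : (X ∷ Y ∷ D) ⊑ R₁) (X≢Y : class X ≢ class Y) where
          W E : List Item
          W = without (class Y) (without (class X) D)
          -- At least seven items of `D` avoid both classes, so `E` has exactly nine classes whether
          -- or not those of `X` and `Y` occur in `D`.
          E = X ∷ Y ∷ take 7 W
          s r : V 4
          s = class X
          r = class Y
          t : Sub 4
          t = support E
          f : V 4 → ℤ
          f = value E

          es : Separated E
          es = (X≢Y ∷ All.take⁺ 7 (without-All (class Y) (without-≢ (class X) D))) ∷ All.take⁺ 7 (without-≢ (class Y) (without (class X) D))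
             ∷ AllPairs.take⁺ 7 (without-Separated (class Y) (without-Separated (class X) ds))

          E⊑ : E ⊑ R₁
          E⊑ = ⊑-trans (⊑-++ (⊑-refl {S = X ∷ Y ∷ []}) (⊑-trans (take-⊑ 7 W) (⊑-trans (without-⊑ (class Y) _) (without-⊑ (class X) D)))) i

          size : count t ≡ 9
          size = ≡-trans (count-support es) (cong (2 ℕ.+_) (length-take-≤ {n = 7} {W} (ℕ.≤-pred (ℕ.≤-pred (ℕ.≤-trans (ℕ.≤-reflexive (sym nine))
            (ℕ.≤-trans (put-longer X ds) (s≤s (put-longer Y (without-Separated (class X) ds)))))))))

          quads : Quads t f κ
          quads = table-quads E⊑ agrees

          X∈ : s ∈ˢ t
          X∈ = ∈-support {X} {E} (here refl)
          Y∈ : r ∈ˢ t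
          Y∈ = ∈-support {Y} {E} (there (here refl))

          -- A quadruple and a sextuple through the two points contradict each other.
          obstructed : Obstruction t f κ s r → ⊥
          obstructed ob = [ (λ d → absurd b₂≢c₂ (≋-sym same-sum) d) , (λ d → absurd (b₂≢c₂ ∘ ≋-sym) (≋-trans (≋-sym same-sum) (≡⇒≋ (ℤ.+-comm (β b₂) (β c₂)))) d) ]′ (weight₃ six)
            where
            open Obstruction ob
            n₁ = proj₁ distinct
            n₂ = proj₁ (proj₂ distinct)
            vs = s ∷ r ∷ z₃ ∷ z₄ ∷ z₅ ∷ z₆ ∷ []
            vs-unique : Unique vs
            vs-unique = let (_ , _ , a₃ , a₄ , a₅ , a₆ , a₇ , a₈ , a₉ , b₁ , b₂ , b₃ , b₄ , b₅ , b₆ , b₇) = distinct in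
              (X≢Y ∷ a₃ ∘ sym ∷ a₅ ∘ sym ∷ a₈ ∘ sym ∷ b₃ ∘ sym ∷ []) ∷ (a₄ ∘ sym ∷ a₆ ∘ sym ∷ a₉ ∘ sym ∷ b₄ ∘ sym ∷ [])
              ∷ (a₇ ∘ sym ∷ b₁ ∘ sym ∷ b₅ ∘ sym ∷ []) ∷ (b₂ ∘ sym ∷ b₆ ∘ sym ∷ []) ∷ (b₇ ∘ sym ∷ []) ∷ [] ∷ []
            vs-in : All (_∈ˢ t) vs
            vs-in = let (_ , _ , i₃ , i₄ , i₅ , i₆) = in-t in X∈ ∷ Y∈ ∷ i₃ ∷ i₄ ∷ i₅ ∷ i₆ ∷ []
            vs-closed : xsum vs ≡ 0ᵛ
            vs-closed = ≡-trans (cong (λ z → s ⊕ᵛ (r ⊕ᵛ (z₃ ⊕ᵛ (z₄ ⊕ᵛ (z₅ ⊕ᵛ (z ⊕ᵛ 0ᵛ)))))) sextuple)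
              (≡-trans (Xor.solve 4 5 (λ s r x y z → s ⊕ (r ⊕ (x ⊕ (y ⊕ (z ⊕ (((((s ⊕ r) ⊕ x) ⊕ y) ⊕ z) ⊕ Xor.id))))) ⊜ (s ⊕ (r ⊕ (x ⊕ (y ⊕ z)))) ⊕ (s ⊕ (r ⊕ (x ⊕ (y ⊕ z))))) refl s r z₃ z₄ z₅)
                (⊕ᵛ-self (s ⊕ᵛ (r ⊕ᵛ (z₃ ⊕ᵛ (z₄ ⊕ᵛ z₅))))))
              where open Xor 4 using (_⊕_; _⊜_)
            six : Opt R₂ 3 (sum-by f vs)
            six = opt-⊑ (⊑-++ˡ (flat (b₂ ∷ c₂ ∷ [])) R₁) (opt-⊑ E⊑ (opt-members E vs-unique vs-in refl vs-closed))
            z₂≢s : z₂ ≢ s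
            z₂≢s e = n₂ (sym (≡-trans (sym (⊕ᵛ-cancel s r)) (≡-trans (cong (s ⊕ᵛ_)
              (≡-trans (sym (⊕ᵛ-cancelʳ (s ⊕ᵛ r) z₁)) (cong (_⊕ᵛ z₁) (≡-trans (sym quad) e)))) (⊕ᵛ-cancel s z₁))))
            z₂≢r : z₂ ≢ r
            z₂≢r e = n₁ (sym (≡-trans (sym (⊕ᵛ-cancelʳ s r)) (≡-trans (cong (_⊕ᵛ r) (≡-trans (sym (⊕ᵛ-cancelʳ (s ⊕ᵛ r) z₁)) (cong (_⊕ᵛ z₁) (≡-trans (sym quad) e))))
              (≡-trans (cong (_⊕ᵛ r) (⊕ᵛ-comm r z₁)) (⊕ᵛ-cancelʳ z₁ r)))))
            z₂≢z₁ : z₂ ≢ z₁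
            z₂≢z₁ e = X≢Y (⊕ᵛ≡0 (⊕ᵛ-injectiveʳ z₁ (≡-trans (sym quad) (≡-trans e (sym (⊕ᵛ-identityˡ z₁))))))
            four : (f s ℤ.+ f r) ℤ.+ (f z₁ ℤ.+ f z₂) ≋ κ
            four = quad-value quads s r z₁ z₂ X∈ Y∈ (proj₁ in-t) (proj₁ (proj₂ in-t)) X≢Y (n₁ ∘ sym) (z₂≢s ∘ sym) (n₂ ∘ sym) (z₂≢r ∘ sym) (z₂≢z₁ ∘ sym)
              (≡-trans (cong (λ z → s ⊕ᵛ r ⊕ᵛ (z₁ ⊕ᵛ z)) quad)
              (≡-trans (Xor.solve 4 3 (λ s r z → (s ⊕ r) ⊕ (z ⊕ ((s ⊕ r) ⊕ z)) ⊜ ((s ⊕ r) ⊕ z) ⊕ ((s ⊕ r) ⊕ z)) refl s r z₁) (⊕ᵛ-self (s ⊕ᵛ r ⊕ᵛ z₁))))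
              where open Xor 4 using (_⊕_; _⊜_)
            absurd : ∀ {x y} → ¬ x ≋ y → κ ≋ x ℤ.+ y → ¬ sum-by f vs ≋ κ ℤ.+ x
            -- The quadruple gives `4(s + r) = 2κ`, hence the sextuple has fourfold sum `6κ`.
            -- Compared with `4(κ + x)` this leaves `4x = 2κ`, and with `κ = x + y` the two values
            -- would coincide.
            absurd {x} {y} x≢y k d = quarter-≢ x≢y k (mk≋ (subst Z (lem (f s) (f r) (f z₁) (f z₂) q κ x)
              (Z-+ (Z-+ (Z-+ (Z-* (+ 4) (un≋ four)) (Z-neg (Z-+ v₁ v₂))) rest) (Z-neg (Z-* (+ 4) (un≋ d))))))
              where
              q = f z₃ ℤ.+ (f z₄ ℤ.+ (f z₅ ℤ.+ (f z₆ ℤ.+ 0ℤ)))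
              v₁ = un≋ (proj₁ values)
              v₂ = un≋ (proj₁ (proj₂ values))
              v₃ = un≋ (proj₁ (proj₂ (proj₂ values)))
              v₄ = un≋ (proj₁ (proj₂ (proj₂ (proj₂ values))))
              v₅ = un≋ (proj₁ (proj₂ (proj₂ (proj₂ (proj₂ values)))))
              v₆ = un≋ (proj₂ (proj₂ (proj₂ (proj₂ (proj₂ values)))))
              sum₄ : ∀ c d e g κ → (((((c ℤ.+ c) ℤ.+ (c ℤ.+ c)) ℤ.- κ) ℤ.+ (((d ℤ.+ d) ℤ.+ (d ℤ.+ d)) ℤ.- κ))
                   ℤ.+ ((((e ℤ.+ e) ℤ.+ (e ℤ.+ e)) ℤ.- κ) ℤ.+ (((g ℤ.+ g) ℤ.+ (g ℤ.+ g)) ℤ.- κ)))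
                   ≡ + 4 ℤ.* ((c ℤ.+ (d ℤ.+ (e ℤ.+ (g ℤ.+ 0ℤ)))) ℤ.- κ)
              sum₄ = solve-∀
              rest : Z (+ 4 ℤ.* (q ℤ.- κ))
              rest = subst Z (sum₄ (f z₃) (f z₄) (f z₅) (f z₆) κ) (Z-+ (Z-+ v₃ v₄) (Z-+ v₅ v₆))
              lem : ∀ s r a b q κ x →
                (+ 4 ℤ.* (((s ℤ.+ r) ℤ.+ (a ℤ.+ b)) ℤ.- κ)
                 ℤ.- ((((a ℤ.+ a) ℤ.+ (a ℤ.+ a)) ℤ.- κ) ℤ.+ (((b ℤ.+ b) ℤ.+ (b ℤ.+ b)) ℤ.- κ))
                 ℤ.+ + 4 ℤ.* (q ℤ.- κ))
                 ℤ.- + 4 ℤ.* ((s ℤ.+ (r ℤ.+ q)) ℤ.- (κ ℤ.+ x))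
                ≡ ((x ℤ.+ x) ℤ.+ (x ℤ.+ x)) ℤ.- (κ ℤ.+ κ)
              lem = solve-∀

          dichotomy : 4· (proj₂ X) ≋ κ ⊎ 4· (proj₂ Y) ≋ κ
          dichotomy = found (nine-dichotomy quads size X∈ Y∈ X≢Y)
            where
            found : (4· (f s) ≋ κ ⊎ 4· (f r) ≋ κ) ⊎ Obstruction t f κ s r → 4· (proj₂ X) ≋ κ ⊎ 4· (proj₂ Y) ≋ κ
            found (inj₁ (inj₁ d)) = inj₁ (subst (λ z → 4· z ≋ κ) (value-∈ {E} es {X} (here refl)) d)
            found (inj₁ (inj₂ d)) = inj₂ (subst (λ z → 4· z ≋ κ) (value-∈ {E} es {Y} (there (here refl))) d)
            found (inj₂ ob)       = ⊥-elim (obstructed ob)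

        halves : ∀ {w w′} → 4· (proj₂ w) ≋ κ → 4· (proj₂ w′) ≋ κ → 4· (β (w , w′)) ≋ 2· κ
        halves {w} {w′} d d′ = mk≋ (subst Z (lem (proj₂ w) (proj₂ w′) κ) (Z-+ (un≋ d) (un≋ d′)))
          where
          lem : ∀ x y κ → (((x ℤ.+ x) ℤ.+ (x ℤ.+ x)) ℤ.- κ) ℤ.+ (((y ℤ.+ y) ℤ.+ (y ℤ.+ y)) ℤ.- κ)
                ≡ (((x ℤ.+ y) ℤ.+ (x ℤ.+ y)) ℤ.+ ((x ℤ.+ y) ℤ.+ (x ℤ.+ y))) ℤ.- (κ ℤ.+ κ)
          lem = solve-∀

      -- Among any item of `b` and any item of `c` one is normal, so one block has two normal items.
      -- Four times that block is `2κ = 2(b + c)`, which would make the blocks equal.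
      apart-case : ⊥
      apart-case = cases (dichotomy i₁ apart) (dichotomy i₂ (apart ∘ λ e → ≡-trans e (sym tc)))
                         (dichotomy i₃ (apart ∘ ≡-trans tb)) (dichotomy i₄ (apart ∘ λ e → ≡-trans tb (≡-trans e (sym tc))))
        where
        x = proj₁ b
        x′ = proj₂ b
        y = proj₁ c
        y′ = proj₂ c
        open Bag using (_⊕_; _⊜_)
        i₁ : (x ∷ y ∷ D) ⊑ R₁
        i₁ = x′ ∷ y′ ∷ [] , Bag.solve 5 (λ x x′ y y′ d → x ⊕ (x′ ⊕ (y ⊕ (y′ ⊕ d))) ⊜ (x ⊕ (y ⊕ d)) ⊕ (x′ ⊕ (y′ ⊕ Bag.id))) refl [ x ] [ x′ ] [ y ] [ y′ ] D
        i₂ : (x ∷ y′ ∷ D) ⊑ R₁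
        i₂ = x′ ∷ y ∷ [] , Bag.solve 5 (λ x x′ y y′ d → x ⊕ (x′ ⊕ (y ⊕ (y′ ⊕ d))) ⊜ (x ⊕ (y′ ⊕ d)) ⊕ (x′ ⊕ (y ⊕ Bag.id))) refl [ x ] [ x′ ] [ y ] [ y′ ] D
        i₃ : (x′ ∷ y ∷ D) ⊑ R₁
        i₃ = x ∷ y′ ∷ [] , Bag.solve 5 (λ x x′ y y′ d → x ⊕ (x′ ⊕ (y ⊕ (y′ ⊕ d))) ⊜ (x′ ⊕ (y ⊕ d)) ⊕ (x ⊕ (y′ ⊕ Bag.id))) refl [ x ] [ x′ ] [ y ] [ y′ ] D
        i₄ : (x′ ∷ y′ ∷ D) ⊑ R₁
        i₄ = x ∷ y ∷ [] , Bag.solve 5 (λ x x′ y y′ d → x ⊕ (x′ ⊕ (y ⊕ (y′ ⊕ d))) ⊜ (x′ ⊕ (y′ ⊕ d)) ⊕ (x ⊕ (y ⊕ Bag.id))) refl [ x ] [ x′ ] [ y ] [ y′ ] D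
        not-b : 4· (proj₂ x) ≋ κ → ¬ 4· (proj₂ x′) ≋ κ
        not-b d d′ = quarter-≢ b≢c ≋-refl (halves {x} {x′} d d′)
        not-c : 4· (proj₂ y) ≋ κ → ¬ 4· (proj₂ y′) ≋ κ
        not-c d d′ = quarter-≢ (b≢c ∘ ≋-sym) (≡⇒≋ (ℤ.+-comm (β b) (β c))) (halves {y} {y′} d d′)
        cases : 4· (proj₂ x) ≋ κ ⊎ 4· (proj₂ y) ≋ κ → 4· (proj₂ x) ≋ κ ⊎ 4· (proj₂ y′) ≋ κ →
                4· (proj₂ x′) ≋ κ ⊎ 4· (proj₂ y) ≋ κ → 4· (proj₂ x′) ≋ κ ⊎ 4· (proj₂ y′) ≋ κ → ⊥
        cases (inj₂ d) (inj₂ d′) _ _ = not-c d d′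
        cases _ _ (inj₂ d) (inj₂ d′) = not-c d d′
        cases (inj₁ d) _ (inj₁ d′) _ = not-b d d′
        cases (inj₁ d) _ _ (inj₁ d′) = not-b d d′
        cases _ (inj₁ d) (inj₁ d′) _ = not-b d d′
        cases _ (inj₁ d) _ (inj₁ d′) = not-b d d′

    rematch : ∀ {b c b₂ c₂ ms R} → Stage S ((b , c) ∷ (b₂ , c₂) ∷ ms) R → Unequal (b , c₂) → Unequal (b₂ , c) →
              Stage S ((b , c₂) ∷ (b₂ , c) ∷ ms) R
    rematch {b} {c} {b₂} {c₂} {ms} {R} st u u₂ =
      push (push (stage-R (Bag.solve 5 (λ b c x y r → (x ⊕ y) ⊕ ((b ⊕ c) ⊕ r) ⊜ (x ⊕ c) ⊕ ((b ⊕ y) ⊕ r)) refl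
        (flat [ b ]) (flat [ c ]) (flat [ b₂ ]) (flat [ c₂ ]) R) (pull (pull st)))
        (proj₁ (pull-twins (pull st))) (proj₂ (pull-twins st)) u₂)
        (proj₁ (pull-twins st)) (proj₂ (pull-twins (pull st))) u
      where open Bag using (_⊕_; _⊜_)

    private
      headclass : Blk → V 4
      headclass b = class (proj₁ b)

      blocks-classes : ∀ {v bs} → All Twin bs → All (λ b → headclass b ≡ v) bs → All (λ x → class x ≡ v) (flat bs)
      blocks-classes [] [] = []
      blocks-classes (t ∷ ts) (e ∷ es) = e ∷ ≡-trans (sym t) e ∷ blocks-classes ts es

      flat-All : ∀ {P : Blk → Set} {ms} → All (λ m → P (proj₁ m) × P (proj₂ m)) ms → All P (flat ms)
      flat-All []                = []
      flat-All ((p , q) ∷ ps) = p ∷ q ∷ flat-All ps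

    -- The aim is a couple joining two classes. If every couple stays within one class but two
    -- couples use different classes, they exchange partners; if all use the same class, it holds
    -- too many items.
    nine-case : ∀ {ms D} → Stage S ms D → 1 ℕ.+ length ms ≡ p → Separated D → length D ≡ 9 → ⊥
    nine-case {[]} st e ds nine = contradiction (subst Prime (sym e) prime) λ ()
    nine-case {_ ∷ []} st e ds nine = odd (subst (λ q → + q ℤ.∣ + 2) e ℤ.∣-refl)
    nine-case {ms@((b , c) ∷ (b₂ , c₂) ∷ ms₀)} {D} st e ds nine =
      first (Any.any? (λ m → ¬? (headclass (proj₁ m) ≟ᵛ headclass (proj₂ m))) ms)
      where
      first : Dec (Any (λ m → headclass (proj₁ m) ≢ headclass (proj₂ m)) ms) → ⊥
      first (yes some) with find some
      ... | (b′ , c′) , m∈ , apart with ∈⇒↭ m∈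
      ...   | [] , σ = contradiction (↭-length σ) λ ()
      ...   | _ ∷ ms′ , σ = apart-case (stage-↭ σ st) (≡-trans (cong suc (sym (↭-length σ))) e) ds nine apart
      first (no none) = second (Any.any? (λ m → ¬? (headclass (proj₁ m) ≟ᵛ headclass b)) ((b₂ , c₂) ∷ ms₀))
        where
        equal : All (λ m → headclass (proj₁ m) ≡ headclass (proj₂ m)) ms
        equal = All.map (λ {m} → decidable-stable (headclass (proj₁ m) ≟ᵛ headclass (proj₂ m))) (All.¬Any⇒All¬ ms none)
        second : Dec (Any (λ m → headclass (proj₁ m) ≢ headclass b) ((b₂ , c₂) ∷ ms₀)) → ⊥
        second (yes some) with find some
        ... | (b′ , c′) , m∈ , apart with ∈⇒↭ m∈
        ...   | ms′ , σ = third (block-value b ≋? block-value c′) (block-value b′ ≋? block-value c)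
          where
          st′ : Stage S ((b , c) ∷ (b′ , c′) ∷ ms′) D
          st′ = stage-↭ (prep (b , c) σ) st
          e′ : 3 ℕ.+ length ms′ ≡ p
          e′ = ≡-trans (cong (2 ℕ.+_) (sym (↭-length σ))) e
          b≢c : Unequal (b , c)
          b≢c = All.head (Stage.unlike st′)
          b′≢c′ : Unequal (b′ , c′)
          b′≢c′ = All.head (Stage.unlike (pull st′))
          c′-apart : headclass b ≢ headclass c′
          c′-apart h = apart (≡-trans (All.lookup equal (there m∈)) (sym h))
          third : Dec (block-value b ≋ block-value c′) → Dec (block-value b′ ≋ block-value c) → ⊥
          third (no n) (no n′)  = apart-case (rematch st′ n n′) e′ ds nine c′-apart
          -- When a crossed pair of blocks has equal values, the other way of crossing the two
          -- couples produces unequal ones.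
          third (yes d) _       = apart-case (rematch (stage-↭ (swap _ _ refl) (flip-pair (stage-↭ (swap _ _ refl) st′)))
            (λ h → b′≢c′ (≋-trans (≋-sym h) d)) (λ h → b≢c (≋-trans d h))) e′ ds nine (apart ∘ sym)
          third _ (yes d)       = apart-case (rematch (stage-↭ (swap _ _ refl) (flip-pair (stage-↭ (swap _ _ refl) st′)))
            (λ h → b≢c (≋-trans h d)) (λ h → b′≢c′ (≋-trans d (≋-sym h)))) e′ ds nine (apart ∘ sym)
        second (no none₂) = concentrated (⊑-trans (⊑-++ʳ (flat (flat ms)) D) (↭⇒⊑ (Stage.layout st)))
            (blocks-classes (Stage.twins st) (flat-All (All.zipWith (λ (p , q) → p , ≡-trans (sym q) p) (same-first , equal)))) long
          where
          same-first : All (λ m → headclass (proj₁ m) ≡ headclass b) ms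
          same-first = refl ∷ All.map (λ {m} → decidable-stable (headclass (proj₁ m) ≟ᵛ headclass b)) (All.¬Any⇒All¬ _ none₂)
          -- The p - 1 couples hold 4p - 4 items, and 4p - 3 is at least 3p because p is at least 3.
          long : 3 ℕ.* p ℕ.≤ suc (length (flat (flat ms)))
          long = subst₂ ℕ._≤_ (cong (3 ℕ.*_) e) (cong suc (sym (≡-trans (length-flat (flat ms)) (cong (2 ℕ.*_) (length-flat ms)))))
            (subst (3 ℕ.* (3 ℕ.+ length ms₀) ℕ.≤_) (lem (length ms₀)) (ℕ.m≤m+n _ (length ms₀)))
            where
            lem : ∀ n → 3 ℕ.* (3 ℕ.+ n) ℕ.+ n ≡ suc (2 ℕ.* (2 ℕ.* (2 ℕ.+ n)))
            lem = ℕ-Solver.solve-∀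

-- Thirteen and fifteen leftover classes

-- `offaxis` consists of the three planes parallel to, and different from, the plane whose first two
-- bits vanish.
full nonzero offaxis : Sub 4
full    = tabulate (λ _ → true)
nonzero = tabulate (λ c → not (same c 0ᵛ))
offaxis = tabulate λ { (a ∷ b ∷ _) → a ∨ b }

∈-full : ∀ v → v ∈ˢ full
∈-full v = look-tabulate (λ _ → true) v

∈-nonzero : ∀ v → v ≢ 0ᵛ → v ∈ˢ nonzero
∈-nonzero v ne = ≡-trans (look-tabulate (λ c → not (same c 0ᵛ)) v) (by (same v 0ᵛ) refl)
  where
  by : ∀ b → same v 0ᵛ ≡ b → not b ≡ true
  by true  e = contradiction (same-sound v 0ᵛ e) ne
  by false e = refl

-- Affine coordinates that place the standard region inside `t`. Since `A` is affine, an even number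
-- of points with sum 0 keeps the sum 0, so closed configurations need to be found in the standard
-- region only.
record Frame (reg t : Sub 4) : Set where
  field
    A        : V 4 → V 4
    A-inj    : ∀ {u v} → A u ≡ A v → u ≡ v
    A-affine : ∀ u v → A (u ⊕ᵛ v) ≡ A u ⊕ᵛ A v ⊕ᵛ A 0ᵛ
    A-in     : ∀ c → c ∈ˢ reg → A c ∈ˢ t

frame-flip : ∀ {reg t} o → Frame reg (flip o t) → Frame reg t
frame-flip {t = t} o fr = record
  { A = λ c → A c ⊕ᵛ o
  ; A-inj = A-inj ∘ ⊕ᵛ-injectiveʳ o
  ; A-affine = λ u v → ≡-trans (cong (_⊕ᵛ o) (A-affine u v))
      (≡-trans (sym (≡-trans (cong ((A u ⊕ᵛ A v ⊕ᵛ A 0ᵛ) ⊕ᵛ o ⊕ᵛ_) (⊕ᵛ-self o)) (⊕ᵛ-identityʳ _)))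
        (Xor.solve 4 4 (λ a b c o → (((a ⊕ b) ⊕ c) ⊕ o) ⊕ (o ⊕ o) ⊜ ((a ⊕ o) ⊕ (b ⊕ o)) ⊕ (c ⊕ o)) refl (A u) (A v) (A 0ᵛ) o))
  ; A-in = λ c c∈ → ≡-trans (sym (look-flip o t (A c))) (A-in c c∈) }
  where
  open Frame fr
  open Xor 4 using (_⊕_; _⊜_)

private
  scale : Bool → V 4 → V 4
  scale true  b = b
  scale false b = 0ᵛ

  scale-xor : ∀ x y b → scale (x xor y) b ≡ scale x b ⊕ᵛ scale y b
  scale-xor true  true  b = sym (⊕ᵛ-self b)
  scale-xor true  false b = sym (⊕ᵛ-identityʳ b)
  scale-xor false y     b = sym (⊕ᵛ-identityˡ _)

  lin : ∀ {n} → Vec (V 4) n → V n → V 4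
  lin []       []      = 0ᵛ
  lin (b ∷ bs) (x ∷ c) = scale x b ⊕ᵛ lin bs c

  lin-⊕ : ∀ {n} (bs : Vec (V 4) n) u v → lin bs (u ⊕ᵛ v) ≡ lin bs u ⊕ᵛ lin bs v
  lin-⊕ []       []      []      = refl
  lin-⊕ (b ∷ bs) (x ∷ u) (y ∷ v) = ≡-trans (cong₂ _⊕ᵛ_ (scale-xor x y b) (lin-⊕ bs u v))
    (Xor.solve 4 4 (λ a b c d → (a ⊕ b) ⊕ (c ⊕ d) ⊜ (a ⊕ c) ⊕ (b ⊕ d)) refl (scale x b) (scale y b) (lin bs u) (lin bs v))
    where open Xor 4 using (_⊕_; _⊜_)

  lin-0 : ∀ {n} (bs : Vec (V 4) n) → lin bs 0ᵛ ≡ 0ᵛ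
  lin-0 []       = refl
  lin-0 (b ∷ bs) = ≡-trans (⊕ᵛ-identityˡ _) (lin-0 bs)

  frame? : ∀ reg t → V 4 → Vec (V 4) 4 → Maybe (Frame reg t)
  frame? reg t o bs =
    forAll nonzero (λ c _ → unequal? (lin bs c) 0ᵛ) >>= λ independent →
    forAll reg (λ c _ → in? t (o ⊕ᵛ lin bs c)) >>= λ inside →
    just record
      { A = λ c → o ⊕ᵛ lin bs c
      ; A-inj = λ {u} {v} e → inj independent u v (≡-trans (sym (⊕ᵛ-cancel o (lin bs u))) (≡-trans (cong (o ⊕ᵛ_) e) (⊕ᵛ-cancel o (lin bs v))))
      ; A-affine = λ u v → ≡-trans (cong (o ⊕ᵛ_) (lin-⊕ bs u v)) (≡-trans
          (sym (≡-trans (cong (o ⊕ᵛ (lin bs u ⊕ᵛ lin bs v) ⊕ᵛ_) (⊕ᵛ-self o)) (⊕ᵛ-identityʳ _)))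
          (≡-trans (Xor.solve 4 3 (λ o a b → (o ⊕ (a ⊕ b)) ⊕ (o ⊕ o) ⊜ ((o ⊕ a) ⊕ (o ⊕ b)) ⊕ (o ⊕ Xor.id)) refl o (lin bs u) (lin bs v))
            (cong (λ z → (o ⊕ᵛ lin bs u) ⊕ᵛ (o ⊕ᵛ lin bs v) ⊕ᵛ (o ⊕ᵛ z)) (sym (lin-0 bs)))))
      ; A-in = inside }
    where
    open Xor 4 using (_⊕_; _⊜_)
    inj : (∀ c → c ∈ˢ nonzero → lin bs c ≢ 0ᵛ) → ∀ u v → lin bs u ≡ lin bs v → u ≡ v
    inj independent u v e with (u ⊕ᵛ v) ≟ᵛ 0ᵛ
    ... | yes z = ⊕ᵛ≡0 z
    ... | no ne = contradiction (≡-trans (lin-⊕ bs u v) (≡-trans (cong (_⊕ᵛ lin bs v) e) (⊕ᵛ-self _))) (independent _ (∈-nonzero _ ne))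

  out? : ∀ (t : Sub 4) v → Maybe (look t v ≡ false)
  out? t v with look t v
  ... | true  = nothing
  ... | false = just refl

  -- The translates of the plane of three missing points that avoid them are full.
  frame₁₃? : ∀ t → Maybe (Frame offaxis t)
  frame₁₃? t =
    search full (λ c _ → out? t c) >>= λ (c₁ , _ , _) →
    search full (λ c _ → out? t c >>= λ _ → unequal? c c₁) >>= λ (c₂ , _ , _) →
    search full (λ c _ → out? t c >>= λ _ → unequal? c c₁ >>= λ _ → unequal? c c₂) >>= λ (c₃ , _ , _) →
    search full (λ e _ → search full (λ e′ _ → frame? offaxis t c₁ (e ∷ e′ ∷ c₁ ⊕ᵛ c₂ ∷ c₁ ⊕ᵛ c₃ ∷ [])))
      >>= λ (_ , _ , _ , _ , fr) → just fr

  -- The missing point becomes the origin. Surjectivity onto `t` is recorded as well, since a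
  -- conclusion about all nonzero points has to be returned to every item of the remainder.
  Covering : Sub 4 → Set
  Covering t = Σ (Frame nonzero t) λ fr → ∀ v → v ∈ˢ t → ∃[ c ] c ∈ˢ nonzero × Frame.A fr c ≡ v

  frame₁₅? : ∀ t → Maybe (Covering t)
  frame₁₅? t =
    search full (λ c _ → out? t c) >>= λ (o , _ , _) →
    frame? nonzero t o ((true ∷ false ∷ false ∷ false ∷ []) ∷ (false ∷ true ∷ false ∷ false ∷ []) ∷
                        (false ∷ false ∷ true ∷ false ∷ []) ∷ (false ∷ false ∷ false ∷ true ∷ []) ∷ []) >>= λ fr →
    forAll t (λ v _ → in? nonzero (v ⊕ᵛ o) >>= λ c∈ → equal? (Frame.A fr (v ⊕ᵛ o)) v >>= λ e → just (v ⊕ᵛ o , c∈ , e)) >>= λ cover →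
    just (fr , cover)
    where
    equal? : ∀ (u v : V 4) → Maybe (u ≡ v)
    equal? u v = by (same u v) refl
      where
      by : ∀ b → same u v ≡ b → Maybe (u ≡ v)
      by true  e = just (same-sound u v e)
      by false e = nothing

-- Sums of a prescribed number of distinct points

record Summing (t : Sub 4) (k : ℕ) (v : V 4) : Set where
  constructor summing
  field
    points   : List (V 4)
    unique   : Unique points
    inside   : All (_∈ˢ t) points
    size     : length points ≡ k
    sum      : xsum points ≡ v

private
  -- The k-fold sum of `o`, which is `o` or 0 according to the parity of k.
  odd-shift : ℕ → V 4 → V 4
  odd-shift zero    o = 0ᵛ
  odd-shift (suc k) o = o ⊕ᵛ odd-shift k o

  xsum-shift : ∀ o vs → xsum (map (_⊕ᵛ o) vs) ≡ xsum vs ⊕ᵛ odd-shift (length vs) o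
  xsum-shift o []       = refl
  xsum-shift o (v ∷ vs) = ≡-trans (cong (v ⊕ᵛ o ⊕ᵛ_) (xsum-shift o vs))
    (Xor.solve 4 4 (λ v o x y → (v ⊕ o) ⊕ (x ⊕ y) ⊜ (v ⊕ x) ⊕ (o ⊕ y)) refl v o (xsum vs) (odd-shift (length vs) o))
    where open Xor 4 using (_⊕_; _⊜_)

  summing-flip : ∀ {t k v} o → Summing (flip o t) k (v ⊕ᵛ odd-shift k o) → Summing t k v
  summing-flip {t} {k} {v} o (summing ps u i refl s) = summing (map (_⊕ᵛ o) ps)
    (AllPairs.map⁺ (AllPairs.map (λ ne e → ne (⊕ᵛ-injectiveʳ o e)) u))
    (All.map⁺ (All.map (λ {w} w∈ → ≡-trans (sym (look-flip o t w)) w∈) i))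
    (length-map _ ps)
    (≡-trans (xsum-shift o ps) (≡-trans (cong (_⊕ᵛ odd-shift (length ps) o) s) (⊕ᵛ-cancelʳ v (odd-shift (length ps) o))))

  -- Only the first `k` further points are searched for; the last one is dictated by the prescribed
  -- sum.
  extend? : ∀ t k {k₀} v {us} → Unique us → All (_∈ˢ t) us → length us ≡ k₀ → Maybe (Summing t (suc (k ℕ.+ k₀)) v)
  extend? t zero {k₀} v {us} u i refl =
    in? t w >>= λ w∈ → fresh w us >>= λ n →
    just (summing (w ∷ us) (n ∷ u) (w∈ ∷ i) refl (⊕ᵛ-cancelʳ v (xsum us)))
    where
    w = v ⊕ᵛ xsum us
    fresh : ∀ w us → Maybe (All (w ≢_) us)
    fresh w []       = just []
    fresh w (x ∷ us) = unequal? w x >>= λ n → fresh w us >>= λ ns → just (n ∷ ns)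
  extend? t (suc k) {k₀} v {us} u i e =
    search t (λ w w∈ → fresh w us >>= λ n → extend? t k v (n ∷ u) (w∈ ∷ i) (cong suc e)) >>= λ (_ , _ , s) →
    just (subst (λ n → Summing t n v) (cong suc (ℕ.+-suc k k₀)) s)
    where
    fresh : ∀ w us → Maybe (All (w ≢_) us)
    fresh w []       = just []
    fresh w (x ∷ us) = unequal? w x >>= λ n → fresh w us >>= λ ns → just (n ∷ ns)

  summing? : ∀ t k v → Maybe (Summing t (suc k) v)
  summing? t k v = extend? t k v [] [] refl >>= λ s → just (subst (λ n → Summing t (suc n) v) (ℕ.+-identityʳ k) s)

  all-sums? : ∀ k t → Maybe (∀ v → v ∈ˢ full → Summing t (suc k) v)
  all-sums? k t = forAll full (λ v _ → summing? t k v)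

private
  abstract
    -- Even sizes serve closed subsets of the remainder, odd sizes those subsets that one extra item
    -- closes. The same holds for fifteen points.
    sums₁₃³ : ∀ t → count t ≡ 13 → balanced t ≡ true → ∀ v → v ∈ˢ full → Summing t 3 v
    sums₁₃³ = byEnumeration balanced (all-sums? 2) refl
    sums₁₃⁴ : ∀ t → count t ≡ 13 → balanced t ≡ true → ∀ v → v ∈ˢ full → Summing t 4 v
    sums₁₃⁴ = byEnumeration balanced (all-sums? 3) refl
    sums₁₃⁵ : ∀ t → count t ≡ 13 → balanced t ≡ true → ∀ v → v ∈ˢ full → Summing t 5 v
    sums₁₃⁵ = byEnumeration balanced (all-sums? 4) refl
    sums₁₃⁶ : ∀ t → count t ≡ 13 → balanced t ≡ true → ∀ v → v ∈ˢ full → Summing t 6 v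
    sums₁₃⁶ = byEnumeration balanced (all-sums? 5) refl
    sums₁₅³ : ∀ t → count t ≡ 15 → balanced t ≡ true → ∀ v → v ∈ˢ full → Summing t 3 v
    sums₁₅³ = byEnumeration balanced (all-sums? 2) refl
    sums₁₅⁴ : ∀ t → count t ≡ 15 → balanced t ≡ true → ∀ v → v ∈ˢ full → Summing t 4 v
    sums₁₅⁴ = byEnumeration balanced (all-sums? 3) refl
    sums₁₅⁵ : ∀ t → count t ≡ 15 → balanced t ≡ true → ∀ v → v ∈ˢ full → Summing t 5 v
    sums₁₅⁵ = byEnumeration balanced (all-sums? 4) refl
    sums₁₅⁶ : ∀ t → count t ≡ 15 → balanced t ≡ true → ∀ v → v ∈ˢ full → Summing t 6 v
    sums₁₅⁶ = byEnumeration balanced (all-sums? 5) refl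
    sums₁₅⁷ : ∀ t → count t ≡ 15 → balanced t ≡ true → ∀ v → v ∈ˢ full → Summing t 7 v
    sums₁₅⁷ = byEnumeration balanced (all-sums? 6) refl
    sums₁₅⁸ : ∀ t → count t ≡ 15 → balanced t ≡ true → ∀ v → v ∈ˢ full → Summing t 8 v
    sums₁₅⁸ = byEnumeration balanced (all-sums? 7) refl

    frame₁₃ : ∀ t → count t ≡ 13 → balanced t ≡ true → Frame offaxis t
    frame₁₃ = byEnumeration balanced frame₁₃? refl

    frame₁₅ : ∀ t → count t ≡ 15 → true ≡ true → Covering t
    frame₁₅ = byEnumeration (λ _ → true) frame₁₅? refl

  translate : ∀ {n k} → (∀ t → count t ≡ n → balanced t ≡ true → ∀ v → v ∈ˢ full → Summing t k v) →
              ∀ t → count t ≡ n → ∀ v → Summing t k v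
  translate {n} {k} sums t c v = summing-flip o (sums (flip o t) (≡-trans (count-flip o t) c) (balanced-flip t) _ (∈-full (v ⊕ᵛ odd-shift k o)))
    where o = balance t

abstract
  three₁₃ : ∀ t → count t ≡ 13 → ∀ v → Summing t 3 v
  three₁₃ = translate sums₁₃³
  four₁₃ : ∀ t → count t ≡ 13 → ∀ v → Summing t 4 v
  four₁₃ = translate sums₁₃⁴
  five₁₃ : ∀ t → count t ≡ 13 → ∀ v → Summing t 5 v
  five₁₃ = translate sums₁₃⁵
  six₁₃ : ∀ t → count t ≡ 13 → ∀ v → Summing t 6 v
  six₁₃ = translate sums₁₃⁶
  three₁₅ : ∀ t → count t ≡ 15 → ∀ v → Summing t 3 v
  three₁₅ = translate sums₁₅³
  four₁₅ : ∀ t → count t ≡ 15 → ∀ v → Summing t 4 v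
  four₁₅ = translate sums₁₅⁴
  five₁₅ : ∀ t → count t ≡ 15 → ∀ v → Summing t 5 v
  five₁₅ = translate sums₁₅⁵
  six₁₅ : ∀ t → count t ≡ 15 → ∀ v → Summing t 6 v
  six₁₅ = translate sums₁₅⁶
  seven₁₅ : ∀ t → count t ≡ 15 → ∀ v → Summing t 7 v
  seven₁₅ = translate sums₁₅⁷
  eight₁₅ : ∀ t → count t ≡ 15 → ∀ v → Summing t 8 v
  eight₁₅ = translate sums₁₅⁸

  thirteen-frame : ∀ t → count t ≡ 13 → Frame offaxis t
  thirteen-frame t c = frame-flip (balance t) (frame₁₃ _ (≡-trans (count-flip (balance t) t) c) (balanced-flip t))

  fifteen-frame : ∀ t → count t ≡ 15 → Σ (Frame nonzero t) λ fr → ∀ v → v ∈ˢ t → ∃[ c ] c ∈ˢ nonzero × Frame.A fr c ≡ v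
  fifteen-frame t c = frame₁₅ t c refl

-- V 4 is fibred by its first two coordinates: the three planes over nonzero
-- points and the punctured plane over 0 are cut into pairs of points differing by a direction.

data Plane : Set where
  Π₁ Π₂ Π₃ : Plane

data Dir : Set where
  d₁ d₂ d₃ : Dir

data Pair : Set where
  main : Plane → Dir → Bool → Pair
  top  : Dir → Pair

second third : Dir → Dir
second d₁ = d₂
second d₂ = d₃
second d₃ = d₁
third d₁ = d₃
third d₂ = d₁
third d₃ = d₂

left right : Plane → Plane
left Π₁ = Π₂
left Π₂ = Π₁
left Π₃ = Π₁
right Π₁ = Π₃
right Π₂ = Π₃
right Π₃ = Π₂

private
  at : Plane → Bool → Bool → V 4
  at Π₁ x y = false ∷ true ∷ x ∷ y ∷ []
  at Π₂ x y = true ∷ false ∷ x ∷ y ∷ []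
  at Π₃ x y = true ∷ true ∷ x ∷ y ∷ []

  base : Bool → Bool → V 4
  base x y = false ∷ false ∷ x ∷ y ∷ []

  half : (Bool → Bool → V 4) → Dir → Bool → V 4 × V 4
  half v d₁ false = v false false , v false true
  half v d₁ true  = v true false , v true true
  half v d₂ false = v false false , v true false
  half v d₂ true  = v false true , v true true
  half v d₃ false = v false false , v true true
  half v d₃ true  = v false true , v true false

ends : Pair → V 4 × V 4
ends (main i l h) = half (at i) l h
ends (top l)      = half base l true

T-∧ : ∀ {a b} → Bool.T (a ∧ b) → Bool.T a × Bool.T b
T-∧ {true} t = _ , t

private
  isFresh : V 4 → List (V 4) → Bool
  isFresh v []       = true
  isFresh v (u ∷ us) = not (same v u) ∧ isFresh v us

  allFresh : List (V 4) → Bool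
  allFresh []       = true
  allFresh (v ∷ vs) = isFresh v vs ∧ allFresh vs

  allIn : Sub 4 → List (V 4) → Bool
  allIn t []       = true
  allIn t (v ∷ vs) = look t v ∧ allIn t vs

  T⇒≡ : ∀ {b} → Bool.T b → b ≡ true
  T⇒≡ {true} _ = refl

  fresh-sound : ∀ v us → Bool.T (isFresh v us) → All (v ≢_) us
  fresh-sound v []       _ = []
  fresh-sound v (u ∷ us) t = (λ { refl → absurd (proj₁ (T-∧ {not (same v u)} t)) }) ∷ fresh-sound v us (proj₂ (T-∧ {not (same v u)} t))
    where
    absurd : Bool.T (not (same v v)) → ⊥
    absurd rewrite same-refl v = λ ()

  allFresh-sound : ∀ vs → Bool.T (allFresh vs) → Unique vs
  allFresh-sound []       _ = []
  allFresh-sound (v ∷ vs) t = fresh-sound v vs (proj₁ (T-∧ {isFresh v vs} t)) ∷ allFresh-sound vs (proj₂ (T-∧ {isFresh v vs} t))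

  allIn-sound : ∀ t vs → Bool.T (allIn t vs) → All (_∈ˢ t) vs
  allIn-sound t []       _ = []
  allIn-sound t (v ∷ vs) p = T⇒≡ (proj₁ (T-∧ {look t v} p)) ∷ allIn-sound t vs (proj₂ (T-∧ {look t v} p))

corners : List Pair → List (V 4)
corners ps = flat (map ends ps)

-- Evaluated once in standard coordinates, which is why later arguments of this kind are just `tt`;
-- `pairs-opt` carries the configuration over to the actual remainder.
valid : Sub 4 → List Pair → Bool
valid reg ps = allFresh (corners ps) ∧ allIn reg (corners ps) ∧ same (xsum (corners ps)) 0ᵛ

allPlanes : (Plane → Bool) → Bool
allPlanes f = f Π₁ ∧ f Π₂ ∧ f Π₃

allDirs : (Dir → Bool) → Bool
allDirs f = f d₁ ∧ f d₂ ∧ f d₃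

allHalves : (Bool → Bool) → Bool
allHalves f = f false ∧ f true

allPlanes-sound : ∀ f → Bool.T (allPlanes f) → ∀ i → Bool.T (f i)
allPlanes-sound f t Π₁ = proj₁ (T-∧ {f Π₁} t)
allPlanes-sound f t Π₂ = proj₁ (T-∧ {f Π₂} (proj₂ (T-∧ {f Π₁} t)))
allPlanes-sound f t Π₃ = proj₂ (T-∧ {f Π₂} (proj₂ (T-∧ {f Π₁} t)))

allDirs-sound : ∀ f → Bool.T (allDirs f) → ∀ l → Bool.T (f l)
allDirs-sound f t d₁ = proj₁ (T-∧ {f d₁} t)
allDirs-sound f t d₂ = proj₁ (T-∧ {f d₂} (proj₂ (T-∧ {f d₁} t)))
allDirs-sound f t d₃ = proj₂ (T-∧ {f d₂} (proj₂ (T-∧ {f d₁} t)))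

allHalves-sound : ∀ f → Bool.T (allHalves f) → ∀ h → Bool.T (f h)
allHalves-sound f t false = proj₁ (T-∧ {f false} t)
allHalves-sound f t true  = proj₂ (T-∧ {f false} t)

module PlaneOptions (D : List Item) {reg} (fr : Frame reg (support D)) where

  open Frame fr

  point : V 4 → ℤ
  point c = value D (A c)

  P : Pair → ℤ
  P q = point (proj₁ (ends q)) ℤ.+ point (proj₂ (ends q))

  private
    xsum-A : ∀ ps → xsum (map A (corners ps)) ≡ A (xsum (corners ps)) ⊕ᵛ A 0ᵛ
    xsum-A []       = sym (⊕ᵛ-self (A 0ᵛ))
    xsum-A (q ∷ ps) = ≡-trans (cong (λ s → A u ⊕ᵛ (A v ⊕ᵛ s)) (xsum-A ps))
      (sym (≡-trans (cong (_⊕ᵛ A 0ᵛ) (≡-trans (A-affine u _) (cong (λ z → A u ⊕ᵛ z ⊕ᵛ A 0ᵛ) (A-affine v _))))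
        (≡-trans (Xor.solve 4 4 (λ a b c o → ((a ⊕ ((b ⊕ c) ⊕ o)) ⊕ o) ⊕ o ⊜ (a ⊕ (b ⊕ (c ⊕ o))) ⊕ (o ⊕ o)) refl (A u) (A v) (A (xsum (corners ps))) (A 0ᵛ))
          (≡-trans (cong ((A u ⊕ᵛ (A v ⊕ᵛ (A (xsum (corners ps)) ⊕ᵛ A 0ᵛ))) ⊕ᵛ_) (⊕ᵛ-self (A 0ᵛ))) (⊕ᵛ-identityʳ _)))))
      where
      u = proj₁ (ends q)
      v = proj₂ (ends q)
      open Xor 4 using (_⊕_; _⊜_)

    sum-A : ∀ ps → sum-by (value D) (map A (corners ps)) ≡ sum-by P ps
    sum-A []       = refl
    sum-A (q ∷ ps) = ≡-trans (cong (λ s → point (proj₁ (ends q)) ℤ.+ (point (proj₂ (ends q)) ℤ.+ s)) (sum-A ps))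
      (sym (ℤ.+-assoc (point (proj₁ (ends q))) _ _))

  pairs-opt : ∀ ps → Bool.T (valid reg ps) → Opt D (length ps) (sum-by P ps)
  pairs-opt ps t = opt-≡ (sum-A ps) (opt-members D
    (AllPairs.map⁺ (AllPairs.map (λ ne e → ne (A-inj e)) (allFresh-sound (corners ps) (proj₁ t₁))))
    (All.map⁺ (All.map (λ {c} → A-in c) (allIn-sound reg (corners ps) (proj₁ t₂))))
    (≡-trans (length-map A (corners ps)) (≡-trans (length-flat (map ends ps)) (cong (2 ℕ.*_) (length-map ends ps))))
    (≡-trans (xsum-A ps) (≡-trans (cong (λ z → A z ⊕ᵛ A 0ᵛ) (same-sound _ 0ᵛ (T⇒≡ (proj₂ t₂)))) (⊕ᵛ-self (A 0ᵛ)))))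
    where
    t₁ = T-∧ {allFresh (corners ps)} t
    t₂ = T-∧ {allIn reg (corners ps)} (proj₂ t₁)

  -- Every direction partitions the same four points. This invariance is what allows the three
  -- directions to be compared.
  plane-sum : ∀ i l → P (main i l false) ℤ.+ P (main i l true) ≡ P (main i d₁ false) ℤ.+ P (main i d₁ true)
  plane-sum i d₁ = refl
  plane-sum i d₂ = lem (point (at i false false)) (point (at i false true)) (point (at i true false)) (point (at i true true))
    where
    lem : ∀ a b c d → (a ℤ.+ c) ℤ.+ (b ℤ.+ d) ≡ (a ℤ.+ b) ℤ.+ (c ℤ.+ d)
    lem = solve-∀
  plane-sum i d₃ = lem (point (at i false false)) (point (at i false true)) (point (at i true false)) (point (at i true true))
    where
    lem : ∀ a b c d → (a ℤ.+ d) ℤ.+ (b ℤ.+ c) ≡ (a ℤ.+ b) ℤ.+ (c ℤ.+ d)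
    lem = solve-∀

  -- The sums of all pairs among three points determine the double of each point, so statements
  -- about pairs become statements about points.
  Triangle : V 4 → Set
  Triangle u = ∃[ v ] ∃[ w ] ∃[ q ] ∃[ r ] ∃[ s ]
    (P q ≡ point u ℤ.+ point v) × (P r ≡ point u ℤ.+ point w) × (P s ≡ point v ℤ.+ point w)

  private
    in-plane : ∀ i x y → Triangle (at i x y)
    in-plane i false false = at i false true , at i true false , main i d₁ false , main i d₂ false , main i d₃ true , refl , refl , refl
    in-plane i false true  = at i false false , at i true false , main i d₁ false , main i d₃ true , main i d₂ false
      , ℤ.+-comm (point (at i false false)) _ , refl , refl
    in-plane i true  false = at i false false , at i false true , main i d₂ false , main i d₃ true , main i d₁ false
      , ℤ.+-comm (point (at i false false)) _ , ℤ.+-comm (point (at i false true)) _ , refl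
    in-plane i true  true  = at i false false , at i false true , main i d₃ false , main i d₂ true , main i d₁ false
      , ℤ.+-comm (point (at i false false)) _ , ℤ.+-comm (point (at i false true)) _ , refl

  triangles : ∀ u → u ≢ 0ᵛ → Triangle u
  triangles (false ∷ false ∷ false ∷ false ∷ []) ne = contradiction refl ne
  triangles (false ∷ false ∷ false ∷ true  ∷ []) _ = base true false , base true true , top d₃ , top d₂ , top d₁ , refl , refl , refl
  triangles (false ∷ false ∷ true  ∷ false ∷ []) _ = base false true , base true true , top d₃ , top d₁ , top d₂ , ℤ.+-comm (point (base false true)) _ , refl , refl
  triangles (false ∷ false ∷ true  ∷ true  ∷ []) _ = base false true , base true false , top d₂ , top d₁ , top d₃
    , ℤ.+-comm (point (base false true)) _ , ℤ.+-comm (point (base true false)) _ , refl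
  triangles (false ∷ true  ∷ x ∷ y ∷ []) _ = in-plane Π₁ x y
  triangles (true  ∷ false ∷ x ∷ y ∷ []) _ = in-plane Π₂ x y
  triangles (true  ∷ true  ∷ x ∷ y ∷ []) _ = in-plane Π₃ x y

Ix : Set
Ix = Plane × Bool

pr : Dir → Ix → Pair
pr l (i , h) = main i l h

private
  -- The six arguments will be the six pairs of one direction in some order. Either of `a`, `b`
  -- joined with either of `c`, `d` is closed, and remains closed when `e` and `f` are added.
  goodSix : Ix → Ix → Ix → Ix → Ix → Ix → Dir → Bool
  goodSix a b c d e f l = two a c ∧ two a d ∧ two b c ∧ two b d ∧ four a c ∧ four a d ∧ four b c ∧ four b d
    where
    two four : Ix → Ix → Bool
    two x y  = valid offaxis (pr l x ∷ pr l y ∷ [])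
    four x y = valid offaxis (pr l x ∷ pr l y ∷ pr l e ∷ pr l f ∷ [])

other : (a b : Plane) → ∃[ i ] i ≢ a × i ≢ b
other Π₁ Π₁ = Π₂ , (λ ()) , (λ ())
other Π₁ Π₂ = Π₃ , (λ ()) , (λ ())
other Π₁ Π₃ = Π₂ , (λ ()) , (λ ())
other Π₂ Π₁ = Π₃ , (λ ()) , (λ ())
other Π₂ Π₂ = Π₁ , (λ ()) , (λ ())
other Π₂ Π₃ = Π₁ , (λ ()) , (λ ())
other Π₃ Π₁ = Π₂ , (λ ()) , (λ ())
other Π₃ Π₂ = Π₁ , (λ ()) , (λ ())
other Π₃ Π₃ = Π₁ , (λ ()) , (λ ())

_≟ᴾ_ : (i j : Plane) → Dec (i ≡ j)
Π₁ ≟ᴾ Π₁ = yes refl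
Π₁ ≟ᴾ Π₂ = no λ ()
Π₁ ≟ᴾ Π₃ = no λ ()
Π₂ ≟ᴾ Π₁ = no λ ()
Π₂ ≟ᴾ Π₂ = yes refl
Π₂ ≟ᴾ Π₃ = no λ ()
Π₃ ≟ᴾ Π₁ = no λ ()
Π₃ ≟ᴾ Π₂ = no λ ()
Π₃ ≟ᴾ Π₃ = yes refl

left≢ : ∀ k → left k ≢ k
left≢ Π₁ ()
left≢ Π₂ ()
left≢ Π₃ ()

right≢ : ∀ k → right k ≢ k
right≢ Π₁ ()
right≢ Π₂ ()
right≢ Π₃ ()

-- Pair sums that take few values

module PairValues (p : ℕ) (prime : Prime p) (odd : ¬ + p ℤ.∣ + 2) where

  open ModPrime p prime
  open OddPrime p prime odd using (halve)

  2<p : 2 ℕ.< p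
  2<p = ℕ.≤∧≢⇒< (ℕ.nonTrivial⇒n>1 p {{Primality.prime⇒nonTrivial prime}})
    λ { refl → odd ℤ.∣-refl }

  -- For disjoint pairs of pairs in one direction: otherwise the four sums across take three values.
  OneOf : ℤ → ℤ → ℤ → ℤ → Set
  OneOf a b c d = a ≋ b ⊎ c ≋ d

  module _ {O : ℤ → Set} (resp : ∀ {u v} → u ≋ v → O v → O u) where

    private
      pick : Bool → ℤ → ℤ → ℤ
      pick false a b = a
      pick true  a b = b

    -- Two Cauchy-Davenport steps from 0: the sumset of two two-element sets has at least three
    -- elements, as p exceeds 2.
    sums₃ : ∀ {a b c d} → ¬ a ≋ b → ¬ c ≋ d → O (a ℤ.+ c) → O (a ℤ.+ d) → O (b ℤ.+ c) → O (b ℤ.+ d) →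
            ∃[ vs ] Distinct vs × All O vs × length vs ≡ 3
    sums₃ {a} {b} {c} {d} a≢b c≢d ac ad bc bd =
      let (ws , dw , aw , lw) = grow P₂ P₁ a b a≢b (λ f → f false) (λ f → f true) {0ℤ ∷ []} ([] ∷ []) (start ∷ []) (s≤s z≤n) (ℕ.<-trans (s≤s (s≤s z≤n)) 2<p)
          (vs , dv , av , lv) = grow P₁ O c d c≢d (λ f → f false) (λ f → f true) dw aw
            (subst (1 ℕ.≤_) (sym lw) (s≤s z≤n)) (subst (ℕ._< p) (sym lw) 2<p)
      in vs , dv , av , ≡-trans lv (cong suc lw)
      where
      P₁ P₂ : ℤ → Set
      P₁ v = ∀ j → O (v ℤ.+ pick j c d)
      P₂ v = ∀ i → P₁ (v ℤ.+ pick i a b)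
      zero-left : ∀ x y → O (x ℤ.+ y) → O ((0ℤ ℤ.+ x) ℤ.+ y)
      zero-left x y = subst O (cong (λ z → z ℤ.+ y) (sym (ℤ.+-identityˡ x)))
      start : P₂ 0ℤ
      start false false = zero-left a c ac
      start false true  = zero-left a d ad
      start true  false = zero-left b c bc
      start true  true  = zero-left b d bd

    widen : ∀ {Q : ℤ → Set} {z} → ¬ Z z → (∀ {v} → Q v → O v) → (∀ {v} → Q v → O (v ℤ.+ z)) →
            ∀ {vs} → Distinct vs → All Q vs → 1 ℕ.≤ length vs → length vs ℕ.< p →
            ∃[ ws ] Distinct ws × All O ws × length ws ≡ suc (length vs)
    widen {Q} {z} z≢0 f g = grow Q O 0ℤ z (λ e → z≢0 (subst Z (lem z) (Z-neg (un≋ e))))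
      (λ {v} q → subst O (sym (ℤ.+-identityʳ v)) (f q)) g
      where
      lem : ∀ z → ℤ.- (0ℤ ℤ.- z) ≡ z
      lem = solve-∀

  module Dominant (w : Plane → Bool → ℤ) where

    -- In one direction all pairs outside the plane `i₀` have the value `q`. A deviation in `i₀` is
    -- expressed through the plane sum, because this is the form that can be compared with other
    -- directions.
    Mostly : Set
    Mostly = ∃[ q ] ∃[ i₀ ] (∀ i h → i ≢ i₀ → w i h ≋ q) × ((∀ h → w i₀ h ≋ q) ⊎ ¬ w i₀ false ℤ.+ w i₀ true ≋ q ℤ.+ q)

    private
      x₀ = w Π₁ false
      x₁ = w Π₁ true
      y₀ = w Π₂ false
      y₁ = w Π₂ true
      z₀ = w Π₃ false
      z₁ = w Π₃ true

      resolve : ∀ {a b c d} → OneOf a b c d → ¬ a ≋ b → c ≋ d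
      resolve (inj₁ e) n = contradiction e n
      resolve (inj₂ e) n = e

      lopsided : ∀ {a b q} → a ≋ q ⊎ b ≋ q → ¬ a ≋ b → ¬ a ℤ.+ b ≋ q ℤ.+ q
      lopsided {a} {b} {q} (inj₁ e) n s = n (≋-trans e (≋-sym (mk≋ (subst Z (lem a b q) (Z-+ (un≋ s) (Z-neg (un≋ e)))))))
        where
        lem : ∀ a b q → ((a ℤ.+ b) ℤ.- (q ℤ.+ q)) ℤ.- (a ℤ.- q) ≡ b ℤ.- q
        lem = solve-∀
      lopsided {a} {b} {q} (inj₂ e) n s = n (≋-trans (mk≋ (subst Z (lem a b q) (Z-+ (un≋ s) (Z-neg (un≋ e))))) (≋-sym e))
        where
        lem : ∀ a b q → ((a ℤ.+ b) ℤ.- (q ℤ.+ q)) ℤ.- (b ℤ.- q) ≡ a ℤ.- q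
        lem = solve-∀

    -- If the halves of one plane differ, the first six relations make all values outside it equal,
    -- and the last two show that one of its halves has this value too; its sum then differs from
    -- `2q`. If no plane has unequal halves, the last two relations link the planes.
    mostly : OneOf x₀ x₁ y₀ y₁ → OneOf x₀ x₁ y₀ z₀ → OneOf x₀ x₁ y₀ z₁ →
             OneOf y₀ y₁ x₀ z₀ → OneOf y₀ y₁ x₀ z₁ → OneOf z₀ z₁ x₀ y₀ →
             OneOf x₀ y₀ x₁ y₁ → OneOf x₀ z₀ x₁ z₁ → Mostly
    mostly xy xz₀ xz₁ yz₀ yz₁ zy cy cz = go (x₀ ≋? x₁) (y₀ ≋? y₁) (z₀ ≋? z₁)
      where
      go : Dec (x₀ ≋ x₁) → Dec (y₀ ≋ y₁) → Dec (z₀ ≋ z₁) → Mostly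
      go (no n) _ _ = y₀ , Π₁ , rest , inj₂ (lopsided (touch cy) n)
        where
        y₁≋ = ≋-sym (resolve xy n)
        rest : ∀ i h → i ≢ Π₁ → w i h ≋ y₀
        rest Π₁ h     ne = contradiction refl ne
        rest Π₂ false ne = ≋-refl
        rest Π₂ true  ne = y₁≋
        rest Π₃ false ne = ≋-sym (resolve xz₀ n)
        rest Π₃ true  ne = ≋-sym (resolve xz₁ n)
        touch : OneOf x₀ y₀ x₁ y₁ → x₀ ≋ y₀ ⊎ x₁ ≋ y₀
        touch (inj₁ e) = inj₁ e
        touch (inj₂ e) = inj₂ (≋-trans e y₁≋)
      go (yes x≋) (no n) _ = x₀ , Π₂ , rest , inj₂ (lopsided (touch cy) n)
        where
        rest : ∀ i h → i ≢ Π₂ → w i h ≋ x₀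
        rest Π₁ false ne = ≋-refl
        rest Π₁ true  ne = ≋-sym x≋
        rest Π₂ h     ne = contradiction refl ne
        rest Π₃ false ne = ≋-sym (resolve yz₀ n)
        rest Π₃ true  ne = ≋-sym (resolve yz₁ n)
        touch : OneOf x₀ y₀ x₁ y₁ → y₀ ≋ x₀ ⊎ y₁ ≋ x₀
        touch (inj₁ e) = inj₁ (≋-sym e)
        touch (inj₂ e) = inj₂ (≋-trans (≋-sym e) (≋-sym x≋))
      go (yes x≋) (yes y≋) (no n) = x₀ , Π₃ , rest , inj₂ (lopsided (touch cz) n)
        where
        y≋x = ≋-sym (resolve zy n)
        rest : ∀ i h → i ≢ Π₃ → w i h ≋ x₀
        rest Π₁ false ne = ≋-refl
        rest Π₁ true  ne = ≋-sym x≋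
        rest Π₂ false ne = y≋x
        rest Π₂ true  ne = ≋-trans (≋-sym y≋) y≋x
        rest Π₃ h     ne = contradiction refl ne
        touch : OneOf x₀ z₀ x₁ z₁ → z₀ ≋ x₀ ⊎ z₁ ≋ x₀
        touch (inj₁ e) = inj₁ (≋-sym e)
        touch (inj₂ e) = inj₂ (≋-trans (≋-sym e) (≋-sym x≋))
      go (yes x≋) (yes y≋) (yes z≋) = x₀ , Π₁ , rest , inj₁ first
        where
        link : ∀ {u₀ u₁} → OneOf x₀ u₀ x₁ u₁ → u₀ ≋ u₁ → u₀ ≋ x₀
        link (inj₁ e) _ = ≋-sym e
        link (inj₂ e) u = ≋-trans u (≋-trans (≋-sym e) (≋-sym x≋))
        first : ∀ h → w Π₁ h ≋ x₀
        first false = ≋-refl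
        first true  = ≋-sym x≋
        rest : ∀ i h → i ≢ Π₁ → w i h ≋ x₀
        rest Π₁ h     ne = contradiction refl ne
        rest Π₂ false ne = link cy y≋
        rest Π₂ true  ne = ≋-trans (≋-sym y≋) (link cy y≋)
        rest Π₃ false ne = link cz z≋
        rest Π₃ true  ne = ≋-trans (≋-sym z≋) (link cz z≋)

  module TwoPlanes (P : Pair → ℤ)
    (plane-sum : ∀ i l → P (main i l false) ℤ.+ P (main i l true) ≡ P (main i d₁ false) ℤ.+ P (main i d₁ true)) where

    private
      mostlyₗ : Dir → Set
      mostlyₗ l = Dominant.Mostly (λ i h → P (main i l h))

      σ : Plane → ℤ
      σ i = P (main i d₁ false) ℤ.+ P (main i d₁ true)

    -- For two directions some plane is exceptional in neither, and its sum is twice either dominant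
    -- value, so these agree. A plane regular in direction `d₁` has the right sum, hence cannot
    -- deviate in another direction either.
    two-planes : (∀ l → mostlyₗ l) → ∃[ k ] ∃[ q ] (∀ l h → P (main (left k) l h) ≋ q) × (∀ l h → P (main (right k) l h) ≋ q)
    two-planes m = bad d₁ , val d₁ , (λ l h → all-fine (left (bad d₁)) (left≢ (bad d₁)) l h) , (λ l h → all-fine (right (bad d₁)) (right≢ (bad d₁)) l h)
      where
      val : Dir → ℤ
      val l = proj₁ (m l)
      bad : Dir → Plane
      bad l = proj₁ (proj₂ (m l))
      fine : ∀ l i h → i ≢ bad l → P (main i l h) ≋ val l
      fine l = proj₁ (proj₂ (proj₂ (m l)))
      σ-fine : ∀ l i → i ≢ bad l → σ i ≋ val l ℤ.+ val l
      σ-fine l i ne = subst (_≋ val l ℤ.+ val l) (plane-sum i l) (mk≋ (subst Z (lem (P (main i l false)) (P (main i l true)) (val l))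
        (Z-+ (un≋ (fine l i false ne)) (un≋ (fine l i true ne)))))
        where
        lem : ∀ a b q → (a ℤ.- q) ℤ.+ (b ℤ.- q) ≡ (a ℤ.+ b) ℤ.- (q ℤ.+ q)
        lem = solve-∀
      agree : ∀ l → val l ≋ val d₁
      agree l = let (i , n , n′) = other (bad l) (bad d₁) in
        mk≋ (halve (subst Z (lem (val l) (val d₁) (σ i)) (Z-+ (Z-neg (un≋ (σ-fine l i n))) (un≋ (σ-fine d₁ i n′)))))
        where
        lem : ∀ x y s → ℤ.- (s ℤ.- (x ℤ.+ x)) ℤ.+ (s ℤ.- (y ℤ.+ y)) ≡ (x ℤ.- y) ℤ.+ (x ℤ.- y)
        lem = solve-∀
      double : ∀ l → val d₁ ℤ.+ val d₁ ≋ val l ℤ.+ val l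
      double l = mk≋ (subst Z (lem (val l) (val d₁)) (Z-neg (Z-+ (un≋ (agree l)) (un≋ (agree l)))))
        where
        lem : ∀ x y → ℤ.- ((x ℤ.- y) ℤ.+ (x ℤ.- y)) ≡ (y ℤ.+ y) ℤ.- (x ℤ.+ x)
        lem = solve-∀
      all-fine : ∀ i → i ≢ bad d₁ → ∀ l h → P (main i l h) ≋ val d₁
      all-fine i ne l h = cases (i ≟ᴾ bad l)
        where
        cases : Dec (i ≡ bad l) → P (main i l h) ≋ val d₁
        cases (no n)  = ≋-trans (fine l i h n) (agree l)
        cases (yes e) = exact (proj₂ (proj₂ (proj₂ (m l))))
          where
          exact : (∀ h → P (main (bad l) l h) ≋ val l) ⊎ ¬ P (main (bad l) l false) ℤ.+ P (main (bad l) l true) ≋ val l ℤ.+ val l → P (main i l h) ≋ val d₁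
          exact (inj₁ f) = ≋-trans (subst (λ j → P (main j l h) ≋ val l) (sym e) (f h)) (agree l)
          exact (inj₂ n) = contradiction (subst (λ j → P (main j l false) ℤ.+ P (main j l true) ≋ val l ℤ.+ val l) e
            (subst (_≋ val l ℤ.+ val l) (sym (plane-sum i l)) (≋-trans (σ-fine d₁ i ne) (double l)))) n

    module _ {O : ℤ → Set} (resp : ∀ {u v} → u ≋ v → O v → O u) where

      private
        pair₂ : ∀ x y → O (P x ℤ.+ (P y ℤ.+ 0ℤ)) → O (P x ℤ.+ P y)
        pair₂ x y = subst (λ z → O (P x ℤ.+ z)) (ℤ.+-identityʳ (P y))

      planes₃ : (∀ {vs} → Distinct vs → All O vs → length vs ≢ 3) →
                (∀ x y → Bool.T (valid offaxis (x ∷ y ∷ [])) → O (P x ℤ.+ (P y ℤ.+ 0ℤ))) →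
                ∃[ k ] ∃[ q ] (∀ l h → P (main (left k) l h) ≋ q) × (∀ l h → P (main (right k) l h) ≋ q)
      planes₃ few quads = two-planes λ l → Dominant.mostly (λ i h → P (main i l h))
          (one l x₀ x₁ y₀ y₁ z₀ z₁ tt) (one l x₀ x₁ y₀ z₀ y₁ z₁ tt) (one l x₀ x₁ y₀ z₁ y₁ z₀ tt)
          (one l y₀ y₁ x₀ z₀ x₁ z₁ tt) (one l y₀ y₁ x₀ z₁ x₁ z₀ tt) (one l z₀ z₁ x₀ y₀ x₁ y₁ tt)
          (one l x₀ y₀ x₁ y₁ z₀ z₁ tt) (one l x₀ z₀ x₁ z₁ y₀ y₁ tt)
        where
        x₀ = Π₁ , false
        x₁ = Π₁ , true
        y₀ = Π₂ , false
        y₁ = Π₂ , true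
        z₀ = Π₃ , false
        z₁ = Π₃ , true
        one : ∀ l a b c d e f → Bool.T (allDirs (goodSix a b c d e f)) → OneOf (P (pr l a)) (P (pr l b)) (P (pr l c)) (P (pr l d))
        one l a b c d e f t = decide (P (pr l a) ≋? P (pr l b)) (P (pr l c) ≋? P (pr l d))
          where
          g = allDirs-sound (goodSix a b c d e f) t l
          two : Ix → Ix → Bool
          two x y = valid offaxis (pr l x ∷ pr l y ∷ [])
          g₁ = T-∧ {two a c} g
          g₂ = T-∧ {two a d} (proj₂ g₁)
          g₃ = T-∧ {two b c} (proj₂ g₂)
          g₄ = T-∧ {two b d} (proj₂ g₃)
          quad : ∀ x y → Bool.T (two x y) → O (P (pr l x) ℤ.+ P (pr l y))
          quad x y v = pair₂ (pr l x) (pr l y) (quads (pr l x) (pr l y) v)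
          decide : Dec (P (pr l a) ≋ P (pr l b)) → Dec (P (pr l c) ≋ P (pr l d)) → OneOf (P (pr l a)) (P (pr l b)) (P (pr l c)) (P (pr l d))
          decide (yes e) _       = inj₁ e
          decide (no _)  (yes e) = inj₂ e
          decide (no n)  (no n′) =
            let (vs , dv , av , lv) = sums₃ resp n n′ (quad a c (proj₁ g₁)) (quad a d (proj₁ g₂)) (quad b c (proj₁ g₃)) (quad b d (proj₁ g₄))
            in contradiction lv (few dv av)

      -- One more value is tolerated than in `planes₃`. It is used up by the remaining pairs `e` and
      -- `f`: they may be added or omitted, and their joint value is itself an option and therefore
      -- not 0.
      planes₄ : 3 ℕ.< p → (∀ {v} → O v → ¬ Z v) → (∀ {vs} → Distinct vs → All O vs → length vs ≢ 4) →
                (∀ x y → Bool.T (valid offaxis (x ∷ y ∷ [])) → O (P x ℤ.+ (P y ℤ.+ 0ℤ))) →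
                (∀ x y z w → Bool.T (valid offaxis (x ∷ y ∷ z ∷ w ∷ [])) → O (P x ℤ.+ (P y ℤ.+ (P z ℤ.+ (P w ℤ.+ 0ℤ))))) →
                ∃[ k ] ∃[ q ] (∀ l h → P (main (left k) l h) ≋ q) × (∀ l h → P (main (right k) l h) ≋ q)
      planes₄ 3<p nonzero′ few quads octs = two-planes λ l → Dominant.mostly (λ i h → P (main i l h))
          (one l x₀ x₁ y₀ y₁ z₀ z₁ tt tt) (one l x₀ x₁ y₀ z₀ y₁ z₁ tt tt) (one l x₀ x₁ y₀ z₁ y₁ z₀ tt tt)
          (one l y₀ y₁ x₀ z₀ x₁ z₁ tt tt) (one l y₀ y₁ x₀ z₁ x₁ z₀ tt tt) (one l z₀ z₁ x₀ y₀ x₁ y₁ tt tt)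
          (one l x₀ y₀ x₁ y₁ z₀ z₁ tt tt) (one l x₀ z₀ x₁ z₁ y₀ y₁ tt tt)
        where
        x₀ = Π₁ , false
        x₁ = Π₁ , true
        y₀ = Π₂ , false
        y₁ = Π₂ , true
        z₀ = Π₃ , false
        z₁ = Π₃ , true
        one : ∀ l a b c d e f → Bool.T (allDirs (goodSix a b c d e f)) → Bool.T (allDirs (λ l → valid offaxis (pr l e ∷ pr l f ∷ []))) →
              OneOf (P (pr l a)) (P (pr l b)) (P (pr l c)) (P (pr l d))
        one l a b c d e f t t′ = decide (P (pr l a) ≋? P (pr l b)) (P (pr l c) ≋? P (pr l d))
          where
          g = allDirs-sound (goodSix a b c d e f) t l
          two four : Ix → Ix → Bool
          two x y = valid offaxis (pr l x ∷ pr l y ∷ [])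
          four x y = valid offaxis (pr l x ∷ pr l y ∷ pr l e ∷ pr l f ∷ [])
          g₁ = T-∧ {two a c} g
          g₂ = T-∧ {two a d} (proj₂ g₁)
          g₃ = T-∧ {two b c} (proj₂ g₂)
          g₄ = T-∧ {two b d} (proj₂ g₃)
          g₅ = T-∧ {four a c} (proj₂ g₄)
          g₆ = T-∧ {four a d} (proj₂ g₅)
          g₇ = T-∧ {four b c} (proj₂ g₆)
          z = P (pr l e) ℤ.+ P (pr l f)
          quad : ∀ x y → Bool.T (two x y) → O (P (pr l x) ℤ.+ P (pr l y))
          quad x y v = pair₂ (pr l x) (pr l y) (quads (pr l x) (pr l y) v)
          z≢0 : ¬ Z z
          z≢0 = nonzero′ (quad e f (allDirs-sound (λ l → valid offaxis (pr l e ∷ pr l f ∷ [])) t′ l))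
          Q : ℤ → Set
          Q v = O v × O (v ℤ.+ z)
          resp-Q : ∀ {u v} → u ≋ v → Q v → Q u
          resp-Q {u} {v} e (o , o′) = resp e o , resp (≋-by (lem u v z) e) o′
            where
            lem : ∀ u v z → u ℤ.- v ≡ (u ℤ.+ z) ℤ.- (v ℤ.+ z)
            lem = solve-∀
          both : ∀ x y → Bool.T (two x y) → Bool.T (four x y) → Q (P (pr l x) ℤ.+ P (pr l y))
          both x y v v′ = quad x y v , resp (≡⇒≋ (lem (P (pr l x)) (P (pr l y)) (P (pr l e)) (P (pr l f)))) (octs (pr l x) (pr l y) (pr l e) (pr l f) v′)
            where
            lem : ∀ a b c d → (a ℤ.+ b) ℤ.+ (c ℤ.+ d) ≡ a ℤ.+ (b ℤ.+ (c ℤ.+ (d ℤ.+ 0ℤ)))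
            lem = solve-∀
          decide : Dec (P (pr l a) ≋ P (pr l b)) → Dec (P (pr l c) ≋ P (pr l d)) → OneOf (P (pr l a)) (P (pr l b)) (P (pr l c)) (P (pr l d))
          decide (yes e) _       = inj₁ e
          decide (no _)  (yes e) = inj₂ e
          decide (no n)  (no n′) =
            let (vs , dv , av , lv) = sums₃ resp-Q n n′ (both a c (proj₁ g₁) (proj₁ g₅)) (both a d (proj₁ g₂) (proj₁ g₆))
                                        (both b c (proj₁ g₃) (proj₁ g₇)) (both b d (proj₁ g₄) (proj₂ g₇))
                (ws , dw , aw , lw) = widen resp z≢0 proj₁ proj₂ dv av (subst (1 ℕ.≤_) (sym lv) (s≤s z≤n)) (subst (ℕ._< p) (sym lv) 3<p)
            in contradiction (≡-trans lw (cong suc lv)) (few dw aw)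

frame-restrict : ∀ {t} → Frame nonzero t → Frame offaxis t
frame-restrict fr = record
  { A = A ; A-inj = A-inj ; A-affine = A-affine
  ; A-in = λ { c@(true ∷ _) c∈ → A-in c (∈-nonzero c λ ()) ; c@(false ∷ true ∷ _) c∈ → A-in c (∈-nonzero c λ ())
             ; (false ∷ false ∷ false ∷ false ∷ []) () ; (false ∷ false ∷ false ∷ true ∷ []) ()
             ; (false ∷ false ∷ true ∷ false ∷ []) () ; (false ∷ false ∷ true ∷ true ∷ []) () } }
  where open Frame fr

-- Options normalised by a common block value

module Spread (p : ℕ) (prime : Prime p) (odd : ¬ + p ℤ.∣ + 2) where

  open OddPrime p prime odd public
  open PairValues p prime odd public

  sum-shift : ∀ {X : Set} (f : X → ℤ) u xs → sum-by (λ x → f x ℤ.- u) xs ≡ sum-by f xs ℤ.- + length xs ℤ.* u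
  sum-shift f u [] = sym (lem u)
    where
    lem : ∀ u → 0ℤ ℤ.- 0ℤ ℤ.* u ≡ 0ℤ
    lem = solve-∀
  sum-shift f u (x ∷ xs) = ≡-trans (cong (λ s → (f x ℤ.- u) ℤ.+ s) (sum-shift f u xs)) (lem (f x) (sum-by f xs) (+ length xs) u)
    where
    lem : ∀ x s n u → (x ℤ.- u) ℤ.+ (s ℤ.- n ℤ.* u) ≡ (x ℤ.+ s) ℤ.- (1ℤ ℤ.+ n) ℤ.* u
    lem = solve-∀

  multiple : ∀ {n} x → n ≡ p → Z (+ n ℤ.* x)
  multiple x refl = ℤ.∣m⇒∣m*n x ℤ.∣-refl

  module _ {S : List Item} (avoids : Avoids S) where

    -- Values of options of weight W, normalised so that a block of value u counts for nothing.
    module Normalised {ms R} (st : Stage S ms R) (W : ℕ) (e : W ℕ.+ length ms ≡ p) (u : ℤ) where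

      O : ℤ → Set
      O v = ∃[ x ] Opt R W x × x ≋ v ℤ.+ + W ℤ.* u

      resp : ∀ {v w} → v ≋ w → O w → O v
      resp {v} {w} d (x , o , h) = x , o , ≋-trans h (≋-by (lem v w (+ W ℤ.* u)) (≋-sym d))
        where
        lem : ∀ v w s → w ℤ.- v ≡ (w ℤ.+ s) ℤ.- (v ℤ.+ s)
        lem = solve-∀

      private
        raw : ∀ {vs} → All O vs → List ℤ
        raw []             = []
        raw ((x , _) ∷ os) = x ∷ raw os

        raw-opts : ∀ {vs} (os : All O vs) → All (Opt R W) (raw os)
        raw-opts []                 = []
        raw-opts ((_ , o , _) ∷ os) = o ∷ raw-opts os

        raw-length : ∀ {vs} (os : All O vs) → length (raw os) ≡ length vs
        raw-length []       = refl
        raw-length (_ ∷ os) = cong suc (raw-length os)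

        raw-apart : ∀ {v x vs} → x ≋ v ℤ.+ + W ℤ.* u → All (λ w → ¬ v ≋ w) vs → (os : All O vs) → All (λ y → ¬ x ≋ y) (raw os)
        raw-apart h [] [] = []
        raw-apart {v} h (_∷_ {w} n ns) ((y , _ , h′) ∷ os) =
          (λ xy → n (≋-by (lem v w (+ W ℤ.* u)) (≋-trans (≋-sym h) (≋-trans xy h′)))) ∷ raw-apart h ns os
          where
          lem : ∀ v w s → (v ℤ.+ s) ℤ.- (w ℤ.+ s) ≡ v ℤ.- w
          lem = solve-∀

        raw-distinct : ∀ {vs} → Distinct vs → (os : All O vs) → Distinct (raw os)
        raw-distinct []      []                 = []
        raw-distinct (n ∷ d) ((_ , _ , h) ∷ os) = raw-apart h n os ∷ raw-distinct d os

      few : 1 ℕ.≤ W → ∀ {vs} → Distinct vs → All O vs → length vs ≢ W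
      few 1≤ d os l = core avoids st e (raw-opts os) (subst (1 ℕ.≤_) (sym len) 1≤) (ℕ.≤-reflexive (sym len)) (raw-distinct d os)
        where len = ≡-trans (raw-length os) l

      -- An option of normalised value 0 counts like `W` blocks of value `u`; together with such a
      -- block from each couple the sum would be `p u`.
      nonzero-O : All (Has u) ms → ∀ {v} → O v → ¬ Z v
      nonzero-O hs {v} (x , o , h) z = finish avoids st hs o e (mk≋ (subst Z (lem x v (+ W) (+ length ms) u) (Z-+ (Z-+ (un≋ h) z) (multiple u e))))
        where
        lem : ∀ x v w t u → ((x ℤ.- (v ℤ.+ w ℤ.* u)) ℤ.+ v) ℤ.+ (w ℤ.+ t) ℤ.* u ≡ (x ℤ.+ t ℤ.* u) ℤ.- 0ℤ
        lem = solve-∀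

    -- Spare blocks of value `u` are normalised to 0, so they bring an option up to the required
    -- weight without changing its normalised value.
    fill : ∀ {ms sp R′ u W w n s} {st : Stage S ms (flat sp ++ R′)} {e : W ℕ.+ length ms ≡ p} →
           All Twin sp → All (λ b → block-value b ≋ u) sp → n ℕ.≤ length sp → Opt R′ w s → n ℕ.+ w ≡ W →
           Normalised.O st W e u (s ℤ.- + w ℤ.* u)
    fill {sp = sp} {R′} {u} {W} {w} {n} {s} ts us n≤ o refl =
      sum-by block-value bs ℤ.+ s
      , subst (λ k → Opt (flat sp ++ R′) (k ℕ.+ w) (sum-by block-value bs ℤ.+ s)) (length-take-≤ n≤)
          (opt-++ (opt-⊑ (flat-⊑ (take-⊑ n sp)) (opt-blocks (All-⊑ (take-⊑ n sp) ts))) o)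
      , mk≋ (subst Z (lem (sum-by block-value bs) s (+ n) (+ w) u)
          (un≋ (subst (λ k → sum-by block-value bs ≋ + k ℤ.* u) (length-take-≤ n≤) (sum-≋ block-value (All-⊑ (take-⊑ n sp) us)))))
      where
      bs = take n sp
      lem : ∀ b s n w u → b ℤ.- n ℤ.* u ≡ (b ℤ.+ s) ℤ.- ((s ℤ.- w ℤ.* u) ℤ.+ (n ℤ.+ w) ℤ.* u)
      lem = solve-∀

  twice : ∀ {a} → ¬ Z a → ¬ Z (+ 2 ℤ.* a)
  twice a≢0 z = [ odd , a≢0 ]′ (Z-*⁻ (+ 2) z)

  module Multiples (3<p : 3 ℕ.< p) where

    three∤ : ¬ Z (+ 3)
    three∤ z with Z-<⇒≡0 3<p z
    ... | ()

    thrice : ∀ {a} → ¬ Z a → ¬ Z (+ 3 ℤ.* a)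
    thrice a≢0 z = [ three∤ , a≢0 ]′ (Z-*⁻ (+ 3) z)

    four-times : ∀ {a} → ¬ Z a → ¬ Z (+ 4 ℤ.* a)
    four-times {a} a≢0 z = twice (twice a≢0) (subst Z (lem a) z)
      where
      lem : ∀ a → + 4 ℤ.* a ≡ + 2 ℤ.* (+ 2 ℤ.* a)
      lem = solve-∀

  ≢-by : ∀ {a x y} → ¬ Z a → x ℤ.- y ≡ a → ¬ x ≋ y
  ≢-by n e (mk≋ d) = n (subst Z e d)

  private
    neg : ∀ {a} → ¬ Z a → ¬ Z (ℤ.- a)
    neg {a} n z = n (subst Z (ℤ.neg-involutive a) (Z-neg z))

  among₃ : ∀ {O : ℤ → Set} → (∀ {vs} → Distinct vs → All O vs → length vs ≢ 4) → ∀ {x y z} → ¬ x ≋ y → ¬ x ≋ z → ¬ y ≋ z →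
           O x → O y → O z → ∀ {w} → O w → w ≋ x ⊎ w ≋ y ⊎ w ≋ z
  among₃ few {x} {y} {z} xy xz yz ox oy oz {w} ow = go (w ≋? x) (w ≋? y) (w ≋? z)
    where
    go : Dec (w ≋ x) → Dec (w ≋ y) → Dec (w ≋ z) → w ≋ x ⊎ w ≋ y ⊎ w ≋ z
    go (yes d) _ _ = inj₁ d
    go (no _) (yes d) _ = inj₂ (inj₁ d)
    go (no _) (no _) (yes d) = inj₂ (inj₂ d)
    go (no n₁) (no n₂) (no n₃) = contradiction refl (few ((n₁ ∷ n₂ ∷ n₃ ∷ []) ∷ (xy ∷ xz ∷ []) ∷ (yz ∷ []) ∷ [] ∷ []) (ow ∷ ox ∷ oy ∷ oz ∷ []))

  among₄ : ∀ {O : ℤ → Set} → (∀ {vs} → Distinct vs → All O vs → length vs ≢ 5) → ∀ {x y z t} →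
           ¬ x ≋ y → ¬ x ≋ z → ¬ x ≋ t → ¬ y ≋ z → ¬ y ≋ t → ¬ z ≋ t →
           O x → O y → O z → O t → ∀ {w} → O w → w ≋ x ⊎ w ≋ y ⊎ w ≋ z ⊎ w ≋ t
  among₄ few {x} {y} {z} {t} xy xz xt yz yt zt ox oy oz ot {w} ow = go (w ≋? x) (w ≋? y) (w ≋? z) (w ≋? t)
    where
    go : Dec (w ≋ x) → Dec (w ≋ y) → Dec (w ≋ z) → Dec (w ≋ t) → w ≋ x ⊎ w ≋ y ⊎ w ≋ z ⊎ w ≋ t
    go (yes d) _ _ _ = inj₁ d
    go (no _) (yes d) _ _ = inj₂ (inj₁ d)
    go (no _) (no _) (yes d) _ = inj₂ (inj₂ (inj₁ d))
    go (no _) (no _) (no _) (yes d) = inj₂ (inj₂ (inj₂ d))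
    go (no n₁) (no n₂) (no n₃) (no n₄) = contradiction refl (few
      ((n₁ ∷ n₂ ∷ n₃ ∷ n₄ ∷ []) ∷ (xy ∷ xz ∷ xt ∷ []) ∷ (yz ∷ yt ∷ []) ∷ (zt ∷ []) ∷ [] ∷ []) (ow ∷ ox ∷ oy ∷ oz ∷ ot ∷ []))

  module Steps (3<p : 3 ℕ.< p) {a} (a≢0 : ¬ Z a) where

    open Multiples 3<p

    -- A progression of three values with difference a, among at most three values including 2a and 4a, starts at 2a.
    progression : ∀ {O : ℤ → Set} → (∀ {vs} → Distinct vs → All O vs → length vs ≢ 4) → ∀ P →
                  O (+ 2 ℤ.* a) → O (+ 4 ℤ.* a) → O (P ℤ.+ a) → O (P ℤ.+ + 2 ℤ.* a) → O (P ℤ.+ + 3 ℤ.* a) → P ≋ a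
    progression few P o₂ o₄ q₁ q₂ q₃ =
      decide (among₃ few n₁₂ n₁₃ n₂₃ q₁ q₂ q₃ o₂) (among₃ few n₁₂ n₁₃ n₂₃ q₁ q₂ q₃ o₄)
      where
      n₁₂ = ≢-by (neg a≢0) (lem P a)
        where
        lem : ∀ P a → (P ℤ.+ a) ℤ.- (P ℤ.+ + 2 ℤ.* a) ≡ ℤ.- a
        lem = solve-∀
      n₁₃ = ≢-by (neg (twice a≢0)) (lem P a)
        where
        lem : ∀ P a → (P ℤ.+ a) ℤ.- (P ℤ.+ + 3 ℤ.* a) ≡ ℤ.- (+ 2 ℤ.* a)
        lem = solve-∀
      n₂₃ = ≢-by (neg a≢0) (lem P a)
        where
        lem : ∀ P a → (P ℤ.+ + 2 ℤ.* a) ℤ.- (P ℤ.+ + 3 ℤ.* a) ≡ ℤ.- a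
        lem = solve-∀
      from₂ : ∀ P a → ℤ.- (+ 2 ℤ.* a ℤ.- (P ℤ.+ a)) ≡ P ℤ.- a
      from₂ = solve-∀
      from₄ : ∀ P a → ℤ.- (+ 4 ℤ.* a ℤ.- (P ℤ.+ + 3 ℤ.* a)) ≡ P ℤ.- a
      from₄ = solve-∀
      clash : ∀ {k x y} → ¬ Z k → x ℤ.- y ≡ k → Z x → Z y → P ≋ a
      clash n e zx zy = contradiction (subst Z e (Z-+ zx (Z-neg zy))) n
      e₁ : ∀ P a → (+ 4 ℤ.* a ℤ.- (P ℤ.+ a)) ℤ.- (+ 2 ℤ.* a ℤ.- (P ℤ.+ + 2 ℤ.* a)) ≡ + 3 ℤ.* a
      e₁ = solve-∀
      e₂ : ∀ P a → (+ 4 ℤ.* a ℤ.- (P ℤ.+ + 2 ℤ.* a)) ℤ.- (+ 2 ℤ.* a ℤ.- (P ℤ.+ + 2 ℤ.* a)) ≡ + 2 ℤ.* a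
      e₂ = solve-∀
      e₃ : ∀ P a → (+ 4 ℤ.* a ℤ.- (P ℤ.+ a)) ℤ.- (+ 2 ℤ.* a ℤ.- (P ℤ.+ + 3 ℤ.* a)) ≡ + 4 ℤ.* a
      e₃ = solve-∀
      e₄ : ∀ P a → (+ 4 ℤ.* a ℤ.- (P ℤ.+ + 2 ℤ.* a)) ℤ.- (+ 2 ℤ.* a ℤ.- (P ℤ.+ + 3 ℤ.* a)) ≡ + 3 ℤ.* a
      e₄ = solve-∀
      decide : + 2 ℤ.* a ≋ P ℤ.+ a ⊎ + 2 ℤ.* a ≋ P ℤ.+ + 2 ℤ.* a ⊎ + 2 ℤ.* a ≋ P ℤ.+ + 3 ℤ.* a →
               + 4 ℤ.* a ≋ P ℤ.+ a ⊎ + 4 ℤ.* a ≋ P ℤ.+ + 2 ℤ.* a ⊎ + 4 ℤ.* a ≋ P ℤ.+ + 3 ℤ.* a → P ≋ a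
      decide (inj₁ d) _ = mk≋ (subst Z (from₂ P a) (Z-neg (un≋ d)))
      decide _ (inj₂ (inj₂ d)) = mk≋ (subst Z (from₄ P a) (Z-neg (un≋ d)))
      decide (inj₂ (inj₁ d)) (inj₁ d′) = clash (thrice a≢0) (e₁ P a) (un≋ d′) (un≋ d)
      decide (inj₂ (inj₁ d)) (inj₂ (inj₁ d′)) = clash (twice a≢0) (e₂ P a) (un≋ d′) (un≋ d)
      decide (inj₂ (inj₂ d)) (inj₁ d′) = clash (four-times a≢0) (e₃ P a) (un≋ d′) (un≋ d)
      decide (inj₂ (inj₂ d)) (inj₂ (inj₁ d′)) = clash (thrice a≢0) (e₄ P a) (un≋ d′) (un≋ d)

    private
      step : ∀ {k} m n → ¬ Z (k ℤ.* a) → m ℤ.* a ℤ.- n ℤ.* a ≡ ℤ.- (k ℤ.* a) → ¬ m ℤ.* a ≋ n ℤ.* a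
      step m n h e = ≢-by (neg h) e

      one : ¬ Z (1ℤ ℤ.* a)
      one = a≢0 ∘ subst Z (ℤ.*-identityˡ a)

      n₂₃ = step {1ℤ} (+ 2) (+ 3) one (lem a)
        where
        lem : ∀ a → + 2 ℤ.* a ℤ.- + 3 ℤ.* a ≡ ℤ.- (1ℤ ℤ.* a)
        lem = solve-∀
      n₃₄ = step {1ℤ} (+ 3) (+ 4) one (lem a)
        where
        lem : ∀ a → + 3 ℤ.* a ℤ.- + 4 ℤ.* a ≡ ℤ.- (1ℤ ℤ.* a)
        lem = solve-∀
      n₄₅ = step {1ℤ} (+ 4) (+ 5) one (lem a)
        where
        lem : ∀ a → + 4 ℤ.* a ℤ.- + 5 ℤ.* a ≡ ℤ.- (1ℤ ℤ.* a)
        lem = solve-∀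
      n₂₄ = step {+ 2} (+ 2) (+ 4) (twice a≢0) (lem a)
        where
        lem : ∀ a → + 2 ℤ.* a ℤ.- + 4 ℤ.* a ≡ ℤ.- (+ 2 ℤ.* a)
        lem = solve-∀
      n₃₅ = step {+ 2} (+ 3) (+ 5) (twice a≢0) (lem a)
        where
        lem : ∀ a → + 3 ℤ.* a ℤ.- + 5 ℤ.* a ≡ ℤ.- (+ 2 ℤ.* a)
        lem = solve-∀
      n₂₅ = step {+ 3} (+ 2) (+ 5) (thrice a≢0) (lem a)
        where
        lem : ∀ a → + 2 ℤ.* a ℤ.- + 5 ℤ.* a ≡ ℤ.- (+ 3 ℤ.* a)
        lem = solve-∀

      read : ∀ {b} i j → i ℤ.* a ℤ.+ b ≋ j ℤ.* a → Z (b ℤ.- (j ℤ.- i) ℤ.* a)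
      read {b} i j (mk≋ d) = subst Z (lem i j a b) d
        where
        lem : ∀ i j a b → (i ℤ.* a ℤ.+ b) ℤ.- j ℤ.* a ≡ b ℤ.- (j ℤ.- i) ℤ.* a
        lem = solve-∀

      apart : ∀ {b} k l m → Z (b ℤ.- k ℤ.* a) → Z (b ℤ.- l ℤ.* a) → l ℤ.- k ≡ m → ¬ Z (m ℤ.* a) → b ≋ a
      apart {b} k l m z z′ refl n = contradiction (subst Z (lem b k l a) (Z-+ z (Z-neg z′))) n
        where
        lem : ∀ b k l a → (b ℤ.- k ℤ.* a) ℤ.- (b ℤ.- l ℤ.* a) ≡ (l ℤ.- k) ℤ.* a
        lem = solve-∀

      equals : ∀ {b} → Z (b ℤ.- 1ℤ ℤ.* a) → b ≋ a
      equals {b} z = mk≋ (subst (λ x → Z (b ℤ.- x)) (ℤ.*-identityˡ a) z)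

    -- The three values `2a`, `3a`, `4a` are all there are. For nonzero `b` different from `a`, the
    -- first shifted value forces `b = 2a` and the second `b = - a`, hence `3a = 0`.
    increment₃ : ∀ {O : ℤ → Set} → (∀ {vs} → Distinct vs → All O vs → length vs ≢ 4) → ∀ {b} → ¬ Z b →
                 O (+ 2 ℤ.* a) → O (+ 3 ℤ.* a) → O (+ 4 ℤ.* a) → O (+ 2 ℤ.* a ℤ.+ b) → O (+ 3 ℤ.* a ℤ.+ b) → b ≋ a
    increment₃ few {b} b≢0 o₂ o₃ o₄ q₂ q₃ = decide (among₃ few n₂₃ n₂₄ n₃₄ o₂ o₃ o₄ q₂) (among₃ few n₂₃ n₂₄ n₃₄ o₂ o₃ o₄ q₃)
      where
      null : ∀ i → i ℤ.* a ℤ.+ b ≋ i ℤ.* a → b ≋ a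
      null i (mk≋ d) = contradiction (subst Z (lem i a b) d) b≢0
        where
        lem : ∀ i a b → (i ℤ.* a ℤ.+ b) ℤ.- i ℤ.* a ≡ b
        lem = solve-∀
      decide : + 2 ℤ.* a ℤ.+ b ≋ + 2 ℤ.* a ⊎ + 2 ℤ.* a ℤ.+ b ≋ + 3 ℤ.* a ⊎ + 2 ℤ.* a ℤ.+ b ≋ + 4 ℤ.* a →
               + 3 ℤ.* a ℤ.+ b ≋ + 2 ℤ.* a ⊎ + 3 ℤ.* a ℤ.+ b ≋ + 3 ℤ.* a ⊎ + 3 ℤ.* a ℤ.+ b ≋ + 4 ℤ.* a → b ≋ a
      decide (inj₁ d) _                      = null (+ 2) d
      decide (inj₂ (inj₁ d)) _               = equals (read (+ 2) (+ 3) d)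
      decide _ (inj₂ (inj₂ d))               = equals (read (+ 3) (+ 4) d)
      decide _ (inj₂ (inj₁ d))               = null (+ 3) d
      decide (inj₂ (inj₂ d)) (inj₁ d′)       = apart (ℤ.- 1ℤ) (+ 2) (+ 3) (read (+ 3) (+ 2) d′) (read (+ 2) (+ 4) d) refl (thrice a≢0)

    -- The same with four values. A third shifted value is needed now, since `b = 2a` would be
    -- compatible with the first two.
    increment₄ : ∀ {O : ℤ → Set} → (∀ {vs} → Distinct vs → All O vs → length vs ≢ 5) → ∀ {b} → ¬ Z b →
                 O (+ 2 ℤ.* a) → O (+ 3 ℤ.* a) → O (+ 4 ℤ.* a) → O (+ 5 ℤ.* a) →
                 O (+ 2 ℤ.* a ℤ.+ b) → O (+ 3 ℤ.* a ℤ.+ b) → O (+ 4 ℤ.* a ℤ.+ b) → b ≋ a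
    increment₄ {O} few {b} b≢0 o₂ o₃ o₄ o₅ q₂ q₃ q₄ = decide (find′ q₂) (find′ q₃) (find′ q₄)
      where
      find′ : ∀ {w} → O w → w ≋ + 2 ℤ.* a ⊎ w ≋ + 3 ℤ.* a ⊎ w ≋ + 4 ℤ.* a ⊎ w ≋ + 5 ℤ.* a
      find′ = among₄ few n₂₃ n₂₄ n₂₅ n₃₄ n₃₅ n₄₅ o₂ o₃ o₄ o₅
      null : ∀ i → i ℤ.* a ℤ.+ b ≋ i ℤ.* a → b ≋ a
      null i (mk≋ d) = contradiction (subst Z (lem i a b) d) b≢0
        where
        lem : ∀ i a b → (i ℤ.* a ℤ.+ b) ℤ.- i ℤ.* a ≡ b
        lem = solve-∀
      Hit : ℤ → Set
      Hit w = w ≋ + 2 ℤ.* a ⊎ w ≋ + 3 ℤ.* a ⊎ w ≋ + 4 ℤ.* a ⊎ w ≋ + 5 ℤ.* a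
      decide : Hit (+ 2 ℤ.* a ℤ.+ b) → Hit (+ 3 ℤ.* a ℤ.+ b) → Hit (+ 4 ℤ.* a ℤ.+ b) → b ≋ a
      decide (inj₁ d) _ _                                  = null (+ 2) d
      decide (inj₂ (inj₁ d)) _ _                           = equals (read (+ 2) (+ 3) d)
      decide _ (inj₂ (inj₁ d)) _                           = null (+ 3) d
      decide _ (inj₂ (inj₂ (inj₁ d))) _                    = equals (read (+ 3) (+ 4) d)
      decide _ _ (inj₂ (inj₂ (inj₁ d)))                    = null (+ 4) d
      decide _ _ (inj₂ (inj₂ (inj₂ d)))                    = equals (read (+ 4) (+ 5) d)
      decide (inj₂ (inj₂ (inj₁ d))) _ (inj₁ d′)            = apart (ℤ.- + 2) (+ 2) (+ 4) (read (+ 4) (+ 2) d′) (read (+ 2) (+ 4) d) refl (four-times a≢0)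
      decide (inj₂ (inj₂ (inj₁ d))) _ (inj₂ (inj₁ d′))     = apart (ℤ.- + 1) (+ 2) (+ 3) (read (+ 4) (+ 3) d′) (read (+ 2) (+ 4) d) refl (thrice a≢0)
      decide (inj₂ (inj₂ (inj₂ d))) (inj₁ d′) _            = apart (ℤ.- + 1) (+ 3) (+ 4) (read (+ 3) (+ 2) d′) (read (+ 2) (+ 5) d) refl (four-times a≢0)
      decide (inj₂ (inj₂ (inj₂ d))) (inj₂ (inj₂ (inj₂ d′))) _ = apart (+ 2) (+ 3) 1ℤ (read (+ 3) (+ 5) d′) (read (+ 2) (+ 5) d) refl one

module ManyPoints (p : ℕ) (prime : Prime p) (odd : ¬ + p ℤ.∣ + 2) where

  open Spread p prime odd public

  module _ {S : List Item} (avoids : Avoids S) where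

    mixed : ∀ {ms sp R′ D u W n reg xs ps} {st : Stage S ms (flat sp ++ R′)} {e : W ℕ.+ length ms ≡ p} (fr : Frame reg (support D)) →
            All Twin sp → All (λ b → block-value b ≋ u) sp → n ℕ.≤ length sp →
            All Twin xs → (flat xs ++ D) ⊑ R′ → Bool.T (valid reg ps) → n ℕ.+ (length xs ℕ.+ length ps) ≡ W →
            Normalised.O avoids st W e u (sum-by (λ x → block-value x ℤ.- u) xs ℤ.+ sum-by (λ q → PlaneOptions.P D fr q ℤ.- u) ps)
    mixed {D = D} {u = u} {xs = xs} {ps} {st} {e} fr ts us n≤ tx i v eq =
      subst (Normalised.O avoids st _ e u) value≡ (fill avoids {st = st} {e} ts us n≤ (opt-⊑ i (opt-++ (opt-blocks tx) (PlaneOptions.pairs-opt D fr ps v))) eq)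
      where
      lem : ∀ x y m n u → (x ℤ.+ y) ℤ.- (m ℤ.+ n) ℤ.* u ≡ (x ℤ.- m ℤ.* u) ℤ.+ (y ℤ.- n ℤ.* u)
      lem = solve-∀
      value≡ : (sum-by block-value xs ℤ.+ sum-by (PlaneOptions.P D fr) ps) ℤ.- + (length xs ℕ.+ length ps) ℤ.* u
             ≡ sum-by (λ x → block-value x ℤ.- u) xs ℤ.+ sum-by (λ q → PlaneOptions.P D fr q ℤ.- u) ps
      value≡ = ≡-trans (lem (sum-by block-value xs) (sum-by (PlaneOptions.P D fr) ps) (+ length xs) (+ length ps) u)
        (sym (cong₂ ℤ._+_ (sum-shift block-value u xs) (sum-shift (PlaneOptions.P D fr) u ps)))

    module Setting {ms sp R′ D u W reg} (st : Stage S ms (flat sp ++ R′)) (e : W ℕ.+ length ms ≡ p)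
      (ts : All Twin sp) (us : All (λ b → block-value b ≋ u) sp) (i : D ⊑ R′) (fr : Frame reg (support D)) where

      open Normalised avoids st W e u public
      open PlaneOptions D fr using (P; plane-sum)

      P′ : Pair → ℤ
      P′ q = P q ℤ.- u

      plane-sum′ : ∀ i l → P′ (main i l false) ℤ.+ P′ (main i l true) ≡ P′ (main i d₁ false) ℤ.+ P′ (main i d₁ true)
      plane-sum′ i l = ≡-trans (lem (P (main i l false)) (P (main i l true)) u)
        (≡-trans (cong (λ s → s ℤ.- (u ℤ.+ u)) (plane-sum i l)) (sym (lem (P (main i d₁ false)) (P (main i d₁ true)) u)))
        where
        lem : ∀ x y u → (x ℤ.- u) ℤ.+ (y ℤ.- u) ≡ (x ℤ.+ y) ℤ.- (u ℤ.+ u)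
        lem = solve-∀

      opts : ∀ n ps → n ℕ.≤ length sp → Bool.T (valid reg ps) → n ℕ.+ length ps ≡ W → O (sum-by P′ ps)
      opts n ps n≤ v eq = subst O (ℤ.+-identityˡ (sum-by P′ ps)) (mixed {D = D} {xs = []} {ps} {st} {e} fr ts us n≤ [] i v eq)

      opts-const : ∀ n ps {a} → n ℕ.≤ length sp → Bool.T (valid reg ps) → n ℕ.+ length ps ≡ W → All (λ q → P′ q ≋ a) ps → O (+ length ps ℤ.* a)
      opts-const n ps {a} n≤ v eq es = resp {+ length ps ℤ.* a} {sum-by P′ ps} (≋-sym (sum-≋ P′ {a} {ps} es)) (opts n ps n≤ v eq)

      opts-one : ∀ n q ps {a} → n ℕ.≤ length sp → Bool.T (valid reg (q ∷ ps)) → n ℕ.+ suc (length ps) ≡ W → All (λ q → P′ q ≋ a) ps → O (P′ q ℤ.+ + length ps ℤ.* a)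
      opts-one n q ps {a} n≤ v eq es = resp {P′ q ℤ.+ + length ps ℤ.* a} {P′ q ℤ.+ sum-by P′ ps} (≋-by (lem (P′ q) (+ length ps ℤ.* a) (sum-by P′ ps)) (≋-sym (sum-≋ P′ {a} {ps} es))) (opts n (q ∷ ps) n≤ v eq)
        where
        lem : ∀ x y z → y ℤ.- z ≡ (x ℤ.+ y) ℤ.- (x ℤ.+ z)
        lem = solve-∀

    Constant : (Pair → ℤ) → ℤ → Set
    Constant P a = ∀ i l h → P (main i l h) ≋ a

    module Main {ms sp R′ D u} (st : Stage S ms (flat sp ++ R′)) (e : 4 ℕ.+ length ms ≡ p)
      (ts : All Twin sp) (us : All (λ b → block-value b ≋ u) sp) (2≤ : 2 ℕ.≤ length sp) (hs : All (Has u) ms)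
      (i : D ⊑ R′) (fr : Frame offaxis (support D)) (3<p : 3 ℕ.< p) where

      open Setting {W = 4} st e ts us i fr

      few₄ : ∀ {vs} → Distinct vs → All O vs → length vs ≢ 4
      few₄ = few (s≤s z≤n)

      -- Two planes share a value `a`, which is nonzero because `2a` is an option. A pair of the
      -- third plane combined with one, two or three pairs of value `a` gives the progression that
      -- forces its value to be `a` as well.
      constant : ∃[ a ] ¬ Z a × Constant P′ a
      constant = finish′ (TwoPlanes.planes₄ P′ plane-sum′ {O} resp 3<p (nonzero-O hs) few₄
          (λ x y v → opts 2 (x ∷ y ∷ []) 2≤ v refl) (λ x y z w v → opts 0 (x ∷ y ∷ z ∷ w ∷ []) z≤n v refl))
        where
        finish′ : ∃[ k ] ∃[ q ] (∀ l h → P′ (main (left k) l h) ≋ q) × (∀ l h → P′ (main (right k) l h) ≋ q) → ∃[ a ] ¬ Z a × Constant P′ a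
        finish′ (k , a , lf , rt) = a , a≢0 , all k lf rt last-plane
          where
          plane : Plane → List Pair
          plane j = main j d₁ false ∷ main j d₁ true ∷ []
          o₂ : O (+ 2 ℤ.* a)
          o₂ = opts-const 2 (plane (left k)) 2≤ (allPlanes-sound (λ k → valid offaxis (plane (left k))) tt k) refl (lf d₁ false ∷ lf d₁ true ∷ [])
          o₄ : O (+ 4 ℤ.* a)
          o₄ = opts-const 0 (plane (left k) ++ plane (right k)) z≤n (allPlanes-sound (λ k → valid offaxis (plane (left k) ++ plane (right k))) tt k) refl
            (lf d₁ false ∷ lf d₁ true ∷ rt d₁ false ∷ rt d₁ true ∷ [])
          a≢0 : ¬ Z a
          a≢0 z = nonzero-O hs o₂ (Z-* (+ 2) z)
          everywhere : (Plane → Dir → Bool → Bool) → Bool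
          everywhere f = allPlanes λ k → allDirs λ l → allHalves (f k l)
          at-all : ∀ f → Bool.T (everywhere f) → ∀ k l h → Bool.T (f k l h)
          at-all f t k l h = allHalves-sound (f k l) (allDirs-sound (λ l → allHalves (f k l)) (allPlanes-sound (λ k → allDirs λ l → allHalves (f k l)) t k) l) h
          ps₁ ps₂ ps₃ : Plane → Dir → List Pair
          ps₁ k l = main (left k) l false ∷ []
          ps₂ k l = main (left k) (second l) false ∷ main (right k) (third l) false ∷ []
          ps₃ k l = main (left k) l false ∷ main (left k) l true ∷ main (right k) l false ∷ []
          last-plane : ∀ l h → P′ (main k l h) ≋ a
          last-plane l h = Steps.progression 3<p a≢0 {O} few₄ (P′ (main k l h)) o₂ o₄
            (subst (λ x → O (P′ (main k l h) ℤ.+ x)) (ℤ.*-identityˡ a)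
              (opts-one 2 (main k l h) (ps₁ k l) 2≤ (at-all (λ k l h → valid offaxis (main k l h ∷ ps₁ k l)) tt k l h) refl (lf l false ∷ [])))
            (opts-one 1 (main k l h) (ps₂ k l) (ℕ.≤-trans (s≤s z≤n) 2≤) (at-all (λ k l h → valid offaxis (main k l h ∷ ps₂ k l)) tt k l h) refl (lf (second l) false ∷ rt (third l) false ∷ []))
            (opts-one 0 (main k l h) (ps₃ k l) z≤n (at-all (λ k l h → valid offaxis (main k l h ∷ ps₃ k l)) tt k l h) refl (lf l false ∷ lf l true ∷ rt l false ∷ []))
          all : ∀ k → (∀ l h → P′ (main (left k) l h) ≋ a) → (∀ l h → P′ (main (right k) l h) ≋ a) → (∀ l h → P′ (main k l h) ≋ a) → Constant P′ a
          all Π₁ lf rt la Π₁ = la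
          all Π₁ lf rt la Π₂ = lf
          all Π₁ lf rt la Π₃ = rt
          all Π₂ lf rt la Π₁ = lf
          all Π₂ lf rt la Π₂ = la
          all Π₂ lf rt la Π₃ = rt
          all Π₃ lf rt la Π₁ = lf
          all Π₃ lf rt la Π₂ = rt
          all Π₃ lf rt la Π₃ = la

    two-spares : ∀ {u₁ u₂ : Blk} → ∀ b c D → flat (b ∷ c ∷ []) ++ (flat (u₁ ∷ u₂ ∷ []) ++ D) ↭ flat (u₁ ∷ u₂ ∷ []) ++ (flat (b ∷ c ∷ []) ++ D)
    two-spares {u₁} {u₂} b c D = shifts (flat (b ∷ c ∷ [])) (flat (u₁ ∷ u₂ ∷ []))

    -- Each couple has the value `u` on at least one side; after flipping, what is shown for the
    -- partner of a block of value `u` provides a block of value `x` in every couple.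
    oriented : ∀ {ms R u x} → Stage S ms R → All (Has u) ms →
               (∀ {b c ms′} → Stage S ((b , c) ∷ ms′) R → length ms ≡ suc (length ms′) → block-value b ≋ u → All (Has u) ms′ → block-value c ≋ x) →
               All (Has x) ms
    oriented {ms} {R} {u} {x} st hs f = for-each one
      where
      one : ∀ {b c ms′} → ms ↭ (b , c) ∷ ms′ → Has x (b , c)
      one {b} {c} {ms′} σ = side (All-resp-↭ σ hs)
        where
        st′ = stage-↭ σ st
        side : All (Has u) ((b , c) ∷ ms′) → Has x (b , c)
        side (inj₁ h ∷ hs′) = inj₂ (f st′ (↭-length σ) h hs′)
        side (inj₂ h ∷ hs′) = inj₁ (f (flip-pair st′) (↭-length σ) h hs′)

    -- A dissolved couple with one block of value `u` raises the weight to 4. All pairs then have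
    -- normalised value `a₀`, and so does the other block. Thus `u + a₀` occurs in every couple and
    -- three pairs contribute three more copies of it.
    thirteen-rest : ∀ {ms u₁ u₂ u D} → Stage S ms (flat (u₁ ∷ u₂ ∷ []) ++ D) → 3 ℕ.+ length ms ≡ p → Twin u₁ → Twin u₂ →
                    block-value u₁ ≋ u → block-value u₂ ≋ u → All (Has u) ms → Separated D → length D ≡ 13 → ⊥
    thirteen-rest {ms} {u₁} {u₂} {u} {D} st e t₁ t₂ h₁ h₂ hs ds thirteen = split-p ms st e hs
      where
      fr = thirteen-frame (support D) (≡-trans (count-support ds) thirteen)
      open PlaneOptions D fr using (P)
      sp = u₁ ∷ u₂ ∷ []
      ts : All Twin sp
      ts = t₁ ∷ t₂ ∷ []
      us : All (λ b → block-value b ≋ u) sp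
      us = h₁ ∷ h₂ ∷ []
      -- A fixed pair supplies the common value, so that it does not vary with the couple that is
      -- dissolved.
      a₀ = P (main Π₁ d₁ false) ℤ.- u

      step : ∀ {b c ms′} → Stage S ((b , c) ∷ ms′) (flat sp ++ D) → 4 ℕ.+ length ms′ ≡ p → block-value b ≋ u → All (Has u) ms′ →
             block-value c ≋ u ℤ.+ a₀ × Constant (λ q → P q ℤ.- u) a₀
      step {b} {c} {ms′} st₀ e₀ hb hs′ = (≋-trans (mk≋ (subst Z (lem (block-value c) u a) (un≋ c≋a))) (≋-by (lem′ u a a₀) (≋-sym (con Π₁ d₁ false))))
          , λ i l h → ≋-trans (con i l h) (≋-sym (con Π₁ d₁ false))
        where
        3<p : 3 ℕ.< p
        3<p = subst (3 ℕ.<_) e₀ (s≤s (s≤s (s≤s (s≤s z≤n))))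
        tc = proj₂ (pull-twins st₀)
        R′ = flat (b ∷ c ∷ []) ++ D
        st₁ : Stage S ms′ (flat sp ++ R′)
        st₁ = stage-R (two-spares b c D) (pull st₀)
        i : D ⊑ R′
        i = ⊑-++ˡ (flat (b ∷ c ∷ [])) D
        ic : (flat [ c ] ++ D) ⊑ R′
        ic = ⊑-++ˡ (flat [ b ]) (flat [ c ] ++ D)
        open Main {sp = sp} st₁ e₀ ts us (s≤s (s≤s z≤n)) hs′ i fr 3<p using (constant; few₄)
        open Setting {sp = sp} {W = 4} st₁ e₀ ts us i fr using (O; resp; opts-const; P′)
        a = proj₁ constant
        a≢0 = proj₁ (proj₂ constant)
        con : Constant P′ a
        con = proj₂ (proj₂ constant)
        β′ = block-value c ℤ.- u
        β′≢0 : ¬ Z β′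
        β′≢0 z = All.head (Stage.unlike st₀) (≋-trans hb (≋-sym (mk≋ z)))
        with-c : ∀ n ps → n ℕ.≤ 2 → Bool.T (valid offaxis ps) → n ℕ.+ suc (length ps) ≡ 4 → All (λ q → P′ q ≋ a) ps → O (+ length ps ℤ.* a ℤ.+ β′)
        with-c n ps n≤ v eq es = resp {+ length ps ℤ.* a ℤ.+ β′} {(β′ ℤ.+ 0ℤ) ℤ.+ sum-by P′ ps} (≋-by (lem₀ β′ (+ length ps ℤ.* a) (sum-by P′ ps)) (≋-sym (sum-≋ P′ {a} {ps} es))) (mixed {D = D} {xs = c ∷ []} {ps} {st₁} {e₀} fr ts us n≤ (tc ∷ []) ic v eq)
          where
          lem₀ : ∀ b y z → y ℤ.- z ≡ (y ℤ.+ b) ℤ.- ((b ℤ.+ 0ℤ) ℤ.+ z)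
          lem₀ = solve-∀
        ps₂ ps₃ ps₄ : List Pair
        ps₂ = main Π₁ d₁ false ∷ main Π₁ d₁ true ∷ []
        ps₃ = main Π₁ d₁ false ∷ main Π₂ d₂ false ∷ main Π₃ d₃ false ∷ []
        ps₄ = main Π₁ d₁ false ∷ main Π₁ d₁ true ∷ main Π₂ d₁ false ∷ main Π₂ d₁ true ∷ []
        c₂ : All (λ q → P′ q ≋ a) ps₂
        c₂ = con Π₁ d₁ false ∷ con Π₁ d₁ true ∷ []
        c₃ : All (λ q → P′ q ≋ a) ps₃
        c₃ = con Π₁ d₁ false ∷ con Π₂ d₂ false ∷ con Π₃ d₃ false ∷ []
        c₄ : All (λ q → P′ q ≋ a) ps₄
        c₄ = con Π₁ d₁ false ∷ con Π₁ d₁ true ∷ con Π₂ d₁ false ∷ con Π₂ d₁ true ∷ []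
        c≋a : β′ ≋ a
        c≋a = Steps.increment₃ 3<p a≢0 {O} few₄ β′≢0
          (opts-const 2 ps₂ ℕ.≤-refl tt refl c₂) (opts-const 1 ps₃ (s≤s z≤n) tt refl c₃) (opts-const 0 ps₄ z≤n tt refl c₄)
          (with-c 1 ps₂ (s≤s z≤n) tt refl c₂) (with-c 0 ps₃ z≤n tt refl c₃)
        lem : ∀ c u a → (c ℤ.- u) ℤ.- a ≡ c ℤ.- (u ℤ.+ a)
        lem = solve-∀
        lem′ : ∀ u a b → a ℤ.- b ≡ (u ℤ.+ a) ℤ.- (u ℤ.+ b)
        lem′ = solve-∀

      large : ∀ {b c ms′} → Stage S ((b , c) ∷ ms′) (flat sp ++ D) → 4 ℕ.+ length ms′ ≡ p → All (Has u) ((b , c) ∷ ms′) → ⊥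
      large {b} {c} {ms′} st₀ e₀ (h ∷ hs′) = finish avoids st₀ has (opt-⊑ (⊑-++ˡ (flat sp) D) (PlaneOptions.pairs-opt D fr ps₃ tt)) e₀
          (mk≋ (subst Z (lem (sum-by P ps₃) (sum-by (λ q → P q ℤ.- u) ps₃) (+ suc (length ms′)) u a₀)
            (Z-+ (Z-+ (Z-neg (un≋ (≡⇒≋ (sum-shift P u ps₃)))) (un≋ (sum-≋ (λ q → P q ℤ.- u) {a₀} {ps₃} (con Π₁ d₁ false ∷ con Π₂ d₂ false ∷ con Π₃ d₃ false ∷ []))))
                 (multiple (u ℤ.+ a₀) e₀))))
        where
        ps₃ : List Pair
        ps₃ = main Π₁ d₁ false ∷ main Π₂ d₂ false ∷ main Π₃ d₃ false ∷ []
        con : Constant (λ q → P q ℤ.- u) a₀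
        con = side h
          where
          side : Has u (b , c) → Constant (λ q → P q ℤ.- u) a₀
          side (inj₁ hb) = proj₂ (step st₀ e₀ hb hs′)
          side (inj₂ hc) = proj₂ (step (flip-pair st₀) e₀ hc hs′)
        has : All (Has (u ℤ.+ a₀)) ((b , c) ∷ ms′)
        has = oriented st₀ (h ∷ hs′) λ st′ len hb hs″ → proj₁ (step st′ (≡-trans (cong (4 ℕ.+_) (sym (ℕ.suc-injective len))) e₀) hb hs″)
        lem : ∀ s s′ n u a → (ℤ.- (s′ ℤ.- (s ℤ.- + 3 ℤ.* u)) ℤ.+ (s′ ℤ.- + 3 ℤ.* a)) ℤ.+ (+ 3 ℤ.+ n) ℤ.* (u ℤ.+ a) ≡ (s ℤ.+ n ℤ.* (u ℤ.+ a)) ℤ.- 0ℤ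
        lem = solve-∀

      split-p : ∀ ms → Stage S ms (flat sp ++ D) → 3 ℕ.+ length ms ≡ p → All (Has u) ms → ⊥
      split-p (_ ∷ _) st e hs = large st e hs
      split-p []      st e hs = small (TwoPlanes.planes₃ P′ plane-sum′ {O} resp (few (s≤s z≤n)) (λ x y v → opts 1 (x ∷ y ∷ []) (s≤s z≤n) v refl))
        where
        open Setting {sp = sp} {W = 3} st e ts us ⊑-refl fr
        -- p = 3: the pairs of the third plane have value 0, hence so does that plane.
        small : ∃[ k ] ∃[ q ] (∀ l h → P′ (main (left k) l h) ≋ q) × (∀ l h → P′ (main (right k) l h) ≋ q) → ⊥
        small (k , a , lf , rt) = nonzero-O [] (opts 1 (plane k) (s≤s z≤n) (allPlanes-sound (λ k → valid offaxis (plane k)) tt k) refl)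
            (Z-+ (null false) (Z-+ (null true) Z-0))
          where
          plane : Plane → List Pair
          plane j = main j d₁ false ∷ main j d₁ true ∷ []
          ps₁ ps₂ : Plane → List Pair
          ps₁ k = main (left k) d₁ false ∷ []
          ps₂ k = main (left k) d₂ false ∷ main (right k) d₃ false ∷ []
          both : (Plane → Bool → Bool) → Bool
          both f = allPlanes λ k → allHalves (f k)
          at-both : ∀ f → Bool.T (both f) → ∀ k h → Bool.T (f k h)
          at-both f t k = allHalves-sound (f k) (allPlanes-sound (λ k → allHalves (f k)) t k)
          a≢0 : ¬ Z a
          a≢0 z = nonzero-O [] (opts-const 1 (plane (left k)) (s≤s z≤n) (allPlanes-sound (λ k → valid offaxis (plane (left k))) tt k) refl (lf d₁ false ∷ lf d₁ true ∷ []))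
            (Z-* (+ 2) z)
          -- Modulo 3 the residues 0, `- a` and `- 2a` are all there are, and options with one or
          -- two pairs of value `a` exclude the last two.
          null : ∀ h → Z (P′ (main k d₁ h))
          null h = decidable-stable (Z? x) λ x≢0 → contradiction (Distinct⇒length≤ (distinct x≢0)) (ℕ.<⇒≱ (subst (ℕ._< 4) e ℕ.≤-refl))
            where
            x = P′ (main k d₁ h)
            x+a : ¬ Z (x ℤ.+ + 1 ℤ.* a)
            x+a = nonzero-O [] (opts-one 1 (main k d₁ h) (ps₁ k) (s≤s z≤n) (at-both (λ k h → valid offaxis (main k d₁ h ∷ ps₁ k)) tt k h) refl (lf d₁ false ∷ []))
            x+2a : ¬ Z (x ℤ.+ + 2 ℤ.* a)
            x+2a = nonzero-O [] (opts-one 0 (main k d₁ h) (ps₂ k) z≤n (at-both (λ k h → valid offaxis (main k d₁ h ∷ ps₂ k)) tt k h) refl (lf d₂ false ∷ rt d₃ false ∷ []))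
            distinct : ¬ Z x → Distinct (x ∷ 0ℤ ∷ ℤ.- (+ 1 ℤ.* a) ∷ ℤ.- (+ 2 ℤ.* a) ∷ [])
            distinct x≢0 = (≢-by x≢0 (ℤ.+-identityʳ x) ∷ ≢-by x+a (cong (λ z → x ℤ.+ z) (ℤ.neg-involutive (+ 1 ℤ.* a))) ∷ ≢-by x+2a (cong (λ z → x ℤ.+ z) (ℤ.neg-involutive (+ 2 ℤ.* a))) ∷ [])
              ∷ (≢-by a≢0 (lem₁ a) ∷ ≢-by (twice a≢0) (lem₂ a) ∷ []) ∷ (≢-by a≢0 (lem₃ a) ∷ []) ∷ [] ∷ []
              where
              lem₁ : ∀ a → 0ℤ ℤ.- ℤ.- (+ 1 ℤ.* a) ≡ a
              lem₁ = solve-∀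
              lem₂ : ∀ a → 0ℤ ℤ.- ℤ.- (+ 2 ℤ.* a) ≡ + 2 ℤ.* a
              lem₂ = solve-∀
              lem₃ : ∀ a → ℤ.- (+ 1 ℤ.* a) ℤ.- ℤ.- (+ 2 ℤ.* a) ≡ a
              lem₃ = solve-∀

opt-sum : ∀ D {n k} → Summing (support D) k 0ᵛ → (k≡ : k ≡ 2 ℕ.* n) → ∃[ v ] Opt D n v × ∃[ vs ] All (_∈ˢ support D) vs × length vs ≡ k × v ≡ sum-by (value D) vs
opt-sum D (summing ps u i refl s) k≡ = _ , opt-members D u i k≡ s , ps , i , refl , refl

opt-with : ∀ w D {n k} → Summing (support D) k (class w) → suc k ≡ 2 ℕ.* n →
           ∃[ v ] Opt (w ∷ D) n (proj₂ w ℤ.+ v) × ∃[ vs ] All (_∈ˢ support D) vs × length vs ≡ k × v ≡ sum-by (value D) vs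
opt-with w D (summing ps u i refl s) k≡ = _ , record
    { items = w ∷ members D ps
    ; within = let (U , π) = members-⊑ D u i in U , prep w π
    ; weight = ≡-trans (cong suc (length-map _ ps)) k≡
    ; closed = ≡-trans (cong (class w ⊕ᵛ_) (≡-trans (cong xsum (classes-members D ps)) s)) (⊕ᵛ-self (class w))
    ; amount = cong (λ z → proj₂ w ℤ.+ z) (total-members D ps) }
  , ps , i , refl , refl

-- Remainders in which all items have equal value, and fifteen classes with three spare blocks

module Thirteen (p : ℕ) (prime : Prime p) (odd : ¬ + p ℤ.∣ + 2) where

  open ManyPoints p prime odd public

  quarter : ∀ {x y} → 4· x ≋ 4· y → x ≋ y
  quarter {x} {y} (mk≋ d) = mk≋ (halve (halve (subst Z (lem x y) d)))
    where
    lem : ∀ x y → ((x ℤ.+ x) ℤ.+ (x ℤ.+ x)) ℤ.- ((y ℤ.+ y) ℤ.+ (y ℤ.+ y)) ≡ ((x ℤ.- y) ℤ.+ (x ℤ.- y)) ℤ.+ ((x ℤ.- y) ℤ.+ (x ℤ.- y))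
    lem = solve-∀

  module Monochrome {D : List Item} {α : ℤ} (mono : ∀ {x} → x ∈ D → proj₂ x ≋ α) where

    mono-sum : ∀ {vs} → All (_∈ˢ support D) vs → sum-by (value D) vs ≋ + length vs ℤ.* α
    mono-sum is = sum-≋ (value D) (All.map (λ v∈ → mono (support-∈ D v∈)) is)

    mono-opt : ∀ {n k} → Summing (support D) k 0ᵛ → k ≡ 2 ℕ.* n → ∃[ v ] Opt D n v × v ≋ + k ℤ.* α
    mono-opt s k≡ with opt-sum D s k≡
    ... | v , o , vs , is , refl , refl = v , o , mono-sum is

    mono-with : ∀ w {n k} → Summing (support D) k (class w) → suc k ≡ 2 ℕ.* n → ∃[ v ] Opt (w ∷ D) n v × v ≋ proj₂ w ℤ.+ + k ℤ.* α
    mono-with w s k≡ with opt-with w D s k≡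
    ... | v , o , vs , is , refl , refl = proj₂ w ℤ.+ v , o , ≋-by (lem (proj₂ w) v (+ length vs ℤ.* α)) (mono-sum is)
      where
      lem : ∀ w v a → v ℤ.- a ≡ (w ℤ.+ v) ℤ.- (w ℤ.+ a)
      lem = solve-∀

  module _ {S : List Item} (avoids : Avoids S) where

    among₂ : ∀ {ms R u v w u′ v′ w′} → Stage S ms R → 3 ℕ.+ length ms ≡ p → Opt R 3 u → Opt R 3 v → Opt R 3 w →
             u ≋ u′ → v ≋ v′ → w ≋ w′ → ¬ u′ ≋ v′ → w′ ≋ u′ ⊎ w′ ≋ v′
    among₂ {u = u} {v} {w} {u′} {v′} {w′} st e ou ov ow eu ev ew n = go (w ≋? u) (w ≋? v)
      where
      go : Dec (w ≋ u) → Dec (w ≋ v) → w′ ≋ u′ ⊎ w′ ≋ v′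
      go (yes d) _       = inj₁ (≋-trans (≋-sym ew) (≋-trans d eu))
      go (no _)  (yes d) = inj₂ (≋-trans (≋-sym ew) (≋-trans d ev))
      go (no n₁) (no n₂) = ⊥-elim (core avoids st e (ow ∷ ou ∷ ov ∷ []) (s≤s z≤n) (s≤s (s≤s (s≤s z≤n)))
        ((n₁ ∷ n₂ ∷ []) ∷ ((λ uv → n (≋-trans (≋-sym eu) (≋-trans uv ev))) ∷ []) ∷ [] ∷ []))

    -- Every item of the remainder is normal, and quarters are unique modulo an odd prime, so all
    -- items have one value `α`. It remains to find the block value `2α` in every couple; then the
    -- reference quadruple and these blocks sum to `2p α`.
    thirteen-full : ∀ {ms D} → Stage S ms D → 2 ℕ.+ length ms ≡ p → Separated D → length D ≡ 13 → ⊥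
    thirteen-full {ms} {D} st e ds thirteen = finish avoids st has q e (mk≋ (subst Z (lem κ α (+ length ms))
        (Z-+ (Z-neg (un≋ α-norm)) (multiple (α ℤ.+ α) e))))
      where
      11≤ : 11 ℕ.≤ length D
      11≤ = subst (11 ℕ.≤_) (sym thirteen) (ℕ.m≤m+n 11 2)
      κ = proj₁ (some-quad ds 11≤)
      q = proj₂ (some-quad ds 11≤)
      quads : Quads (support D) (value D) κ
      quads = table-quads ⊑-refl λ o → agree avoids st e o q
      norm : ∀ {x} → x ∈ D → 4· (proj₂ x) ≋ κ
      norm = large-value ds (eleven 11≤) quads
      first : ∀ (E : List Item) → length E ≡ 13 → ∃[ x ] x ∈ E
      first (x ∷ _) _ = x , here refl
      α = proj₂ (proj₁ (first D thirteen))
      α-norm : 4· α ≋ κ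
      α-norm = norm (proj₂ (first D thirteen))
      t = support D
      c13 : count t ≡ 13
      c13 = ≡-trans (count-support ds) thirteen
      open Monochrome {D} {α} (λ x∈ → quarter (≋-trans (norm x∈) (≋-sym α-norm)))
      lem : ∀ κ α n → ℤ.- (((α ℤ.+ α) ℤ.+ (α ℤ.+ α)) ℤ.- κ) ℤ.+ (+ 2 ℤ.+ n) ℤ.* (α ℤ.+ α) ≡ (κ ℤ.+ n ℤ.* (α ℤ.+ α)) ℤ.- 0ℤ
      lem = solve-∀
      has : All (Has (α ℤ.+ α)) ms
      has = for-each one
        where
        one : ∀ {b c ms′} → ms ↭ (b , c) ∷ ms′ → Has (α ℤ.+ α) (b , c)
        one {b@(x , x′)} {c} {ms′} σ = choose (block-value c ≋? α ℤ.+ α)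
          where
          st₁ = pull (stage-↭ σ st)
          e₁ : 3 ℕ.+ length ms′ ≡ p
          e₁ = ≡-trans (cong (2 ℕ.+_) (sym (↭-length σ))) e
          tc = proj₂ (pull-twins (stage-↭ σ st))
          R = flat (b ∷ c ∷ []) ++ D
          -- Write `w = α + δ` and `c = 2α + γ`. Up to the common summand `6α` there are options 0,
          -- `γ`, `δ` and `γ + δ`, of which at most two may differ. As `γ` is nonzero, `δ` must
          -- vanish: the alternative `δ = γ` with `γ + δ = 0` gives `2γ = 0`.
          plain : ∀ w → (flat [ c ] ++ (w ∷ D)) ⊑ R → ¬ block-value c ≋ α ℤ.+ α → proj₂ w ≋ α
          plain w i c≢ = decide (among₂ st₁ e₁ six four+c w-six s₆ s₄ s₆w n) (among₂ st₁ e₁ six four+c w-four+c s₆ s₄ s₄w n)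
            where
            iD : D ⊑ (flat [ c ] ++ (w ∷ D))
            iD = ⊑-++ˡ (flat [ c ] ++ [ w ]) D
            open Σ (mono-opt {n = 3} (six₁₃ t c13 0ᵛ) refl) renaming (proj₁ to v₆; proj₂ to r₆)
            open Σ (mono-opt {n = 2} (four₁₃ t c13 0ᵛ) refl) renaming (proj₁ to v₄; proj₂ to r₄)
            open Σ (mono-with w {n = 3} (five₁₃ t c13 (class w)) refl) renaming (proj₁ to v₅; proj₂ to r₅)
            open Σ (mono-with w {n = 2} (three₁₃ t c13 (class w)) refl) renaming (proj₁ to v₃; proj₂ to r₃)
            β = block-value c
            six : Opt R 3 v₆
            six = opt-⊑ i (opt-⊑ iD (proj₁ r₆))
            c-block : Opt (flat [ c ]) 1 (β ℤ.+ 0ℤ)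
            c-block = opt-blocks (tc ∷ [])
            four+c : Opt R 3 (β ℤ.+ 0ℤ ℤ.+ v₄)
            four+c = opt-⊑ i (opt-++ c-block (opt-⊑ (⊑-++ˡ [ w ] D) (proj₁ r₄)))
            w-six : Opt R 3 v₅
            w-six = opt-⊑ i (opt-⊑ (⊑-++ˡ (flat [ c ]) (w ∷ D)) (proj₁ r₅))
            w-four+c : Opt R 3 (β ℤ.+ 0ℤ ℤ.+ v₃)
            w-four+c = opt-⊑ i (opt-++ c-block (proj₁ r₃))
            s₆ : v₆ ≋ + 6 ℤ.* α
            s₆ = proj₂ r₆
            add : ∀ {v z} → v ≋ z → β ℤ.+ 0ℤ ℤ.+ v ≋ β ℤ.+ z
            add {v} {z} = ≋-by (lem₀ β v z)
              where
              lem₀ : ∀ b v z → v ℤ.- z ≡ (b ℤ.+ 0ℤ ℤ.+ v) ℤ.- (b ℤ.+ z)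
              lem₀ = solve-∀
            s₄ : β ℤ.+ 0ℤ ℤ.+ v₄ ≋ β ℤ.+ + 4 ℤ.* α
            s₄ = add (proj₂ r₄)
            s₆w : v₅ ≋ proj₂ w ℤ.+ + 5 ℤ.* α
            s₆w = proj₂ r₅
            s₄w : β ℤ.+ 0ℤ ℤ.+ v₃ ≋ β ℤ.+ (proj₂ w ℤ.+ + 3 ℤ.* α)
            s₄w = add (proj₂ r₃)
            n : ¬ + 6 ℤ.* α ≋ β ℤ.+ + 4 ℤ.* α
            n d = c≢ (≋-sym (≋-by (lem₁ α β) d))
              where
              lem₁ : ∀ α β → + 6 ℤ.* α ℤ.- (β ℤ.+ + 4 ℤ.* α) ≡ (α ℤ.+ α) ℤ.- β
              lem₁ = solve-∀
            decide : proj₂ w ℤ.+ + 5 ℤ.* α ≋ + 6 ℤ.* α ⊎ proj₂ w ℤ.+ + 5 ℤ.* α ≋ β ℤ.+ + 4 ℤ.* α →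
                     β ℤ.+ (proj₂ w ℤ.+ + 3 ℤ.* α) ≋ + 6 ℤ.* α ⊎ β ℤ.+ (proj₂ w ℤ.+ + 3 ℤ.* α) ≋ β ℤ.+ + 4 ℤ.* α → proj₂ w ≋ α
            decide (inj₁ d) _ = ≋-by (lem₁ (proj₂ w) α) d
              where
              lem₁ : ∀ w α → (w ℤ.+ + 5 ℤ.* α) ℤ.- + 6 ℤ.* α ≡ w ℤ.- α
              lem₁ = solve-∀
            decide _ (inj₂ d) = ≋-by (lem₁ (proj₂ w) α β) d
              where
              lem₁ : ∀ w α β → (β ℤ.+ (w ℤ.+ + 3 ℤ.* α)) ℤ.- (β ℤ.+ + 4 ℤ.* α) ≡ w ℤ.- α
              lem₁ = solve-∀
            decide (inj₂ d) (inj₁ d′) = contradiction (mk≋ (halve (subst Z (lem₁ (proj₂ w) α β) (Z-+ (un≋ d′) (Z-neg (un≋ d)))))) c≢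
              where
              lem₁ : ∀ w α β → ((β ℤ.+ (w ℤ.+ + 3 ℤ.* α)) ℤ.- + 6 ℤ.* α) ℤ.- ((w ℤ.+ + 5 ℤ.* α) ℤ.- (β ℤ.+ + 4 ℤ.* α)) ≡ (β ℤ.- (α ℤ.+ α)) ℤ.+ (β ℤ.- (α ℤ.+ α))
              lem₁ = solve-∀
          choose : Dec (block-value c ≋ α ℤ.+ α) → Has (α ℤ.+ α) (b , c)
          choose (yes d) = inj₂ d
          choose (no n)  = inj₁ (mk≋ (subst Z (lem₂ (proj₂ x) (proj₂ x′) α) (Z-+ (un≋ (plain x i₁ n)) (un≋ (plain x′ i₂ n)))))
            where
            open Bag using (_⊕_; _⊜_)
            i₁ : (flat [ c ] ++ (x ∷ D)) ⊑ R
            i₁ = [ x′ ] , Bag.solve 4 (λ x x′ c d → x ⊕ (x′ ⊕ (c ⊕ d)) ⊜ (c ⊕ (x ⊕ d)) ⊕ x′) refl [ x ] [ x′ ] (flat [ c ]) D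
            i₂ : (flat [ c ] ++ (x′ ∷ D)) ⊑ R
            i₂ = [ x ] , Bag.solve 4 (λ x x′ c d → x ⊕ (x′ ⊕ (c ⊕ d)) ⊜ (c ⊕ (x′ ⊕ d)) ⊕ x) refl [ x ] [ x′ ] (flat [ c ]) D
            lem₂ : ∀ x y a → (x ℤ.- a) ℤ.+ (y ℤ.- a) ≡ (x ℤ.+ y) ℤ.- (a ℤ.+ a)
            lem₂ = solve-∀

    fifteen-rest : ∀ {ms u₁ u₂ u₃ u D} → Stage S ms (flat (u₁ ∷ u₂ ∷ u₃ ∷ []) ++ D) → 4 ℕ.+ length ms ≡ p →
                   All Twin (u₁ ∷ u₂ ∷ u₃ ∷ []) → All (λ b → block-value b ≋ u) (u₁ ∷ u₂ ∷ u₃ ∷ []) →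
                   All (Has u) ms → Separated D → length D ≡ 15 → ⊥
    fifteen-rest {ms} {u₁} {u₂} {u₃} {u} {D} st e ts us hs ds fifteen =
        finish avoids st has (opt-⊑ (⊑-++ˡ (flat sp) D) (PlaneOptions.pairs-opt D fr ps₄ tt)) e
          (mk≋ (subst Z (lem (sum-by P ps₄) (sum-by (λ q → P q ℤ.- u) ps₄) (+ length ms) u a)
            (Z-+ (Z-+ (Z-neg (un≋ (≡⇒≋ (sum-shift P u ps₄)))) (un≋ (sum-≋ (λ q → P q ℤ.- u) {a} {ps₄} c₄))) (multiple (u ℤ.+ a) e))))
      where
      fr = proj₁ (fifteen-frame (support D) (≡-trans (count-support ds) fifteen))
      open PlaneOptions D fr using (P)
      sp = u₁ ∷ u₂ ∷ u₃ ∷ []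
      3<p : 3 ℕ.< p
      3<p = subst (3 ℕ.<_) e (s≤s (s≤s (s≤s (s≤s z≤n))))
      open Main avoids {sp = sp} st e ts us (s≤s (s≤s z≤n)) hs ⊑-refl (frame-restrict fr) 3<p using (constant; few₄)
      open Setting avoids {sp = sp} {W = 4} st e ts us ⊑-refl fr
      a = proj₁ constant
      a≢0 = proj₁ (proj₂ constant)
      con : Constant avoids P′ a
      con = proj₂ (proj₂ constant)
      ps₂ ps₃ ps₄ ps₅ : List Pair
      ps₂ = main Π₁ d₁ false ∷ main Π₁ d₁ true ∷ []
      ps₃ = main Π₁ d₁ false ∷ main Π₂ d₂ false ∷ main Π₃ d₃ false ∷ []
      ps₄ = main Π₁ d₁ false ∷ main Π₁ d₁ true ∷ main Π₂ d₁ false ∷ main Π₂ d₁ true ∷ []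
      -- The option `5a` needs a pair over 0: the twelve points off that plane have sum 0, so ten of
      -- them with sum 0 would leave two equal points.
      ps₅ = top d₁ ∷ main Π₁ d₂ false ∷ main Π₂ d₃ false ∷ main Π₃ d₁ false ∷ main Π₃ d₁ true ∷ []
      c₂ : All (λ q → P′ q ≋ a) ps₂
      c₂ = con Π₁ d₁ false ∷ con Π₁ d₁ true ∷ []
      c₃ : All (λ q → P′ q ≋ a) ps₃
      c₃ = con Π₁ d₁ false ∷ con Π₂ d₂ false ∷ con Π₃ d₃ false ∷ []
      c₄ : All (λ q → P′ q ≋ a) ps₄
      c₄ = con Π₁ d₁ false ∷ con Π₁ d₁ true ∷ con Π₂ d₁ false ∷ con Π₂ d₁ true ∷ []
      top-value : P′ (top d₁) ≋ a
      top-value = Steps.progression 3<p a≢0 {O} few₄ (P′ (top d₁))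
        (opts-const 2 ps₂ (s≤s (s≤s z≤n)) tt refl c₂) (opts-const 0 ps₄ z≤n tt refl c₄)
        (subst (λ x → O (P′ (top d₁) ℤ.+ x)) (ℤ.*-identityˡ a)
          (opts-one 2 (top d₁) (main Π₁ d₁ false ∷ []) (s≤s (s≤s z≤n)) tt refl (con Π₁ d₁ false ∷ [])))
        (opts-one 1 (top d₁) (main Π₁ d₂ false ∷ main Π₂ d₃ false ∷ []) (s≤s z≤n) tt refl (con Π₁ d₂ false ∷ con Π₂ d₃ false ∷ []))
        (opts-one 0 (top d₁) (main Π₁ d₁ false ∷ main Π₁ d₁ true ∷ main Π₂ d₁ false ∷ []) z≤n tt refl (con Π₁ d₁ false ∷ con Π₁ d₁ true ∷ con Π₂ d₁ false ∷ []))
      c₅ : All (λ q → P′ q ≋ a) ps₅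
      c₅ = top-value ∷ con Π₁ d₂ false ∷ con Π₂ d₃ false ∷ con Π₃ d₁ false ∷ con Π₃ d₁ true ∷ []
      lem : ∀ s s′ n u a → (ℤ.- (s′ ℤ.- (s ℤ.- + 4 ℤ.* u)) ℤ.+ (s′ ℤ.- + 4 ℤ.* a)) ℤ.+ (+ 4 ℤ.+ n) ℤ.* (u ℤ.+ a) ≡ (s ℤ.+ n ℤ.* (u ℤ.+ a)) ℤ.- 0ℤ
      lem = solve-∀
      step : ∀ {b c ms′} → Stage S ((b , c) ∷ ms′) (flat sp ++ D) → 5 ℕ.+ length ms′ ≡ p → block-value b ≋ u → block-value c ≋ u ℤ.+ a
      step {b} {c} {ms′} st₀ e₀ hb = mk≋ (subst Z (lem₁ (block-value c) u a) (un≋ c≋a))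
        where
        tc = proj₂ (pull-twins st₀)
        R′ = flat (b ∷ c ∷ []) ++ D
        st₁ : Stage S ms′ (flat sp ++ R′)
        st₁ = stage-R (shifts (flat (b ∷ c ∷ [])) (flat sp)) (pull st₀)
        i : D ⊑ R′
        i = ⊑-++ˡ (flat (b ∷ c ∷ [])) D
        ic : (flat [ c ] ++ D) ⊑ R′
        ic = ⊑-++ˡ (flat [ b ]) (flat [ c ] ++ D)
        module S₅ = Setting avoids {sp = sp} {W = 5} st₁ e₀ ts us i fr
        β′ = block-value c ℤ.- u
        β′≢0 : ¬ Z β′
        β′≢0 z = All.head (Stage.unlike st₀) (≋-trans hb (≋-sym (mk≋ z)))
        with-c : ∀ n ps → n ℕ.≤ 3 → Bool.T (valid nonzero ps) → n ℕ.+ suc (length ps) ≡ 5 → All (λ q → P′ q ≋ a) ps → S₅.O (+ length ps ℤ.* a ℤ.+ β′)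
        with-c n ps n≤ v eq es = S₅.resp {+ length ps ℤ.* a ℤ.+ β′} {(β′ ℤ.+ 0ℤ) ℤ.+ sum-by P′ ps}
          (≋-by (lem₀ β′ (+ length ps ℤ.* a) (sum-by P′ ps)) (≋-sym (sum-≋ P′ {a} {ps} es))) (mixed avoids {D = D} {xs = c ∷ []} {ps} {st₁} {e₀} fr ts us n≤ (tc ∷ []) ic v eq)
          where
          lem₀ : ∀ b y z → y ℤ.- z ≡ (y ℤ.+ b) ℤ.- ((b ℤ.+ 0ℤ) ℤ.+ z)
          lem₀ = solve-∀
        c≋a : β′ ≋ a
        c≋a = Steps.increment₄ 3<p a≢0 {S₅.O} (S₅.few (s≤s z≤n)) β′≢0
          (S₅.opts-const 3 ps₂ ℕ.≤-refl tt refl c₂) (S₅.opts-const 2 ps₃ (s≤s (s≤s z≤n)) tt refl c₃)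
          (S₅.opts-const 1 ps₄ (s≤s z≤n) tt refl c₄) (S₅.opts-const 0 ps₅ z≤n tt refl c₅)
          (with-c 2 ps₂ (s≤s (s≤s z≤n)) tt refl c₂) (with-c 1 ps₃ (s≤s z≤n) tt refl c₃) (with-c 0 ps₄ z≤n tt refl c₄)
        lem₁ : ∀ c u a → (c ℤ.- u) ℤ.- a ≡ c ℤ.- (u ℤ.+ a)
        lem₁ = solve-∀
      has : All (Has (u ℤ.+ a)) ms
      has = oriented avoids st hs λ st′ len hb _ → step st′ (≡-trans (cong (4 ℕ.+_) (sym len)) e) hb

all-or-except : {A : Set} {P : A → Set} → (∀ x → Dec (P x)) → ∀ xs → All P xs ⊎ ∃[ x ] ∃[ ys ] xs ↭ x ∷ ys × ¬ P x
all-or-except P? xs = go (All.all? P? xs)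
  where
  go : Dec (All _ xs) → _
  go (yes ps) = inj₁ ps
  go (no n)   = let (x , x∈ , ¬p) = find (All.¬All⇒Any¬ P? xs n) ; (ys , σ) = ∈⇒↭ x∈ in inj₂ (x , ys , σ , ¬p)

-- Fifteen classes with one spare block

module Fifteen (p : ℕ) (prime : Prime p) (odd : ¬ + p ℤ.∣ + 2) where

  open Thirteen p prime odd public

  among₁ : ∀ {O : ℤ → Set} → (∀ {vs} → Distinct vs → All O vs → length vs ≢ 3) → ∀ {x y} → ¬ x ≋ y → O x → O y → ∀ {w} → O w → w ≋ x ⊎ w ≋ y
  among₁ few {x} {y} xy ox oy {w} ow = go (w ≋? x) (w ≋? y)
    where
    go : Dec (w ≋ x) → Dec (w ≋ y) → w ≋ x ⊎ w ≋ y
    go (yes d) _      = inj₁ d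
    go (no _) (yes d) = inj₂ d
    go (no n) (no n′) = contradiction refl (few ((n ∷ n′ ∷ []) ∷ (xy ∷ []) ∷ [] ∷ []) (ow ∷ ox ∷ oy ∷ []))

  module Two {O : ℤ → Set} (few : ∀ {vs} → Distinct vs → All O vs → length vs ≢ 3) {X} (X≢0 : ¬ Z X) where

    private
      cancel : ∀ {x y} z → x ℤ.+ z ≋ y ℤ.+ z → x ≋ y
      cancel {x} {y} z = ≋-by (lem x y z)
        where
        lem : ∀ x y z → (x ℤ.+ z) ℤ.- (y ℤ.+ z) ≡ x ℤ.- y
        lem = solve-∀
      to-Z : ∀ {x} → x ≋ 0ℤ → Z x
      to-Z {x} (mk≋ d) = subst Z (ℤ.+-identityʳ x) d
      from-Z : ∀ {x} → Z x → x ≋ 0ℤ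
      from-Z {x} d = mk≋ (subst Z (sym (ℤ.+-identityʳ x)) d)
      double : ¬ X ℤ.+ X ≋ 0ℤ
      double d = X≢0 (halve (to-Z d))

    null-or-X : O X → ∀ {y} → O y → O (y ℤ.+ X) → y ≋ 0ℤ ⊎ y ≋ X
    null-or-X oX {y} oy oyX = go (y ≋? 0ℤ)
      where
      shifted : ∀ {y} → X ≋ y ℤ.+ X → y ≋ 0ℤ
      shifted {y} (mk≋ d) = from-Z (subst Z (lem X y) (Z-neg d))
        where
        lem : ∀ X y → ℤ.- (X ℤ.- (y ℤ.+ X)) ≡ y
        lem = solve-∀
      decide : ¬ y ≋ 0ℤ → y ≋ X ⊎ y ≋ y ℤ.+ X → y ≋ 0ℤ ⊎ y ≋ X
      decide n (inj₁ d) = inj₂ d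
      decide n (inj₂ (mk≋ d)) = contradiction (subst Z (lem y X) (Z-neg d)) X≢0
        where
        lem : ∀ y X → ℤ.- (y ℤ.- (y ℤ.+ X)) ≡ X
        lem = solve-∀
      go : Dec (y ≋ 0ℤ) → y ≋ 0ℤ ⊎ y ≋ X
      go (yes d) = inj₁ d
      go (no n)  = decide n (among₁ {O} few (n ∘ shifted) oX oyX oy)

    -- Only 0 and `X` are available as values; `y = X` would make `2X` one of them.
    null-by-zero : O 0ℤ → O X → ∀ {y} → O y → O (y ℤ.+ X) → y ≋ 0ℤ
    null-by-zero o₀ oX {y} oy oyX = decide (among₁ {O} few 0≢X o₀ oX oy) (among₁ {O} few 0≢X o₀ oX oyX)
      where
      0≢X : ¬ 0ℤ ≋ X
      0≢X d = X≢0 (to-Z (≋-sym d))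
      decide : y ≋ 0ℤ ⊎ y ≋ X → y ℤ.+ X ≋ 0ℤ ⊎ y ℤ.+ X ≋ X → y ≋ 0ℤ
      decide (inj₁ d) _ = d
      decide (inj₂ d) (inj₁ d′) = contradiction (≋-trans (≋-by (lem y X) (≋-sym d)) d′) double
        where
        lem : ∀ y X → X ℤ.- y ≡ (X ℤ.+ X) ℤ.- (y ℤ.+ X)
        lem = solve-∀
      decide (inj₂ _) (inj₂ d′) = cancel X (≋-trans d′ (≡⇒≋ (sym (ℤ.+-identityˡ X))))

    -- Here 0 is not yet known to be an option. If `y = X`, then either `y′` supplies 0, or `y′ = X`
    -- and the three distinct values `X`, `2X`, `3X` are options.
    null-by-sum : O X → (∀ {u v} → u ≋ v → O v → O u) → ∀ {y y′} → O y → O (y ℤ.+ X) → O y′ → O (y′ ℤ.+ X) → O ((y ℤ.+ y′) ℤ.+ X) → y ≋ 0ℤ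
    null-by-sum oX resp {y} {y′} oy oyX oy′ oy′X os = decide (null-or-X oX oy oyX) (null-or-X oX oy′ oy′X)
      where
      decide : y ≋ 0ℤ ⊎ y ≋ X → y′ ≋ 0ℤ ⊎ y′ ≋ X → y ≋ 0ℤ
      decide (inj₁ d) _ = d
      decide (inj₂ d) (inj₁ d′) = null-by-zero (resp (≋-sym d′) oy′) oX oy oyX
      decide (inj₂ d) (inj₂ d′) = contradiction refl (few {X ∷ (X ℤ.+ X) ∷ (X ℤ.+ X ℤ.+ X) ∷ []}
        ((≢-by X≢0 (lem₁ X) ∘ ≋-sym ∷ ≢-by (X≢0 ∘ halve) (lem₂ X) ∘ ≋-sym ∷ []) ∷ (≢-by X≢0 (lem₃ X) ∘ ≋-sym ∷ []) ∷ [] ∷ [])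
        (oX ∷ resp (≋-by (lem₄ X y) (≋-sym d)) oyX ∷ resp (mk≋ (subst Z (lem₅ X y y′) (Z-neg (Z-+ (un≋ d) (un≋ d′))))) os ∷ []))
        where
        lem₁ : ∀ X → (X ℤ.+ X) ℤ.- X ≡ X
        lem₁ = solve-∀
        lem₂ : ∀ X → (X ℤ.+ X ℤ.+ X) ℤ.- X ≡ X ℤ.+ X
        lem₂ = solve-∀
        lem₃ : ∀ X → (X ℤ.+ X ℤ.+ X) ℤ.- (X ℤ.+ X) ≡ X
        lem₃ = solve-∀
        lem₄ : ∀ X y → X ℤ.- y ≡ (X ℤ.+ X) ℤ.- (y ℤ.+ X)
        lem₄ = solve-∀
        lem₅ : ∀ X y y′ → ℤ.- ((y ℤ.- X) ℤ.+ (y′ ℤ.- X)) ≡ (X ℤ.+ X ℤ.+ X) ℤ.- ((y ℤ.+ y′) ℤ.+ X)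
        lem₅ = solve-∀

  module _ {S : List Item} (avoids : Avoids S) where

    -- The values of the plane k, and then those of top, are compared with the value X ≢ 0 of the spare block.
    module Planes {ms s D} (st : Stage S ms (flat [ s ] ++ D)) (e : 3 ℕ.+ length ms ≡ p) (ts : Twin s) (fr : Frame nonzero (support D))
      {A} (X≢0 : ¬ block-value s ≋ A) (k : Plane)
      (lf : ∀ l h → PlaneOptions.P D fr (main (left k) l h) ≋ A) (rt : ∀ l h → PlaneOptions.P D fr (main (right k) l h) ≋ A) where

      open Normalised avoids st 3 e A
      open PlaneOptions D fr using (P)

      X : ℤ
      X = block-value s ℤ.- A

      P″ : Pair → ℤ
      P″ q = P q ℤ.- A

      private
        null : ∀ {q} → P q ≋ A → P″ q ≋ 0ℤ
        null {q} = ≋-by (lem (P q) A)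
          where
          lem : ∀ x a → x ℤ.- a ≡ (x ℤ.- a) ℤ.- 0ℤ
          lem = solve-∀

        lf′ : ∀ l h → P″ (main (left k) l h) ≋ 0ℤ
        lf′ l h = null {main (left k) l h} (lf l h)

        rt′ : ∀ l h → P″ (main (right k) l h) ≋ 0ℤ
        rt′ l h = null {main (right k) l h} (rt l h)

        zeros : ∀ {qs} → All (λ q → P″ q ≋ 0ℤ) qs → sum-by P″ qs ≋ 0ℤ
        zeros {qs} es = ≋-trans (sum-≋ P″ {0ℤ} {qs} es) (≡⇒≋ (ℤ.*-zeroʳ (+ length qs)))

        with-spare : ∀ ps qs → Bool.T (valid nonzero (ps ++ qs)) → length (ps ++ qs) ≡ 2 → All (λ q → P″ q ≋ 0ℤ) qs → O (sum-by P″ ps ℤ.+ X)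
        with-spare ps qs v len es = resp {sum-by P″ ps ℤ.+ X} {(X ℤ.+ 0ℤ) ℤ.+ sum-by P″ (ps ++ qs)}
          (mk≋ (subst Z (≡-trans (lem (sum-by P″ ps) (sum-by P″ qs) X) (cong (λ z → (sum-by P″ ps ℤ.+ X) ℤ.- ((X ℤ.+ 0ℤ) ℤ.+ z)) (sym (sum-by-++ P″ ps)))) (Z-neg (un≋ (zeros {qs} es)))))
          (mixed avoids {sp = []} {R′ = flat [ s ] ++ D} {D = D} {xs = s ∷ []} {ps ++ qs} {st} {e} fr [] [] z≤n (ts ∷ []) ⊑-refl v (cong suc len))
          where
          lem : ∀ x y X → ℤ.- (y ℤ.- 0ℤ) ≡ (x ℤ.+ X) ℤ.- ((X ℤ.+ 0ℤ) ℤ.+ (x ℤ.+ y))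
          lem = solve-∀

        without-spare : ∀ ps qs → Bool.T (valid nonzero (ps ++ qs)) → length (ps ++ qs) ≡ 3 → All (λ q → P″ q ≋ 0ℤ) qs → O (sum-by P″ ps)
        without-spare ps qs v len es = resp {sum-by P″ ps} {0ℤ ℤ.+ sum-by P″ (ps ++ qs)}
          (mk≋ (subst Z (≡-trans (lem (sum-by P″ ps) (sum-by P″ qs)) (cong (λ z → sum-by P″ ps ℤ.- (0ℤ ℤ.+ z)) (sym (sum-by-++ P″ ps)))) (Z-neg (un≋ (zeros {qs} es)))))
          (mixed avoids {sp = []} {R′ = flat [ s ] ++ D} {D = D} {xs = []} {ps ++ qs} {st} {e} fr [] [] z≤n [] (⊑-++ˡ (flat [ s ]) D) v len)
          where
          lem : ∀ x y → ℤ.- (y ℤ.- 0ℤ) ≡ x ℤ.- (0ℤ ℤ.+ (x ℤ.+ y))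
          lem = solve-∀

        X≢ : ¬ Z X
        X≢ z = X≢0 (mk≋ z)

        few₃ : ∀ {vs} → Distinct vs → All O vs → length vs ≢ 3
        few₃ = few (s≤s z≤n)

        open Two {O} few₃ X≢

        everywhere : (Plane → Dir → Bool → Bool) → Bool
        everywhere f = allPlanes λ k → allDirs λ l → allHalves (f k l)
        at-all : ∀ f → Bool.T (everywhere f) → ∀ k l h → Bool.T (f k l h)
        at-all f t k l h = allHalves-sound (f k l) (allDirs-sound (λ l → allHalves (f k l)) (allPlanes-sound (λ k → allDirs λ l → allHalves (f k l)) t k) l) h

        O-X : O X
        O-X = subst O (ℤ.+-identityˡ X) (with-spare [] (main (left k) d₁ false ∷ main (left k) d₁ true ∷ [])
          (allPlanes-sound (λ k → valid nonzero (main (left k) d₁ false ∷ main (left k) d₁ true ∷ [])) tt k) refl (lf′ d₁ false ∷ lf′ d₁ true ∷ []))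

        one+X : ∀ q q′ → Bool.T (valid nonzero (q ∷ q′ ∷ [])) → P″ q′ ≋ 0ℤ → O (P″ q ℤ.+ X)
        one+X q q′ v d = subst (λ z → O (z ℤ.+ X)) (ℤ.+-identityʳ (P″ q)) (with-spare (q ∷ []) (q′ ∷ []) v refl (d ∷ []))

        one : ∀ q q′ q″ → Bool.T (valid nonzero (q ∷ q′ ∷ q″ ∷ [])) → P″ q′ ≋ 0ℤ → P″ q″ ≋ 0ℤ → O (P″ q)
        one q q′ q″ v d d′ = subst O (ℤ.+-identityʳ (P″ q)) (without-spare (q ∷ []) (q′ ∷ q″ ∷ []) v refl (d ∷ d′ ∷ []))

        last+X : ∀ l h → O (P″ (main k l h) ℤ.+ X)
        last+X l h = one+X (main k l h) (main (left k) l false) (at-all (λ k l h → valid nonzero (main k l h ∷ main (left k) l false ∷ [])) tt k l h) (lf′ l false)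

        last : ∀ l h → O (P″ (main k l h))
        last l h = one (main k l h) (main (left k) (second l) false) (main (right k) (third l) false)
          (at-all (λ k l h → valid nonzero (main k l h ∷ main (left k) (second l) false ∷ main (right k) (third l) false ∷ [])) tt k l h) (lf′ (second l) false) (rt′ (third l) false)

        last-sum : ∀ l h → O ((P″ (main k l h) ℤ.+ P″ (main k l (not h))) ℤ.+ X)
        last-sum l h = subst (λ z → O (z ℤ.+ X)) (cong (λ z → P″ (main k l h) ℤ.+ z) (ℤ.+-identityʳ _))
          (with-spare (main k l h ∷ main k l (not h) ∷ []) [] (at-all (λ k l h → valid nonzero (main k l h ∷ main k l (not h) ∷ [])) tt k l h) refl [])

        last-null : ∀ l h → P″ (main k l h) ≋ 0ℤ
        last-null l h = null-by-sum O-X resp (last l h) (last+X l h) (last l (not h)) (last+X l (not h)) (last-sum l h)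

        all : ∀ k → (∀ l h → P″ (main (left k) l h) ≋ 0ℤ) → (∀ l h → P″ (main (right k) l h) ≋ 0ℤ) → (∀ l h → P″ (main k l h) ≋ 0ℤ) → ∀ i l h → P″ (main i l h) ≋ 0ℤ
        all Π₁ lf rt la Π₁ = la
        all Π₁ lf rt la Π₂ = lf
        all Π₁ lf rt la Π₃ = rt
        all Π₂ lf rt la Π₁ = lf
        all Π₂ lf rt la Π₂ = la
        all Π₂ lf rt la Π₃ = rt
        all Π₃ lf rt la Π₁ = lf
        all Π₃ lf rt la Π₂ = rt
        all Π₃ lf rt la Π₃ = la

        main-null : ∀ i l h → P″ (main i l h) ≋ 0ℤ
        main-null = all k lf′ rt′ last-null

        O-0 : O 0ℤ
        O-0 = without-spare [] (main Π₁ d₁ false ∷ main Π₂ d₂ false ∷ main Π₃ d₃ false ∷ []) tt refl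
          (main-null Π₁ d₁ false ∷ main-null Π₂ d₂ false ∷ main-null Π₃ d₃ false ∷ [])

        pair-null : ∀ q → P″ q ≋ 0ℤ
        pair-null (main i l h) = main-null i l h
        pair-null (top l) = null-by-zero O-0 O-X
          (one (top l) (main Π₁ (second l) false) (main Π₂ (third l) false) (allDirs-sound (λ l → valid nonzero (top l ∷ main Π₁ (second l) false ∷ main Π₂ (third l) false ∷ [])) tt l)
            (main-null Π₁ (second l) false) (main-null Π₂ (third l) false))
          (one+X (top l) (main Π₁ l false) (allDirs-sound (λ l → valid nonzero (top l ∷ main Π₁ l false ∷ [])) tt l) (main-null Π₁ l false))

      -- The three pairs of a triangle all have value `A`, so two of them minus the third give the
      -- double of a point.
      point-double : ∀ c → c ≢ 0ᵛ → PlaneOptions.point D fr c ℤ.+ PlaneOptions.point D fr c ≋ A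
      point-double c ne = go (PlaneOptions.triangles D fr c ne)
        where
        f = PlaneOptions.point D fr
        lem : ∀ x y z a → (((x ℤ.+ y) ℤ.- a) ℤ.- 0ℤ) ℤ.+ (((x ℤ.+ z) ℤ.- a) ℤ.- 0ℤ) ℤ.+ ℤ.- (((y ℤ.+ z) ℤ.- a) ℤ.- 0ℤ) ≡ (x ℤ.+ x) ℤ.- a
        lem = solve-∀
        via : ∀ {q z} → P q ≡ z → Z ((z ℤ.- A) ℤ.- 0ℤ)
        via {q} refl = un≋ (pair-null q)
        go : PlaneOptions.Triangle D fr c → f c ℤ.+ f c ≋ A
        go (v , w , q , r , s , eq , er , es) = mk≋ (subst Z (lem (f c) (f v) (f w) A)
          (Z-+ (Z-+ (via {q} eq) (via {r} er)) (Z-neg (via {s} es))))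

    -- The spare block, a matched block c and an item w of the other block, all deviating from α, would yield four options.
    module OneValue {ms s D} (st : Stage S ms (flat [ s ] ++ D)) (e : 3 ℕ.+ length ms ≡ p) (ts : Twin s) (fifteen : count (support D) ≡ 15)
      {α} (mono : ∀ {x} → x ∈ D → proj₂ x ≋ α) (X≢ : ¬ block-value s ≋ α ℤ.+ α) where

      open Monochrome {D} {α} mono

      private
        A = α ℤ.+ α
        t = support D

      plain : ∀ {b c w ms′} → Stage S ((b , c) ∷ ms′) (flat [ s ] ++ D) → 4 ℕ.+ length ms′ ≡ p →
              (flat (c ∷ s ∷ []) ++ (w ∷ D)) ⊑ (flat (b ∷ c ∷ []) ++ (flat [ s ] ++ D)) → ¬ block-value c ≋ A → proj₂ w ≋ α
      plain {b} {c} {w} {ms′} st₀ e₀ i C≢ = decidable-stable (proj₂ w ≋? α) λ δ≢ → four-values δ≢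
        where
        R = flat (b ∷ c ∷ []) ++ (flat [ s ] ++ D)
        tc = proj₂ (pull-twins st₀)
        st₁ : Stage S ms′ R
        st₁ = pull st₀
        open Normalised avoids st₁ 4 e₀ A
        β′ : Blk → ℤ
        β′ x = block-value x ℤ.- A
        lem₀ : ∀ b v n y α r → v ℤ.- (y ℤ.+ r ℤ.* (α ℤ.+ α)) ≡ (b ℤ.+ v) ℤ.- (((b ℤ.- n ℤ.* (α ℤ.+ α)) ℤ.+ y) ℤ.+ (n ℤ.+ r) ℤ.* (α ℤ.+ α))
        lem₀ = solve-∀
        value-of : ∀ xs r {v y} → length xs ℕ.+ r ≡ 4 → v ≋ y ℤ.+ + r ℤ.* A → sum-by block-value xs ℤ.+ v ≋ (sum-by β′ xs ℤ.+ y) ℤ.+ + 4 ℤ.* A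
        value-of xs r {v} {y} n≡ d = mk≋ (subst Z (≡-trans (lem₀ (sum-by block-value xs) v (+ length xs) y α (+ r))
            (cong₂ (λ m z → (sum-by block-value xs ℤ.+ v) ℤ.- ((z ℤ.+ y) ℤ.+ + m ℤ.* A)) n≡ (sym (sum-shift block-value A xs)))) (un≋ d))
        plain-cell : ∀ xs r → All Twin xs → (flat xs ++ (w ∷ D)) ⊑ R → length xs ℕ.+ r ≡ 4 → (∀ v → Summing t (2 ℕ.* r) v) → O (sum-by β′ xs ℤ.+ 0ℤ)
        plain-cell xs r tx j n≡ su = let (v , o , d) = mono-opt {n = r} (su 0ᵛ) refl in
          sum-by block-value xs ℤ.+ v
          , subst (λ n → Opt R n (sum-by block-value xs ℤ.+ v)) n≡ (opt-⊑ j (opt-++ (opt-blocks tx) (opt-⊑ (⊑-++ˡ [ w ] D) o)))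
          , value-of xs r n≡ (≋-trans d (≡⇒≋ (≡-trans (cong (λ m → m ℤ.* α) (ℤ.pos-* 2 r)) (lem (+ r) α))))
          where
          lem : ∀ r α → (+ 2 ℤ.* r) ℤ.* α ≡ 0ℤ ℤ.+ r ℤ.* (α ℤ.+ α)
          lem = solve-∀
        extra-cell : ∀ xs r k → All Twin xs → (flat xs ++ (w ∷ D)) ⊑ R → length xs ℕ.+ r ≡ 4 → suc k ≡ 2 ℕ.* r → (∀ v → Summing t k v) → O (sum-by β′ xs ℤ.+ (proj₂ w ℤ.- α))
        extra-cell xs r k tx j n≡ k≡ su = let (v , o , d) = mono-with w {n = r} (su (class w)) k≡ in
          sum-by block-value xs ℤ.+ v
          , subst (λ n → Opt R n (sum-by block-value xs ℤ.+ v)) n≡ (opt-⊑ j (opt-++ (opt-blocks tx) o))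
          , value-of xs r n≡ (≋-trans d (≡⇒≋ (≡-trans (lem (proj₂ w) (+ k) α)
              (≡-trans (cong (λ m → (proj₂ w ℤ.- α) ℤ.+ + m ℤ.* α) k≡) (≡-trans (cong (λ m → (proj₂ w ℤ.- α) ℤ.+ m ℤ.* α) (ℤ.pos-* 2 r)) (lem′ (proj₂ w) (+ r) α))))))
          where
          lem : ∀ w k α → w ℤ.+ k ℤ.* α ≡ (w ℤ.- α) ℤ.+ (1ℤ ℤ.+ k) ℤ.* α
          lem = solve-∀
          lem′ : ∀ w r α → (w ℤ.- α) ℤ.+ (+ 2 ℤ.* r) ℤ.* α ≡ (w ℤ.- α) ℤ.+ r ℤ.* (α ℤ.+ α)
          lem′ = solve-∀
        δ = proj₂ w ℤ.- α
        j₁ : (flat [ c ] ++ (w ∷ D)) ⊑ R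
        j₁ = ⊑-trans (⊑-++ {S = flat [ c ]} ⊑-refl (⊑-++ˡ (flat [ s ]) (w ∷ D))) i
        j₂ : (flat [ s ] ++ (w ∷ D)) ⊑ R
        j₂ = ⊑-trans (⊑-++ˡ (flat [ c ]) (flat [ s ] ++ (w ∷ D))) i
        j₀ : (w ∷ D) ⊑ R
        j₀ = ⊑-trans (⊑-++ˡ (flat [ s ]) (w ∷ D)) j₂
        -- `Q₀ v` makes `v` an option together with its translates by all subset sums of `δ`, `β′ c`
        -- and `β′ s`. Three nonzero increments produce at least four residues, one more than weight
        -- 4 tolerates.
        Q₂ Q₁ Q₀ : ℤ → Set
        Q₂ v = O v × O (v ℤ.+ δ)
        Q₁ v = Q₂ v × Q₂ (v ℤ.+ β′ c)
        Q₀ v = Q₁ v × Q₁ (v ℤ.+ β′ s)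
        moved : ∀ {x y} z → x ≡ y → O (x ℤ.+ z) → O (y ℤ.+ z)
        moved z refl o = o
        cells : ∀ xs r k {y} → sum-by β′ xs ≡ y → All Twin xs → (flat xs ++ (w ∷ D)) ⊑ R → length xs ℕ.+ r ≡ 4 → suc k ≡ 2 ℕ.* r →
                (∀ v → Summing t (2 ℕ.* r) v) → (∀ v → Summing t k v) → Q₂ y
        cells xs r k {y} y≡ tx j n≡ k≡ su su′ =
          subst O (≡-trans (ℤ.+-identityʳ (sum-by β′ xs)) y≡) (plain-cell xs r tx j n≡ su)
          , moved δ y≡ (extra-cell xs r k tx j n≡ k≡ su′)
        start : Q₀ 0ℤ
        start = (cells [] 4 7 refl [] j₀ refl refl (eight₁₅ t fifteen) (seven₁₅ t fifteen)
                , cells [ c ] 3 5 (ℤ.+-comm (β′ c) 0ℤ) (tc ∷ []) j₁ refl refl (six₁₅ t fifteen) (five₁₅ t fifteen))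
              , (cells [ s ] 3 5 (ℤ.+-comm (β′ s) 0ℤ) (ts ∷ []) j₂ refl refl (six₁₅ t fifteen) (five₁₅ t fifteen)
                , cells (c ∷ s ∷ []) 2 3 (lem (β′ c) (β′ s)) (tc ∷ ts ∷ []) i refl refl (four₁₅ t fifteen) (three₁₅ t fifteen))
          where
          lem : ∀ x y → x ℤ.+ (y ℤ.+ 0ℤ) ≡ (0ℤ ℤ.+ y) ℤ.+ x
          lem = solve-∀
        apart : ∀ {x y} → ¬ x ≋ y → ¬ Z (x ℤ.- y)
        apart n z = n (mk≋ z)
        below : ∀ {n} → n ℕ.≤ 3 → n ℕ.< p
        below n≤ = ℕ.≤-<-trans n≤ (subst (3 ℕ.<_) e₀ (s≤s (s≤s (s≤s (s≤s z≤n)))))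
        resp₂ : ∀ {u v} → u ≋ v → Q₂ v → Q₂ u
        resp₂ {u} {v} d (o , o′) = resp {u} {v} d o , resp {u ℤ.+ δ} {v ℤ.+ δ} (≋-by (lem u v δ) d) o′
          where
          lem : ∀ u v z → u ℤ.- v ≡ (u ℤ.+ z) ℤ.- (v ℤ.+ z)
          lem = solve-∀
        resp₁ : ∀ {u v} → u ≋ v → Q₁ v → Q₁ u
        resp₁ {u} {v} d (o , o′) = resp₂ {u} {v} d o , resp₂ {u ℤ.+ β′ c} {v ℤ.+ β′ c} (≋-by (lem u v (β′ c)) d) o′
          where
          lem : ∀ u v z → u ℤ.- v ≡ (u ℤ.+ z) ℤ.- (v ℤ.+ z)
          lem = solve-∀
        four-values : ¬ ¬ proj₂ w ≋ α
        four-values δ≢ =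
          let (v₂ , d₂′ , a₂ , l₂) = widen {Q₁} (λ {u} {v} → resp₁ {u} {v}) {Q₀} (apart X≢) proj₁ proj₂ {0ℤ ∷ []} ([] ∷ []) (start ∷ []) (s≤s z≤n) (below (s≤s z≤n))
              (v₃ , d₃′ , a₃ , l₃) = widen {Q₂} (λ {u} {v} → resp₂ {u} {v}) {Q₁} (apart C≢) proj₁ proj₂ {v₂} d₂′ a₂ (subst (1 ℕ.≤_) (sym l₂) (s≤s z≤n)) (below (ℕ.≤-trans (ℕ.≤-reflexive l₂) (s≤s (s≤s z≤n))))
              (v₄ , d₄′ , a₄ , l₄) = widen {O} (λ {u} {v} → resp {u} {v}) {Q₂} (apart δ≢) proj₁ proj₂ {v₃} d₃′ a₃ (subst (1 ℕ.≤_) (sym l₃) (s≤s z≤n)) (below (ℕ.≤-reflexive (≡-trans l₃ (cong suc l₂))))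
          in few (s≤s z≤n) {v₄} d₄′ a₄ (≡-trans l₄ (cong suc (≡-trans l₃ (cong suc l₂))))

      -- By `plain` one of the two blocks of each couple has the value `2α`. Six items of the
      -- remainder act as three more such blocks, which makes p in total.
      contradictory : ⊥
      contradictory = done (mono-opt {n = 3} (six₁₅ t fifteen 0ᵛ) refl)
        where
        has : All (Has A) ms
        has = for-each one
          where
          one : ∀ {b c ms′} → ms ↭ (b , c) ∷ ms′ → Has A (b , c)
          one {b@(x , x′)} {c} {ms′} σ = choose (block-value c ≋? A)
            where
            st₀ = stage-↭ σ st
            e₀ : 4 ℕ.+ length ms′ ≡ p
            e₀ = ≡-trans (cong (3 ℕ.+_) (sym (↭-length σ))) e
            choose : Dec (block-value c ≋ A) → Has A (b , c)
            choose (yes d) = inj₂ d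
            choose (no n)  = inj₁ (mk≋ (subst Z (lem₂ (proj₂ x) (proj₂ x′) α) (Z-+ (un≋ (plain {w = x} st₀ e₀ i₁ n)) (un≋ (plain {w = x′} st₀ e₀ i₂ n)))))
              where
              open Bag using (_⊕_; _⊜_)
              i₁ : (flat (c ∷ s ∷ []) ++ (x ∷ D)) ⊑ (flat (b ∷ c ∷ []) ++ (flat [ s ] ++ D))
              i₁ = [ x′ ] , Bag.solve 5 (λ x x′ c s d → x ⊕ (x′ ⊕ (c ⊕ (s ⊕ d))) ⊜ ((c ⊕ s) ⊕ (x ⊕ d)) ⊕ x′) refl [ x ] [ x′ ] (flat [ c ]) (flat [ s ]) D
              i₂ : (flat (c ∷ s ∷ []) ++ (x′ ∷ D)) ⊑ (flat (b ∷ c ∷ []) ++ (flat [ s ] ++ D))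
              i₂ = [ x ] , Bag.solve 5 (λ x x′ c s d → x ⊕ (x′ ⊕ (c ⊕ (s ⊕ d))) ⊜ ((c ⊕ s) ⊕ (x′ ⊕ d)) ⊕ x) refl [ x ] [ x′ ] (flat [ c ]) (flat [ s ]) D
              lem₂ : ∀ x y a → (x ℤ.- a) ℤ.+ (y ℤ.- a) ≡ (x ℤ.+ y) ℤ.- (a ℤ.+ a)
              lem₂ = solve-∀
        done : ∃[ v ] Opt D 3 v × v ≋ + 6 ℤ.* α → ⊥
        done (v , o , d) = finish avoids st has (opt-⊑ (⊑-++ˡ (flat [ s ]) D) o) e
          (mk≋ (subst Z (lem v α (+ length ms)) (Z-+ (un≋ d) (multiple A e))))
          where
          lem : ∀ v α n → (v ℤ.- + 6 ℤ.* α) ℤ.+ (+ 3 ℤ.+ n) ℤ.* (α ℤ.+ α) ≡ (v ℤ.+ n ℤ.* (α ℤ.+ α)) ℤ.- 0ℤ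
          lem = solve-∀

    private
      finish-planes : ∀ {ms s D} → Stage S ms (flat [ s ] ++ D) → 3 ℕ.+ length ms ≡ p → Twin s → Separated D → length D ≡ 15 →
                      (fr : Frame nonzero (support D)) → (∀ v → v ∈ˢ support D → ∃[ c ] c ∈ˢ nonzero × Frame.A fr c ≡ v) →
                      ∀ {A} → ¬ block-value s ≋ A → ∀ k →
                      (∀ l h → PlaneOptions.P D fr (main (left k) l h) ≋ A) → (∀ l h → PlaneOptions.P D fr (main (right k) l h) ≋ A) → ⊥
      finish-planes {ms} {s} {D} st e ts ds fifteen fr cover {A} X≢ k lf rt = from-first D refl
        where
        not-null : ∀ c → c ∈ˢ nonzero → c ≢ 0ᵛ
        not-null _ () refl
        doubled : ∀ {x} → x ∈ D → proj₂ x ℤ.+ proj₂ x ≋ A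
        doubled {x} x∈ = let (c , c∈ , Ac) = cover (class x) (∈-support x∈) in
          subst (λ z → z ℤ.+ z ≋ A) (≡-trans (cong (value D) Ac) (value-∈ ds x∈))
            (Planes.point-double {s = s} st e ts fr X≢ k lf rt c (not-null c c∈))
        equal : ∀ {x y} → x ℤ.+ x ≋ A → y ℤ.+ y ≋ A → x ≋ y
        equal {x} {y} (mk≋ d) (mk≋ d′) = mk≋ (halve (subst Z (lem x y A) (Z-+ d (Z-neg d′))))
          where
          lem : ∀ x y a → ((x ℤ.+ x) ℤ.- a) ℤ.- ((y ℤ.+ y) ℤ.- a) ≡ (x ℤ.- y) ℤ.+ (x ℤ.- y)
          lem = solve-∀
        from-first : ∀ E → E ≡ D → ⊥
        from-first []      e′ = contradiction (≡-trans (cong length e′) fifteen) λ ()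
        from-first (x ∷ E) e′ = OneValue.contradictory {s = s} st e ts (≡-trans (count-support ds) fifteen) {proj₂ x}
            (λ y∈ → equal (doubled y∈) 2x) (λ d → X≢ (≋-trans d 2x))
          where
          2x = doubled (subst (x ∈_) e′ (here refl))

    -- Two planes have pairs of value `A`. If the spare block differs from `A`, it can serve as the
    -- nonzero `X`. If not, either all couples contain `A` and an option of normalised value 0
    -- exists, or some couple does not and provides a better spare block.
    fifteen-spare : ∀ {ms s D} → Stage S ms (flat [ s ] ++ D) → 3 ℕ.+ length ms ≡ p → Twin s → Separated D → length D ≡ 15 → ⊥
    fifteen-spare {ms} {s} {D} st e ts ds fifteen =
        go (TwoPlanes.planes₃ P′ plane-sum′ {O} resp (few (s≤s z≤n)) (λ x y v → opts 1 (x ∷ y ∷ []) (s≤s z≤n) v refl))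
      where
      covering = fifteen-frame (support D) (≡-trans (count-support ds) fifteen)
      fr = proj₁ covering
      u = block-value s
      open PlaneOptions D fr using (P)
      open Setting avoids {sp = [ s ]} {u = u} {W = 3} st e (ts ∷ []) (≋-refl ∷ []) ⊑-refl (frame-restrict fr)
      go : ∃[ k ] ∃[ q ] (∀ l h → P′ (main (left k) l h) ≋ q) × (∀ l h → P′ (main (right k) l h) ≋ q) → ⊥
      go (k , a , lf , rt) = cases (Z? a)
        where
        A = a ℤ.+ u
        raise : ∀ q → P′ q ≋ a → P q ≋ A
        raise q = ≋-by (lem (P q) u a)
          where
          lem : ∀ x u a → (x ℤ.- u) ℤ.- a ≡ x ℤ.- (a ℤ.+ u)
          lem = solve-∀
        lfA : ∀ l h → P (main (left k) l h) ≋ A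
        lfA l h = raise (main (left k) l h) (lf l h)
        rtA : ∀ l h → P (main (right k) l h) ≋ A
        rtA l h = raise (main (right k) l h) (rt l h)
        shifted : block-value s ≋ A → Z a
        shifted (mk≋ d) = subst Z (lem u a) (Z-neg d)
          where
          lem : ∀ u a → ℤ.- (u ℤ.- (a ℤ.+ u)) ≡ a
          lem = solve-∀
        -- The couple avoids `u`, so the spare block can be coupled with its block `b`, and `c`,
        -- which differs from `A`, becomes the spare block.
        rotate : ∀ {m ms′} → Z a → ms ↭ m ∷ ms′ → ¬ Has u m → ⊥
        rotate {b , c} z σ ¬has = finish-planes {s = c}
            (exchange (stage-↭ σ st) ts (λ d → ¬has (inj₁ (≋-sym d))))
            (≡-trans (cong (3 ℕ.+_) (sym (↭-length σ))) e) (proj₂ (pull-twins (stage-↭ σ st))) ds fifteen fr (proj₂ covering)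
            (λ d → ¬has (inj₂ (≋-trans d (mk≋ (subst Z (lem a u) z))))) k lfA rtA
          where
          lem : ∀ a u → a ≡ (a ℤ.+ u) ℤ.- u
          lem = solve-∀
        decide : Z a → All (Has u) ms ⊎ ∃[ m ] ∃[ ms′ ] ms ↭ m ∷ ms′ × ¬ Has u m → ⊥
        decide z (inj₁ hs) = nonzero-O hs (opts-const 1 (plane k) (s≤s z≤n) (allPlanes-sound (λ k → valid offaxis (plane k)) tt k) refl (lf d₁ false ∷ lf d₁ true ∷ []))
            (Z-* (+ 2) z)
          where
          plane : Plane → List Pair
          plane k = main (left k) d₁ false ∷ main (left k) d₁ true ∷ []
        decide z (inj₂ (m , ms′ , σ , n)) = rotate z σ n
        cases : Dec (Z a) → ⊥
        cases (yes z) = decide z (all-or-except (Has? u) ms)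
        cases (no a≢0) = finish-planes {s = s} st e ts ds fifteen fr (proj₂ covering) (a≢0 ∘ shifted) k lfA rtA

-- Prime modulus

module OddCase (p : ℕ) (prime : Prime p) (odd : ¬ + p ℤ.∣ + 2) where

  open Fifteen p prime odd
  open NinePoints p prime odd using (nine-case)

  private
    even-or-odd : ∀ {a b} m → a ≡ 2 ℕ.* m → b ≡ suc a → ∀ q → b ≢ 2 ℕ.* q
    even-or-odd m refl refl q e = ℕ.even≢odd q m (sym e)

    halves : ∀ {a} m q → a ≡ 2 ℕ.* m → a ≡ 2 ℕ.* q → m ≡ q
    halves m q refl e = ℕ.*-cancelˡ-≡ m q 2 e

    -- If the couples and unmatched blocks together numbered q or more, q blocks of one value could
    -- be selected. Below that, the number of unmatched blocks is bounded by the shortage `o`.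
    excess : ∀ t r o q → suc (t ℕ.+ r) ℕ.≤ q → 2 ℕ.+ (2 ℕ.* t ℕ.+ r) ℕ.+ o ≡ 2 ℕ.* q → r ℕ.≤ o
    excess t r o q small e = ℕ.+-cancelˡ-≤ (2 ℕ.+ (2 ℕ.* t ℕ.+ r)) r o
      (ℕ.≤-trans (ℕ.≤-reflexive (lem t r)) (ℕ.≤-trans (ℕ.*-monoʳ-≤ 2 small) (ℕ.≤-reflexive (sym e))))
      where
      lem : ∀ t r → 2 ℕ.+ (2 ℕ.* t ℕ.+ r) ℕ.+ r ≡ 2 ℕ.* suc (t ℕ.+ r)
      lem = ℕ-Solver.solve-∀

  module _ {S : List Item} (avoids : Avoids S) {bs D} (π : S ↭ flat bs ++ D) (ts : All Twin bs) (ds : Separated D) where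

    private
      m = matching bs
      ms = Matching.matched m
      t = length ms

      Small : ℕ → List Blk → Set
      Small o r = length r ℕ.≤ 1 ⊎ (length r ℕ.≤ o × ∃[ u ] All (λ b → block-value b ≋ u) r × All (Has u) ms)

      small : ∀ {o} → 2 ℕ.+ length bs ℕ.+ o ≡ 2 ℕ.* p → Small o (Matching.rest m)
      small {o} e = go (Matching.maximal m)
        where
        go : length (Matching.rest m) ℕ.≤ 1 ⊎ ∃[ u ] All (λ b → block-value b ≋ u) (Matching.rest m) × All (Has u) ms → Small o (Matching.rest m)
        go (inj₁ r≤1) = inj₁ r≤1
        go (inj₂ (u , rs , hs)) = inj₂ (excess t (length (Matching.rest m)) o p
          (ℕ.≰⇒> λ p≤ → no-zero-blocks avoids π ts (majority⇒zero block-value {bs} m rs hs p≤))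
          (≡-trans (cong (λ k → 2 ℕ.+ k ℕ.+ o) (matching-length block-value {bs} m)) e) , u , rs , hs)

      twins′ : All Twin (flat ms ++ Matching.rest m)
      twins′ = All-resp-↭ (Matching.splits m) ts

      layout′ : Stage S ms (flat (Matching.rest m) ++ D)
      layout′ = stage (trans π (trans (++⁺ʳ D (trans (flat-↭ (Matching.splits m)) (↭-reflexive (flat-++ (flat ms) (Matching.rest m)))))
          (Bag.solve 3 (λ a b c → (a ⊕ b) ⊕ c ⊜ a ⊕ (b ⊕ c)) refl (flat (flat ms)) (flat (Matching.rest m)) D)))
        (All.++⁻ˡ (flat ms) twins′) (Matching.unequal m)
        where open Bag using (_⊕_; _⊜_)

      size : ∀ o r → 2 ℕ.+ (2 ℕ.* t ℕ.+ r) ℕ.+ o ≡ 2 ℕ.* p → ∀ n → 2 ℕ.+ r ℕ.+ o ≡ 2 ℕ.* n → n ℕ.+ t ≡ p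
      size o r e n e′ = halves (n ℕ.+ t) p (≡-trans (lem t r o) (≡-trans (cong (2 ℕ.* t ℕ.+_) e′) (lem′ t n))) e
        where
        lem : ∀ t r o → 2 ℕ.+ (2 ℕ.* t ℕ.+ r) ℕ.+ o ≡ 2 ℕ.* t ℕ.+ (2 ℕ.+ r ℕ.+ o)
        lem = ℕ-Solver.solve-∀
        lem′ : ∀ t n → 2 ℕ.* t ℕ.+ 2 ℕ.* n ≡ 2 ℕ.* (n ℕ.+ t)
        lem′ = ℕ-Solver.solve-∀

      unbalanced : ∀ o r → 2 ℕ.+ (2 ℕ.* t ℕ.+ r) ℕ.+ o ≡ 2 ℕ.* p → ∀ n → 2 ℕ.+ r ℕ.+ o ≡ suc (2 ℕ.* n) → ⊥
      unbalanced o r e n e′ = even-or-odd (n ℕ.+ t) refl (≡-trans (lem t r o) (≡-trans (cong (2 ℕ.* t ℕ.+_) e′) (lem′ t n))) p e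
        where
        lem : ∀ t r o → 2 ℕ.+ (2 ℕ.* t ℕ.+ r) ℕ.+ o ≡ 2 ℕ.* t ℕ.+ (2 ℕ.+ r ℕ.+ o)
        lem = ℕ-Solver.solve-∀
        lem′ : ∀ t n → 2 ℕ.* t ℕ.+ suc (2 ℕ.* n) ≡ suc (2 ℕ.* (n ℕ.+ t))
        lem′ = ℕ-Solver.solve-∀

      -- The count makes the number of unmatched blocks congruent to `o` modulo 2, and it is at most
      -- 1 or at most `o`. What survives are the pairs (0,0), (1,1), (2,0), (2,2), (3,1) and (3,3).
      cases : ∀ o r → Stage S ms (flat r ++ D) → All Twin r → Small o r → 2 ℕ.+ (2 ℕ.* t ℕ.+ length r) ℕ.+ o ≡ 2 ℕ.* p →
              o ℕ.≤ 3 → length D ≡ 9 ℕ.+ 2 ℕ.* o → ⊥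
      cases 0 [] st _ _ e _ l = nine-case avoids st (size 0 0 e 1 refl) ds l
      cases 0 (_ ∷ []) st _ _ e _ l = unbalanced 0 1 e 1 refl
      cases 1 [] st _ _ e _ l = unbalanced 1 0 e 1 refl
      cases 1 (s ∷ []) st (ts ∷ []) _ e _ l = eleven-case avoids st ts (size 1 1 e 2 refl) ds (ℕ.≤-reflexive (sym l))
      cases 2 [] st _ _ e _ l = thirteen-full avoids st (size 2 0 e 2 refl) ds l
      cases 2 (_ ∷ []) st _ _ e _ l = unbalanced 2 1 e 2 refl
      cases 2 (_ ∷ _ ∷ []) st (t₁ ∷ t₂ ∷ []) (inj₂ (_ , _ , h₁ ∷ h₂ ∷ [] , hs)) e _ l =
        thirteen-rest avoids st (size 2 2 e 3 refl) t₁ t₂ h₁ h₂ hs ds l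
      cases 3 [] st _ _ e _ l = unbalanced 3 0 e 2 refl
      cases 3 (s ∷ []) st (ts ∷ []) _ e _ l = fifteen-spare avoids st (size 3 1 e 3 refl) ts ds l
      cases 3 (_ ∷ _ ∷ []) st _ _ e _ l = unbalanced 3 2 e 3 refl
      cases 3 (_ ∷ _ ∷ _ ∷ []) st ts (inj₂ (_ , _ , us , hs)) e _ l =
        fifteen-rest avoids st (size 3 3 e 4 refl) ts us hs ds l
      cases 0 (_ ∷ _ ∷ _) st _ (inj₁ (s≤s ())) e _ l
      cases 0 (_ ∷ _ ∷ _) st _ (inj₂ (() , _)) e _ l
      cases 1 (_ ∷ _ ∷ _) st _ (inj₁ (s≤s ())) e _ l
      cases 1 (_ ∷ _ ∷ _) st _ (inj₂ (s≤s () , _)) e _ l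
      cases 2 (_ ∷ _ ∷ _) st _ (inj₁ (s≤s ())) e _ l
      cases 2 (_ ∷ _ ∷ _ ∷ _) st _ (inj₂ (s≤s (s≤s ()) , _)) e _ l
      cases 3 (_ ∷ _ ∷ _) st _ (inj₁ (s≤s ())) e _ l
      cases 3 (_ ∷ _ ∷ _ ∷ _ ∷ _) st _ (inj₂ (s≤s (s≤s (s≤s ())) , _)) e _ l
      cases (suc (suc (suc (suc _)))) r st _ _ _ (s≤s (s≤s (s≤s ()))) _

    rank-four : length D ℕ.+ 2 ℕ.* length bs ≡ 4 ℕ.* p ℕ.+ 5 → ⊥
    rank-four len = let (o , e) = ℕ.m≤n⇒∃[o]m+o≡n (few-blocks avoids π ts) ; l = size-D o e in
      cases o (Matching.rest m) layout′ (All.++⁻ʳ (flat ms) twins′) (small e)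
        (≡-trans (cong (λ k → 2 ℕ.+ k ℕ.+ o) (matching-length block-value {bs} m)) e) (o≤3 o l) l
      where
      size-D : ∀ o → 2 ℕ.+ length bs ℕ.+ o ≡ 2 ℕ.* p → length D ≡ 9 ℕ.+ 2 ℕ.* o
      size-D o e = ℕ.+-cancelʳ-≡ (2 ℕ.* length bs) _ _ (≡-trans len (≡-trans (lem p) (≡-trans (cong (λ q → 2 ℕ.* q ℕ.+ 5) (sym e)) (lem′ (length bs) o))))
        where
        lem : ∀ p → 4 ℕ.* p ℕ.+ 5 ≡ 2 ℕ.* (2 ℕ.* p) ℕ.+ 5
        lem = ℕ-Solver.solve-∀
        lem′ : ∀ b o → 2 ℕ.* (2 ℕ.+ b ℕ.+ o) ℕ.+ 5 ≡ (9 ℕ.+ 2 ℕ.* o) ℕ.+ 2 ℕ.* b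
        lem′ = ℕ-Solver.solve-∀
      o≤3 : ∀ o → length D ≡ 9 ℕ.+ 2 ℕ.* o → o ℕ.≤ 3
      o≤3 o l = ℕ.≮⇒≥ λ 4≤o → ℕ.<⇒≱ (ℕ.+-monoʳ-≤ 9 (ℕ.*-monoʳ-≤ 2 4≤o)) (subst (ℕ._≤ 16) (≡-trans (count-support ds) l) (count≤ (support D)))

    -- Eight flat classes leave no room for `7 + 2 o` unless `o` is 0, so all blocks are matched.
    rank-three : All Flat S → length D ℕ.+ 2 ℕ.* length bs ≡ 4 ℕ.* p ℕ.+ 3 → ⊥
    rank-three fs len = let (o , e) = ℕ.m≤n⇒∃[o]m+o≡n (few-blocks avoids π ts) in final o (Matching.rest m) e (small e) layout′
        (≡-trans (cong (λ k → 2 ℕ.+ k ℕ.+ o) (matching-length block-value {bs} m)) e)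
      where
      flat-D : All Flat D
      flat-D = All.++⁻ʳ (flat bs) (All-resp-↭ π fs)
      at-most-8 : length D ℕ.≤ 8
      at-most-8 = subst (ℕ._≤ 8) (≡-trans (sym (ℕ.+-identityʳ _)) (≡-trans (cong (λ t → count {3} (proj₁ (support D)) ℕ.+ count {3} t) (sym (support-flat flat-D))) (count-support ds))) (count≤ {3} (proj₁ (support D)))
      size-D : ∀ o → 2 ℕ.+ length bs ℕ.+ o ≡ 2 ℕ.* p → length D ≡ 7 ℕ.+ 2 ℕ.* o
      size-D o e = ℕ.+-cancelʳ-≡ (2 ℕ.* length bs) _ _ (≡-trans len (≡-trans (lem p) (≡-trans (cong (λ q → 2 ℕ.* q ℕ.+ 3) (sym e)) (lem′ (length bs) o))))
        where
        lem : ∀ p → 4 ℕ.* p ℕ.+ 3 ≡ 2 ℕ.* (2 ℕ.* p) ℕ.+ 3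
        lem = ℕ-Solver.solve-∀
        lem′ : ∀ b o → 2 ℕ.* (2 ℕ.+ b ℕ.+ o) ℕ.+ 3 ≡ (7 ℕ.+ 2 ℕ.* o) ℕ.+ 2 ℕ.* b
        lem′ = ℕ-Solver.solve-∀
      final : ∀ o r → 2 ℕ.+ length bs ℕ.+ o ≡ 2 ℕ.* p → Small o r → Stage S ms (flat r ++ D) → 2 ℕ.+ (2 ℕ.* t ℕ.+ length r) ℕ.+ o ≡ 2 ℕ.* p → ⊥
      final (suc o) r e₀ _ _ _ = ℕ.<⇒≱ (ℕ.≤-trans (ℕ.m≤m+n 9 (2 ℕ.* o)) (ℕ.≤-reflexive (sym (≡-trans (size-D (suc o) e₀) (lem o))))) at-most-8
        where
        lem : ∀ o → 7 ℕ.+ 2 ℕ.* suc o ≡ 9 ℕ.+ 2 ℕ.* o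
        lem = ℕ-Solver.solve-∀
      final 0 [] e₀ _ st e = hyperplane-case avoids st (size 0 0 e 1 refl) ds (ℕ.≤-reflexive (sym (size-D 0 e₀))) fs
      final 0 (_ ∷ []) e₀ _ st e = unbalanced 0 1 e 1 refl
      final 0 (_ ∷ _ ∷ _) e₀ (inj₁ (s≤s ())) st e
      final 0 (_ ∷ _ ∷ _) e₀ (inj₂ (() , _)) st e

-- The parity bit

Even : ℤ → Set
Even x = + 2 ℤ.∣ x

module _ where

  open Mod 2 using (Z-+; Z-neg; Z-0)

  even-or-odd : ∀ z → Even z ⊎ Even (z ℤ.- 1ℤ)
  even-or-odd z = go (z %ℕ 2) (n%ℕd<d z 2) (a≡a%ℕn+[a/ℕn]*n z 2)
    where
    lem : ∀ k → (1ℤ ℤ.+ k ℤ.* + 2) ℤ.- 1ℤ ≡ k ℤ.* + 2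
    lem = solve-∀
    go : ∀ r → r ℕ.< 2 → z ≡ + r ℤ.+ z /ℕ 2 ℤ.* + 2 → Even z ⊎ Even (z ℤ.- 1ℤ)
    go 0 _ e = inj₁ (ℤ.divides (z /ℕ 2) (≡-trans e (ℤ.+-identityˡ _)))
    go 1 _ e = inj₂ (ℤ.divides (z /ℕ 2) (≡-trans (cong (λ w → w ℤ.- 1ℤ) e) (lem (z /ℕ 2))))
    go (suc (suc _)) (s≤s (s≤s ())) _

  even∧odd : ∀ z → Even z → Even (z ℤ.- 1ℤ) → ⊥
  even∧odd z d d′ with ℤ.∣⇒∣ᵤ (subst Even (lem z) (Z-+ d (Z-neg d′)))
    where
    lem : ∀ z → z ℤ.- (z ℤ.- 1ℤ) ≡ 1ℤ
    lem = solve-∀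
  ... | ℕ.divides zero ()
  ... | ℕ.divides (suc _) ()

  parity : ℤ → Bool
  parity z = not (does (ℤ._∣?_ (+ 2) z))

  parity-even : ∀ z → Even z → parity z ≡ false
  parity-even z d = cong not (dec-true (ℤ._∣?_ (+ 2) z) d)

  parity-odd : ∀ z → Even (z ℤ.- 1ℤ) → parity z ≡ true
  parity-odd z d = cong not (dec-false (ℤ._∣?_ (+ 2) z) λ d′ → even∧odd z d′ d)

  parity⇒even : ∀ z → parity z ≡ false → Even z
  parity⇒even z e = [ id , (λ d → contradiction (≡-trans (sym (parity-odd z d)) e) λ ()) ]′ (even-or-odd z)

  parity-+ : ∀ x y → parity (x ℤ.+ y) ≡ parity x xor parity y
  parity-+ x y = go (even-or-odd x) (even-or-odd y)
    where
    odd-even : ∀ x y → (x ℤ.- 1ℤ) ℤ.+ y ≡ (x ℤ.+ y) ℤ.- 1ℤ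
    odd-even = solve-∀
    even-odd : ∀ x y → x ℤ.+ (y ℤ.- 1ℤ) ≡ (x ℤ.+ y) ℤ.- 1ℤ
    even-odd = solve-∀
    odd-odd : ∀ x y → ((x ℤ.- 1ℤ) ℤ.+ (y ℤ.- 1ℤ)) ℤ.+ + 2 ≡ x ℤ.+ y
    odd-odd = solve-∀
    go : Even x ⊎ Even (x ℤ.- 1ℤ) → Even y ⊎ Even (y ℤ.- 1ℤ) → parity (x ℤ.+ y) ≡ parity x xor parity y
    go (inj₁ d) (inj₁ d′) = ≡-trans (parity-even (x ℤ.+ y) (Z-+ d d′)) (sym (cong₂ _xor_ (parity-even x d) (parity-even y d′)))
    go (inj₁ d) (inj₂ d′) = ≡-trans (parity-odd (x ℤ.+ y) (subst Even (even-odd x y) (Z-+ d d′))) (sym (cong₂ _xor_ (parity-even x d) (parity-odd y d′)))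
    go (inj₂ d) (inj₁ d′) = ≡-trans (parity-odd (x ℤ.+ y) (subst Even (odd-even x y) (Z-+ d d′))) (sym (cong₂ _xor_ (parity-odd x d) (parity-even y d′)))
    go (inj₂ d) (inj₂ d′) = ≡-trans (parity-even (x ℤ.+ y) (subst Even (odd-odd x y) (Z-+ (Z-+ d d′) (ℤ.∣-refl)))) (sym (cong₂ _xor_ (parity-odd x d) (parity-odd y d′)))

-- The last bit of the class is tied to the value, so that cancelling classes also makes the total
-- even.
Marked : Item → Set
Marked x = Vec.last (class x) ≡ parity (proj₂ x)

last-⊕ᵛ : ∀ (u v : V 4) → Vec.last (u ⊕ᵛ v) ≡ Vec.last u xor Vec.last v
last-⊕ᵛ (_ ∷ _ ∷ _ ∷ _ ∷ []) (_ ∷ _ ∷ _ ∷ _ ∷ []) = refl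

marked-sum : ∀ {T} → All Marked T → Vec.last (xsum (classes T)) ≡ parity (total T)
marked-sum []                = sym (parity-even 0ℤ (Mod.Z-0 2))
marked-sum {x ∷ T} (m ∷ ms) = ≡-trans (last-⊕ᵛ (class x) (xsum (classes T)))
  (≡-trans (cong₂ _xor_ m (marked-sum ms)) (sym (parity-+ (proj₂ x) (total T))))

closed⇒even : ∀ {T} → All Marked T → xsum (classes T) ≡ 0ᵛ → Even (total T)
closed⇒even {T} ms e = parity⇒even (total T) (≡-trans (sym (marked-sum ms)) (cong Vec.last e))

-- The prime two, modulo 4

module TwoCase where

  open Mod 4
  open QuadValues 4

  residues : ∀ {x} → Even x → x ≋ 0ℤ ⊎ x ≋ + 2
  residues {x} (ℤ.divides k refl) = go (even-or-odd k)
    where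
    twofold : ∀ {k} → Even k → Z (k ℤ.* + 2)
    twofold (ℤ.divides q refl) = ℤ.divides q (ℤ.*-assoc q (+ 2) (+ 2))
    lem : ∀ k → (k ℤ.- 1ℤ) ℤ.* + 2 ≡ k ℤ.* + 2 ℤ.- + 2
    lem = solve-∀
    go : Even k ⊎ Even (k ℤ.- 1ℤ) → k ℤ.* + 2 ≋ 0ℤ ⊎ k ℤ.* + 2 ≋ + 2
    go (inj₁ d) = inj₁ (Z⇒≋ (twofold d))
    go (inj₂ d) = inj₂ (mk≋ (subst Z (lem k) (twofold d)))

  module _ {S : List Item} (marked : All Marked S)
    (avoids : ∀ {T} → T ⊑ S → length T ≡ 4 → xsum (classes T) ≡ 0ᵛ → ¬ Z (total T))
    {bs D} (π : S ↭ flat bs ++ D) (ts : All Twin bs) (ds : Separated D) where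

    private
      D⊑S : D ⊑ S
      D⊑S = flat bs , trans π (++-comm (flat bs) D)

      -- A closed quadruple has an even total that is not divisible by 4. So all quadruples agree
      -- without any help from couples.
      two : ∀ {T} → T ⊑ S → length T ≡ 4 → xsum (classes T) ≡ 0ᵛ → total T ≋ + 2
      two {T} i l e = [ (λ z → contradiction (≋⇒Z z) (avoids i l e)) , id ]′ (residues {total T} (closed⇒even {T} (All-⊑ i marked) e))

      quads : ∀ {E} → E ⊑ S → Quads (support E) (value E) (+ 2)
      quads {E} i = mkQuads λ a b c d a∈ b∈ c∈ d∈ n₁ n₂ n₃ n₄ n₅ n₆ e →
        let o = StageOps.quad-opt 2 Primality.prime[2] E a∈ b∈ c∈ d∈ n₁ n₂ n₃ n₄ n₅ n₆ e in
        subst (_≋ + 2) (amount o) (two (⊑-trans (within o) i) (weight o) (closed o))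

      twofold : ∀ {x y} → Even x → Even y → x ≋ y → Z (x ℤ.+ (y ℤ.+ 0ℤ))
      twofold {x} {y} dx dy e = [ zeros , twos ]′ (residues {x} dx)
        where
        lem₀ : ∀ x y → (x ℤ.- 0ℤ) ℤ.+ (y ℤ.- 0ℤ) ≡ x ℤ.+ (y ℤ.+ 0ℤ)
        lem₀ = solve-∀
        lem₂ : ∀ x y → ((x ℤ.- + 2) ℤ.+ (y ℤ.- + 2)) ℤ.+ + 4 ≡ x ℤ.+ (y ℤ.+ 0ℤ)
        lem₂ = solve-∀
        zeros : x ≋ 0ℤ → Z (x ℤ.+ (y ℤ.+ 0ℤ))
        zeros z = subst Z (lem₀ x y) (Z-+ (un≋ z) (un≋ (≋-trans (≋-sym e) z)))
        twos : x ≋ + 2 → Z (x ℤ.+ (y ℤ.+ 0ℤ))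
        twos z = subst Z (lem₂ x y) (Z-+ (Z-+ (un≋ z) (un≋ (≋-trans (≋-sym e) z))) ℤ.∣-refl)

      even-blocks : All (λ b → Even (block-value b)) bs
      even-blocks = All.tabulate λ {b} b∈ → subst Even (≡-trans (total-flat [ b ]) (ℤ.+-identityʳ (block-value b)))
          (closed⇒even {flat [ b ]} (All-⊑ (⊑-trans (flat-⊑ {ps = [ b ]} {bs} (∈⇒↭ b∈)) (D , π)) marked) (xsum-twins {[ b ]} (All.lookup ts b∈ ∷ [])))

      unequal : ∀ {b c cs} → bs ↭ b ∷ c ∷ cs → ¬ block-value b ≋ block-value c
      unequal {b} {c} {cs} σ e = avoids (⊑-trans (flat-⊑ {ps = b ∷ c ∷ []} {bs} (cs , σ)) (D , π)) refl (xsum-twins {b ∷ c ∷ []} (All.head tw ∷ All.head (All.tail tw) ∷ []))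
          (subst Z (sym (total-flat (b ∷ c ∷ []))) (twofold {block-value b} {block-value c} (All.head evens) (All.head (All.tail evens)) e))
        where
        evens = All-resp-↭ σ even-blocks
        tw = All-resp-↭ σ ts

      -- Block values are 0 or 2 modulo 4, and two blocks of equal value would sum to 0; hence at
      -- most one block of each value.
      few : length bs ℕ.≤ 2
      few = ℕ.≮⇒≥ (three bs refl)
        where
        three : ∀ cs → cs ≡ bs → ¬ 2 ℕ.< length cs
        three (a ∷ b ∷ c ∷ cs) refl _ = pigeon (residues {block-value a} (All.head even-blocks)) (residues {block-value b} (All.head (All.tail even-blocks))) (residues {block-value c} (All.head (All.tail (All.tail even-blocks))))
          where
          ab = unequal refl
          ac : ¬ block-value a ≋ block-value c
          ac = unequal (prep a (swap b c refl))
          bc : ¬ block-value b ≋ block-value c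
          bc = unequal (trans (swap a b refl) (prep b (swap a c refl)))
          Res : ℤ → Set
          Res x = x ≋ 0ℤ ⊎ x ≋ + 2
          pigeon : Res (block-value a) → Res (block-value b) → Res (block-value c) → ⊥
          pigeon (inj₁ x) (inj₁ y) _ = ab (≋-trans x (≋-sym y))
          pigeon (inj₂ x) (inj₂ y) _ = ab (≋-trans x (≋-sym y))
          pigeon (inj₁ x) _ (inj₁ y) = ac (≋-trans x (≋-sym y))
          pigeon (inj₂ x) _ (inj₂ y) = ac (≋-trans x (≋-sym y))
          pigeon _ (inj₁ x) (inj₁ y) = bc (≋-trans x (≋-sym y))
          pigeon _ (inj₂ x) (inj₂ y) = bc (≋-trans x (≋-sym y))
        three (_ ∷ []) _ (s≤s ())
        three (_ ∷ _ ∷ []) _ (s≤s (s≤s ()))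

      four-fold : ∀ {x} → ¬ 4· x ≋ + 2
      four-fold {x} (mk≋ d) = ℕ.<⇒≱ (s≤s (s≤s (s≤s z≤n))) (ℕ.∣⇒≤ (ℤ.∣⇒∣ᵤ
          (subst Z (lem x) (Z-+ (Z-neg d) (ℤ.divides x refl)))))
        where
        lem : ∀ x → ℤ.- (((x ℤ.+ x) ℤ.+ (x ℤ.+ x)) ℤ.- + 2) ℤ.+ x ℤ.* + 4 ≡ + 2
        lem = solve-∀

      remaining : ∀ n → length D ℕ.+ 2 ℕ.* length bs ≡ n ℕ.+ 4 → n ℕ.≤ length D
      remaining n len = ℕ.+-cancelʳ-≤ 4 n (length D) (subst (ℕ._≤ length D ℕ.+ 4) len (ℕ.+-monoʳ-≤ (length D) (ℕ.*-monoʳ-≤ 2 few)))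

    -- With at most two blocks nine classes remain, and nine points contain a normal one. Its
    -- fourfold value would be 2 modulo 4, which is impossible.
    rank-four : length D ℕ.+ 2 ℕ.* length bs ≡ 13 → ⊥
    rank-four len = let (v , v∈ , d) = nine-value (quads (⊑-trans (take-⊑ 9 D) D⊑S))
                                          (≡-trans (count-support (AllPairs.take⁺ 9 ds)) (length-take-≤ {xs = D} (remaining 9 len)))
                    in four-fold {value (take 9 D) v} d

    rank-three : All Flat S → length D ℕ.+ 2 ℕ.* length bs ≡ 11 → ⊥
    rank-three fs len = first D refl
      where
      7≤ = remaining 7 len
      empty-half : proj₂ (support D) ≡ empty
      empty-half = support-flat (All-⊑ D⊑S fs)
      big : Big (support D)
      big = hyperplane (subst (7 ℕ.≤_) (≡-trans (sym (count-support ds)) (≡-trans (cong (λ t → count {3} (proj₁ (support D)) ℕ.+ count {3} t) empty-half) (ℕ.+-identityʳ _))) 7≤) empty-half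
      first : ∀ E → E ≡ D → ⊥
      first []      refl = contradiction 7≤ λ ()
      first (x ∷ E) refl = four-fold {value D (class x)} (big-value (quads D⊑S) big {class x} (∈-support {x} {x ∷ E} (here refl)))

-- Decidability of the search lets a refutation of "no such subsequence" be turned into an actual
-- subsequence, so the prime case can be argued by contradiction.
⊑-search : {A : Set} {P : List A → Set} → (∀ {T T′} → T ↭ T′ → P T → P T′) → (∀ T → Dec (P T)) → ∀ S → Dec (∃[ T ] T ⊑ S × P T)
⊑-search resp P? [] = map′ (λ h → [] , ⊑-refl , h) (λ { ([] , _ , h) → h ; (_ ∷ _ , (_ , π) , _) → contradiction (↭-length π) λ () }) (P? [])
⊑-search {A} {P} resp P? (x ∷ S) = map′ [ with-x , without-x ]′ either
    (⊑-search (λ σ → resp (prep x σ)) (λ T → P? (x ∷ T)) S ⊎-dec ⊑-search resp P? S)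
  where
  with-x : ∃[ T ] T ⊑ S × P (x ∷ T) → ∃[ T ] T ⊑ (x ∷ S) × P T
  with-x (T , (U , π) , h) = x ∷ T , (U , prep x π) , h
  without-x : ∃[ T ] T ⊑ S × P T → ∃[ T ] T ⊑ (x ∷ S) × P T
  without-x (T , i , h) = T , ⊑-trans i (⊑-++ˡ [ x ] S) , h
  either : ∃[ T ] T ⊑ (x ∷ S) × P T → (∃[ T ] T ⊑ S × P (x ∷ T)) ⊎ (∃[ T ] T ⊑ S × P T)
  either (T , (U , π) , h) = go (∈-++⁻ T (∈-resp-↭ π (here refl)))
    where
    go : x ∈ T ⊎ x ∈ U → _
    go (inj₁ x∈) = let (T′ , σ) = ∈⇒↭ x∈ in inj₁ (T′ , (U , drop-∷ (trans π (++⁺ʳ U σ))) , resp σ h)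
    go (inj₂ x∈) = let (U′ , σ) = ∈⇒↭ x∈ in inj₂ (T , (U′ , drop-∷ (trans π (trans (++⁺ˡ T σ) (shift x T U′)))) , h)

Neutral : ℕ → List Item → Set
Neutral n T = length T ≡ 2 ℕ.* n × xsum (classes T) ≡ 0ᵛ × + (2 ℕ.* n) ℤ.∣ total T

neutral-↭ : ∀ {n T T′} → T ↭ T′ → Neutral n T → Neutral n T′
neutral-↭ {n} σ (l , e , d) = ≡-trans (sym (↭-length σ)) l , ≡-trans (sym (xsum-↭ (map⁺ class σ))) e
  , subst (+ (2 ℕ.* n) ℤ.∣_) (sum-by-↭ proj₂ σ) d

neutral? : ∀ n T → Dec (Neutral n T)
neutral? n T = (length T ℕ.≟ 2 ℕ.* n) ×-dec ((xsum (classes T) ≟ᵛ 0ᵛ) ×-dec ℤ._∣?_ (+ (2 ℕ.* n)) (total T))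

HasNeutral : ℕ → List Item → Set
HasNeutral n S = ∃[ T ] T ⊑ S × Neutral n T

has-neutral : ∀ {n S} → ¬ ¬ HasNeutral n S → HasNeutral n S
has-neutral {n} {S} = decidable-stable (⊑-search (neutral-↭ {n}) (neutral? n) S)

paired-length : ∀ {S} (P : Pairing S) → length (Pairing.leftover P) ℕ.+ 2 ℕ.* length (Pairing.blocks P) ≡ length S
paired-length P = sym (≡-trans (↭-length (Pairing.paired P)) (≡-trans (length-++ (flat (Pairing.blocks P)))
  (≡-trans (cong (ℕ._+ length (Pairing.leftover P)) (length-flat (Pairing.blocks P))) (ℕ.+-comm _ (length (Pairing.leftover P))))))

module PrimeCase (q : ℕ) (prime : Prime q) where

  private
    double : ¬ + q ℤ.∣ + 2 → ∀ {x} → Even x → + q ℤ.∣ x → + (2 ℕ.* q) ℤ.∣ x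
    double odd {x} (ℤ.divides k refl) d = go (ModPrime.Z-*⁻ q prime k d)
      where
      go : + q ℤ.∣ k ⊎ + q ℤ.∣ + 2 → + (2 ℕ.* q) ℤ.∣ k ℤ.* + 2
      go (inj₂ d′) = contradiction d′ odd
      go (inj₁ (ℤ.divides m refl)) = ℤ.divides m
        (≡-trans (lem m (+ q)) (cong (λ z → m ℤ.* z) (sym (ℤ.pos-* 2 q))))
        where
        lem : ∀ m q → (m ℤ.* q) ℤ.* + 2 ≡ m ℤ.* (+ 2 ℤ.* q)
        lem = solve-∀

    is-two : + q ℤ.∣ + 2 → q ≡ 2
    is-two d = ℕ.≤-antisym (ℕ.∣⇒≤ (ℤ.∣⇒∣ᵤ d)) (ℕ.nonTrivial⇒n>1 q {{Primality.prime⇒nonTrivial prime}})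

    avoids : ∀ {S} → ¬ + q ℤ.∣ + 2 → All Marked S → ¬ HasNeutral q S → Stages.Avoids q prime S
    avoids odd ms none {T} i l e d = none (T , i , l , e , double odd (closed⇒even (All-⊑ i ms) e) d)

    two? = ℤ._∣?_ (+ q) (+ 2)

    exact-four : ∀ {S} → All Marked S → length S ≡ 4 ℕ.* q ℕ.+ 5 → HasNeutral q S
    exact-four {S} ms len = has-neutral {q} λ none → go none two?
      where
      open Pairing (pairing S)
      l = ≡-trans (paired-length (pairing S)) len
      go : ¬ HasNeutral q S → Dec _ → ⊥
      go none (no odd) = OddCase.rank-four q prime odd (avoids odd ms none) paired twins separated l
      go none (yes d)  = TwoCase.rank-four ms (λ {T} i l e d′ → none (T , i , ≡-trans l (cong (2 ℕ.*_) (sym (is-two d))) , e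
          , subst (λ q → + (2 ℕ.* q) ℤ.∣ total T) (sym (is-two d)) d′))
        paired twins separated (≡-trans l (cong (λ q → 4 ℕ.* q ℕ.+ 5) (is-two d)))

    exact-three : ∀ {S} → All Marked S → All Flat S → length S ≡ 4 ℕ.* q ℕ.+ 3 → HasNeutral q S
    exact-three {S} ms fs len = has-neutral {q} λ none → go none two?
      where
      open Pairing (pairing S)
      l = ≡-trans (paired-length (pairing S)) len
      go : ¬ HasNeutral q S → Dec _ → ⊥
      go none (no odd) = OddCase.rank-three q prime odd (avoids odd ms none) paired twins separated fs l
      go none (yes d)  = TwoCase.rank-three ms (λ {T} i l e d′ → none (T , i , ≡-trans l (cong (2 ℕ.*_) (sym (is-two d))) , e
          , subst (λ q → + (2 ℕ.* q) ℤ.∣ total T) (sym (is-two d)) d′))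
        paired twins separated fs (≡-trans l (cong (λ q → 4 ℕ.* q ℕ.+ 3) (is-two d)))

    shorten : ∀ {P : Item → Set} {n S} → All P S → n ℕ.≤ length S → (∀ {S′} → All P S′ → length S′ ≡ n → HasNeutral q S′) → HasNeutral q S
    shorten {n = n} {S} ps n≤ f = let (T , i , h) = f (All-⊑ (take-⊑ n S) ps) (length-take-≤ n≤) in T , ⊑-trans i (take-⊑ n S) , h

  prime-four : ∀ {S} → All Marked S → 4 ℕ.* q ℕ.+ 5 ℕ.≤ length S → HasNeutral q S
  prime-four ms len = shorten ms len exact-four

  prime-three : ∀ {S} → All (λ x → Marked x × Flat x) S → 4 ℕ.* q ℕ.+ 3 ℕ.≤ length S → HasNeutral q S
  prime-three ms len = shorten ms len λ ms → exact-three (All.map proj₁ ms) (All.map proj₂ ms)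

-- Multiplicativity

Forces : ℕ → (Item → Set) → ℕ → Set
Forces c F n = ∀ {S} → All F S → 4 ℕ.* n ℕ.+ c ℕ.≤ length S → HasNeutral n S

module Multiply {c F n} (forces : Forces c F n) where

  Part : Set
  Part = ∃[ T ] Neutral n T

  quotient : Part → ℤ
  quotient (_ , _ , _ , divides k _) = k

  join : List Part → List Item
  join []       = []
  join (T ∷ Ts) = proj₁ T ++ join Ts

  join-++ : ∀ Ts {Us} → join (Ts ++ Us) ≡ join Ts ++ join Us
  join-++ []            = refl
  join-++ (T ∷ Ts) {Us} = ≡-trans (cong (proj₁ T ++_) (join-++ Ts)) (sym (++-assoc (proj₁ T) (join Ts) (join Us)))

  join-↭ : ∀ {Ts Us} → Ts ↭ Us → join Ts ↭ join Us
  join-↭ refl         = refl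
  join-↭ (prep T σ)   = ++⁺ˡ (proj₁ T) (join-↭ σ)
  join-↭ (swap T U σ) = trans (shifts (proj₁ T) (proj₁ U)) (++⁺ˡ (proj₁ U) (++⁺ˡ (proj₁ T) (join-↭ σ)))
  join-↭ (trans σ τ)  = trans (join-↭ σ) (join-↭ τ)

  join-length : ∀ Ts → length (join Ts) ≡ 2 ℕ.* n ℕ.* length Ts
  join-length [] = sym (ℕ.*-zeroʳ (2 ℕ.* n))
  join-length ((T , l , _) ∷ Ts) = ≡-trans (length-++ T) (≡-trans (cong₂ ℕ._+_ l (join-length Ts)) (sym (ℕ.*-suc (2 ℕ.* n) (length Ts))))

  join-closed : ∀ Ts → xsum (classes (join Ts)) ≡ 0ᵛ
  join-closed [] = refl
  join-closed ((T , _ , e , _) ∷ Ts) = ≡-trans (cong xsum (map-++ class T (join Ts)))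
    (≡-trans (xsum-++ (classes T)) (≡-trans (cong₂ _⊕ᵛ_ e (join-closed Ts)) refl))

  join-total : ∀ Ts → total (join Ts) ≡ sum-by quotient Ts ℤ.* + (2 ℕ.* n)
  join-total [] = refl
  join-total ((T , _ , _ , divides k e) ∷ Ts) = ≡-trans (sum-by-++ proj₂ T)
    (≡-trans (cong₂ ℤ._+_ e (join-total Ts)) (sym (ℤ.*-distribʳ-+ (+ (2 ℕ.* n)) k (sum-by quotient Ts))))

  -- Before each extraction at least `4n + c` terms are present: `2n` for the part itself and
  -- `2n + c` held in reserve.
  extract : ∀ k {S} → All F S → 2 ℕ.* n ℕ.* k ℕ.+ (2 ℕ.* n ℕ.+ c) ℕ.≤ length S → ∃[ Ts ] join Ts ⊑ S × length Ts ≡ k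
  extract zero    {S} fs long = [] , (S , refl) , refl
  extract (suc k) {S} fs long =
    let (T , (U , π) , N) = forces fs (ℕ.≤-trans (ℕ.≤-trans (ℕ.m≤n+m _ (2 ℕ.* n ℕ.* k)) (ℕ.≤-reflexive (lem n k c))) long)
        (Ts , i , l) = extract k (All.++⁻ʳ T (All-resp-↭ π fs)) (ℕ.+-cancelˡ-≤ (2 ℕ.* n) _ _
          (ℕ.≤-trans (ℕ.≤-reflexive (lem′ n k c)) (ℕ.≤-trans long (ℕ.≤-reflexive (≡-trans (↭-length π) (≡-trans (length-++ T) (cong (ℕ._+ length U) (proj₁ N))))))))
    in (T , N) ∷ Ts , ⊑-trans (⊑-++ {S = T} ⊑-refl i) (↭⇒⊑ π) , cong suc l
    where
    lem : ∀ n k c → 2 ℕ.* n ℕ.* k ℕ.+ (4 ℕ.* n ℕ.+ c) ≡ 2 ℕ.* n ℕ.* suc k ℕ.+ (2 ℕ.* n ℕ.+ c)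
    lem = ℕ-Solver.solve-∀
    lem′ : ∀ n k c → 2 ℕ.* n ℕ.+ (2 ℕ.* n ℕ.* k ℕ.+ (2 ℕ.* n ℕ.+ c)) ≡ 2 ℕ.* n ℕ.* suc k ℕ.+ (2 ℕ.* n ℕ.+ c)
    lem′ = ℕ-Solver.solve-∀

  -- From `4qn + c` terms exactly 2q - 1 disjoint neutral parts can be extracted. Dividing their
  -- totals by `2n` and applying Erdős-Ginzburg-Ziv modulo q selects q parts, which join to a
  -- neutral sequence for `q n`.
  multiply : ∀ {q} → Prime q → Forces c F (q ℕ.* n)
  multiply {q} q-prime {S} fs long =
    let (Ts , i , l) = extract k fs (ℕ.≤-trans (ℕ.≤-reflexive size) long)
        (Us , (Ws , σ) , l′ , z) = PrimeBlocks.egz q q-prime quotient {Ts} (ℕ.≤-reflexive (sym (≡-trans (cong suc l) suc-k)))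
    in join Us , ⊑-trans (join Ws , trans (join-↭ σ) (↭-reflexive (join-++ Us))) i
     , ≡-trans (join-length Us) (≡-trans (cong (2 ℕ.* n ℕ.*_) l′) (lem₂ n q)) , join-closed Us , divides-both Us z
    where
    k = ℕ.pred (2 ℕ.* q)
    suc-k : suc k ≡ 2 ℕ.* q
    suc-k = ℕ.suc-pred (2 ℕ.* q) {{ℕ.m*n≢0 2 q {{_}} {{Primality.prime⇒nonZero q-prime}}}}
    lem₁ : ∀ n k c → 2 ℕ.* n ℕ.* k ℕ.+ (2 ℕ.* n ℕ.+ c) ≡ 2 ℕ.* n ℕ.* suc k ℕ.+ c
    lem₁ = ℕ-Solver.solve-∀
    lem₂ : ∀ n q → 2 ℕ.* n ℕ.* q ≡ 2 ℕ.* (q ℕ.* n)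
    lem₂ = ℕ-Solver.solve-∀
    lem₃ : ∀ n q c → 2 ℕ.* n ℕ.* (2 ℕ.* q) ℕ.+ c ≡ 4 ℕ.* (q ℕ.* n) ℕ.+ c
    lem₃ = ℕ-Solver.solve-∀
    size : 2 ℕ.* n ℕ.* k ℕ.+ (2 ℕ.* n ℕ.+ c) ≡ 4 ℕ.* (q ℕ.* n) ℕ.+ c
    size = ≡-trans (lem₁ n k c) (≡-trans (cong (λ j → 2 ℕ.* n ℕ.* j ℕ.+ c) suc-k) (lem₃ n q c))
    divides-both : ∀ Us → + q ℤ.∣ sum-by quotient Us → + (2 ℕ.* (q ℕ.* n)) ℤ.∣ total (join Us)
    divides-both Us (divides j e) = divides j (≡-trans (join-total Us) (≡-trans (cong (λ s → s ℤ.* + (2 ℕ.* n)) e)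
      (≡-trans (ℤ.*-assoc j (+ q) (+ (2 ℕ.* n))) (cong (λ s → j ℤ.* s) (≡-trans (sym (ℤ.pos-* q (2 ℕ.* n))) (cong +_ (lem₄ q n)))))))
      where
      lem₄ : ∀ q n → q ℕ.* (2 ℕ.* n) ≡ 2 ℕ.* (q ℕ.* n)
      lem₄ = ℕ-Solver.solve-∀

all-forced : ∀ {c F} → (∀ q → Prime q → Forces c F q) → ∀ n → 2 ℕ.≤ n → Forces c F n
all-forced {c} {F} base n 2≤n = subst (Forces c F) (sym isFactorisation) (go factors factorsPrime (subst (2 ℕ.≤_) isFactorisation 2≤n))
  where
  open PrimeFactorisation (factorise n {{ℕ.>-nonZero (ℕ.<-trans (s≤s z≤n) 2≤n)}})
  from : ∀ q qs → Prime q → All Prime qs → Forces c F (ℕ.product (q ∷ qs))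
  from q []        pq []         = subst (Forces c F) (sym (ℕ.*-identityʳ q)) (base q pq)
  from q (q′ ∷ qs) pq (pq′ ∷ ps) = Multiply.multiply {c} {F} {ℕ.product (q′ ∷ qs)} (from q′ qs pq′ ps) pq
  go : ∀ qs → All Prime qs → 2 ℕ.≤ ℕ.product qs → Forces c F (ℕ.product qs)
  go []       []       (s≤s ())
  go (q ∷ qs) (pq ∷ ps) _ = from q qs pq ps

four-forced : ∀ n → 2 ℕ.≤ n → Forces 5 Marked n
four-forced = all-forced λ q prime → PrimeCase.prime-four q prime

FlatMarked : Item → Set
FlatMarked x = Marked x × Flat x

three-forced : ∀ n → 2 ℕ.≤ n → Forces 3 FlatMarked n
three-forced = all-forced λ q prime → PrimeCase.prime-three q prime

-- From zero-sums of length 2n to short zero-sums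

⊑-split : {A : Set} (S : List A) {R T : List A} → T ⊑ (S ++ R) → ∃[ T₁ ] ∃[ T₂ ] T ↭ T₁ ++ T₂ × T₁ ⊑ S × T₂ ⊑ R
⊑-split []      {T = T} i = [] , T , refl , ⊑-refl , i
⊑-split (x ∷ S) {R} {T} (U , π) = go (∈-++⁻ T (∈-resp-↭ π (here refl)))
  where
  go : x ∈ T ⊎ x ∈ U → _
  go (inj₁ x∈) =
    let (T′ , σ) = ∈⇒↭ x∈
        (T₁ , T₂ , τ , (U₁ , ρ) , j) = ⊑-split S {R} {T′} (U , drop-∷ (trans π (++⁺ʳ U σ)))
    in x ∷ T₁ , T₂ , trans σ (prep x τ) , (U₁ , prep x ρ) , j
  go (inj₂ x∈) =
    let (U′ , σ) = ∈⇒↭ x∈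
        (T₁ , T₂ , τ , i , j) = ⊑-split S {R} {T} (U′ , drop-∷ (trans π (trans (++⁺ˡ T σ) (shift x T U′))))
    in T₁ , T₂ , τ , ⊑-trans i (⊑-++ˡ [ x ] S) , j

Short : ℕ → List Item → Set
Short n T = 1 ℕ.≤ length T × length T ℕ.≤ 2 ℕ.* n × xsum (classes T) ≡ 0ᵛ × + (2 ℕ.* n) ℤ.∣ total T

zero-item : Item
zero-item = 0ᵛ , 0ℤ

-- 2n - 1 zeros turn a zero-sum subsequence of length 2n into a short one.
short : ∀ {c F} n → Forces c F n → F zero-item → ∀ {S} → All F S → suc (2 ℕ.* n ℕ.+ c) ℕ.≤ length S → 1 ℕ.≤ n → ∃[ T ] T ⊑ S × Short n T
short {c} {F} n forces f₀ {S} fs long 1≤n =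
  let (T , i , N) = forces (All.++⁺ fs (All.replicate⁺ k f₀)) (ℕ.≤-trans enough (ℕ.≤-reflexive (sym (≡-trans (length-++ S) (cong (length S ℕ.+_) (length-replicate k))))))
      (T₁ , T₂ , σ , i₁ , i₂) = ⊑-split S i
  in T₁ , i₁ , conclude σ i₂ (neutral-↭ {n} σ N)
  where
  k = ℕ.pred (2 ℕ.* n)
  suc-k : suc k ≡ 2 ℕ.* n
  suc-k = ℕ.suc-pred (2 ℕ.* n) {{ℕ.m*n≢0 2 n {{_}} {{ℕ.>-nonZero 1≤n}}}}
  enough : 4 ℕ.* n ℕ.+ c ℕ.≤ length S ℕ.+ k
  enough = ℕ.≤-trans (ℕ.≤-reflexive (≡-trans (lem n c) (≡-trans (cong (λ j → 2 ℕ.* n ℕ.+ c ℕ.+ j) (sym suc-k)) (ℕ.+-suc _ k)))) (ℕ.+-monoˡ-≤ k long)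
    where
    lem : ∀ n c → 4 ℕ.* n ℕ.+ c ≡ 2 ℕ.* n ℕ.+ c ℕ.+ 2 ℕ.* n
    lem = ℕ-Solver.solve-∀
  null : ∀ {Z} → All (_≡ zero-item) Z → xsum (classes Z) ≡ 0ᵛ × total Z ≡ 0ℤ
  null [] = refl , refl
  null (refl ∷ es) = let (e , e′) = null es in ≡-trans (cong (0ᵛ ⊕ᵛ_) e) refl , ≡-trans (ℤ.+-identityˡ _) e′
  conclude : ∀ {T T₁ T₂} → T ↭ T₁ ++ T₂ → T₂ ⊑ replicate k zero-item → Neutral n (T₁ ++ T₂) → Short n T₁
  conclude {T₁ = T₁} {T₂} σ i₂ (l , e , d) =
      nonempty , ℕ.≤-trans (ℕ.m≤m+n (length T₁) (length T₂)) (ℕ.≤-reflexive l′)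
    , ≡-trans (sym (⊕ᵛ-identityʳ _)) (≡-trans (cong (xsum (classes T₁) ⊕ᵛ_) (sym (proj₁ z))) (≡-trans (sym (≡-trans (cong xsum (map-++ class T₁ T₂)) (xsum-++ (classes T₁)))) e))
    , subst (+ (2 ℕ.* n) ℤ.∣_) (≡-trans (sum-by-++ proj₂ T₁) (≡-trans (cong (λ s → total T₁ ℤ.+ s) (proj₂ z)) (ℤ.+-identityʳ _))) d
    where
    z = null (All-⊑ i₂ (All.replicate⁺ k refl))
    l′ : length T₁ ℕ.+ length T₂ ≡ 2 ℕ.* n
    l′ = ≡-trans (sym (length-++ T₁)) l
    -- The neutral subsequence has 2n terms, one more than there are added zeros.
    nonempty : 1 ℕ.≤ length T₁
    nonempty = ℕ.+-cancelʳ-≤ k 1 (length T₁) (ℕ.≤-trans (ℕ.≤-reflexive (≡-trans suc-k (sym l′)))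
      (ℕ.+-monoʳ-≤ (length T₁) (ℕ.≤-trans (⊑-length i₂) (ℕ.≤-reflexive (length-replicate k)))))

-- Groups

open import Defs

module AG = AbelianGroup

⊑-map⁻ : {A B : Set} (f : A → B) (S : List A) {T : List B} → T ⊑ map f S → ∃[ T′ ] T′ ⊑ S × map f T′ ≡ T
⊑-map⁻ f S {T} (U , π) = let (S′ , e , σ) = ↭-map-inv f π in
    take (length T) S′ , ⊑-trans (take-⊑ (length T) S′) (↭⇒⊑ σ)
  , ≡-trans (sym (take-map (length T) S′)) (≡-trans (cong (take (length T)) (sym e)) (take-all T U))
  where
  take-all : ∀ (T U : List _) → take (length T) (T ++ U) ≡ T
  take-all []      U = refl
  take-all (x ∷ T) U = cong (x ∷_) (take-all T U)

parity-cong : ∀ {x y} → Even (x ℤ.- y) → parity x ≡ parity y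
parity-cong {x} {y} d = ≡-trans (cong parity (lem x y)) (≡-trans (parity-+ (x ℤ.- y) y) (cong (_xor parity y) (parity-even (x ℤ.- y) d)))
  where
  lem : ∀ x y → x ≡ (x ℤ.- y) ℤ.+ y
  lem = solve-∀

bits : ∀ r → AG.Carrier (C 2 ^⊕ r) → V r
bits zero    _       = []
bits (suc r) (a , x) = parity a ∷ bits r x

bits-ε : ∀ r → bits r (AG.ε (C 2 ^⊕ r)) ≡ 0ᵛ
bits-ε zero    = refl
bits-ε (suc r) = cong (false ∷_) (bits-ε r)

bits-∙ : ∀ r x y → bits r (AG._∙_ (C 2 ^⊕ r) x y) ≡ bits r x ⊕ᵛ bits r y
bits-∙ zero    _       _       = refl
bits-∙ (suc r) (a , x) (b , y) = cong₂ _∷_ (parity-+ a b) (bits-∙ r x y)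

bits-cong : ∀ r {x y} → AG._≈_ (C 2 ^⊕ r) x y → bits r x ≡ bits r y
bits-cong zero    _       = refl
bits-cong (suc r) {a , _} {b , _} (d , e) = cong₂ _∷_ (parity-cong {a} {b} d) (bits-cong r e)

bits⇒≈ε : ∀ r {x} → bits r x ≡ 0ᵛ → AG._≈_ (C 2 ^⊕ r) x (AG.ε (C 2 ^⊕ r))
bits⇒≈ε zero    _ = _
bits⇒≈ε (suc r) {a , x} e = subst Even (sym (ℤ.+-identityʳ a)) (parity⇒even a (cong Vec.head e)) , bits⇒≈ε r (cong Vec.tail e)

mark : V 3 → Bool → V 4
mark (a ∷ b ∷ c ∷ []) d = a ∷ b ∷ c ∷ d ∷ []

mark-⊕ᵛ : ∀ u v a b → mark (u ⊕ᵛ v) (a xor b) ≡ mark u a ⊕ᵛ mark v b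
mark-⊕ᵛ (_ ∷ _ ∷ _ ∷ []) (_ ∷ _ ∷ _ ∷ []) a b = refl

mark≡0 : ∀ {u a} → mark u a ≡ 0ᵛ → u ≡ 0ᵛ
mark≡0 {_ ∷ _ ∷ _ ∷ []} refl = refl

last-mark : ∀ u {a} → Vec.last (mark u a) ≡ a
last-mark (_ ∷ _ ∷ _ ∷ []) = refl

-- An additive injection into three bits, which lets both groups use the same four-bit classes.
record Padding (r : ℕ) : Set where
  field
    pad   : V r → V 3
    pad-⊕ : ∀ u v → pad (u ⊕ᵛ v) ≡ pad u ⊕ᵛ pad v
    pad-0 : pad 0ᵛ ≡ 0ᵛ
    pad⇒0 : ∀ {u} → pad u ≡ 0ᵛ → u ≡ 0ᵛ

module Upper {r n c F} (P : Padding r) (1≤n : 1 ℕ.≤ n) (forces : Forces c F n)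
  (F-all : ∀ v z → F (mark (Padding.pad P v) (parity z) , z)) where

  open Padding P

  G : AbelianGroup 0ℓ 0ℓ
  G = C 2 ^⊕ r ⊕ C (2 ℕ.* n)

  open AG G using (Carrier; _∙_; ε; isEquivalence)

  item : Carrier → Item
  item (x , z) = mark (pad (bits r x)) (parity z) , z

  sum-class : ∀ T → class (item (foldr _∙_ ε T)) ≡ xsum (classes (map item T))
  sum-class [] = ≡-trans (cong (λ v → mark (pad v) false) (bits-ε r)) (cong (λ v → mark v false) pad-0)
  sum-class ((x , z) ∷ T) = let s = foldr _∙_ ε T in
    ≡-trans (cong₂ mark (≡-trans (cong pad (bits-∙ r x (proj₁ s))) (pad-⊕ (bits r x) (bits r (proj₁ s)))) (parity-+ z (proj₂ s)))
      (≡-trans (mark-⊕ᵛ (pad (bits r x)) (pad (bits r (proj₁ s))) (parity z) (parity (proj₂ s))) (cong (class (item (x , z)) ⊕ᵛ_) (sum-class T)))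

  sum-total : ∀ T → proj₂ (foldr _∙_ ε T) ≡ total (map item T)
  sum-total []            = refl
  sum-total ((x , z) ∷ T) = cong (λ s → z ℤ.+ s) (sum-total T)

  zero-sum : ∀ T → xsum (classes (map item T)) ≡ 0ᵛ → + (2 ℕ.* n) ℤ.∣ total (map item T) → ZeroSum G T
  zero-sum T e d = bits⇒≈ε r (pad⇒0 (mark≡0 (≡-trans (sum-class T) e)))
    , subst (+ (2 ℕ.* n) ℤ.∣_) (≡-trans (sym (sum-total T)) (sym (ℤ.+-identityʳ _))) d

  subsequence : ∀ {S T} → T ⊑ S → _IsSubsequenceOf_ G T S
  subsequence (U , π) = U , ↭⇒↭ₛ′ isEquivalence (↭-sym π)

  items-F : ∀ S → All F (map item S)
  items-F []            = []
  items-F ((x , z) ∷ S) = F-all (bits r x) z ∷ items-F S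

  𝗌-bound : ∀ S → length S ℕ.≥ 4 ℕ.* n ℕ.+ c → ∃[ T ] _IsSubsequenceOf_ G T S × ZeroSum G T × length T ≡ 2 ℕ.* n
  𝗌-bound S long = found (forces (items-F S) (subst (4 ℕ.* n ℕ.+ c ℕ.≤_) (sym (length-map item S)) long))
    where
    found : HasNeutral n (map item S) → ∃[ T ] _IsSubsequenceOf_ G T S × ZeroSum G T × length T ≡ 2 ℕ.* n
    found (T , i , l , e , d) with ⊑-map⁻ item S i
    ... | T′ , j , refl = T′ , subsequence j , zero-sum T′ e d , ≡-trans (sym (length-map item T′)) l

  η-bound : F zero-item → ∀ S → length S ℕ.≥ 2 ℕ.* n ℕ.+ suc c →
            ∃[ T ] _IsSubsequenceOf_ G T S × ZeroSum G T × 1 ℕ.≤ length T × length T ℕ.≤ 2 ℕ.* n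
  η-bound f₀ S long = found (short n forces f₀ (items-F S)
      (ℕ.≤-trans (ℕ.≤-reflexive (sym (ℕ.+-suc (2 ℕ.* n) c))) (subst (2 ℕ.* n ℕ.+ suc c ℕ.≤_) (sym (length-map item S)) long)) 1≤n)
    where
    found : ∃[ T ] T ⊑ map item S × Short n T → ∃[ T ] _IsSubsequenceOf_ G T S × ZeroSum G T × 1 ℕ.≤ length T × length T ℕ.≤ 2 ℕ.* n
    found (T , i , l , l′ , e , d) with ⊑-map⁻ item S i
    ... | T′ , j , refl = T′ , subsequence j , zero-sum T′ e d , subst (1 ℕ.≤_) (length-map item T′) l , subst (ℕ._≤ 2 ℕ.* n) (length-map item T′) l′

-- The exponent

Annihilates : ℕ → AbelianGroup 0ℓ 0ℓ → Set
Annihilates m G = ∀ x → AG._≈_ G (m · x) (AG.ε G)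
  where open RawMonoid (AG.rawMonoid G) using () renaming (_×_ to _·_)

module _ (G H : AbelianGroup 0ℓ 0ℓ) where

  private
    module G×H = RawMonoid (AG.rawMonoid (G ⊕ H))
    module GM = RawMonoid (AG.rawMonoid G)
    module HM = RawMonoid (AG.rawMonoid H)

  multiple-pair : ∀ m x y → m G×H.× (x , y) ≡ (m GM.× x , m HM.× y)
  multiple-pair zero    x y = refl
  multiple-pair (suc m) x y = cong (AG._∙_ (G ⊕ H) (x , y)) (multiple-pair m x y)

  annihilates-⊕ : ∀ {m} → Annihilates m G → Annihilates m H → Annihilates m (G ⊕ H)
  annihilates-⊕ {m} f g (x , y) rewrite multiple-pair m x y = f x , g y

multiple-C : ∀ k m z → RawMonoid._×_ (AG.rawMonoid (C k)) m z ≡ + m ℤ.* z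
multiple-C k zero    z = refl
multiple-C k (suc m) z = ≡-trans (cong (λ s → z ℤ.+ s) (multiple-C k m z)) (lem z (+ m))
  where
  lem : ∀ z m → z ℤ.+ m ℤ.* z ≡ (1ℤ ℤ.+ m) ℤ.* z
  lem = solve-∀

annihilates-C : ∀ {k m} → k ℕ.∣ m → Annihilates m (C k)
annihilates-C {k} {m} k∣m z = subst (+ k ℤ.∣_) (sym (≡-trans (ℤ.+-identityʳ _) (multiple-C k m z)))
  (ℤ.∣m⇒∣m*n {i = + k} {m = + m} z (∣ᵤ⇒∣ k∣m))

annihilates-^⊕ : ∀ {m} r → 2 ℕ.∣ m → Annihilates m (C 2 ^⊕ r)
annihilates-^⊕     zero    d x = _
annihilates-^⊕ {m} (suc r) d   = annihilates-⊕ (C 2) (C 2 ^⊕ r) {m} (annihilates-C d) (annihilates-^⊕ r d)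

exponent : ∀ r n → 1 ℕ.≤ n → IsExponent (C 2 ^⊕ r ⊕ C (2 ℕ.* n)) (2 ℕ.* n)
exponent r n 1≤n = (ℕ.≤-trans 1≤n (ℕ.m≤m+n n _) , annihilates-⊕ (C 2 ^⊕ r) (C (2 ℕ.* n)) {2 ℕ.* n}
      (annihilates-^⊕ r (ℕ.m∣m*n n)) (annihilates-C ℕ.∣-refl))
    , least
  where
  least : ∀ k → k ℕ.≥ 1 × Annihilates k (C 2 ^⊕ r ⊕ C (2 ℕ.* n)) → 2 ℕ.* n ℕ.≤ k
  least k@(suc _) (_ , f) = ℕ.∣⇒≤ (∣⇒∣ᵤ (subst (+ (2 ℕ.* n) ℤ.∣_)
    (≡-trans (ℤ.+-identityʳ _) (≡-trans (cong proj₂ (multiple-pair (C 2 ^⊕ r) (C (2 ℕ.* n)) k (AG.ε (C 2 ^⊕ r)) 1ℤ))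
      (≡-trans (multiple-C (2 ℕ.* n) k 1ℤ) (ℤ.*-identityʳ (+ k)))))
    (proj₂ (f (AG.ε (C 2 ^⊕ r) , 1ℤ)))))

-- Extremal sequences

Cell : ℕ → Set
Cell r = V r × ℕ

corner : ∀ r → List (Cell r)
corner zero    = []
corner (suc r) = (true ∷ 0ᵛ , 0) ∷ (true ∷ 0ᵛ , 1) ∷ map (λ (v , k) → false ∷ v , k) (corner r)

length-corner : ∀ r → length (corner r) ≡ 2 ℕ.* r
length-corner zero    = refl
length-corner (suc r) = ≡-trans (cong (2 ℕ.+_) (≡-trans (length-map _ (corner r)) (length-corner r))) (sym (ℕ.*-suc 2 r))

heads : ∀ {r} → List (Cell r) → V r
heads T = xsum (map proj₁ T)

tails : ∀ {r} → List (Cell r) → ℕ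
tails T = ℕ.sum (map proj₂ T)

heads-++ : ∀ {r} (T U : List (Cell r)) → heads (T ++ U) ≡ heads T ⊕ᵛ heads U
heads-++ T U = ≡-trans (cong xsum (map-++ proj₁ T U)) (xsum-++ (map proj₁ T))

tails-++ : ∀ {r} (T U : List (Cell r)) → tails (T ++ U) ≡ tails T ℕ.+ tails U
tails-++ T U = ≡-trans (cong ℕ.sum (map-++ proj₂ T U)) (sum-++ (map proj₂ T) (map proj₂ U))

heads-↭ : ∀ {r} {T U : List (Cell r)} → T ↭ U → heads T ≡ heads U
heads-↭ σ = xsum-↭ (map⁺ proj₁ σ)

tails-↭ : ∀ {r} {T U : List (Cell r)} → T ↭ U → tails T ≡ tails U
tails-↭ σ = sum-↭ (map⁺ proj₂ σ)

-- The coordinate of e forces both or none of (e , 0) and (e , 1) to occur.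
corner-closed : ∀ r {T} → T ⊑ corner r → heads T ≡ 0ᵛ → length T ≡ 2 ℕ.* tails T
corner-closed zero    {T} (U , π) e = none T (↭-length π)
  where
  none : ∀ T → 0 ≡ length (T ++ U) → length T ≡ 2 ℕ.* tails T
  none [] _ = refl
corner-closed (suc r) {T} i e =
  let (T₁ , T₂ , σ , i₁ , i₂) = ⊑-split (p ∷ q ∷ []) i
      (T₃ , i₃ , e₃) = ⊑-map⁻ down (corner r) i₂
      σ′ = trans σ (↭-reflexive (cong (T₁ ++_) (sym e₃)))
      h : heads T₁ ⊕ᵛ (false ∷ heads T₃) ≡ 0ᵛ
      h = ≡-trans (cong (heads T₁ ⊕ᵛ_) (sym (down-heads T₃))) (≡-trans (sym (heads-++ T₁ (map down T₃))) (≡-trans (sym (heads-↭ σ′)) e))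
      (z , l) = pair-closed T₁ i₁ h
      h₃ : heads T₃ ≡ 0ᵛ
      h₃ = cong Vec.tail (≡-trans (sym (⊕ᵛ-identityˡ (false ∷ heads T₃))) (≡-trans (cong (_⊕ᵛ (false ∷ heads T₃)) (sym z)) h))
  in ≡-trans (↭-length σ′) (≡-trans (length-++ T₁) (≡-trans (cong₂ ℕ._+_ l (≡-trans (length-map down T₃) (≡-trans (corner-closed r i₃ h₃) (cong (2 ℕ.*_) (sym (down-tails T₃))))))
       (≡-trans (sym (ℕ.*-distribˡ-+ 2 (tails T₁) (tails (map down T₃)))) (cong (2 ℕ.*_) (≡-trans (sym (tails-++ T₁ (map down T₃))) (sym (tails-↭ σ′)))))))
  where
  p q : Cell (suc r)
  p = true ∷ 0ᵛ , 0
  q = true ∷ 0ᵛ , 1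
  down : Cell r → Cell (suc r)
  down (v , k) = false ∷ v , k
  down-heads : ∀ T → heads (map down T) ≡ false ∷ heads T
  down-heads []      = refl
  down-heads (x ∷ T) = cong ((false ∷ proj₁ x) ⊕ᵛ_) (down-heads T)
  down-tails : ∀ T → tails (map down T) ≡ tails T
  down-tails []      = refl
  down-tails (x ∷ T) = cong (proj₂ x ℕ.+_) (down-tails T)
  pair-closed : ∀ T {v} → T ⊑ (p ∷ q ∷ []) → heads T ⊕ᵛ (false ∷ v) ≡ 0ᵛ → heads T ≡ 0ᵛ × length T ≡ 2 ℕ.* tails T
  pair-closed [] _ _ = refl , refl
  pair-closed (x ∷ []) {v} (U , π) h = contradiction (≡-trans (sym (one (∈-resp-↭ (↭-sym π) (here refl)))) (cong Vec.head h)) λ ()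
    where
    one : x ∈ p ∷ q ∷ [] → Vec.head (heads (x ∷ []) ⊕ᵛ (false ∷ v)) ≡ true
    one (here refl)         = refl
    one (there (here refl)) = refl
  pair-closed (x ∷ y ∷ []) ([] , π) _ = ≡-trans (sym (heads-↭ π)) (≡-trans (cong ((true ∷ 0ᵛ) ⊕ᵛ_) (⊕ᵛ-identityʳ _)) (⊕ᵛ-self (true ∷ 0ᵛ))) , cong (2 ℕ.*_) (tails-↭ π)
  pair-closed (_ ∷ _ ∷ []) (_ ∷ _ , π) _ = contradiction (↭-length π) λ ()
  pair-closed (_ ∷ _ ∷ _ ∷ _) (_ , π) _ = contradiction (↭-length π) λ ()

module Extremal (r n : ℕ) (1≤n : 1 ℕ.≤ n) where

  m = 2 ℕ.* n

  instance
    m≢0 : ℕ.NonZero m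
    m≢0 = ℕ.m*n≢0 2 n {{_}} {{ℕ.>-nonZero 1≤n}}

  k = ℕ.pred m

  suc-k : suc k ≡ m
  suc-k = ℕ.suc-pred m

  extremal : ℕ → List (Cell r)
  extremal a = replicate a (0ᵛ , 0) ++ (replicate k (0ᵛ , 1) ++ corner r)

  length-extremal : ∀ a → length (extremal a) ≡ a ℕ.+ (k ℕ.+ 2 ℕ.* r)
  length-extremal a = ≡-trans (length-++ (replicate a _)) (cong₂ ℕ._+_ (length-replicate a)
    (≡-trans (length-++ (replicate k _)) (cong₂ ℕ._+_ (length-replicate k) (length-corner r))))

  private
    constant : ∀ {b} {T : List (Cell r)} → All (_≡ (0ᵛ , b)) T → heads T ≡ 0ᵛ × tails T ≡ length T ℕ.* b
    constant []              = refl , refl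
    constant {b} (refl ∷ es) = let (h , t) = constant es in ≡-trans (⊕ᵛ-identityˡ _) h , cong (b ℕ.+_) t

  -- Such a T has z zeros, s ones and j pairs, of total s + j and length z + s + 2j.
  few-zeros : ∀ z s j a → z ℕ.≤ a → s ℕ.≤ k → z ℕ.+ (s ℕ.+ 2 ℕ.* j) ℕ.≤ m → m ℕ.∣ s ℕ.+ j → z ℕ.+ (s ℕ.+ 2 ℕ.* j) ℕ.≤ a
  few-zeros z zero    zero    a z≤ s≤ l d = subst (ℕ._≤ a) (sym (ℕ.+-identityʳ z)) z≤
  few-zeros z (suc s) zero    a z≤ s≤ l d = contradiction (ℕ.∣⇒≤ d)
    (ℕ.<⇒≱ (subst (suc (suc s ℕ.+ 0) ℕ.≤_) suc-k (s≤s (subst (ℕ._≤ k) (sym (ℕ.+-identityʳ (suc s))) s≤))))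
  few-zeros z s (suc i) a z≤ s≤ l d = contradiction (ℕ.≤-trans (ℕ.≤-trans (s≤s (ℕ.m≤n+m (s ℕ.+ suc i) (z ℕ.+ i))) (ℕ.≤-trans (ℕ.≤-reflexive (lem z s i)) l)) (large (ℕ.+-suc s i) d)) (ℕ.<-irrefl refl)
    where
    large : ∀ {x i} → x ≡ suc i → m ℕ.∣ x → m ℕ.≤ x
    large refl d = ℕ.∣⇒≤ d
    lem : ∀ z s i → suc (z ℕ.+ i ℕ.+ (s ℕ.+ suc i)) ≡ z ℕ.+ (s ℕ.+ 2 ℕ.* suc i)
    lem = ℕ-Solver.solve-∀

  at-most : ∀ a {T} → T ⊑ extremal a → heads T ≡ 0ᵛ → m ℕ.∣ tails T → length T ℕ.≤ m → length T ℕ.≤ a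
  at-most a {T} i e d l = subst (ℕ._≤ a) (sym size) (few-zeros (length T₁) (length T₂) (tails T₃) a (short-of a i₁) (short-of k i₂)
      (subst (ℕ._≤ m) size l) (subst (m ℕ.∣_) weight′ d))
    where
    first = ⊑-split (replicate a (0ᵛ , 0)) i
    T₁ = proj₁ first
    i₁ = proj₁ (proj₂ (proj₂ (proj₂ first)))
    second′ = ⊑-split (replicate k (0ᵛ , 1)) (proj₂ (proj₂ (proj₂ (proj₂ first))))
    T₂ = proj₁ second′
    T₃ = proj₁ (proj₂ second′)
    i₂ = proj₁ (proj₂ (proj₂ (proj₂ second′)))
    i₃ = proj₂ (proj₂ (proj₂ (proj₂ second′)))
    σ : T ↭ T₁ ++ (T₂ ++ T₃)
    σ = trans (proj₁ (proj₂ (proj₂ first))) (++⁺ˡ T₁ (proj₁ (proj₂ (proj₂ second′))))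
    short-of : ∀ b {x : Cell r} {U} → U ⊑ replicate b x → length U ℕ.≤ b
    short-of b {U = U} j = subst (λ l → length U ℕ.≤ l) (length-replicate b) (⊑-length j)
    z = constant (All-⊑ i₁ (All.replicate⁺ a refl))
    s = constant (All-⊑ i₂ (All.replicate⁺ k refl))
    h₃ : heads T₃ ≡ 0ᵛ
    h₃ = ≡-trans (sym (≡-trans (heads-++ T₁ (T₂ ++ T₃)) (≡-trans (cong₂ _⊕ᵛ_ (proj₁ z) (≡-trans (heads-++ T₂ T₃) (≡-trans (cong (_⊕ᵛ heads T₃) (proj₁ s)) (⊕ᵛ-identityˡ _)))) (⊕ᵛ-identityˡ _))))
      (≡-trans (sym (heads-↭ σ)) e)
    size : length T ≡ length T₁ ℕ.+ (length T₂ ℕ.+ 2 ℕ.* tails T₃)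
    size = ≡-trans (↭-length σ) (≡-trans (length-++ T₁) (cong (length T₁ ℕ.+_) (≡-trans (length-++ T₂) (cong (length T₂ ℕ.+_) (corner-closed r i₃ h₃)))))
    weight′ : tails T ≡ length T₂ ℕ.+ tails T₃
    weight′ = ≡-trans (tails-↭ σ) (≡-trans (tails-++ T₁ (T₂ ++ T₃)) (cong₂ ℕ._+_ (≡-trans (proj₂ z) (ℕ.*-zeroʳ (length T₁)))
      (≡-trans (tails-++ T₂ T₃) (cong (ℕ._+ tails T₃) (≡-trans (proj₂ s) (ℕ.*-identityʳ (length T₂)))))))

  G : AbelianGroup 0ℓ 0ℓ
  G = C 2 ^⊕ r ⊕ C m

  open AG G using (Carrier; _≈_; _∙_; ε)

  cell : Carrier → Cell r
  cell (x , z) = bits r x , z %ℕ m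

  private
    residue-cong : ∀ {x y} → + m ℤ.∣ x ℤ.- y → x %ℕ m ≡ y %ℕ m
    residue-cong {x} {y} d = ℤ.+-injective (ℤ.i-j≡0⇒i≡j _ _ (ℤ.∣i∣≡0⇒i≡0 (small (∣⇒∣ᵤ difference) below)))
      where
      lem : ∀ a b q q′ m → ((a ℤ.+ q ℤ.* m) ℤ.- (b ℤ.+ q′ ℤ.* m)) ℤ.- (q ℤ.- q′) ℤ.* m ≡ a ℤ.- b
      lem = solve-∀
      difference : + m ℤ.∣ + (x %ℕ m) ℤ.- + (y %ℕ m)
      difference = subst (+ m ℤ.∣_)
        (≡-trans (cong (λ w → w ℤ.- (x /ℕ m ℤ.- y /ℕ m) ℤ.* + m) (cong₂ ℤ._-_ (a≡a%ℕn+[a/ℕn]*n x m) (a≡a%ℕn+[a/ℕn]*n y m)))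
          (lem (+ (x %ℕ m)) (+ (y %ℕ m)) (x /ℕ m) (y /ℕ m) (+ m)))
        (ℤ.∣m∣n⇒∣m-n d (divides (x /ℕ m ℤ.- y /ℕ m) refl))
      below : ℤ.∣ + (x %ℕ m) ℤ.- + (y %ℕ m) ∣ ℕ.< m
      below = ℕ.≤-<-trans (subst (λ w → ℤ.∣ w ∣ ℕ.≤ x %ℕ m ℕ.⊔ y %ℕ m) (sym (ℤ.m-n≡m⊖n (x %ℕ m) (y %ℕ m))) (ℤ.∣m⊝n∣≤m⊔n (x %ℕ m) (y %ℕ m)))
        (ℕ.⊔-lub (n%ℕd<d x m) (n%ℕd<d y m))
      small : ∀ {w} → m ℕ.∣ w → w ℕ.< m → w ≡ 0
      small {zero}  _  _  = refl
      small {suc _} d w< = contradiction (ℕ.∣⇒≤ d) (ℕ.<⇒≱ w<)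

  cell-cong : ∀ {x y} → x ≈ y → cell x ≡ cell y
  cell-cong {_ , x} {_ , y} (d , e) = cong₂ _,_ (bits-cong r d) (residue-cong {x} {y} e)

  sum-heads : ∀ T → bits r (proj₁ (foldr _∙_ ε T)) ≡ heads (map cell T)
  sum-heads []            = bits-ε r
  sum-heads ((x , z) ∷ T) = ≡-trans (bits-∙ r x _) (cong (bits r x ⊕ᵛ_) (sum-heads T))

  sum-tails : ∀ T → + m ℤ.∣ proj₂ (foldr _∙_ ε T) ℤ.- + tails (map cell T)
  sum-tails []            = divides 0ℤ refl
  sum-tails ((x , z) ∷ T) = subst (+ m ℤ.∣_) (sym (lem z (+ (z %ℕ m)) _ (+ tails (map cell T))))
    (ℤ.∣m∣n⇒∣m+n (divides (z /ℕ m) (≡-trans (cong (λ w → w ℤ.- + (z %ℕ m)) (a≡a%ℕn+[a/ℕn]*n z m)) (lem′ (+ (z %ℕ m)) (z /ℕ m ℤ.* + m)))) (sum-tails T))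
    where
    lem : ∀ z a s t → (z ℤ.+ s) ℤ.- (a ℤ.+ t) ≡ (z ℤ.- a) ℤ.+ (s ℤ.- t)
    lem = solve-∀
    lem′ : ∀ a q → (a ℤ.+ q) ℤ.- a ≡ q
    lem′ = solve-∀

  zero-sum-cells : ∀ T → ZeroSum G T → heads (map cell T) ≡ 0ᵛ × m ℕ.∣ tails (map cell T)
  zero-sum-cells T (d , e) = ≡-trans (sym (sum-heads T)) (≡-trans (bits-cong r d) (bits-ε r))
    , ∣⇒∣ᵤ (subst (+ m ℤ.∣_) (lem (proj₂ (foldr _∙_ ε T)) (+ tails (map cell T)))
        (ℤ.∣m∣n⇒∣m-n e (sum-tails T)))
    where
    lem : ∀ s t → (s ℤ.- 0ℤ) ℤ.- (s ℤ.- t) ≡ t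
    lem = solve-∀

  unbits : ∀ {r} → V r → AG.Carrier (C 2 ^⊕ r)
  unbits []      = _
  unbits (b ∷ v) = (if b then 1ℤ else 0ℤ) , unbits v

  bits-unbits : ∀ {r} (v : V r) → bits r (unbits v) ≡ v
  bits-unbits []          = refl
  bits-unbits (false ∷ v) = cong (false ∷_) (bits-unbits v)
  bits-unbits (true  ∷ v) = cong (true ∷_) (bits-unbits v)

  embed : Cell r → Carrier
  embed (v , k) = unbits v , + k

  cell-embed : ∀ {c} → proj₂ c ℕ.< m → cell (embed c) ≡ c
  cell-embed {v , k} k< = cong₂ _,_ (bits-unbits v) (ℕ.m<n⇒m%n≡m k<)

  private
    1<m : 1 ℕ.< m
    1<m = ℕ.*-monoʳ-≤ 2 1≤n

    corner-small : ∀ r → All (λ c → proj₂ c ℕ.< m) (corner r)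
    corner-small zero    = []
    corner-small (suc r) = ℕ.<-trans (s≤s z≤n) 1<m ∷ 1<m ∷ All.map⁺ (corner-small r)

    small : ∀ a → All (λ c → proj₂ c ℕ.< m) (extremal a)
    small a = All.++⁺ (All.replicate⁺ a (ℕ.<-trans (s≤s z≤n) 1<m)) (All.++⁺ (All.replicate⁺ k 1<m) (corner-small r))

    cells : ∀ {S} → All (λ c → proj₂ c ℕ.< m) S → map cell (map embed S) ≡ S
    cells []       = refl
    cells (h ∷ hs) = cong₂ _∷_ (cell-embed h) (cells hs)

  -- The number `a` of zeros is free because both constants use it: `a = 2n - 1` excludes zero-sums
  -- of length 2n, and `a = 0` excludes all short ones.
  no-longer : ∀ a {T} → _IsSubsequenceOf_ G T (map embed (extremal a)) → ZeroSum G T → length T ℕ.≤ m → length T ℕ.≤ a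
  no-longer a {T} (U , σ) zs l = subst (ℕ._≤ a) (length-map cell T) (at-most a (map cell U , ↭-sym τ) (proj₁ z) (proj₂ z) (subst (ℕ._≤ m) (sym (length-map cell T)) l))
    where
    z = zero-sum-cells T zs
    τ : map cell T ++ map cell U ↭ extremal a
    τ = subst₂ _↭_ (map-++ cell T U) (cells (small a))
      (↭ₛ⇒↭ (Permutationₛ.map⁺ (AG.setoid G) (setoid (Cell r)) (λ {x} {y} → cell-cong {x} {y}) σ))

  length-embedded : ∀ a → length (map embed (extremal a)) ≡ a ℕ.+ (k ℕ.+ 2 ℕ.* r)
  length-embedded a = ≡-trans (length-map embed (extremal a)) (length-extremal a)

-- The equation `suc c ≡ 2 * r` is where upper and lower bounds meet: `2r` corner terms in the
-- extremal sequence against the surplus `c` that forces a neutral subsequence.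
module Bounds {r n c F} (P : Padding r) (1≤n : 1 ℕ.≤ n) (forces : Forces c F n) (F-zero : F zero-item)
  (F-all : ∀ v z → F (mark (Padding.pad P v) (parity z) , z)) (c≡ : suc c ≡ 2 ℕ.* r) where

  open Upper {c = c} {F} P 1≤n forces F-all using (G; 𝗌-bound; η-bound)
  open Extremal r n 1≤n using (m; k; suc-k; extremal; embed; no-longer; length-embedded)

  is𝗌 : Is𝗌 G (4 ℕ.* n ℕ.+ c)
  is𝗌 = m , exponent r n 1≤n , (ℕ.≤-trans (ℕ.≤-trans 1≤n (ℕ.m≤n*m n 4)) (ℕ.m≤m+n _ c) , 𝗌-bound) , λ l (_ , f) → ℕ.≮⇒≥ λ l< →
    -- With 2n - 1 zeros the extremal sequence has `4n + c - 1` terms, just one below the bound.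
    let (T , i , zs , len) = f (map embed (extremal k)) (ℕ.≤-trans (ℕ.≤-pred (ℕ.≤-trans l< (ℕ.≤-reflexive size))) (ℕ.≤-reflexive (sym (length-embedded k))))
    in ℕ.<⇒≱ (ℕ.≤-reflexive suc-k) (subst (ℕ._≤ k) len (no-longer k i zs (ℕ.≤-reflexive len)))
    where
    lem : ∀ n c → 4 ℕ.* n ℕ.+ c ≡ 2 ℕ.* n ℕ.+ (2 ℕ.* n ℕ.+ c)
    lem = ℕ-Solver.solve-∀
    lem′ : ∀ k c → suc k ℕ.+ (suc k ℕ.+ c) ≡ suc (k ℕ.+ (k ℕ.+ suc c))
    lem′ = ℕ-Solver.solve-∀
    size : 4 ℕ.* n ℕ.+ c ≡ suc (k ℕ.+ (k ℕ.+ 2 ℕ.* r))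
    size = ≡-trans (lem n c) (≡-trans (cong (λ q → q ℕ.+ (q ℕ.+ c)) (sym suc-k)) (≡-trans (lem′ k c) (cong (λ d → suc (k ℕ.+ (k ℕ.+ d))) c≡)))

  isη : Isη G (2 ℕ.* n ℕ.+ suc c)
  isη = m , exponent r n 1≤n , (ℕ.≤-trans (s≤s z≤n) (ℕ.m≤n+m (suc c) m) , η-bound F-zero) , λ l (_ , f) → ℕ.≮⇒≥ λ l< →
    -- Without zeros it has `2n + c` terms, and a short zero-sum subsequence would have to be empty.
    let (T , i , zs , 1≤ , len) = f (map embed (extremal 0)) (ℕ.≤-trans (ℕ.≤-pred (ℕ.≤-trans l< (ℕ.≤-reflexive size))) (ℕ.≤-reflexive (sym (length-embedded 0))))
    in ℕ.<⇒≱ 1≤ (no-longer 0 i zs len)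
    where
    size : 2 ℕ.* n ℕ.+ suc c ≡ suc (0 ℕ.+ (k ℕ.+ 2 ℕ.* r))
    size = cong₂ ℕ._+_ (sym suc-k) c≡

theorem1p2 : (n : ℕ) → n ≥ 2 →
    (Isη (C 2 ^⊕ 2 ⊕ C (2 * n)) (2 * n + 4) × Is𝗌 (C 2 ^⊕ 2 ⊕ C (2 * n)) (4 * n + 3)) ×
    (Isη (C 2 ^⊕ 3 ⊕ C (2 * n)) (2 * n + 6) × (n ≥ 36 → Is𝗌 (C 2 ^⊕ 3 ⊕ C (2 * n)) (4 * n + 5)))
theorem1p2 n 2≤n = (Rank₃.isη , Rank₃.is𝗌) , (Rank₄.isη , λ _ → Rank₄.is𝗌)
  where
  1≤n : 1 ℕ.≤ n
  1≤n = ℕ.<-trans (s≤s z≤n) 2≤n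
  -- A leading bit 0 puts all classes into the hyperplane of flat items.
  plane : Padding 2
  plane = record
    { pad   = false ∷_
    ; pad-⊕ = λ _ _ → refl
    ; pad-0 = refl
    ; pad⇒0 = cong Vec.tail
    }
  whole : Padding 3
  whole = record { pad = id ; pad-⊕ = λ _ _ → refl ; pad-0 = refl ; pad⇒0 = id }
  marked₂ : ∀ (v : V 2) z → FlatMarked (mark (false ∷ v) (parity z) , z)
  marked₂ (_ ∷ _ ∷ []) z = refl , refl
  marked₃ : ∀ (v : V 3) z → Marked (mark v (parity z) , z)
  marked₃ v z = last-mark v
  module Rank₃ = Bounds {c = 3} {FlatMarked} plane 1≤n (three-forced n 2≤n) (refl , refl) marked₂ refl
  module Rank₄ = Bounds {c = 5} {Marked} whole 1≤n (four-forced n 2≤n) refl marked₃ refl
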